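{- Let $q$ be a power of the prime $3$ and let $\Delta$ be the coset graph, with group $G=\langle G_1,G_2\rangle\le \mathrm{Sym}(\Omega)$ acting by right multiplication, defined in the context. Then $\Delta$ is a locally finite and locally $5$-arc transitive $G$-graph of pushing up type such that, for an edge $\{x_1,x_2\}$ of $\Delta$ (with its two ends suitably labelled), the following hold: (i) $|\Delta(x_1)|=q+1$ and $|\Delta(x_2)|=q$; (ii) $G_{x_1}^{\Delta(x_1)}\cong \mathrm{P\Gamma L}_2(q)$ and $G_{x_2}^{\Delta(x_2)}\cong \mathrm{A\Gamma L}_1(q)$; (iii) $G_{x_1}\cong E_{q^3}\rtimes \mathrm{\Gamma L}_2(q)$; (iv) $G_{x_2}\cong (E_q\times U)\rtimes \mathrm{\Gamma L}_2(q,S_0)$, where $U$ is isomorphic to a Sylow $3$-subgroup of $\mathrm{ASL}_2(q)$; (v) $G_{x_2}$ is transitive on the $6$-arcs originating at $x_2$.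
   Context: Graph terminology. Graphs are finite, connected, undirected, without loops or multiple edges. A $G$-graph is a graph $\Delta$ together with a subgroup $G\le \mathrm{Aut}(\Delta)$. $\Delta(z)$ is the set of neighbours of $z$; $G_z$ is the stabilizer of $z$; $G_z^{[1]}$ is the kernel of the action of $G_z$ on $\Delta(z)$; $G_z^{\Delta(z)}\cong G_z/G_z^{[1]}$ is the induced permutation group. An $s$-arc originating at $x_0$ is a path $(x_0,\dots,x_s)$ with $x_{i-1}\ne x_{i+1}$ for $1\le i\le s-1$. The $G$-graph is locally finite if every $G_z$ is finite; it is locally $s$-arc transitive if for each vertex $z$ the group $G_z$ is transitive on the $s$-arcs originating at $z$. It is of local characteristic $p$ ($p$ prime) if $C_{G_z}(O_p(G_z^{[1]}))\le O_p(G_z^{[1]})$ for all vertices $z$. It is of pushing up type with respect to the $1$-arc $(x_1,x_2)$ and the prime $p$ if it is of local characteristic $p$ and $O_p(G_{x_1}^{[1]})\le O_p(G_{x_2}^{[1]})$; it is of pushing up type if this holds for some $1$-arc and some prime (here $p=3$). Group notation. $E_q$, $E_{q^3}$ denote elementary abelian groups of order $q$, $q^3$. $\mathrm{ASL}_2(q)$ is the semidirect product of $\mathrm{SL}_2(q)$ with its natural module. $\mathrm{\Gamma L}_2(q,S_0):=N_{\mathrm{\Gamma L}_2(q)}(S_0)$ where $S_0$ is a Sylow $3$-subgroup of $\mathrm{SL}_2(q)$. Construction of $\Delta$. Let $q=3^r$ with $r\ge1$, $\varepsilon=q/3$, $\Omega=\{(a,b,c)\mid a,b,c\in\mathbb F_q\}$.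 Permutations are applied from left to right. Define the permutations of $\Omega$: $\alpha_{(u,v,w)}:(a,b,c)\mapsto(a+u,b+v,c+w)$ for $u,v,w\in\mathbb F_q$; $\beta_{\lambda,\mu}:(a,b,c)\mapsto(\lambda a,\mu b,(\lambda\mu)^{2\varepsilon}c)$ for $\lambda,\mu\in\mathbb F_q^*$; $\gamma_e:(a,b,c)\mapsto(a+eb,b,c)$ for $e\in\mathbb F_q$; $\delta:(a,b,c)\mapsto(b,-a,c)$; $\tau_d:(a,b,c)\mapsto(a+db^2+d^{\varepsilon}c,b,c)$ for $d\in\mathbb F_q$; $\sigma:(a,b,c)\mapsto(a^3,b^3,c^3)$. Put $A=\langle\alpha_{(u,v,w)}\mid u,v,w\in\mathbb F_q\rangle$, $C=\langle\gamma_e\mid e\in\mathbb F_q\rangle$, $S=\langle\beta_{\mu^2,\mu}\mid\mu\in\mathbb F_q^*\rangle$, $T=\langle\beta_{\mu,\mu^{ -1}}\mid\mu\in\mathbb F_q^*\rangle$, $D=\langle\delta\rangle$, $E=\langle\tau_d\mid d\in\mathbb F_q\rangle$, $\Sigma=\langle\sigma\rangle$, $M=\langle C,D,T\rangle$, $Q=\langle A,C\rangle$. Let $G_1=AMS\Sigma$, $G_2=QSET\Sigma$, $G=\langle G_1,G_2\rangle$. $\Delta$ is the graph whose vertices are the right cosets of $G_1$ and of $G_2$ in $G$, where $G_1g_1$ and $G_2g_2$ are adjacent if and only if $G_1g_1\cap G_2g_2\ne\emptyset$; $G$ acts by right multiplication. -}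

module Defs where

open import Algebra.Apartness.Structures using (IsHeytingField)
open import Algebra.Bundles using (CommutativeRing; Group)
open import Algebra.Core using (Op₁; Op₂)
import Algebra.Construct.DirectProduct as Direct
import Algebra.Definitions.RawMonoid as RawMonoidOps
open import Algebra.Morphism.Structures using (IsGroupIsomorphism; IsRingIsomorphism)
import Algebra.Morphism.Construct.Composition as Comp
import Algebra.Morphism.Construct.Identity as Ident
import Algebra.Properties.Group as GroupProperties
import Algebra.Properties.Ring as RingProperties
import Algebra.Properties.Semiring.Exp as Exp
open import Data.Empty using (⊥)
open import Data.Fin.Base using (Fin; toℕ; inject₁; suc; zero)
open import Data.Nat.Base as ℕ using (ℕ)
open import Data.Nat.Divisibility using (_∣_)
open import Data.Nat.DivMod using (_/_)
open import Data.Product using (Σ; ∃; ∃₂; _×_; _,_; proj₁; proj₂)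
open import Data.Sum.Base using (_⊎_; inj₁; inj₂)
open import Data.Sum.Relation.Binary.Pointwise as Sum using (_⊎ₛ_)
open import Data.Unit.Base using (⊤; tt)
open import Function.Base using (id; _∘_)
open import Function.Bundles using (Inverse; _↔_)
open import Function.Construct.Composition using (inverse)
open import Function.Construct.Identity using (↔-id)
open import Function.Construct.Symmetry using (↔-sym)
open import Level using (0ℓ)
open import Relation.Binary.Bundles using (Setoid)
open import Relation.Binary.Core using (Rel)
open import Relation.Binary.Definitions using (Symmetric; _Respects_; _Respects₂_)
open import Relation.Binary.Construct.Closure.ReflexiveTransitive using (Star)
import Relation.Binary.Construct.On as On
import Relation.Binary.Construct.Union as Union
open import Relation.Binary.PropositionalEquality as ≡ using (_≡_; _≢_; refl; sym; trans; cong; cong₂; subst)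
open import Relation.Nullary.Negation using (¬_)
open import Relation.Unary using (Pred; _∈_; _⊆_; _≐_; _∪_; _≬_)
open import Relation.Unary.Relation.Binary.Equality using (≐-isEquivalence)

∣_∣≡_ : Setoid 0ℓ 0ℓ → ℕ → Set
∣ S ∣≡ n = Inverse S (≡.setoid (Fin n))

Finite : Setoid 0ℓ 0ℓ → Set
Finite S = ∃ λ n → ∣ S ∣≡ n

subsetoid : (S : Setoid 0ℓ 0ℓ) → Pred (Setoid.Carrier S) 0ℓ → Setoid 0ℓ 0ℓ
subsetoid S P = On.setoid {B = Σ (Setoid.Carrier S) P} S proj₁

infix 4 _≅_

_≅_ : Group 0ℓ 0ℓ → Group 0ℓ 0ℓ → Set
G ≅ H = Σ (Group.Carrier G → Group.Carrier H)
          (IsGroupIsomorphism (Group.rawGroup G) (Group.rawGroup H))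

order : Group 0ℓ 0ℓ → Setoid 0ℓ 0ℓ
order = Group.setoid

IsElementaryAbelian : ℕ → Group 0ℓ 0ℓ → Set
IsElementaryAbelian p G = (∀ x y → x ∙ y ≈ y ∙ x) × (∀ x → p ×ᴳ x ≈ ε)
  where
  open Group G
  open RawMonoidOps rawMonoid renaming (_×_ to _×ᴳ_)

module _ (G : Group 0ℓ 0ℓ) where
  open Group G

  record Subgroup : Set₁ where
    field
      Member : Pred Carrier 0ℓ
      resp   : Member Respects _≈_
      ε∈     : ε ∈ Member
      ∙∈     : ∀ {x y} → x ∈ Member → y ∈ Member → x ∙ y ∈ Member
      ⁻¹∈    : ∀ {x} → x ∈ Member → x ⁻¹ ∈ Member

    group : Group 0ℓ 0ℓ
    group = record
      { Carrier = Σ Carrier Member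
      ; _≈_     = λ x y → proj₁ x ≈ proj₁ y
      ; _∙_     = λ x y → proj₁ x ∙ proj₁ y , ∙∈ (proj₂ x) (proj₂ y)
      ; ε       = ε , ε∈
      ; _⁻¹     = λ x → proj₁ x ⁻¹ , ⁻¹∈ (proj₂ x)
      ; isGroup = record
        { isMonoid = record
          { isSemigroup = record
            { isMagma = record
              { isEquivalence = On.isEquivalence proj₁ isEquivalence
              ; ∙-cong        = ∙-cong
              }
            ; assoc = λ x y z → assoc (proj₁ x) (proj₁ y) (proj₁ z)
            }
          ; identity = (λ x → identityˡ (proj₁ x)) , (λ x → identityʳ (proj₁ x))
          }
        ; inverse = (λ x → inverseˡ (proj₁ x)) , (λ x → inverseʳ (proj₁ x))
        ; ⁻¹-cong = ⁻¹-cong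
        }
      }

module Subsets (G : Group 0ℓ 0ℓ) where
  open Group G using (Carrier; _≈_; _∙_; ε; _⁻¹)

  data ⟨_⟩ (X : Pred Carrier 0ℓ) : Pred Carrier 0ℓ where
    gen  : ∀ {x} → x ∈ X → x ∈ ⟨ X ⟩
    resp : ∀ {x y} → x ≈ y → x ∈ ⟨ X ⟩ → y ∈ ⟨ X ⟩
    unit : ε ∈ ⟨ X ⟩
    mul  : ∀ {x y} → x ∈ ⟨ X ⟩ → y ∈ ⟨ X ⟩ → x ∙ y ∈ ⟨ X ⟩
    inv  : ∀ {x} → x ∈ ⟨ X ⟩ → x ⁻¹ ∈ ⟨ X ⟩

  generated : Pred Carrier 0ℓ → Subgroup G
  generated X = record { Member = ⟨ X ⟩ ; resp = resp ; ε∈ = unit ; ∙∈ = mul ; ⁻¹∈ = inv }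

  infixl 7 _⊙_

  _⊙_ : Pred Carrier 0ℓ → Pred Carrier 0ℓ → Pred Carrier 0ℓ
  (X ⊙ Y) g = ∃₂ λ x y → x ∈ X × y ∈ Y × g ≈ x ∙ y

  rightCoset : Pred Carrier 0ℓ → Carrier → Pred Carrier 0ℓ
  rightCoset H g x = ∃ λ h → h ∈ H × x ≈ h ∙ g

module _ {G : Group 0ℓ 0ℓ} where
  open Group G renaming (refl to ≈-refl; sym to ≈-sym; trans to ≈-trans)
  open GroupProperties G
  open Subgroup
  open import Relation.Binary.Reasoning.Setoid setoid

  whole : Subgroup G
  whole = record
    { Member = λ _ → ⊤ ; resp = λ _ _ → tt ; ε∈ = tt ; ∙∈ = λ _ _ → tt ; ⁻¹∈ = λ _ → tt }

  infix 4 _⊴_ _≤ₛ_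

  _≤ₛ_ : Subgroup G → Subgroup G → Set
  K ≤ₛ H = Member K ⊆ Member H

  _⊴_ : Subgroup G → Subgroup G → Set
  K ⊴ H = K ≤ₛ H × (∀ {h k} → h ∈ Member H → k ∈ Member K → h ⁻¹ ∙ k ∙ h ∈ Member K)

  quotient : (H K : Subgroup G) → K ⊴ H → Group 0ℓ 0ℓ
  quotient H K (K≤H , norm) = record
    { Carrier = Σ Carrier (Member H)
    ; _≈_     = _∼_
    ; _∙_     = Group._∙_ (group H)
    ; ε       = Group.ε (group H)
    ; _⁻¹     = Group._⁻¹ (group H)
    ; isGroup = record
      { isMonoid = record
        { isSemigroup = record
          { isMagma = record
            { isEquivalence = record
              { refl  = λ {x} → ⇒∼ x x ≈-refl
              ; sym   = λ {x} {y} x∼y →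
                  resp K (⁻¹-anti-homo-// (proj₁ x) (proj₁ y)) (⁻¹∈ K x∼y)
              ; trans = λ {x} {y} {z} x∼y y∼z →
                  resp K (cancel (proj₁ x) (proj₁ y) (proj₁ z)) (∙∈ K x∼y y∼z)
              }
            ; ∙-cong = λ {x} {y} {u} {v} x∼y u∼v →
                resp K (mulEq (proj₁ x) (proj₁ y) (proj₁ u) (proj₁ v))
                  (∙∈ K (conj (proj₂ x) u∼v) x∼y)
            }
          ; assoc = λ x y z → ⇒∼ (x ∙ₕ y ∙ₕ z) (x ∙ₕ (y ∙ₕ z)) (assoc _ _ _)
          }
        ; identity = (λ x → ⇒∼ (εₕ ∙ₕ x) x (identityˡ _)) , (λ x → ⇒∼ (x ∙ₕ εₕ) x (identityʳ _))
        }
      ; inverse = (λ x → ⇒∼ (invₕ x ∙ₕ x) εₕ (inverseˡ _)) , (λ x → ⇒∼ (x ∙ₕ invₕ x) εₕ (inverseʳ _))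
      ; ⁻¹-cong = λ {x} {y} x∼y → resp K (invEq (proj₁ x) (proj₁ y)) (⁻¹∈ K (norm (proj₂ x) x∼y))
      }
    }
    where
    open Group (group H) using () renaming (_∙_ to _∙ₕ_; ε to εₕ; _⁻¹ to invₕ)

    _∼_ : Rel (Σ Carrier (Member H)) 0ℓ
    x ∼ y = proj₁ x // proj₁ y ∈ Member K

    ⇒∼ : ∀ x y → proj₁ x ≈ proj₁ y → x ∼ y
    ⇒∼ x y x≈y = resp K (≈-sym (x≈y⇒x∙y⁻¹≈ε x≈y)) (ε∈ K)

    conj : ∀ {h k} → h ∈ Member H → k ∈ Member K → h ∙ k ∙ h ⁻¹ ∈ Member K
    conj h∈ k∈ = resp K (∙-congʳ (∙-congʳ (⁻¹-involutive _))) (norm (⁻¹∈ H h∈) k∈)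

    cancel : ∀ x y z → (x // y) ∙ (y // z) ≈ x // z
    cancel x y z = begin
      x ∙ y ⁻¹ ∙ (y ∙ z ⁻¹)   ≈⟨ assoc _ _ _ ⟨
      x ∙ y ⁻¹ ∙ y ∙ z ⁻¹     ≈⟨ ∙-congʳ (//-rightDividesˡ y x) ⟩
      x ∙ z ⁻¹                ∎

    mulEq : ∀ x y u v → (x ∙ (u // v) ∙ x ⁻¹) ∙ (x // y) ≈ (x ∙ u) // (y ∙ v)
    mulEq x y u v = begin
      (x ∙ (u // v) ∙ x ⁻¹) ∙ (x ∙ y ⁻¹)  ≈⟨ assoc _ _ _ ⟨
      x ∙ (u // v) ∙ x ⁻¹ ∙ x ∙ y ⁻¹      ≈⟨ ∙-congʳ (//-rightDividesˡ x _) ⟩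
      x ∙ (u ∙ v ⁻¹) ∙ y ⁻¹               ≈⟨ ∙-congʳ (assoc _ _ _) ⟨
      x ∙ u ∙ v ⁻¹ ∙ y ⁻¹                 ≈⟨ assoc _ _ _ ⟩
      x ∙ u ∙ (v ⁻¹ ∙ y ⁻¹)               ≈⟨ ∙-congˡ (⁻¹-anti-homo-∙ y v) ⟨
      x ∙ u ∙ (y ∙ v) ⁻¹                  ∎

    invEq : ∀ x y → (x ⁻¹ ∙ (x // y) ∙ x) ⁻¹ ≈ x ⁻¹ // (y ⁻¹)
    invEq x y = begin
      (x ⁻¹ ∙ (x ∙ y ⁻¹) ∙ x) ⁻¹  ≈⟨ ⁻¹-cong (∙-congʳ (\\-leftDividesʳ x (y ⁻¹))) ⟩
      (y ⁻¹ ∙ x) ⁻¹               ≈⟨ ⁻¹-anti-homo-∙ (y ⁻¹) x ⟩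
      x ⁻¹ ∙ (y ⁻¹) ⁻¹            ∎

  centraliser : Subgroup G → Subgroup G → Pred Carrier 0ℓ
  centraliser H K g = g ∈ Member H × (∀ {k} → k ∈ Member K → g ∙ k ≈ k ∙ g)

  normaliser : Subgroup G → Subgroup G → Subgroup G
  normaliser H K = record
    { Member = λ g → g ∈ Member H × (∀ x → (x ∈ Member K → g ⁻¹ ∙ x ∙ g ∈ Member K)
                                         × (g ⁻¹ ∙ x ∙ g ∈ Member K → x ∈ Member K))
    ; resp = λ { g≈h (g∈ , n) → resp H g≈h g∈ , λ x →
          (λ x∈ → resp K (cj g≈h) (proj₁ (n x) x∈))
        , (λ y∈ → proj₂ (n x) (resp K (≈-sym (cj g≈h)) y∈)) }
    ; ε∈ = ε∈ H , λ x → (λ x∈ → resp K (≈-sym (conjε x)) x∈) , (λ y∈ → resp K (conjε x) y∈)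
    ; ∙∈ = λ { {g} {h} (g∈ , n) (h∈ , m) → ∙∈ H g∈ h∈ , λ x →
          (λ x∈ → resp K (≈-sym (conj∙ g h x)) (proj₁ (m _) (proj₁ (n x) x∈)))
        , (λ y∈ → proj₂ (n x) (proj₂ (m _) (resp K (conj∙ g h x) y∈))) }
    ; ⁻¹∈ = λ { {g} (g∈ , n) → ⁻¹∈ H g∈ , λ x →
          (λ x∈ → proj₂ (n _) (resp K (≈-sym (undo g x)) x∈))
        , (λ y∈ → resp K (undo g x) (proj₁ (n _) y∈)) }
    }
    where
    cj : ∀ {g h x} → g ≈ h → g ⁻¹ ∙ x ∙ g ≈ h ⁻¹ ∙ x ∙ h
    cj g≈h = ∙-cong (∙-congʳ (⁻¹-cong g≈h)) g≈h

    conjε : ∀ x → ε ⁻¹ ∙ x ∙ ε ≈ x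
    conjε x = ≈-trans (identityʳ _) (≈-trans (∙-congʳ ε⁻¹≈ε) (identityˡ x))

    conj∙ : ∀ g h x → (g ∙ h) ⁻¹ ∙ x ∙ (g ∙ h) ≈ h ⁻¹ ∙ (g ⁻¹ ∙ x ∙ g) ∙ h
    conj∙ g h x = begin
      (g ∙ h) ⁻¹ ∙ x ∙ (g ∙ h)       ≈⟨ assoc _ _ _ ⟨
      (g ∙ h) ⁻¹ ∙ x ∙ g ∙ h         ≈⟨ ∙-congʳ (∙-congʳ (∙-congʳ (⁻¹-anti-homo-∙ g h))) ⟩
      h ⁻¹ ∙ g ⁻¹ ∙ x ∙ g ∙ h        ≈⟨ ∙-congʳ (∙-congʳ (assoc _ _ _)) ⟩
      h ⁻¹ ∙ (g ⁻¹ ∙ x) ∙ g ∙ h      ≈⟨ ∙-congʳ (assoc _ _ _) ⟩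
      h ⁻¹ ∙ (g ⁻¹ ∙ x ∙ g) ∙ h      ∎

    undo : ∀ g x → g ⁻¹ ∙ (g ⁻¹ ⁻¹ ∙ x ∙ g ⁻¹) ∙ g ≈ x
    undo g x = begin
      g ⁻¹ ∙ (g ⁻¹ ⁻¹ ∙ x ∙ g ⁻¹) ∙ g  ≈⟨ ∙-congʳ (∙-congˡ (assoc _ _ _)) ⟩
      g ⁻¹ ∙ (g ⁻¹ ⁻¹ ∙ (x ∙ g ⁻¹)) ∙ g ≈⟨ ∙-congʳ (\\-leftDividesˡ (g ⁻¹) _) ⟩
      x ∙ g ⁻¹ ∙ g                       ≈⟨ //-rightDividesˡ g x ⟩
      x                                  ∎

  -- For prime p and finite K.
  IsPGroup : ℕ → Subgroup G → Set
  IsPGroup p K = ∃ λ n → ∣ order (group K) ∣≡ (p ℕ.^ n)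

  IsSylow : ℕ → Subgroup G → Subgroup G → Set
  IsSylow p H P = P ≤ₛ H × ∃₂ λ k m →
    ∣ order (group P) ∣≡ (p ℕ.^ k) × ∣ order (group H) ∣≡ (p ℕ.^ k ℕ.* m) × ¬ p ∣ m

  -- K = O_p(H), as the largest normal p-subgroup of H.
  record IsPCore (p : ℕ) (H K : Subgroup G) : Set₁ where
    field
      normal  : K ⊴ H
      isP     : IsPGroup p K
      largest : ∀ L → L ⊴ H → IsPGroup p L → L ≤ₛ K

-- Right actions; n ◃ h is n^h.
record GroupAction (N H : Group 0ℓ 0ℓ) : Set where
  private
    module N = Group N
    module H = Group H
  infixl 7 _◃_
  field
    _◃_    : N.Carrier → H.Carrier → N.Carrier
    ◃-cong : ∀ {m n g h} → m N.≈ n → g H.≈ h → m ◃ g N.≈ n ◃ h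
    ◃-homo : ∀ m n h → (m N.∙ n) ◃ h N.≈ (m ◃ h) N.∙ (n ◃ h)
    ◃-ε    : ∀ n → n ◃ H.ε N.≈ n
    ◃-∙    : ∀ n g h → n ◃ (g H.∙ h) N.≈ n ◃ g ◃ h

-- (h , n) stands for the product hn, so that hn·h′n′ = hh′·n^h′n′.
_⋊_[_] : (N H : Group 0ℓ 0ℓ) → GroupAction N H → Group 0ℓ 0ℓ
N ⋊ H [ φ ] = record
  { Carrier = H.Carrier × N.Carrier
  ; _≈_     = HN._≈_
  ; _∙_     = λ { (h , n) (h′ , n′) → h H.∙ h′ , (n ◃ h′) N.∙ n′ }
  ; ε       = H.ε , N.ε
  ; _⁻¹     = λ { (h , n) → h H.⁻¹ , (n N.⁻¹) ◃ (h H.⁻¹) }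
  ; isGroup = record
    { isMonoid = record
      { isSemigroup = record
        { isMagma = record
          { isEquivalence = HN.isEquivalence
          ; ∙-cong = λ { (h≈ , n≈) (h′≈ , n′≈) → H.∙-cong h≈ h′≈ , N.∙-cong (◃-cong n≈ h′≈) n′≈ }
          }
        ; assoc = λ { (h , n) (h′ , n′) (h″ , n″) → H.assoc h h′ h″ , (begin
            ((n ◃ h′) N.∙ n′) ◃ h″ N.∙ n″            ≈⟨ N.∙-congʳ (◃-homo _ _ _) ⟩
            ((n ◃ h′ ◃ h″) N.∙ (n′ ◃ h″)) N.∙ n″     ≈⟨ N.assoc _ _ _ ⟩
            (n ◃ h′ ◃ h″) N.∙ ((n′ ◃ h″) N.∙ n″)     ≈⟨ N.∙-congʳ (◃-∙ n h′ h″) ⟨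
            (n ◃ (h′ H.∙ h″)) N.∙ ((n′ ◃ h″) N.∙ n″) ∎) }
        }
      ; identity = (λ { (h , n) → H.identityˡ h , N.trans (N.∙-congʳ (ε◃ h)) (N.identityˡ n) })
                 , (λ { (h , n) → H.identityʳ h , N.trans (N.identityʳ _) (◃-ε n) })
      }
    ; inverse = (λ { (h , n) → H.inverseˡ h , (begin
                    (n N.⁻¹ ◃ (h H.⁻¹) ◃ h) N.∙ n     ≈⟨ N.∙-congʳ (◃-∙ _ _ _) ⟨
                    (n N.⁻¹ ◃ (h H.⁻¹ H.∙ h)) N.∙ n   ≈⟨ N.∙-congʳ (◃-cong N.refl (H.inverseˡ h)) ⟩
                    (n N.⁻¹ ◃ H.ε) N.∙ n              ≈⟨ N.∙-congʳ (◃-ε _) ⟩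
                    n N.⁻¹ N.∙ n                      ≈⟨ N.inverseˡ n ⟩
                    N.ε                               ∎) })
              , (λ { (h , n) → H.inverseʳ h , (begin
                    (n ◃ (h H.⁻¹)) N.∙ (n N.⁻¹ ◃ (h H.⁻¹)) ≈⟨ ◃-homo _ _ _ ⟨
                    (n N.∙ n N.⁻¹) ◃ (h H.⁻¹)              ≈⟨ ◃-cong (N.inverseʳ n) H.refl ⟩
                    N.ε ◃ (h H.⁻¹)                         ≈⟨ ε◃ _ ⟩
                    N.ε                                    ∎) })
    ; ⁻¹-cong = λ { (h≈ , n≈) → H.⁻¹-cong h≈ , ◃-cong (N.⁻¹-cong n≈) (H.⁻¹-cong h≈) }
    }
  }
  where
  module N = Group N
  module H = Group H
  module HN = Group (Direct.group H N)
  open GroupAction φ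
  open import Relation.Binary.Reasoning.Setoid N.setoid
  open GroupProperties N using (identityʳ-unique)

  ε◃ : ∀ h → N.ε ◃ h N.≈ N.ε
  ε◃ h = identityʳ-unique (N.ε ◃ h) (N.ε ◃ h) (begin
    (N.ε ◃ h) N.∙ (N.ε ◃ h)  ≈⟨ ◃-homo _ _ _ ⟨
    (N.ε N.∙ N.ε) ◃ h        ≈⟨ ◃-cong (N.identityˡ N.ε) H.refl ⟩
    N.ε ◃ h                  ∎)

-- Permutations are composed from left to right.
Sym : Set → Group 0ℓ 0ℓ
Sym X = record
  { Carrier = X ↔ X
  ; _≈_     = λ f g → ∀ x → Inverse.to f x ≡ Inverse.to g x
  ; _∙_     = λ f g → inverse f g
  ; ε       = ↔-id X
  ; _⁻¹     = ↔-sym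
  ; isGroup = record
    { isMonoid = record
      { isSemigroup = record
        { isMagma = record
          { isEquivalence = record
            { refl  = λ _ → refl
            ; sym   = λ f≈g x → sym (f≈g x)
            ; trans = λ f≈g g≈h x → trans (f≈g x) (g≈h x)
            }
          ; ∙-cong = λ {f} {g} {h} {k} f≈g h≈k x → trans (h≈k _) (cong (Inverse.to k) (f≈g x))
          }
        ; assoc = λ _ _ _ _ → refl
        }
      ; identity = (λ _ _ → refl) , (λ _ _ → refl)
      }
    ; inverse = (λ f x → Inverse.strictlyInverseˡ f x) , (λ f x → Inverse.strictlyInverseʳ f x)
    ; ⁻¹-cong = λ {f} {g} f≈g x → Inverse.inverseʳ f
                  (trans (sym (Inverse.strictlyInverseˡ g x)) (sym (f≈g _)))
    }
  }

record Graph : Set₁ where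
  infix 4 _~_
  field
    vertices : Setoid 0ℓ 0ℓ
  open Setoid vertices public using () renaming (Carrier to Vertex; _≈_ to infix 4 _≈ᵥ_)
  field
    _~_    : Rel Vertex 0ℓ
    ~-resp : _~_ Respects₂ _≈ᵥ_
    ~-sym  : Symmetric _~_
    noLoop : ∀ {u v} → u ≈ᵥ v → ¬ (u ~ v)

  neighbours : Vertex → Setoid 0ℓ 0ℓ
  neighbours z = subsetoid vertices (z ~_)

  -- Walks may also move between equal vertices, since ≈ᵥ is not propositional equality.
  Connected : Set
  Connected = ∀ u v → Star (_≈ᵥ_ Union.∪ _~_) u v

  record Arc (s : ℕ) (z : Vertex) : Set where
    field
      at       : Fin (ℕ.suc s) → Vertex
      origin   : at zero ≈ᵥ z
      path     : ∀ (i : Fin s) → at (inject₁ i) ~ at (suc i)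
      straight : ∀ i j → toℕ j ≡ 2 ℕ.+ toℕ i → ¬ (at i ≈ᵥ at j)

-- Preserving adjacency suffices for a group to act by automorphisms.
record ActionOn (Δ : Graph) (G : Group 0ℓ 0ℓ) : Set where
  open Graph Δ
  private module G = Group G
  infixl 7 _·_
  field
    _·_    : Vertex → G.Carrier → Vertex
    ·-cong : ∀ {u v g h} → u ≈ᵥ v → g G.≈ h → u · g ≈ᵥ v · h
    ·-ε    : ∀ v → v · G.ε ≈ᵥ v
    ·-∙    : ∀ v g h → v · (g G.∙ h) ≈ᵥ v · g · h
    ·-~    : ∀ {u v} g → u ~ v → u · g ~ v · g

module GGraph {Δ : Graph} {G : Group 0ℓ 0ℓ} (action : ActionOn Δ G) where
  open Graph Δ
  open ActionOn action
  open Group G using (_≈_; _∙_; ε; _⁻¹)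
  private
    module G = Group G
    module V = Setoid vertices

  -- Faithfulness of the action is what makes G a subgroup of Aut(Δ).
  IsGGraph : Set
  IsGGraph = Finite vertices × Connected × (∀ g → (∀ v → v · g ≈ᵥ v) → g ≈ ε)

  private
    fix-⁻¹ : ∀ {v g} → v · g ≈ᵥ v → v · g ⁻¹ ≈ᵥ v
    fix-⁻¹ {v} {g} vg≈v = V.trans (·-cong (V.sym vg≈v) G.refl)
      (V.trans (V.sym (·-∙ v g (g ⁻¹))) (V.trans (·-cong V.refl (G.inverseʳ g)) (·-ε v)))

    fix-∙ : ∀ {v g h} → v · g ≈ᵥ v → v · h ≈ᵥ v → v · (g ∙ h) ≈ᵥ v
    fix-∙ {v} {g} {h} vg≈v vh≈v = V.trans (·-∙ v g h) (V.trans (·-cong vg≈v G.refl) vh≈v)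

  stabiliser : Vertex → Subgroup G
  stabiliser z = record
    { Member = λ g → z · g ≈ᵥ z
    ; resp   = λ g≈h zg → V.trans (·-cong V.refl (G.sym g≈h)) zg
    ; ε∈     = ·-ε z
    ; ∙∈     = fix-∙
    ; ⁻¹∈    = fix-⁻¹
    }

  kernel : Vertex → Subgroup G
  kernel z = record
    { Member = λ g → z · g ≈ᵥ z × (∀ y → z ~ y → y · g ≈ᵥ y)
    ; resp   = λ { g≈h (zg , k) → V.trans (·-cong V.refl (G.sym g≈h)) zg
                                , λ y z~y → V.trans (·-cong V.refl (G.sym g≈h)) (k y z~y) }
    ; ε∈     = ·-ε z , λ y _ → ·-ε y
    ; ∙∈     = λ { (zg , k) (zh , l) → fix-∙ zg zh , λ y z~y → fix-∙ (k y z~y) (l y z~y) }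
    ; ⁻¹∈    = λ { (zg , k) → fix-⁻¹ zg , λ y z~y → fix-⁻¹ (k y z~y) }
    }

  -- The permutation group induced by G_z on Δ(z): two elements of G_z are
  -- identified when they agree on Δ(z).
  localGroup : Vertex → Group 0ℓ 0ℓ
  localGroup z = record
    { Carrier = Gz.Carrier
    ; _≈_     = _≈ₗ_
    ; _∙_     = Gz._∙_
    ; ε       = Gz.ε
    ; _⁻¹     = Gz._⁻¹
    ; isGroup = record
      { isMonoid = record
        { isSemigroup = record
          { isMagma = record
            { isEquivalence = record
              { refl  = λ _ _ → V.refl
              ; sym   = λ g≈h y z~y → V.sym (g≈h y z~y)
              ; trans = λ g≈h h≈k y z~y → V.trans (g≈h y z~y) (h≈k y z~y)
              }
            ; ∙-cong = λ {g} {g′} {h} {h′} g≈g′ h≈h′ y z~y → V.trans (·-∙ y (proj₁ g) (proj₁ h))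
                (V.trans (h≈h′ _ (preserve g z~y))
                (V.trans (·-cong (g≈g′ y z~y) G.refl) (V.sym (·-∙ y (proj₁ g′) (proj₁ h′)))))
            }
          ; assoc = λ g h k → ⇒ₗ {g Gz.∙ h Gz.∙ k} {g Gz.∙ (h Gz.∙ k)} (Gz.assoc g h k)
          }
        ; identity = (λ g → ⇒ₗ {Gz.ε Gz.∙ g} {g} (Gz.identityˡ g))
                   , (λ g → ⇒ₗ {g Gz.∙ Gz.ε} {g} (Gz.identityʳ g))
        }
      ; inverse = (λ g → ⇒ₗ {g Gz.⁻¹ Gz.∙ g} {Gz.ε} (Gz.inverseˡ g))
                , (λ g → ⇒ₗ {g Gz.∙ g Gz.⁻¹} {Gz.ε} (Gz.inverseʳ g))
      ; ⁻¹-cong = λ {g} {h} g≈h y z~y → V.trans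
          (·-cong (V.sym (cancel h y)) G.refl)
          (V.trans (·-cong (V.sym (g≈h _ (preserve (h Gz.⁻¹) z~y))) G.refl)
          (V.trans (V.sym (·-∙ _ (proj₁ g) (proj₁ g ⁻¹)))
          (V.trans (·-cong V.refl (G.inverseʳ (proj₁ g))) (·-ε _))))
      }
    }
    where
    module Gz = Group (Subgroup.group (stabiliser z))

    _≈ₗ_ : Rel Gz.Carrier 0ℓ
    (g , _) ≈ₗ (h , _) = ∀ y → z ~ y → y · g ≈ᵥ y · h

    ⇒ₗ : ∀ {g h} → g Gz.≈ h → g ≈ₗ h
    ⇒ₗ g≈h y _ = ·-cong V.refl g≈h

    preserve : ∀ (g : Gz.Carrier) {y} → z ~ y → z ~ y · proj₁ g
    preserve (g , zg≈z) z~y = proj₂ ~-resp zg≈z (·-~ g z~y)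

    cancel : ∀ (h : Gz.Carrier) y → y · proj₁ h ⁻¹ · proj₁ h ≈ᵥ y
    cancel (h , _) y = V.trans (V.sym (·-∙ y (h ⁻¹) h))
      (V.trans (·-cong V.refl (G.inverseˡ h)) (·-ε y))

  TransitiveOnArcsFrom : ℕ → Vertex → Set
  TransitiveOnArcsFrom s z = ∀ (a b : Arc s z) →
    ∃ λ g → g ∈ Subgroup.Member (stabiliser z) × (∀ i → Arc.at a i · g ≈ᵥ Arc.at b i)

  LocallyArcTransitive : ℕ → Set
  LocallyArcTransitive s = ∀ z → TransitiveOnArcsFrom s z

  LocallyFinite : Set
  LocallyFinite = ∀ z → Finite (order (Subgroup.group (stabiliser z)))

  -- p-cores are unique, so quantifying O_p existentially is harmless here.
  LocalCharacteristic : ℕ → Set₁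
  LocalCharacteristic p = ∀ z → Σ (Subgroup G) λ O →
    IsPCore p (kernel z) O × centraliser (stabiliser z) O ⊆ Subgroup.Member O

  PushingUpTypeAt : ℕ → Vertex → Vertex → Set₁
  PushingUpTypeAt p x₁ x₂ = x₁ ~ x₂ × LocalCharacteristic p ×
    Σ (Subgroup G) λ O₁ → Σ (Subgroup G) λ O₂ →
      IsPCore p (kernel x₁) O₁ × IsPCore p (kernel x₂) O₂ × O₁ ≤ₛ O₂

  PushingUpType : ℕ → Set₁
  PushingUpType p = ∃₂ (PushingUpTypeAt p)

-- Vertices are represented by g in G, standing for H₁g or H₂g, and are equal
-- when these cosets are equal as sets.
module CosetGraph (G : Group 0ℓ 0ℓ) (H₁ H₂ : Pred (Group.Carrier G) 0ℓ) where
  open Group G renaming (refl to ≈-refl; sym to ≈-sym; trans to ≈-trans)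
  open GroupProperties G using (//-rightDividesˡ; //-rightDividesʳ)
  open Subsets G using (rightCoset)

  cosets : Pred Carrier 0ℓ → Setoid 0ℓ 0ℓ
  cosets H = record
    { Carrier       = Carrier
    ; _≈_           = λ g h → rightCoset H g ≐ rightCoset H h
    ; isEquivalence = On.isEquivalence (rightCoset H) ≐-isEquivalence
    }

  private
    Adj : Rel (Carrier ⊎ Carrier) 0ℓ
    Adj (inj₁ g) (inj₁ h) = ⊥
    Adj (inj₁ g) (inj₂ h) = rightCoset H₁ g ≬ rightCoset H₂ h
    Adj (inj₂ g) (inj₁ h) = rightCoset H₁ h ≬ rightCoset H₂ g
    Adj (inj₂ g) (inj₂ h) = ⊥

    _≈ᵥ_ : Rel (Carrier ⊎ Carrier) 0ℓ
    _≈ᵥ_ = Setoid._≈_ (cosets H₁ ⊎ₛ cosets H₂)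

    Adj-sym : Symmetric Adj
    Adj-sym {inj₁ _} {inj₂ _} a = a
    Adj-sym {inj₂ _} {inj₁ _} a = a

    Adj-respʳ : ∀ {u} → (Adj u) Respects _≈ᵥ_
    Adj-respʳ {inj₁ _} (Sum.inj₂ e) (x , p , q) = x , p , proj₁ e q
    Adj-respʳ {inj₂ _} (Sum.inj₁ e) (x , p , q) = x , proj₁ e p , q

    shift : ∀ H {g x k} → x ∈ rightCoset H g → x ∙ k ∈ rightCoset H (g ∙ k)
    shift H (h , h∈ , x≈) = h , h∈ , ≈-trans (∙-congʳ x≈) (assoc _ _ _)

    unshift : ∀ H {g x k} → x ∈ rightCoset H (g ∙ k) → x // k ∈ rightCoset H g
    unshift H {g} {x} {k} (h , h∈ , x≈) = h , h∈ ,
      ≈-trans (∙-congʳ (≈-trans x≈ (≈-sym (assoc _ _ _)))) (//-rightDividesʳ k (h ∙ g))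

    coset-resp : ∀ H {g} → (rightCoset H g) Respects _≈_
    coset-resp H x≈y (h , h∈ , x≈) = h , h∈ , ≈-trans (≈-sym x≈y) x≈

    coset-cong : ∀ H {g h} → g ≈ h → rightCoset H g ⊆ rightCoset H h
    coset-cong H g≈h (k , k∈ , x≈) = k , k∈ , ≈-trans x≈ (∙-congˡ g≈h)

    mult-cong : ∀ H {g h k l} → rightCoset H g ⊆ rightCoset H h → k ≈ l →
                rightCoset H (g ∙ k) ⊆ rightCoset H (h ∙ l)
    mult-cong H {k = k} s k≈l x∈ = coset-cong H (∙-congˡ k≈l)
      (coset-resp H (//-rightDividesˡ k _) (shift H (s (unshift H x∈))))

    same : ∀ H {g h} → g ≈ h → rightCoset H g ≐ rightCoset H h
    same H g≈h = coset-cong H g≈h , coset-cong H (≈-sym g≈h)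

  Δ : Graph
  Δ = record
    { vertices = cosets H₁ ⊎ₛ cosets H₂
    ; _~_      = Adj
    ; ~-resp   = Adj-respʳ , λ {w} {u} {v} u≈v u~w → Adj-sym {w} {v} (Adj-respʳ {w} u≈v (Adj-sym {u} {w} u~w))
    ; ~-sym    = λ {u} {v} → Adj-sym {u} {v}
    ; noLoop   = λ { (Sum.inj₁ _) () ; (Sum.inj₂ _) () }
    }

  action : ActionOn Δ G
  action = record
    { _·_    = λ { (inj₁ g) k → inj₁ (g ∙ k) ; (inj₂ g) k → inj₂ (g ∙ k) }
    ; ·-cong = λ { (Sum.inj₁ (s , t)) k≈l → Sum.inj₁ (mult-cong H₁ s k≈l , mult-cong H₁ t (≈-sym k≈l))
                 ; (Sum.inj₂ (s , t)) k≈l → Sum.inj₂ (mult-cong H₂ s k≈l , mult-cong H₂ t (≈-sym k≈l)) }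
    ; ·-ε    = λ { (inj₁ g) → Sum.inj₁ (same H₁ (identityʳ g)) ; (inj₂ g) → Sum.inj₂ (same H₂ (identityʳ g)) }
    ; ·-∙    = λ { (inj₁ g) k l → Sum.inj₁ (same H₁ (≈-sym (assoc g k l)))
                 ; (inj₂ g) k l → Sum.inj₂ (same H₂ (≈-sym (assoc g k l))) }
    ; ·-~    = λ { {inj₁ _} {inj₂ _} k (x , p , q) → x ∙ k , shift H₁ p , shift H₂ q
                 ; {inj₂ _} {inj₁ _} k (x , p , q) → x ∙ k , shift H₁ p , shift H₂ q }
    }

-- A finite field has decidable equality, so nothing is lost by taking ≡ for its
-- equality and ≢ for its apartness; the library's field axioms then include 1 ≢ 0.
record FiniteField (q : ℕ) : Set₁ where
  infix  8 -_
  infixl 7 _*_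
  infixl 6 _+_
  field
    Carrier        : Set
    _+_ _*_        : Op₂ Carrier
    -_             : Op₁ Carrier
    0# 1#          : Carrier
    isHeytingField : IsHeytingField _≡_ _≢_ _+_ _*_ -_ 0# 1#
    cardinality    : ∣ ≡.setoid Carrier ∣≡ q

  private module IsField = IsHeytingField isHeytingField

  commutativeRing : CommutativeRing 0ℓ 0ℓ
  commutativeRing = record { isCommutativeRing = IsField.isCommutativeRing }

  private
    module R = CommutativeRing commutativeRing
    open RingProperties R.ring using (-0#≈0#)

  recip : ∀ {k} → k ≢ 0# → ∃ λ l → l * k ≡ 1#
  recip {k} k≢0 with IsField.#⇒invertible k≢0
  ... | l , lk≡1 , _ = l , subst (λ z → l * z ≡ 1#) (trans (cong (k +_) -0#≈0#) (R.+-identityʳ k)) lk≡1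

  1≢0 : 1# ≢ 0#
  1≢0 1≡0 = IsField.invertible⇒# (0# , eq , eq′) refl
    where
    eq : 0# * (0# + - 0#) ≡ 1#
    eq = trans (R.zeroˡ _) (sym 1≡0)
    eq′ : (0# + - 0#) * 0# ≡ 1#
    eq′ = trans (R.zeroʳ _) (sym 1≡0)

module Groups {q : ℕ} (𝔽 : FiniteField q) where
  open FiniteField 𝔽 using (commutativeRing; recip; 1≢0) renaming (Carrier to F)
  open CommutativeRing commutativeRing using
    ( _+_; _*_; -_; _-_; 0#; 1#; rawRing; ring; commutativeSemiring; +-group; +-identityˡ; +-identityʳ; +-assoc; +-comm
    ; *-identityˡ; *-identityʳ; *-assoc; *-comm; distribˡ; distribʳ; zeroˡ; zeroʳ; -‿inverseʳ; -‿inverseˡ)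
  open RingProperties ring using (-‿distribˡ-*; -‿distribʳ-*; -‿involutive)
  open import Algebra.Solver.Ring.NaturalCoefficients.Default commutativeSemiring
    using (solve; _:=_; _:+_; _:*_; con)
  open Inverse using (to; from; strictlyInverseˡ; strictlyInverseʳ)
  open ≡.≡-Reasoning

  IsAut : (F → F) → Set
  IsAut = IsRingIsomorphism rawRing rawRing

  private
    module Aut {θ : F → F} (aut : IsAut θ) = IsRingIsomorphism aut

    *-nonzero : ∀ {k l} → k ≢ 0# → l ≢ 0# → k * l ≢ 0#
    *-nonzero {k} {l} k≢0 l≢0 kl≡0 with recip k≢0
    ... | m , mk≡1 = l≢0 (begin
      l            ≡⟨ *-identityˡ l ⟨
      1# * l       ≡⟨ cong (_* l) mk≡1 ⟨
      m * k * l    ≡⟨ *-assoc m k l ⟩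
      m * (k * l)  ≡⟨ cong (m *_) kl≡0 ⟩
      m * 0#       ≡⟨ zeroʳ m ⟩
      0#           ∎)

    recip-nonzero : ∀ {k l} → l * k ≡ 1# → l ≢ 0#
    recip-nonzero {k} lk≡1 l≡0 = 1≢0 (trans (sym lk≡1) (trans (cong (_* k) l≡0) (zeroˡ k)))

    aut-nonzero : ∀ {θ k} → IsAut θ → k ≢ 0# → θ k ≢ 0#
    aut-nonzero aut k≢0 θk≡0 = k≢0 (Aut.injective aut (trans θk≡0 (sym (Aut.0#-homo aut))))

    aut-id : IsAut id
    aut-id = Ident.isRingIsomorphism rawRing refl

    aut-∘ : ∀ {θ φ} → IsAut θ → IsAut φ → IsAut (φ ∘ θ)
    aut-∘ = Comp.isRingIsomorphism trans

    aut-inverse : ∀ {θ} → IsAut θ → ∃ λ φ → IsAut φ × (∀ k → θ (φ k) ≡ k)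
    aut-inverse {θ} aut = φ , isAut , θφ
      where
      open Aut aut
      φ : F → F
      φ k = proj₁ (surjective k)
      θφ : ∀ k → θ (φ k) ≡ k
      θφ k = proj₂ (surjective k) refl
      isAut : IsAut φ
      isAut = record
        { isRingMonomorphism = record
          { isRingHomomorphism = record
            { isSemiringHomomorphism = record
              { isNearSemiringHomomorphism = record
                { +-isMonoidHomomorphism = record
                  { isMagmaHomomorphism = record
                    { isRelHomomorphism = record { cong = cong φ }
                    ; homo = λ x y → injective (trans (θφ _)
                        (sym (trans (+-homo _ _) (cong₂ _+_ (θφ x) (θφ y))))) }
                  ; ε-homo = injective (trans (θφ _) (sym 0#-homo)) }
                ; *-homo = λ x y → injective (trans (θφ _)
                    (sym (trans (*-homo _ _) (cong₂ _*_ (θφ x) (θφ y))))) }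
              ; 1#-homo = injective (trans (θφ _) (sym 1#-homo)) }
            ; -‿homo = λ x → injective (trans (θφ _) (sym (trans (-‿homo _) (cong -_ (θφ x))))) }
          ; injective = λ {x} {y} e → trans (sym (θφ x)) (trans (cong θ e) (θφ y)) }
        ; surjective = λ y → θ y , λ { refl → injective (θφ (θ y)) }
        }

    perm-injective : ∀ {X : Set} (f : X ↔ X) {x y} → to f x ≡ to f y → x ≡ y
    perm-injective f {x} {y} e = trans (sym (strictlyInverseʳ f x)) (trans (cong (from f) e) (strictlyInverseʳ f y))

  F² : Set
  F² = F × F

  infixl 6 _⊕_
  infixr 7 _•_

  _⊕_ : F² → F² → F²
  (x , y) ⊕ (x′ , y′) = x + x′ , y + y′

  _•_ : F → F² → F²
  k • (x , y) = k * x , k * y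

  private
    •-assoc : ∀ k l v → (k * l) • v ≡ k • l • v
    •-assoc k l (x , y) = cong₂ _,_ (*-assoc k l x) (*-assoc k l y)

    •-one : ∀ v → 1# • v ≡ v
    •-one (x , y) = cong₂ _,_ (*-identityˡ x) (*-identityˡ y)

    •-⊕ : ∀ k u v → k • (u ⊕ v) ≡ k • u ⊕ k • v
    •-⊕ k _ _ = cong₂ _,_ (distribˡ k _ _) (distribˡ k _ _)

    •-comm : ∀ k l v → k • l • v ≡ l • k • v
    •-comm k l v = trans (sym (•-assoc k l v)) (trans (cong (_• v) (*-comm k l)) (•-assoc l k v))

  ΓL₂ : Subgroup (Sym F²)
  ΓL₂ = record
    { Member = λ f → ∃ λ θ → IsAut θ × (∀ u v → to f (u ⊕ v) ≡ to f u ⊕ to f v)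
                                    × (∀ k v → to f (k • v) ≡ θ k • to f v)
    ; resp = λ { f≈g (θ , aut , add , semi) → θ , aut
        , (λ u v → trans (sym (f≈g _)) (trans (add u v) (cong₂ _⊕_ (f≈g u) (f≈g v))))
        , (λ k v → trans (sym (f≈g _)) (trans (semi k v) (cong (θ k •_) (f≈g v)))) }
    ; ε∈ = id , aut-id , (λ _ _ → refl) , (λ _ _ → refl)
    ; ∙∈ = λ { {f} {g} (θ , aut , add , semi) (φ , aut′ , add′ , semi′) → φ ∘ θ , aut-∘ aut aut′
        , (λ u v → trans (cong (to g) (add u v)) (add′ _ _))
        , (λ k v → trans (cong (to g) (semi k v)) (semi′ _ _)) }
    ; ⁻¹∈ = λ { {f} (θ , aut , add , semi) → let φ , aut′ , θφ = aut-inverse aut in φ , aut′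
        , (λ u v → perm-injective f (begin
            to f (from f (u ⊕ v))                ≡⟨ strictlyInverseˡ f _ ⟩
            u ⊕ v                                ≡⟨ cong₂ _⊕_ (strictlyInverseˡ f u) (strictlyInverseˡ f v) ⟨
            to f (from f u) ⊕ to f (from f v)    ≡⟨ add _ _ ⟨
            to f (from f u ⊕ from f v)           ∎))
        , (λ k v → perm-injective f (begin
            to f (from f (k • v))                ≡⟨ strictlyInverseˡ f _ ⟩
            k • v                                ≡⟨ cong₂ _•_ (θφ k) (strictlyInverseˡ f v) ⟨
            θ (φ k) • to f (from f v)            ≡⟨ semi _ _ ⟨
            to f (φ k • from f v)                ∎)) }
    }

  Scalars : Subgroup (Sym F²)
  Scalars = record
    { Member = λ f → ∃ λ k → k ≢ 0# × (∀ v → to f v ≡ k • v)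
    ; resp = λ { f≈g (k , k≢0 , e) → k , k≢0 , λ v → trans (sym (f≈g v)) (e v) }
    ; ε∈ = 1# , 1≢0 , λ v → sym (•-one v)
    ; ∙∈ = λ { {f} {g} (k , k≢0 , e) (l , l≢0 , e′) → l * k , *-nonzero l≢0 k≢0
        , λ v → trans (cong (to g) (e v)) (trans (e′ _) (sym (•-assoc l k v))) }
    ; ⁻¹∈ = λ { {f} (k , k≢0 , e) → let l , lk≡1 = recip k≢0 in l , recip-nonzero lk≡1
        , λ v → begin
            from f v                  ≡⟨ •-one _ ⟨
            1# • from f v             ≡⟨ cong (_• from f v) lk≡1 ⟨
            (l * k) • from f v        ≡⟨ •-assoc l k _ ⟩
            l • k • from f v          ≡⟨ cong (l •_) (e (from f v)) ⟨
            l • to f (from f v)       ≡⟨ cong (l •_) (strictlyInverseˡ f v) ⟩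
            l • v                     ∎ }
    }

  Scalars⊴ΓL₂ : Scalars ⊴ ΓL₂
  Scalars⊴ΓL₂ =
      (λ { {f} (k , _ , e) → id , aut-id
         , (λ u v → trans (e _) (trans (•-⊕ k u v) (sym (cong₂ _⊕_ (e u) (e v)))))
         , (λ l v → trans (e _) (trans (•-comm k l v) (cong (l •_) (sym (e v))))) })
    , (λ { {h} {f} (θ , aut , _ , semi) (k , k≢0 , e) → θ k , aut-nonzero aut k≢0
         , λ v → trans (cong (to h) (e _)) (trans (semi _ _) (cong (θ k •_) (strictlyInverseˡ h v))) })

  -- Equality in this quotient is equality up to a nonzero scalar.
  PΓL₂ : Group 0ℓ 0ℓ
  PΓL₂ = quotient ΓL₂ Scalars Scalars⊴ΓL₂

  private
    -- a d - b c = 1 without subtraction, as the semiring solver needs it.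
    det⇒ : ∀ {m n} → m - n ≡ 1# → m ≡ 1# + n
    det⇒ {m} {n} e = begin
      m               ≡⟨ +-identityʳ m ⟨
      m + 0#          ≡⟨ cong (m +_) (-‿inverseˡ n) ⟨
      m + (- n + n)   ≡⟨ +-assoc m (- n) n ⟨
      m - n + n       ≡⟨ cong (_+ n) e ⟩
      1# + n          ∎

    det⇐ : ∀ {m n} → m ≡ 1# + n → m - n ≡ 1#
    det⇐ {m} {n} refl = trans (+-assoc 1# n (- n)) (trans (cong (1# +_) (-‿inverseʳ n)) (+-identityʳ 1#))

    det-mult : ∀ a b c d a′ b′ c′ d′ → a * d - b * c ≡ 1# → a′ * d′ - b′ * c′ ≡ 1# →
               (a′ * a + b′ * c) * (c′ * b + d′ * d) - (a′ * b + b′ * d) * (c′ * a + d′ * c) ≡ 1#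
    det-mult a b c d a′ b′ c′ d′ e e′ = det⇐ (begin
      (a′ * a + b′ * c) * (c′ * b + d′ * d)
        ≡⟨ solve 8 (λ a b c d a′ b′ c′ d′ →
             (a′ :* a :+ b′ :* c) :* (c′ :* b :+ d′ :* d) :=
             (a′ :* d′) :* (a :* d) :+ (b′ :* c′) :* (b :* c) :+ (a′ :* a :* c′ :* b :+ b′ :* c :* d′ :* d))
             refl a b c d a′ b′ c′ d′ ⟩
      (a′ * d′) * (a * d) + (b′ * c′) * (b * c) + (a′ * a * c′ * b + b′ * c * d′ * d)
        ≡⟨ cong₂ (λ x y → x * y + (b′ * c′) * (b * c) + (a′ * a * c′ * b + b′ * c * d′ * d)) (det⇒ e′) (det⇒ e) ⟩
      (1# + b′ * c′) * (1# + b * c) + (b′ * c′) * (b * c) + (a′ * a * c′ * b + b′ * c * d′ * d)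
        ≡⟨ solve 8 (λ a b c d a′ b′ c′ d′ →
             (con 1 :+ b′ :* c′) :* (con 1 :+ b :* c) :+ (b′ :* c′) :* (b :* c)
               :+ (a′ :* a :* c′ :* b :+ b′ :* c :* d′ :* d) :=
             con 1 :+ ((con 1 :+ b′ :* c′) :* (b :* c) :+ (b′ :* c′) :* (con 1 :+ b :* c)
               :+ (a′ :* a :* c′ :* b :+ b′ :* c :* d′ :* d)))
             refl a b c d a′ b′ c′ d′ ⟩
      1# + ((1# + b′ * c′) * (b * c) + (b′ * c′) * (1# + b * c) + (a′ * a * c′ * b + b′ * c * d′ * d))
        ≡⟨ cong₂ (λ x y → 1# + (x * (b * c) + (b′ * c′) * y + (a′ * a * c′ * b + b′ * c * d′ * d))) (det⇒ e′) (det⇒ e) ⟨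
      1# + ((a′ * d′) * (b * c) + (b′ * c′) * (a * d) + (a′ * a * c′ * b + b′ * c * d′ * d))
        ≡⟨ cong (1# +_) (solve 8 (λ a b c d a′ b′ c′ d′ →
             (a′ :* d′) :* (b :* c) :+ (b′ :* c′) :* (a :* d) :+ (a′ :* a :* c′ :* b :+ b′ :* c :* d′ :* d) :=
             (a′ :* b :+ b′ :* d) :* (c′ :* a :+ d′ :* c))
             refl a b c d a′ b′ c′ d′) ⟩
      1# + (a′ * b + b′ * d) * (c′ * a + d′ * c) ∎)

    row-mult : ∀ a b c d x y p q → p * (a * x + b * y) + q * (c * x + d * y)
                                 ≡ (p * a + q * c) * x + (p * b + q * d) * y
    row-mult = solve 8 (λ a b c d x y p q → p :* (a :* x :+ b :* y) :+ q :* (c :* x :+ d :* y)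
                                          := (p :* a :+ q :* c) :* x :+ (p :* b :+ q :* d) :* y) refl

    neg-*-neg : ∀ b c → - b * - c ≡ b * c
    neg-*-neg b c = begin
      - b * - c      ≡⟨ -‿distribˡ-* b (- c) ⟨
      - (b * - c)    ≡⟨ cong -_ (-‿distribʳ-* b c) ⟨
      - - (b * c)    ≡⟨ -‿involutive _ ⟩
      b * c          ∎

    adjugate : ∀ a b c d x y → a * d - b * c ≡ 1# →
               (a * (d * x + - b * y) + b * (- c * x + a * y) , c * (d * x + - b * y) + d * (- c * x + a * y)) ≡ (x , y)
    adjugate a b c d x y e = cong₂ _,_
      (trans (row-mult d (- b) (- c) a x y a b) (lemma (trans (cong (a * d +_) (sym (-‿distribʳ-* b c))) e)
        (trans (cong₂ _+_ (sym (-‿distribʳ-* a b)) (*-comm b a)) (-‿inverseˡ _))))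
      (trans (row-mult d (- b) (- c) a x y c d) (trans (+-comm _ _) (lemma
        (trans (+-comm _ _) (trans (cong₂ _+_ (*-comm d a) (trans (sym (-‿distribʳ-* c b)) (cong -_ (*-comm c b)))) e))
        (trans (cong₂ _+_ (*-comm c d) (sym (-‿distribʳ-* d c))) (-‿inverseʳ _)))))
      where
      lemma : ∀ {m n x y} → m ≡ 1# → n ≡ 0# → m * x + n * y ≡ x
      lemma {x = x} {y} refl refl = trans (cong₂ _+_ (*-identityˡ x) (zeroˡ y)) (+-identityʳ x)

  SL₂ : Subgroup (Sym F²)
  SL₂ = record
    { Member = λ f → ∃₂ λ a b → ∃₂ λ c d → a * d - b * c ≡ 1# ×
                     (∀ x y → to f (x , y) ≡ (a * x + b * y , c * x + d * y))
    ; resp = λ { f≈g (a , b , c , d , det , e) → a , b , c , d , det , λ x y → trans (sym (f≈g _)) (e x y) }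
    ; ε∈ = 1# , 0# , 0# , 1# , det⇐ (trans (*-identityˡ 1#) (sym (trans (cong (1# +_) (zeroˡ 0#)) (+-identityʳ 1#))))
         , λ x y → cong₂ _,_ (sym (trans (cong₂ _+_ (*-identityˡ x) (zeroˡ y)) (+-identityʳ x)))
                             (sym (trans (cong₂ _+_ (zeroˡ x) (*-identityˡ y)) (+-identityˡ y)))
    ; ∙∈ = λ { {f} {g} (a , b , c , d , det , e) (a′ , b′ , c′ , d′ , det′ , e′) →
          a′ * a + b′ * c , a′ * b + b′ * d , c′ * a + d′ * c , c′ * b + d′ * d
        , det-mult a b c d a′ b′ c′ d′ det det′
        , λ x y → trans (cong (to g) (e x y)) (trans (e′ _ _)
            (cong₂ _,_ (row-mult a b c d x y a′ b′) (row-mult a b c d x y c′ d′))) }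
    ; ⁻¹∈ = λ { {f} (a , b , c , d , det , e) → d , - b , - c , a
        , trans (cong₂ _-_ (*-comm d a) (neg-*-neg b c)) det
        , λ x y → perm-injective f (begin
            to f (from f (x , y))                        ≡⟨ strictlyInverseˡ f _ ⟩
            (x , y)                                      ≡⟨ adjugate a b c d x y det ⟨
            _                                            ≡⟨ e _ _ ⟨
            to f (d * x + - b * y , - c * x + a * y)     ∎) }
    }

  naturalModule : GroupAction (Direct.group +-group +-group) (Subgroup.group SL₂)
  naturalModule = record
    { _◃_    = λ v f → to (proj₁ f) v
    ; ◃-cong = λ { {m} (refl , refl) f≈g → split (f≈g m) }
    ; ◃-homo = λ { (x , y) (x′ , y′) (f , a , b , c , d , _ , e) → split (begin
        to f (x + x′ , y + y′)                                                ≡⟨ e _ _ ⟩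
        (a * (x + x′) + b * (y + y′) , c * (x + x′) + d * (y + y′))           ≡⟨ cong₂ _,_ (row-add a b x x′ y y′) (row-add c d x x′ y y′) ⟩
        (a * x + b * y , c * x + d * y) ⊕ (a * x′ + b * y′ , c * x′ + d * y′) ≡⟨ cong₂ _⊕_ (e x y) (e x′ y′) ⟨
        to f (x , y) ⊕ to f (x′ , y′)                                         ∎) }
    ; ◃-ε    = λ _ → refl , refl
    ; ◃-∙    = λ _ _ _ → refl , refl
    }
    where
    split : ∀ {u v : F²} → u ≡ v → proj₁ u ≡ proj₁ v × proj₂ u ≡ proj₂ v
    split refl = refl , refl

    row-add : ∀ a b x x′ y y′ → a * (x + x′) + b * (y + y′) ≡ (a * x + b * y) + (a * x′ + b * y′)
    row-add = solve 6 (λ a b x x′ y y′ → a :* (x :+ x′) :+ b :* (y :+ y′)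
                                       := (a :* x :+ b :* y) :+ (a :* x′ :+ b :* y′)) refl

  ASL₂ : Group 0ℓ 0ℓ
  ASL₂ = Direct.group +-group +-group ⋊ Subgroup.group SL₂ [ naturalModule ]

  AΓL₁ : Subgroup (Sym F)
  AΓL₁ = record
    { Member = λ f → ∃₂ λ a b → ∃ λ θ → a ≢ 0# × IsAut θ × (∀ x → to f x ≡ a * θ x + b)
    ; resp = λ { f≈g (a , b , θ , a≢0 , aut , e) → a , b , θ , a≢0 , aut , λ x → trans (sym (f≈g x)) (e x) }
    ; ε∈ = 1# , 0# , id , 1≢0 , aut-id , λ x → sym (trans (+-identityʳ _) (*-identityˡ x))
    ; ∙∈ = λ { {f} {g} (a , b , θ , a≢0 , aut , e) (a′ , b′ , φ , a′≢0 , aut′ , e′) →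
          a′ * φ a , a′ * φ b + b′ , φ ∘ θ , *-nonzero a′≢0 (aut-nonzero aut′ a≢0) , aut-∘ aut aut′ , λ x → begin
            to g (to f x)                          ≡⟨ cong (to g) (e x) ⟩
            to g (a * θ x + b)                     ≡⟨ e′ _ ⟩
            a′ * φ (a * θ x + b) + b′              ≡⟨ cong (λ z → a′ * z + b′) (trans (Aut.+-homo aut′ _ _) (cong (_+ φ b) (Aut.*-homo aut′ _ _))) ⟩
            a′ * (φ a * φ (θ x) + φ b) + b′        ≡⟨ solve 5 (λ a′ p t r b′ → a′ :* (p :* t :+ r) :+ b′ := (a′ :* p) :* t :+ (a′ :* r :+ b′)) refl a′ (φ a) (φ (θ x)) (φ b) b′ ⟩
            a′ * φ a * φ (θ x) + (a′ * φ b + b′)   ∎ }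
    ; ⁻¹∈ = λ { {f} (a , b , θ , a≢0 , aut , e) →
          let φ , aut′ , θφ = aut-inverse aut
              l , la≡1 = recip a≢0
          in φ l , φ (l * - b) , φ , aut-nonzero aut′ (recip-nonzero la≡1) , aut′ , λ x → perm-injective f (begin
            to f (from f x)                            ≡⟨ strictlyInverseˡ f x ⟩
            x                                          ≡⟨ solveFor a b l x la≡1 ⟨
            a * (l * x + l * - b) + b                  ≡⟨ cong (λ z → a * z + b) (cong₂ _+_ (cong₂ _*_ (θφ l) (θφ x)) (θφ (l * - b))) ⟨
            a * (θ (φ l) * θ (φ x) + θ (φ (l * - b))) + b ≡⟨ cong (λ z → a * (z + θ (φ (l * - b))) + b) (Aut.*-homo aut _ _) ⟨
            a * (θ (φ l * φ x) + θ (φ (l * - b))) + b  ≡⟨ cong (λ z → a * z + b) (Aut.+-homo aut _ _) ⟨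
            a * θ (φ l * φ x + φ (l * - b)) + b        ≡⟨ e _ ⟨
            to f (φ l * φ x + φ (l * - b))             ∎) }
    }
    where
    solveFor : ∀ a b l x → l * a ≡ 1# → a * (l * x + l * - b) + b ≡ x
    solveFor a b l x la≡1 = begin
      a * (l * x + l * - b) + b     ≡⟨ solve 5 (λ a b l x n → a :* (l :* x :+ l :* n) :+ b := (l :* a) :* (x :+ n) :+ b) refl a b l x (- b) ⟩
      l * a * (x + - b) + b         ≡⟨ cong (λ z → z * (x + - b) + b) la≡1 ⟩
      1# * (x + - b) + b            ≡⟨ cong (_+ b) (*-identityˡ _) ⟩
      x + - b + b                   ≡⟨ +-assoc _ _ _ ⟩
      x + (- b + b)                 ≡⟨ cong (x +_) (-‿inverseˡ b) ⟩
      x + 0#                        ≡⟨ +-identityʳ x ⟩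
      x                             ∎

module Construction {q : ℕ} (𝔽 : FiniteField q) where
  open FiniteField 𝔽 using (commutativeRing) renaming (Carrier to F)
  open CommutativeRing commutativeRing using (_+_; _*_; -_; 0#; 1#; semiring)
  open Exp semiring using (_^_)

  Ω : Set
  Ω = F × F × F

  open Subsets (Sym Ω)

  Perm : Set
  Perm = Ω ↔ Ω

  ε : ℕ
  ε = q / 3

  -- The permutations of Ω given by the formula f (one up to equality in Sym Ω
  -- if f is a bijection, as it is in each case below).
  Is : (Ω → Ω) → Pred Perm 0ℓ
  Is f g = ∀ x → Inverse.to g x ≡ f x

  α : F → F → F → Pred Perm 0ℓ
  α u v w = Is λ { (a , b , c) → a + u , b + v , c + w }

  -- Only used for nonzero l and m.
  β : F → F → Pred Perm 0ℓ
  β l m = Is λ { (a , b , c) → l * a , m * b , (l * m) ^ (2 ℕ.* ε) * c }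

  γ : F → Pred Perm 0ℓ
  γ e = Is λ { (a , b , c) → a + e * b , b , c }

  δ : Pred Perm 0ℓ
  δ = Is λ { (a , b , c) → b , - a , c }

  τ : F → Pred Perm 0ℓ
  τ d = Is λ { (a , b , c) → a + d * b ^ 2 + d ^ ε * c , b , c }

  σ : Pred Perm 0ℓ
  σ = Is λ { (a , b , c) → a ^ 3 , b ^ 3 , c ^ 3 }

  -- Φ stands for Σ, which would clash with the dependent sum.
  A C S T D E Φ M Q : Pred Perm 0ℓ
  A = ⟨ (λ g → ∃₂ λ u v → ∃ λ w → g ∈ α u v w) ⟩
  C = ⟨ (λ g → ∃ λ e → g ∈ γ e) ⟩
  S = ⟨ (λ g → ∃ λ m → m ≢ 0# × g ∈ β (m ^ 2) m) ⟩
  T = ⟨ (λ g → ∃₂ λ m m⁻¹ → m * m⁻¹ ≡ 1# × g ∈ β m m⁻¹) ⟩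
  D = ⟨ δ ⟩
  E = ⟨ (λ g → ∃ λ d → g ∈ τ d) ⟩
  Φ = ⟨ σ ⟩
  M = ⟨ C ∪ D ∪ T ⟩
  Q = ⟨ A ∪ C ⟩

  -- The products of subgroups are plain product sets; that they are again
  -- subgroups is not presupposed anywhere below.
  G₁ G₂ : Pred Perm 0ℓ
  G₁ = A ⊙ M ⊙ S ⊙ Φ
  G₂ = Q ⊙ S ⊙ E ⊙ T ⊙ Φ

  G : Group 0ℓ 0ℓ
  G = Subgroup.group (generated (G₁ ∪ G₂))

  open CosetGraph G (λ g → proj₁ g ∈ G₁) (λ g → proj₁ g ∈ G₂) public using (Δ; action)
  open Graph Δ public
  open GGraph action public

{-# OPTIONS --safe #-}

-- In characteristic 3 the exponent ε = q/3 is the cube root, and every field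
-- automorphism is a power of the Frobenius map. So G₁ consists of the maps
-- x ↦ lift f x + t with f in ΓL₂(q), where lift f acts by f on (a , b) and by
-- det(f)^(2ε) θ on c, and G₂ is the product of Q = E_q × U with a copy of the
-- Borel subgroup of ΓL₂(q) that is twisted so that its root elements become
-- the τ_d; both are semidirect products. The neighbours of G₁ are the lines of
-- F², those of G₂ the lines other than that of e₁, and an element fixes all
-- neighbours exactly when its linear part is scalar. This gives the local
-- groups, and O₃ of the kernel is the normal subgroup acting trivially on F²
-- because scalars have no 3-torsion. For arc transitivity the end of an arc is
-- moved back to the edge {G₁ , G₂} after every step, where root elements or
-- diagonal matrices fixing the whole arc are transitive on the continuations.
-- Finally, the elements of a Sylow 3-subgroup of SL₂(q) have trace 2, hence a
-- common fixed vector, so the subgroup is conjugate to the root group.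
module Submission where

open import Algebra.Bundles using (CommutativeMonoid; CommutativeRing; Group)
import Algebra.Construct.DirectProduct as Direct
open import Algebra.Morphism.Structures using (IsGroupIsomorphism; IsRingIsomorphism)
import Algebra.Properties.CommutativeMonoid.Sum as Sums
import Algebra.Properties.Group as GroupProperties
import Algebra.Properties.Monoid.Mult as Mult
open import Data.Empty using (⊥-elim)
open import Data.Fin.Base as Fin using (Fin; toℕ; inject₁; fromℕ; suc; zero)
import Data.Fin.Properties as Finₚ
import Data.Fin.Permutation as Perm
open import Data.List.Base as List using (List; []; _∷_)
open import Data.List.Relation.Unary.Any as Any using (Any; here; there)
import Data.List.Relation.Unary.Any.Properties as Anyₚ
open import Data.Nat.Base as ℕ using (ℕ)
import Data.Nat.Properties as ℕₚ
open import Data.Nat.Divisibility using (_∣_; divides)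
import Data.Nat.DivMod as DivMod
open import Data.Product using (Σ; ∃; ∃₂; _×_; _,_; proj₁; proj₂)
open import Data.Product.Relation.Binary.Pointwise.NonDependent using (_×ₛ_)
open import Data.Sum.Base using (_⊎_; inj₁; inj₂)
open import Data.Unit.Base using (⊤; tt)
open import Function.Base using (id; _∘_)
open import Function.Bundles using (Inverse; _↔_; mk↔ₛ′)
import Function.Construct.Composition as Compose
import Function.Construct.Symmetry as Symmetry
open import Level using (0ℓ)
open import Relation.Binary.Bundles using (Setoid)
open import Relation.Binary.Definitions using (Decidable; _Respects_; tri<; tri≈; tri>)
open import Relation.Binary.PropositionalEquality as ≡ using (_≡_; _≢_; refl; sym; trans; cong; cong₂; subst)
open import Relation.Nullary.Decidable using (Dec; yes; no; map′; _×-dec_; ¬?; decidable-stable)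
open import Relation.Nullary.Negation using (¬_; contradiction)
open import Relation.Unary using (Pred; _∈_; _⊆_; _≐_)
open import Defs
open import Data.Vec.Base as Vec using (Vec; []; _∷_; _∷ʳ_; lookup)
import Data.Vec.Properties as Vecₚ
open import Data.Sum.Relation.Binary.Pointwise as Sum using (_⊎ₛ_)
open import Data.Fin.Relation.Unary.Top using (view; view-fromℕ; view-inject₁; ‵fromℕ; ‵inj₁)
open import Data.Bool.Base using (Bool; true; false; not)
open import Data.Vec.Relation.Unary.All as VAll using ([]; _∷_)
open import Data.Vec.Relation.Binary.Pointwise.Inductive as VPw using ([]; _∷_)
open import Relation.Binary.Construct.Closure.ReflexiveTransitive as Star using (Star; _◅◅_; _◅_; gmap) renaming (ε to done)
open import Relation.Unary using (_∪_)
import Data.Nat.Divisibility as ℕ∣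

module _ {S : Setoid 0ℓ 0ℓ} where
  open Setoid S renaming (refl to ≈-refl; sym to ≈-sym; trans to ≈-trans)

  ∣∣-injective : ∀ {n} (c : ∣ S ∣≡ n) {x y} → Inverse.to c x ≡ Inverse.to c y → x ≈ y
  ∣∣-injective c {x} {y} e = ≈-trans (≈-sym (Inverse.strictlyInverseʳ c x))
    (≈-trans (Inverse.from-cong c e) (Inverse.strictlyInverseʳ c y))

  ∣∣-dec : ∀ {n} → ∣ S ∣≡ n → Decidable _≈_
  ∣∣-dec c x y = map′ (∣∣-injective c) (Inverse.to-cong c) (Inverse.to c x Finₚ.≟ Inverse.to c y)

  Covers : List Carrier → Set
  Covers xs = ∀ x → Any (x ≈_) xs

  ∣∣-list : ∀ {n} → ∣ S ∣≡ n → List Carrier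
  ∣∣-list c = List.tabulate (Inverse.from c)

  ∣∣-covers : ∀ {n} (c : ∣ S ∣≡ n) → Covers (∣∣-list c)
  ∣∣-covers c x = Anyₚ.tabulate⁺ (Inverse.to c x) (≈-sym (Inverse.strictlyInverseʳ c x))

  distinct : Decidable _≈_ → (xs : List Carrier) → ∃ λ n → Σ (Fin n → Carrier) λ f →
             (∀ {i j} → f i ≈ f j → i ≡ j) × (∀ {x} → Any (x ≈_) xs → ∃ λ i → x ≈ f i)
  distinct _≟_ [] = 0 , (λ ()) , (λ { {()} }) , λ ()
  distinct _≟_ (y ∷ ys) with distinct _≟_ ys
  ... | n , f , inj , cov with Finₚ.any? (λ i → y ≟ f i)
  ...   | yes (i , y≈) = n , f , inj , λ { (here x≈) → i , ≈-trans x≈ y≈ ; (there a) → cov a }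
  ...   | no y∉ = ℕ.suc n , g , g-inj , λ
          { (here x≈) → zero , x≈ ; (there a) → let i , x≈ = cov a in suc i , x≈ }
    where
    g : Fin (ℕ.suc n) → Carrier
    g zero = y
    g (suc i) = f i
    g-inj : ∀ {i j} → g i ≈ g j → i ≡ j
    g-inj {zero} {zero} _ = refl
    g-inj {zero} {suc j} e = ⊥-elim (y∉ (j , e))
    g-inj {suc i} {zero} e = ⊥-elim (y∉ (i , ≈-sym e))
    g-inj {suc i} {suc j} e = cong suc (inj e)

  covered⇒finite : Decidable _≈_ → ∀ {xs} → Covers xs → Finite S
  covered⇒finite _≟_ {xs} covers with distinct _≟_ xs
  ... | n , f , inj , cov = n , record
    { to = λ x → proj₁ (cov (covers x))
    ; from = f
    ; to-cong = λ {x} {y} x≈y → inj (≈-trans (≈-sym (proj₂ (cov (covers x))))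
        (≈-trans x≈y (proj₂ (cov (covers y)))))
    ; from-cong = λ { refl → ≈-refl }
    ; inverse = (λ {i} x≈ → inj (≈-trans (≈-sym (proj₂ (cov (covers _)))) x≈))
              , λ { {x} refl → ≈-sym (proj₂ (cov (covers x))) }
    }

  satisfying : ∀ {P : Pred Carrier 0ℓ} → (∀ x → Dec (P x)) → List Carrier → List (Σ Carrier P)
  satisfying P? [] = []
  satisfying P? (x ∷ xs) with P? x
  ... | yes p = (x , p) ∷ satisfying P? xs
  ... | no _ = satisfying P? xs

  satisfying-covers : ∀ {P : Pred Carrier 0ℓ} (P? : ∀ x → Dec (P x)) → P Respects _≈_ →
                      ∀ {x xs} → P x → Any (x ≈_) xs → Any ((x ≈_) ∘ proj₁) (satisfying P? xs)
  satisfying-covers P? resp {xs = y ∷ ys} p a with P? y | a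
  ... | yes q | here x≈ = here x≈
  ... | yes q | there b = there (satisfying-covers P? resp p b)
  ... | no ¬q | here x≈ = contradiction (resp x≈ p) ¬q
  ... | no ¬q | there b = satisfying-covers P? resp p b

module _ {S : Setoid 0ℓ 0ℓ} where
  open Setoid S renaming (refl to ≈-refl; sym to ≈-sym; trans to ≈-trans)

  subset-finite : Finite S → ∀ {P : Pred Carrier 0ℓ} → (∀ x → Dec (P x)) → P Respects _≈_ →
                  Finite (subsetoid S P)
  subset-finite (n , c) P? resp = covered⇒finite {S = subsetoid S _} (λ x y → ∣∣-dec c (proj₁ x) (proj₁ y))
    (λ x → satisfying-covers {S} P? resp (proj₂ x) (∣∣-covers c (proj₁ x)))

  ∃? : Finite S → ∀ {P : Pred Carrier 0ℓ} → (∀ x → Dec (P x)) → P Respects _≈_ → Dec (∃ P)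
  ∃? (n , c) P? resp = map′ (λ { (i , p) → Inverse.from c i , p })
    (λ { (x , p) → Inverse.to c x , resp (≈-sym (Inverse.strictlyInverseʳ c x)) p })
    (Finₚ.any? (P? ∘ Inverse.from c))

_×-∣∣_ : ∀ {S T m n} → ∣ S ∣≡ m → ∣ T ∣≡ n → ∣ S ×ₛ T ∣≡ (m ℕ.* n)
_×-∣∣_ {S} {T} {m} {n} c d = record
  { to = λ { (x , y) → Fin.combine (C.to x) (D.to y) }
  ; from = λ k → C.from (proj₁ (Fin.remQuot {m} n k)) , D.from (proj₂ (Fin.remQuot {m} n k))
  ; to-cong = λ { (p , q) → cong₂ Fin.combine (C.to-cong p) (D.to-cong q) }
  ; from-cong = λ { refl → Setoid.refl S , Setoid.refl T }
  ; inverse = (λ { {k} (p , q) → trans (cong₂ Fin.combine (C.inverseˡ p) (D.inverseˡ q)) (Finₚ.combine-remQuot {m} n k) })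
            , λ { {x , y} refl →
                Setoid.trans S (C.from-cong (cong proj₁ (Finₚ.remQuot-combine (C.to x) (D.to y)))) (C.strictlyInverseʳ x)
              , Setoid.trans T (D.from-cong (cong proj₂ (Finₚ.remQuot-combine (C.to x) (D.to y)))) (D.strictlyInverseʳ y) }
  }
  where
  module C = Inverse c
  module D = Inverse d

∣∣-via : ∀ {S T n} → Inverse S T → ∣ T ∣≡ n → ∣ S ∣≡ n
∣∣-via i c = Compose.inverse i c

module _ {S T : Setoid 0ℓ 0ℓ} where
  private
    module S = Setoid S
    module T = Setoid T

  IsInjection : (S.Carrier → T.Carrier) → Set
  IsInjection f = (∀ {x y} → x S.≈ y → f x T.≈ f y) × (∀ {x y} → f x T.≈ f y → x S.≈ y)

  private
    code-injective : ∀ {m n} (c : ∣ S ∣≡ m) (d : ∣ T ∣≡ n) {f} → IsInjection f → ∀ {i j} →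
                     Inverse.to d (f (Inverse.from c i)) ≡ Inverse.to d (f (Inverse.from c j)) → i ≡ j
    code-injective c d (_ , inj) {i} {j} e = trans (sym (Inverse.strictlyInverseˡ c i))
      (Inverse.inverseˡ c (inj (∣∣-injective d e)))

  injection⇒≤ : ∀ {m n} → ∣ S ∣≡ m → ∣ T ∣≡ n → ∀ {f} → IsInjection f → m ℕ.≤ n
  injection⇒≤ c d inj = Finₚ.injective⇒≤ (code-injective c d inj)

  injection⇒surjection : ∀ {m n} → ∣ S ∣≡ m → ∣ T ∣≡ n → n ℕ.≤ m → ∀ {f} → IsInjection f →
                         ∀ y → ∃ λ x → f x T.≈ y
  injection⇒surjection {m} {n} c d n≤m {f} inj y with Finₚ.any? (λ i → Inverse.to d (f (Inverse.from c i)) Finₚ.≟ Inverse.to d y)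
  ... | yes (i , e) = Inverse.from c i , ∣∣-injective d e
  injection⇒surjection {m} {ℕ.suc n} c d n≤m {f} inj y | no y∉ =
    contradiction (Finₚ.injective⇒≤ {f = λ i → Fin.punchOut (avoids i)}
      (λ {i} {j} e → code-injective c d inj (Finₚ.punchOut-injective (avoids i) (avoids j) e))) (ℕₚ.<⇒≱ n≤m)
    where
    avoids : ∀ i → Inverse.to d y ≢ Inverse.to d (f (Inverse.from c i))
    avoids i e = y∉ (i , sym e)
  injection⇒surjection {m} {ℕ.zero} c d n≤m {f} inj y | no y∉ with () ← Inverse.to d y

∣∣-unique : ∀ {S m n} → ∣ S ∣≡ m → ∣ S ∣≡ n → m ≡ n
∣∣-unique {S} c d = ℕₚ.≤-antisym (injection⇒≤ c d (id , id)) (injection⇒≤ d c (id , id))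

mk≅ : ∀ {A B : Group 0ℓ 0ℓ} → let module A = Group A; module B = Group B in
      (f : A.Carrier → B.Carrier) → (∀ {x y} → x A.≈ y → f x B.≈ f y) →
      (∀ x y → f (x A.∙ y) B.≈ f x B.∙ f y) → (∀ {x y} → f x B.≈ f y → x A.≈ y) →
      (∀ y → ∃ λ x → f x B.≈ y) → A ≅ B
mk≅ {A} {B} f f-cong homo injective surjective = f , record
  { isGroupMonomorphism = record
    { isGroupHomomorphism = record
      { isMonoidHomomorphism = record
        { isMagmaHomomorphism = record
          { isRelHomomorphism = record { cong = f-cong }
          ; homo = homo
          }
        ; ε-homo = f-ε
        }
      ; ⁻¹-homo = λ x → inverseʳ-unique (f x) (f (x A.⁻¹))
          (B.trans (B.sym (homo _ _)) (B.trans (f-cong (A.inverseʳ x)) f-ε))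
      }
    ; injective = injective
    }
  ; surjective = λ y → let x , e = surjective y in x , λ z≈x → B.trans (f-cong z≈x) e
  }
  where
  module A = Group A
  module B = Group B
  open GroupProperties B
  f-ε : f A.ε B.≈ B.ε
  f-ε = identityʳ-unique (f A.ε) (f A.ε) (B.trans (B.sym (homo _ _)) (f-cong (A.identityˡ _)))

≅-trans : ∀ {A B C : Group 0ℓ 0ℓ} → A ≅ B → B ≅ C → A ≅ C
≅-trans {A} {B} {C} (f , fi) (g , gi) = mk≅ {A} {C} (g ∘ f) (g.⟦⟧-cong ∘ f.⟦⟧-cong)
  (λ x y → Group.trans C (g.⟦⟧-cong (f.∙-homo x y)) (g.∙-homo _ _)) (f.injective ∘ g.injective)
  (λ z → let y , e = g.surjective z ; x , e′ = f.surjective y in x , e (e′ (Group.refl A)))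
  where
  module f = IsGroupIsomorphism fi
  module g = IsGroupIsomorphism gi

≅-sym : ∀ {A B : Group 0ℓ 0ℓ} → A ≅ B → B ≅ A
≅-sym {A} {B} (f , fi) = mk≅ {B} {A} g
  (λ x≈y → injective (B.trans (fg _) (B.trans x≈y (B.sym (fg _)))))
  (λ x y → injective (B.trans (fg _) (B.sym (B.trans (∙-homo _ _) (B.∙-cong (fg x) (fg y))))))
  (λ e → B.trans (B.sym (fg _)) (B.trans (⟦⟧-cong e) (fg _)))
  (λ x → f x , injective (fg _))
  where
  module A = Group A
  module B = Group B
  open IsGroupIsomorphism fi
  g : B.Carrier → A.Carrier
  g y = proj₁ (surjective y)
  fg : ∀ y → f (g y) B.≈ y
  fg y = proj₂ (surjective y) A.refl

module _ (M : CommutativeMonoid 0ℓ 0ℓ) where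
  open CommutativeMonoid M renaming (refl to ≈-refl; sym to ≈-sym; trans to ≈-trans)
  open Sums M
  open Mult monoid renaming (_×_ to _·_)

  sum-shift : ∀ {n} (f : Fin n → Carrier) (π : Perm.Permutation n n) c →
              (∀ i → f (π Perm.⟨$⟩ʳ i) ≈ c ∙ f i) → sum f ≈ n · c ∙ sum f
  sum-shift {n} f π c shift = ≈-trans (sum-permute f π) (≈-trans (sum-cong-≋ shift)
    (≈-trans (∑-distrib-+ (λ _ → c) f) (∙-congʳ (sum-replicate n))))

module _ {G : Group 0ℓ 0ℓ} where
  open Group G renaming (refl to ≈-refl; sym to ≈-sym; trans to ≈-trans)
  open GroupProperties G
  open Mult monoid renaming (_×_ to _·_)
  open Subgroup

  proj₁-power : ∀ (H : Subgroup G) n x → proj₁ (Mult._×_ (Group.monoid (group H)) n x) ≡ n · proj₁ x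
  proj₁-power H ℕ.zero x = refl
  proj₁-power H (ℕ.suc n) x = cong (proj₁ x ∙_) (proj₁-power H n x)

  translation : ∀ {n} → ∣ order G ∣≡ n → Carrier → Perm.Permutation n n
  translation c x = mk↔ₛ′ (λ i → to (x ∙ from i)) (λ i → to (x ⁻¹ ∙ from i))
    (λ i → trans (to-cong (≈-trans (∙-congˡ (strictlyInverseʳ _)) (\\-leftDividesˡ x (from i)))) (strictlyInverseˡ i))
    (λ i → trans (to-cong (≈-trans (∙-congˡ (strictlyInverseʳ _)) (\\-leftDividesʳ x (from i)))) (strictlyInverseˡ i))
    where open Inverse c

module _ {G : Group 0ℓ 0ℓ} where
  open Group G renaming (refl to ≈-refl; sym to ≈-sym; trans to ≈-trans)
  open GroupProperties G
  open Mult monoid renaming (_×_ to _·_)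
  open Subgroup

  module _ {N : ℕ} (c : ∣ order G ∣≡ N) (H : Subgroup G) (H? : ∀ x → Dec (x ∈ Member H)) where
    private
      _≈?_ : Decidable _≈_
      _≈?_ = ∣∣-dec c

      cosets : Setoid 0ℓ 0ℓ
      cosets = record
        { Carrier = Carrier
        ; _≈_ = λ x y → x // y ∈ Member H
        ; isEquivalence = record
          { refl = λ {x} → resp H (≈-sym (inverseʳ x)) (ε∈ H)
          ; sym = λ {x} {y} m → resp H (⁻¹-anti-homo-// x y) (⁻¹∈ H m)
          ; trans = λ {x} {y} {z} m n → resp H (≈-trans (≈-sym (assoc _ _ _)) (∙-congʳ (//-rightDividesˡ y x))) (∙∈ H m n)
          }
        }

      cosets-finite : Finite cosets
      cosets-finite = covered⇒finite {S = cosets} (λ x y → H? (x // y))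
        (λ x → Any.map (λ {y} e → resp H (≈-sym (≈-trans (∙-congʳ e) (inverseʳ y))) (ε∈ H)) (∣∣-covers {S = order G} c x))

      module Q = Inverse (proj₂ cosets-finite)

      rep : Fin (proj₁ cosets-finite) → Carrier
      rep = Q.from

      split : Inverse (order G) (order (group H) ×ₛ ≡.setoid (Fin (proj₁ cosets-finite)))
      split = record
        { to = λ x → (x // rep (Q.to x) , near x) , Q.to x
        ; from = λ { ((h , _) , i) → h ∙ rep i }
        ; to-cong = λ {x} {y} x≈y → ∙-cong x≈y (⁻¹-cong (reflexive (cong rep (Q.to-cong (close x≈y))))) , Q.to-cong (close x≈y)
        ; from-cong = λ { (e , refl) → ∙-congʳ e }
        ; inverse = (λ { {(h , h∈) , i} {x} x≈ →
              let e = trans (Q.to-cong (close x≈)) (inCoset h h∈ i) in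
              ≈-trans (∙-cong x≈ (⁻¹-cong (reflexive (cong rep e)))) (//-rightDividesʳ (rep i) h) , e })
          , λ { {x} (h≈ , refl) → ≈-trans (∙-congʳ h≈) (//-rightDividesˡ (rep (Q.to x)) x) }
        }
        where
        near : ∀ x → x // rep (Q.to x) ∈ Member H
        near x = Setoid.sym cosets {rep (Q.to x)} {x} (Q.strictlyInverseʳ x)

        close : ∀ {x y} → x ≈ y → x // y ∈ Member H
        close {x} {y} e = resp H (≈-sym (≈-trans (∙-congʳ e) (inverseʳ y))) (ε∈ H)

        inCoset : ∀ h → h ∈ Member H → ∀ i → Q.to (h ∙ rep i) ≡ i
        inCoset h h∈ i = trans (Q.to-cong (resp H (≈-sym (//-rightDividesʳ (rep i) h)) h∈)) (Q.strictlyInverseˡ i)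

    lagrange : ∃ λ M → ∣ order (group H) ∣≡ M × M ∣ N
    lagrange with subset-finite {order G} (N , c) H? (resp H)
    ... | M , d = M , d , divides (proj₁ cosets-finite) (trans (∣∣-unique c (∣∣-via split (d ×-∣∣ Symmetry.inverse (idFin _)))) (ℕₚ.*-comm M _))
      where
      idFin : ∀ k → ∣ ≡.setoid (Fin k) ∣≡ k
      idFin k = record { to = id ; from = id ; to-cong = id ; from-cong = id ; inverse = id , id }

  power-order : ∀ {N} → ∣ order G ∣≡ N → ∀ x → N · x ≈ ε
  power-order {N} c x = let M , d , M∣N = lagrange c ⟨x⟩ ∈? in help M d M∣N
    where
    period : ∃ λ k → ℕ.suc k · x ≈ ε
    period with Finₚ.pigeonhole (ℕₚ.n<1+n N) (λ i → Inverse.to c (toℕ i · x))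
    ... | i , j , i<j , e = toℕ j ℕ.∸ ℕ.suc (toℕ i) , ∙-cancelˡ (toℕ i · x) _ _
      (≈-trans (≈-sym (×-homo-+ x (toℕ i) _)) (≈-trans (reflexive (cong (_· x)
        (trans (ℕₚ.+-suc (toℕ i) _) (ℕₚ.m+[n∸m]≡n i<j)))) (≈-trans (≈-sym (∣∣-injective c e)) (≈-sym (identityʳ _)))))

    d : ℕ
    d = ℕ.suc (proj₁ period)

    d·k : ∀ k → (k ℕ.* d) · x ≈ ε
    d·k ℕ.zero = ≈-refl
    d·k (ℕ.suc k) = ≈-trans (×-homo-+ x d (k ℕ.* d)) (≈-trans (∙-cong (proj₂ period) (d·k k)) (identityˡ ε))

    ⟨x⟩ : Subgroup G
    ⟨x⟩ = record
      { Member = λ y → ∃ λ n → y ≈ n · x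
      ; resp = λ { y≈z (n , e) → n , ≈-trans (≈-sym y≈z) e }
      ; ε∈ = 0 , ≈-refl
      ; ∙∈ = λ { (m , e) (n , e′) → m ℕ.+ n , ≈-trans (∙-cong e e′) (≈-sym (×-homo-+ x m n)) }
      ; ⁻¹∈ = λ { {y} (n , e) → n ℕ.* proj₁ period , ≈-sym (inverseʳ-unique y _ (≈-trans (∙-congʳ e)
          (≈-trans (≈-sym (×-homo-+ x n _)) (≈-trans (reflexive (cong (_· x) (sym (ℕₚ.*-suc n _)))) (d·k n))))) }
      }

    ∈? : ∀ y → Dec (y ∈ Member ⟨x⟩)
    ∈? y = map′ (λ { (i , e) → toℕ i , e }) (λ { (n , e) → DivMod._mod_ n d ,
        ≈-trans e (≈-trans (reflexive (cong (_· x) (trans (DivMod.m≡m%n+[m/n]*n n d)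
          (cong (ℕ._+ (n DivMod./ d) ℕ.* d) (sym (Finₚ.toℕ-fromℕ< (DivMod.m%n<n n d)))))))
          (≈-trans (×-homo-+ x (toℕ (DivMod._mod_ n d)) _) (≈-trans (∙-congˡ (d·k (n DivMod./ d))) (identityʳ _)))) })
      (Finₚ.any? λ (i : Fin d) → ∣∣-dec c y (toℕ i · x))

    commutative : CommutativeMonoid 0ℓ 0ℓ
    commutative = record { isCommutativeMonoid = record
      { isMonoid = Group.isMonoid (group ⟨x⟩)
      ; comm = λ { (y , m , e) (z , n , e′) → ≈-trans (∙-cong e e′) (≈-trans (≈-sym (×-homo-+ x m n))
          (≈-trans (reflexive (cong (_· x) (ℕₚ.+-comm m n))) (≈-trans (×-homo-+ x n m) (∙-cong (≈-sym e′) (≈-sym e))))) }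
      } }

    help : ∀ M → ∣ order (group ⟨x⟩) ∣≡ M → M ∣ N → N · x ≈ ε
    help M d (divides k N≡) = ≈-trans (reflexive (cong (_· x) N≡)) (multiple k)
      where
      x′ : Group.Carrier (group ⟨x⟩)
      x′ = x , 1 , ≈-sym (identityʳ x)

      M·x : M · x ≈ ε
      M·x = ≈-trans (reflexive (sym (proj₁-power ⟨x⟩ M x′)))
        (identityˡ-unique _ _ (≈-sym (sum-shift commutative (Inverse.from d) (translation {group ⟨x⟩} d x′) x′
          (λ i → Inverse.strictlyInverseʳ d _))))

      multiple : ∀ k → (k ℕ.* M) · x ≈ ε
      multiple ℕ.zero = ≈-refl
      multiple (ℕ.suc k) = ≈-trans (×-homo-+ x M (k ℕ.* M)) (≈-trans (∙-cong M·x (multiple k)) (identityˡ ε))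

module _ {G : Group 0ℓ 0ℓ} where
  open Group G using (Carrier; _≈_) renaming (sym to ≈-sym)
  open Subsets G using (⟨_⟩; gen; unit; mul; inv) renaming (resp to ⟨resp⟩)

  ⟨⟩-least : ∀ {X : Pred Carrier 0ℓ} (H : Subgroup G) → X ⊆ Subgroup.Member H → ⟨ X ⟩ ⊆ Subgroup.Member H
  ⟨⟩-least H X⊆H (gen x∈) = X⊆H x∈
  ⟨⟩-least H X⊆H (⟨resp⟩ e x∈) = Subgroup.resp H e (⟨⟩-least H X⊆H x∈)
  ⟨⟩-least H X⊆H unit = Subgroup.ε∈ H
  ⟨⟩-least H X⊆H (mul x∈ y∈) = Subgroup.∙∈ H (⟨⟩-least H X⊆H x∈) (⟨⟩-least H X⊆H y∈)
  ⟨⟩-least H X⊆H (inv x∈) = Subgroup.⁻¹∈ H (⟨⟩-least H X⊆H x∈)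

  Listed : Pred Carrier 0ℓ → Set
  Listed P = ∃ λ n → Σ (Fin n → Carrier) λ f → (∀ i → P (f i)) × (∀ x → P x → ∃ λ i → x ≈ f i)

  listed-dec : Decidable _≈_ → ∀ {P} → Listed P → P Respects _≈_ → ∀ x → Dec (P x)
  listed-dec _≟_ (n , f , P-f , cov) resp x = map′ (λ { (i , e) → resp (≈-sym e) (P-f i) }) (cov x) (Finₚ.any? (λ i → x ≟ f i))

  listed-finite : Decidable _≈_ → (H : Subgroup G) → Listed (Subgroup.Member H) → Finite (order (Subgroup.group H))
  listed-finite _≟_ H (n , f , P-f , cov) = covered⇒finite {S = order (Subgroup.group H)}
    (λ x y → proj₁ x ≟ proj₁ y) {List.tabulate (λ i → f i , P-f i)}
    (λ x → Anyₚ.tabulate⁺ (proj₁ (cov (proj₁ x) (proj₂ x))) (proj₂ (cov (proj₁ x) (proj₂ x))))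

  listed-≐ : ∀ {P Q} → P ⊆ Q → Q ⊆ P → Listed P → Listed Q
  listed-≐ P⊆Q Q⊆P (n , f , P-f , cov) = n , f , P⊆Q ∘ P-f , λ x → cov x ∘ Q⊆P

-- The set of words is enlarged by a missing product until it is closed; this
-- stops because the group embeds into a finite set.
module _ {G : Group 0ℓ 0ℓ} where
  open Group G renaming (refl to ≈-refl; sym to ≈-sym; trans to ≈-trans)
  open GroupProperties G
  open Subsets G using (⟨_⟩; gen; unit; mul; inv) renaming (resp to ⟨resp⟩)

  module _ {K : ℕ} (code : Carrier → Fin K) (code-cong : ∀ {x y} → x ≈ y → code x ≡ code y)
           (code-injective : ∀ {x y} → code x ≡ code y → x ≈ y)
           {k : ℕ} (gs : Fin k → Carrier) (gs⁻¹ : ∀ a → ∃ λ b → gs a ⁻¹ ≈ gs b) where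

    Generators : Pred Carrier 0ℓ
    Generators x = ∃ λ a → x ≈ gs a

    private
      _≟_ : Decidable _≈_
      x ≟ y = map′ code-injective code-cong (code x Finₚ.≟ code y)

      W : Set
      W = Σ Carrier ⟨ Generators ⟩

      Closed : ∀ {n} → (Fin n → W) → Set
      Closed f = (∃ λ i → proj₁ (f i) ≈ ε) × (∀ i a → ∃ λ j → proj₁ (f i) ∙ gs a ≈ proj₁ (f j))

      close : ∀ fuel n → n ℕ.+ fuel ≡ ℕ.suc K → (f : Fin n → W) → (∀ {i j} → proj₁ (f i) ≈ proj₁ (f j) → i ≡ j) →
              (∃ λ i → proj₁ (f i) ≈ ε) → ∃ λ m → Σ (Fin m → W) Closed
      close ℕ.zero n n≡ f f-inj _ = contradiction
        (ℕₚ.≤-trans (ℕₚ.≤-reflexive (trans (sym n≡) (ℕₚ.+-identityʳ n)))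
          (Finₚ.injective⇒≤ {f = code ∘ proj₁ ∘ f} (f-inj ∘ code-injective)))
        (ℕₚ.<-irrefl refl)
      close (ℕ.suc fuel) n n≡ f f-inj (i₀ , e₀)
        with Finₚ.any? (λ i → Finₚ.any? (λ a → ¬? (Finₚ.any? (λ j → (proj₁ (f i) ∙ gs a) ≟ proj₁ (f j)))))
      ... | no none = n , f , (i₀ , e₀) , λ i a → decidable-stable (Finₚ.any? (λ j → (proj₁ (f i) ∙ gs a) ≟ proj₁ (f j)))
                        (λ ∄ → none (i , a , ∄))
      ... | yes (i , a , ∄) = close fuel (ℕ.suc n) (trans (sym (ℕₚ.+-suc n fuel)) n≡) g g-inj (suc i₀ , e₀)
        where
        g : Fin (ℕ.suc n) → W
        g zero = proj₁ (f i) ∙ gs a , mul (proj₂ (f i)) (gen (a , ≈-refl))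
        g (suc j) = f j
        g-inj : ∀ {i j} → proj₁ (g i) ≈ proj₁ (g j) → i ≡ j
        g-inj {zero} {zero} _ = refl
        g-inj {zero} {suc j} e = contradiction (j , e) ∄
        g-inj {suc j} {zero} e = contradiction (j , ≈-sym e) ∄
        g-inj {suc i} {suc j} e = cong suc (f-inj e)

    generated-listed : Listed {G} ⟨ Generators ⟩
    generated-listed with close K 1 refl (λ { zero → ε , unit }) (λ { {zero} {zero} _ → refl }) (zero , ≈-refl)
    ... | m , f , (i₀ , e₀) , closed = m , proj₁ ∘ f , proj₂ ∘ f , λ x x∈ →
      let j , e = proj₁ (⟨⟩-least {G} good gens-good x∈) i₀ in j , ≈-trans (≈-sym (identityˡ x)) (≈-trans (∙-congʳ (≈-sym e₀)) e)
      where
      Step : Carrier → Set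
      Step x = ∀ i → ∃ λ j → proj₁ (f i) ∙ x ≈ proj₁ (f j)

      step-resp : ∀ {x y} → x ≈ y → Step x → Step y
      step-resp x≈y s i = let j , e = s i in j , ≈-trans (∙-congˡ (≈-sym x≈y)) e

      step-∙ : ∀ {x y} → Step x → Step y → Step (x ∙ y)
      step-∙ s t i = let j , e = s i ; l , e′ = t j in l , ≈-trans (≈-sym (assoc _ _ _)) (≈-trans (∙-congʳ e) e′)

      step-ε : Step ε
      step-ε i = i , identityʳ _

      good : Subgroup G
      good = record
        { Member = λ x → Step x × Step (x ⁻¹)
        ; resp = λ { e (s , t) → step-resp e s , step-resp (⁻¹-cong e) t }
        ; ε∈ = step-ε , step-resp (≈-sym ε⁻¹≈ε) step-ε
        ; ∙∈ = λ { {x} {y} (s , t) (s′ , t′) → step-∙ s s′ , step-resp (≈-sym (⁻¹-anti-homo-∙ x y)) (step-∙ t′ t) }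
        ; ⁻¹∈ = λ { {x} (s , t) → t , step-resp (≈-sym (⁻¹-involutive x)) s }
        }

      gens-good : ∀ {x} → Generators x → Step x × Step (x ⁻¹)
      gens-good (a , e) = step-resp (≈-sym e) (λ i → closed i a)
        , let b , e′ = gs⁻¹ a in step-resp (≈-sym (≈-trans (⁻¹-cong e) e′)) (λ i → closed i b)

record Factorisation (G K H : Group 0ℓ 0ℓ) : Set where
  private
    module G = Group G
    module K = Group K
    module H = Group H
  infixl 7 _◃_
  field
    i : K.Carrier → G.Carrier
    j : H.Carrier → G.Carrier
    _◃_ : K.Carrier → H.Carrier → K.Carrier
    i-cong : ∀ {k l} → k K.≈ l → i k G.≈ i l
    i-homo : ∀ k l → i (k K.∙ l) G.≈ i k G.∙ i l
    i-injective : ∀ {k l} → i k G.≈ i l → k K.≈ l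
    j-cong : ∀ {g h} → g H.≈ h → j g G.≈ j h
    j-homo : ∀ g h → j (g H.∙ h) G.≈ j g G.∙ j h
    twist : ∀ k h → i k G.∙ j h G.≈ j h G.∙ i (k ◃ h)
    disjoint : ∀ h k → j h G.≈ i k → h H.≈ H.ε

  open GroupProperties G
  open import Relation.Binary.Reasoning.Setoid G.setoid

  i-ε : i K.ε G.≈ G.ε
  i-ε = identityʳ-unique _ _ (G.trans (G.sym (i-homo _ _)) (i-cong (K.identityˡ _)))

  j-ε : j H.ε G.≈ G.ε
  j-ε = identityʳ-unique _ _ (G.trans (G.sym (j-homo _ _)) (j-cong (H.identityˡ _)))

  i-⁻¹ : ∀ k → i (k K.⁻¹) G.≈ i k G.⁻¹
  i-⁻¹ k = inverseʳ-unique _ _ (G.trans (G.sym (i-homo _ _)) (G.trans (i-cong (K.inverseʳ k)) i-ε))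

  j-⁻¹ : ∀ h → j (h H.⁻¹) G.≈ j h G.⁻¹
  j-⁻¹ h = inverseʳ-unique _ _ (G.trans (G.sym (j-homo _ _)) (G.trans (j-cong (H.inverseʳ h)) j-ε))

  private
    i-◃ : ∀ k h → i (k ◃ h) G.≈ j h G.⁻¹ G.∙ (i k G.∙ j h)
    i-◃ k h = G.trans (G.sym (\\-leftDividesʳ (j h) _)) (G.∙-congˡ (G.sym (twist k h)))

  product : ∀ h k h′ k′ → (j h G.∙ i k) G.∙ (j h′ G.∙ i k′) G.≈ j (h H.∙ h′) G.∙ i ((k ◃ h′) K.∙ k′)
  product h k h′ k′ = begin
    (j h G.∙ i k) G.∙ (j h′ G.∙ i k′)              ≈⟨ G.assoc _ _ _ ⟩
    j h G.∙ (i k G.∙ (j h′ G.∙ i k′))              ≈⟨ G.∙-congˡ (G.assoc _ _ _) ⟨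
    j h G.∙ ((i k G.∙ j h′) G.∙ i k′)              ≈⟨ G.∙-congˡ (G.∙-congʳ (twist k h′)) ⟩
    j h G.∙ ((j h′ G.∙ i (k ◃ h′)) G.∙ i k′)       ≈⟨ G.∙-congˡ (G.assoc _ _ _) ⟩
    j h G.∙ (j h′ G.∙ (i (k ◃ h′) G.∙ i k′))       ≈⟨ G.assoc _ _ _ ⟨
    (j h G.∙ j h′) G.∙ (i (k ◃ h′) G.∙ i k′)       ≈⟨ G.∙-cong (j-homo h h′) (i-homo _ _) ⟨
    j (h H.∙ h′) G.∙ i ((k ◃ h′) K.∙ k′)           ∎

  unique : ∀ {h k h′ k′} → j h G.∙ i k G.≈ j h′ G.∙ i k′ → h H.≈ h′ × k K.≈ k′
  unique {h} {k} {h′} {k′} e = h≈h′ , i-injective (∙-cancelˡ (j h) _ _ (G.trans e (G.∙-congʳ (j-cong (H.sym h≈h′)))))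
    where
    h≈h′ : h H.≈ h′
    h≈h′ = H.trans (H.sym (GroupProperties.⁻¹-involutive H h)) (H.sym (GroupProperties.inverseʳ-unique H (h H.⁻¹) h′ (disjoint (h H.⁻¹ H.∙ h′) (k K.∙ k′ K.⁻¹) (begin
      j (h H.⁻¹ H.∙ h′)               ≈⟨ j-homo _ _ ⟩
      j (h H.⁻¹) G.∙ j h′             ≈⟨ G.∙-cong (j-⁻¹ h) (G.sym (//-rightDividesʳ (i k′) (j h′))) ⟩
      j h G.⁻¹ G.∙ (j h′ G.∙ i k′ G.∙ i k′ G.⁻¹) ≈⟨ G.∙-congˡ (G.∙-congʳ e) ⟨
      j h G.⁻¹ G.∙ (j h G.∙ i k G.∙ i k′ G.⁻¹)   ≈⟨ G.∙-congˡ (G.assoc _ _ _) ⟩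
      j h G.⁻¹ G.∙ (j h G.∙ (i k G.∙ i k′ G.⁻¹)) ≈⟨ \\-leftDividesʳ (j h) _ ⟩
      i k G.∙ i k′ G.⁻¹               ≈⟨ G.∙-congˡ (i-⁻¹ k′) ⟨
      i k G.∙ i (k′ K.⁻¹)             ≈⟨ i-homo _ _ ⟨
      i (k K.∙ k′ K.⁻¹)               ∎))))

  image : Subgroup G
  image = record
    { Member = λ g → ∃₂ λ h k → g G.≈ j h G.∙ i k
    ; resp = λ { g≈ (h , k , e) → h , k , G.trans (G.sym g≈) e }
    ; ε∈ = H.ε , K.ε , G.sym (G.trans (G.∙-cong j-ε i-ε) (G.identityˡ _))
    ; ∙∈ = λ { (h , k , e) (h′ , k′ , e′) → h H.∙ h′ , (k ◃ h′) K.∙ k′ , G.trans (G.∙-cong e e′) (product h k h′ k′) }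
    ; ⁻¹∈ = λ { {g} (h , k , e) → h H.⁻¹ , (k K.⁻¹) ◃ (h H.⁻¹) , (begin
        g G.⁻¹                                      ≈⟨ G.⁻¹-cong e ⟩
        (j h G.∙ i k) G.⁻¹                          ≈⟨ ⁻¹-anti-homo-∙ _ _ ⟩
        i k G.⁻¹ G.∙ j h G.⁻¹                       ≈⟨ G.∙-cong (i-⁻¹ k) (j-⁻¹ h) ⟨
        i (k K.⁻¹) G.∙ j (h H.⁻¹)                   ≈⟨ twist _ _ ⟩
        j (h H.⁻¹) G.∙ i ((k K.⁻¹) ◃ (h H.⁻¹))      ∎) }
    }

  φ : GroupAction K H
  φ = record
    { _◃_ = _◃_
    ; ◃-cong = λ {m} {n} {g} {h} m≈n g≈h → i-injective (begin
        i (m ◃ g)                       ≈⟨ i-◃ m g ⟩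
        j g G.⁻¹ G.∙ (i m G.∙ j g)      ≈⟨ G.∙-cong (G.⁻¹-cong (j-cong g≈h)) (G.∙-cong (i-cong m≈n) (j-cong g≈h)) ⟩
        j h G.⁻¹ G.∙ (i n G.∙ j h)      ≈⟨ i-◃ n h ⟨
        i (n ◃ h)                       ∎)
    ; ◃-homo = λ m n h → i-injective (∙-cancelˡ (j h) _ _ (begin
        j h G.∙ i ((m K.∙ n) ◃ h)             ≈⟨ twist _ _ ⟨
        i (m K.∙ n) G.∙ j h                   ≈⟨ G.∙-congʳ (i-homo m n) ⟩
        i m G.∙ i n G.∙ j h                   ≈⟨ G.assoc _ _ _ ⟩
        i m G.∙ (i n G.∙ j h)                 ≈⟨ G.∙-congˡ (twist n h) ⟩
        i m G.∙ (j h G.∙ i (n ◃ h))           ≈⟨ G.assoc _ _ _ ⟨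
        i m G.∙ j h G.∙ i (n ◃ h)             ≈⟨ G.∙-congʳ (twist m h) ⟩
        j h G.∙ i (m ◃ h) G.∙ i (n ◃ h)       ≈⟨ G.assoc _ _ _ ⟩
        j h G.∙ (i (m ◃ h) G.∙ i (n ◃ h))     ≈⟨ G.∙-congˡ (i-homo _ _) ⟨
        j h G.∙ i ((m ◃ h) K.∙ (n ◃ h))       ∎))
    ; ◃-ε = λ n → i-injective (∙-cancelˡ (j H.ε) _ _ (begin
        j H.ε G.∙ i (n ◃ H.ε)    ≈⟨ twist n H.ε ⟨
        i n G.∙ j H.ε            ≈⟨ G.∙-congˡ j-ε ⟩
        i n G.∙ G.ε              ≈⟨ G.identityʳ _ ⟩
        i n                      ≈⟨ G.identityˡ _ ⟨
        G.ε G.∙ i n              ≈⟨ G.∙-congʳ j-ε ⟨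
        j H.ε G.∙ i n            ∎))
    ; ◃-∙ = λ n g h → i-injective (∙-cancelˡ (j (g H.∙ h)) _ _ (begin
        j (g H.∙ h) G.∙ i (n ◃ (g H.∙ h))    ≈⟨ twist _ _ ⟨
        i n G.∙ j (g H.∙ h)                  ≈⟨ G.∙-congˡ (j-homo g h) ⟩
        i n G.∙ (j g G.∙ j h)                ≈⟨ G.assoc _ _ _ ⟨
        i n G.∙ j g G.∙ j h                  ≈⟨ G.∙-congʳ (twist n g) ⟩
        j g G.∙ i (n ◃ g) G.∙ j h            ≈⟨ G.assoc _ _ _ ⟩
        j g G.∙ (i (n ◃ g) G.∙ j h)          ≈⟨ G.∙-congˡ (twist _ h) ⟩
        j g G.∙ (j h G.∙ i (n ◃ g ◃ h))      ≈⟨ G.assoc _ _ _ ⟨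
        j g G.∙ j h G.∙ i (n ◃ g ◃ h)        ≈⟨ G.∙-congʳ (j-homo g h) ⟨
        j (g H.∙ h) G.∙ i (n ◃ g ◃ h)        ∎))
    }

  image≅ : Subgroup.group image ≅ K ⋊ H [ φ ]
  image≅ = mk≅ {Subgroup.group image} {K ⋊ H [ φ ]} (λ { (g , h , k , e) → h , k })
    (λ { {_ , _ , _ , e} {_ , _ , _ , e′} g≈ → unique (G.trans (G.sym e) (G.trans g≈ e′)) })
    (λ _ _ → H.refl , K.refl)
    (λ { {_ , _ , _ , e} {_ , _ , _ , e′} (h≈ , k≈) → G.trans e (G.trans (G.∙-cong (j-cong h≈) (i-cong k≈)) (G.sym e′)) })
    (λ { (h , k) → (j h G.∙ i k , h , k , G.refl) , H.refl , K.refl })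

  reorder : ∀ h k → j h G.∙ i k G.≈ i (k ◃ (h H.⁻¹)) G.∙ j h
  reorder h k = begin
    j h G.∙ i k                        ≈⟨ G.∙-congˡ (i-cong (◃-ε k)) ⟨
    j h G.∙ i (k ◃ H.ε)                ≈⟨ G.∙-congˡ (i-cong (◃-cong {k} {k} {h H.⁻¹ H.∙ h} {H.ε} K.refl (H.inverseˡ h))) ⟨
    j h G.∙ i (k ◃ (h H.⁻¹ H.∙ h))     ≈⟨ G.∙-congˡ (i-cong (◃-∙ k (h H.⁻¹) h)) ⟩
    j h G.∙ i (k ◃ (h H.⁻¹) ◃ h)       ≈⟨ twist (k ◃ (h H.⁻¹)) h ⟨
    i (k ◃ (h H.⁻¹)) G.∙ j h           ∎
    where open GroupAction φ using (◃-ε; ◃-cong; ◃-∙)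

  part-cong : ∀ {g g′} (m : g ∈ Subgroup.Member image) (m′ : g′ ∈ Subgroup.Member image) → g G.≈ g′ → proj₁ m H.≈ proj₁ m′ × proj₁ (proj₂ m) K.≈ proj₁ (proj₂ m′)
  part-cong (_ , _ , e) (_ , _ , e′) g≈g′ = unique (G.trans (G.sym e) (G.trans g≈g′ e′))

  j∈ : ∀ h → j h ∈ Subgroup.Member image
  j∈ h = h , K.ε , G.sym (G.trans (G.∙-congˡ i-ε) (G.identityʳ _))

  i∈ : ∀ k → i k ∈ Subgroup.Member image
  i∈ k = H.ε , k , G.sym (G.trans (G.∙-congʳ j-ε) (G.identityˡ _))

module FieldTheory (r′ : ℕ) (𝔽 : FiniteField (3 ℕ.^ ℕ.suc r′)) where
  r q : ℕ
  r = ℕ.suc r′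
  q = 3 ℕ.^ r

  open FiniteField 𝔽 public using (commutativeRing; recip; 1≢0; cardinality) renaming (Carrier to F)
  open CommutativeRing commutativeRing public using
    ( _+_; _*_; -_; _-_; 0#; 1#; rawRing; ring; semiring; commutativeSemiring; +-group; +-commutativeMonoid; *-commutativeMonoid
    ; +-identityˡ; +-identityʳ; +-assoc; +-comm; *-identityˡ; *-identityʳ; *-assoc; *-comm; distribˡ; distribʳ
    ; zeroˡ; zeroʳ; -‿inverseʳ; -‿inverseˡ)
  open import Algebra.Properties.Semiring.Exp semiring public using (_^_; ^-assocʳ; ^-homo-*)
  open import Algebra.Properties.CommutativeSemiring.Exp commutativeSemiring public using (^-distrib-*)
  open import Algebra.Properties.Semiring.Mult semiring using (×1-homo-*) renaming (_×_ to _·_)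
  open import Algebra.Properties.Ring ring public using (-0#≈0#)
  open Groups 𝔽 public
  open ≡.≡-Reasoning

  _≟_ : Decidable {A = F} _≡_
  _≟_ = ∣∣-dec cardinality

  F-finite : Finite (≡.setoid F)
  F-finite = q , cardinality

  *-cancelˡ : ∀ {k x y} → k ≢ 0# → k * x ≡ k * y → x ≡ y
  *-cancelˡ {k} {x} {y} k≢0 e with recip k≢0
  ... | l , lk≡1 = begin
    x            ≡⟨ *-identityˡ x ⟨
    1# * x       ≡⟨ cong (_* x) lk≡1 ⟨
    l * k * x    ≡⟨ *-assoc l k x ⟩
    l * (k * x)  ≡⟨ cong (l *_) e ⟩
    l * (k * y)  ≡⟨ *-assoc l k y ⟨
    l * k * y    ≡⟨ cong (_* y) lk≡1 ⟩
    1# * y       ≡⟨ *-identityˡ y ⟩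
    y            ∎

  *-zero : ∀ {k x} → k ≢ 0# → k * x ≡ 0# → x ≡ 0#
  *-zero k≢0 e = *-cancelˡ k≢0 (trans e (sym (zeroʳ _)))

  *-nonzero : ∀ {k l} → k ≢ 0# → l ≢ 0# → k * l ≢ 0#
  *-nonzero k≢0 l≢0 e = l≢0 (*-zero k≢0 e)

  factorˡ≢0 : ∀ {k l} → k * l ≢ 0# → k ≢ 0#
  factorˡ≢0 {l = l} e refl = e (zeroˡ l)

  factorʳ≢0 : ∀ {k l} → k * l ≢ 0# → l ≢ 0#
  factorʳ≢0 {k} e refl = e (zeroʳ k)

  ^-nonzero : ∀ {k} n → k ≢ 0# → k ^ n ≢ 0#
  ^-nonzero ℕ.zero _ = 1≢0
  ^-nonzero (ℕ.suc n) k≢0 = *-nonzero k≢0 (^-nonzero n k≢0)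

  open Sums *-commutativeMonoid public using () renaming (sum to Π)

  product≢0 : ∀ {m} (h : Fin m → F) → (∀ i → h i ≢ 0#) → Π h ≢ 0#
  product≢0 {ℕ.zero} h _ = 1≢0
  product≢0 {ℕ.suc m} h h≢0 = *-nonzero (h≢0 zero) (product≢0 (h ∘ suc) (h≢0 ∘ suc))

  three≡0 : 1# + (1# + (1# + 0#)) ≡ 0#
  three≡0 = decidable-stable (_ ≟ _) λ 3≢0 → ^-nonzero r 3≢0 (trans (sym (powers r))
    (power-order {+-group} (∣∣-via same cardinality) 1#))
    where
    same : Inverse (order +-group) (≡.setoid F)
    same = record { to = id ; from = id ; to-cong = id ; from-cong = id ; inverse = id , id }

    powers : ∀ n → (3 ℕ.^ n) · 1# ≡ (1# + (1# + (1# + 0#))) ^ n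
    powers ℕ.zero = +-identityʳ 1#
    powers (ℕ.suc n) = trans (×1-homo-* 3 (3 ℕ.^ n)) (cong ((1# + (1# + (1# + 0#))) *_) (powers n))

  -- Ring identities in characteristic 3 are decided with coefficients in ℤ/3,
  -- whose elements 0, 1, 2 stand for 0, 1, -1.
  module Solver₃ where
    open import Algebra.Bundles.Raw using (RawRing)
    open import Algebra.Solver.Ring.AlmostCommutativeRing using (fromCommutativeRing; _-Raw-AlmostCommutative⟶_)
    open import Data.Maybe.Base using (Maybe; just; nothing)
    open import Algebra.Properties.Ring ring using (-‿involutive)

    pattern 0₃ = zero
    pattern 1₃ = suc zero
    pattern 2₃ = suc (suc zero)

    add mult : Fin 3 → Fin 3 → Fin 3
    add 0₃ y = y
    add 1₃ 0₃ = 1₃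
    add 1₃ 1₃ = 2₃
    add 1₃ 2₃ = 0₃
    add 2₃ 0₃ = 2₃
    add 2₃ 1₃ = 0₃
    add 2₃ 2₃ = 1₃
    mult 0₃ y = 0₃
    mult 1₃ y = y
    mult 2₃ 0₃ = 0₃
    mult 2₃ 1₃ = 2₃
    mult 2₃ 2₃ = 1₃

    neg : Fin 3 → Fin 3
    neg 0₃ = 0₃
    neg 1₃ = 2₃
    neg 2₃ = 1₃

    ⟦_⟧₃ : Fin 3 → F
    ⟦ 0₃ ⟧₃ = 0#
    ⟦ 1₃ ⟧₃ = 1#
    ⟦ 2₃ ⟧₃ = - 1#

    three : 1# + (1# + 1#) ≡ 0#
    three = trans (cong (λ z → 1# + (1# + z)) (sym (+-identityʳ 1#))) three≡0

    open GroupProperties +-group using (inverseʳ-unique)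

    1+1 : 1# + 1# ≡ - 1#
    1+1 = inverseʳ-unique _ _ three

    -1-1 : - 1# + - 1# ≡ 1#
    -1-1 = trans (cong₂ _+_ (sym 1+1) (sym 1+1)) (trans (+-assoc 1# 1# _) (trans (cong (1# +_) three) (+-identityʳ 1#)))

    add-homo : ∀ x y → ⟦ add x y ⟧₃ ≡ ⟦ x ⟧₃ + ⟦ y ⟧₃
    add-homo 0₃ y = sym (+-identityˡ _)
    add-homo 1₃ 0₃ = sym (+-identityʳ _)
    add-homo 1₃ 1₃ = sym 1+1
    add-homo 1₃ 2₃ = sym (-‿inverseʳ 1#)
    add-homo 2₃ 0₃ = sym (+-identityʳ _)
    add-homo 2₃ 1₃ = sym (-‿inverseˡ 1#)
    add-homo 2₃ 2₃ = sym -1-1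

    mult-homo : ∀ x y → ⟦ mult x y ⟧₃ ≡ ⟦ x ⟧₃ * ⟦ y ⟧₃
    mult-homo 0₃ y = sym (zeroˡ _)
    mult-homo 1₃ y = sym (*-identityˡ _)
    mult-homo 2₃ 0₃ = sym (zeroʳ _)
    mult-homo 2₃ 1₃ = sym (*-identityʳ _)
    mult-homo 2₃ 2₃ = sym (trans (cong₂ _*_ (sym 1+1) refl) (trans (distribʳ (- 1#) 1# 1#)
      (trans (cong₂ _+_ (*-identityˡ _) (*-identityˡ _)) -1-1)))

    neg-homo : ∀ x → ⟦ neg x ⟧₃ ≡ - ⟦ x ⟧₃
    neg-homo 0₃ = sym -0#≈0#
    neg-homo 1₃ = refl
    neg-homo 2₃ = sym (-‿involutive 1#)

    coefficients : RawRing 0ℓ 0ℓ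
    coefficients = record { Carrier = Fin 3 ; _≈_ = _≡_ ; _+_ = add ; _*_ = mult ; -_ = neg ; 0# = 0₃ ; 1# = 1₃ }

    morphism : coefficients -Raw-AlmostCommutative⟶ fromCommutativeRing commutativeRing
    morphism = record { ⟦_⟧ = ⟦_⟧₃ ; +-homo = add-homo ; *-homo = mult-homo ; -‿homo = neg-homo ; 0-homo = refl ; 1-homo = refl }

    equal? : (x y : Fin 3) → Maybe (⟦ x ⟧₃ ≡ ⟦ y ⟧₃)
    equal? x y with x Finₚ.≟ y
    ... | yes e = just (cong ⟦_⟧₃ e)
    ... | no _ = nothing

    open import Algebra.Solver.Ring coefficients (fromCommutativeRing commutativeRing) morphism equal? public
      using (solve; _:=_; _:+_; _:*_; _:-_; :-_; con; _:^_)

  open Solver₃ public using (solve; _:=_; _:+_; _:*_; _:-_; :-_; con; _:^_; 0₃; 1₃; 2₃; ⟦_⟧₃)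

  modulo : ∀ {a b x y} k → a ≡ b → x ≡ y + k * (a - b) → x ≡ y
  modulo {a} {_} {x} {y} k refl e = begin
    x                 ≡⟨ e ⟩
    y + k * (a - a)   ≡⟨ solve 3 (λ y k a → y :+ k :* (a :- a) := y) refl y k a ⟩
    y                 ∎

  difference : ∀ {x y} → x - y ≡ 0# → x ≡ y
  difference {x} {y} e = trans (solve 2 (λ x y → x := x :- y :+ y) refl x y) (trans (cong (_+ y) e) (+-identityˡ y))

  private
    fermat : ∀ {n} → ∣ ≡.setoid F ∣≡ ℕ.suc n → ∀ {a} → a ≢ 0# → a ^ n ≡ 1#
    fermat {n} c {a} a≢0 = trans (sym Πg≡a^n) (*-cancelˡ Πf≢0 (trans (*-comm _ _) (trans (sym Πf≡) (sym (*-identityʳ _)))))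
      where
      open Inverse c
      open Sums *-commutativeMonoid
      i₀ : Fin (ℕ.suc n)
      i₀ = to 0#

      choose : ∀ {x} → Dec (x ≡ 0#) → F → F
      choose (yes _) _ = 1#
      choose (no _) y = y

      f g : Fin (ℕ.suc n) → F
      f i = choose (from i ≟ 0#) (from i)
      g i = choose (from i ≟ 0#) a

      π : Perm.Permutation (ℕ.suc n) (ℕ.suc n)
      π = mk↔ₛ′ (λ i → to (a * from i)) (λ i → to (b * from i))
        (λ i → trans (cong (to ∘ (a *_)) (strictlyInverseʳ _)) (trans (cong to (undo (trans (*-comm a b) ba≡1) _)) (strictlyInverseˡ i)))
        (λ i → trans (cong (to ∘ (b *_)) (strictlyInverseʳ _)) (trans (cong to (undo ba≡1 _)) (strictlyInverseˡ i)))
        where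
        b = proj₁ (recip a≢0)
        ba≡1 = proj₂ (recip a≢0)
        undo : ∀ {k l} → k * l ≡ 1# → ∀ x → k * (l * x) ≡ x
        undo e x = trans (sym (*-assoc _ _ x)) (trans (cong (_* x) e) (*-identityˡ x))

      fπ : ∀ i → f (π Perm.⟨$⟩ʳ i) ≡ g i * f i
      fπ i rewrite strictlyInverseʳ (a * from i) with from i ≟ 0# | (a * from i) ≟ 0#
      ... | yes _ | yes _ = sym (*-identityˡ 1#)
      ... | yes e | no ne = contradiction (trans (cong (a *_) e) (zeroʳ a)) ne
      ... | no ne | yes e = contradiction (*-zero a≢0 e) ne
      ... | no _ | no _ = refl

      f≢0 : ∀ i → f i ≢ 0#
      f≢0 i with from i ≟ 0#
      ... | yes _ = 1≢0
      ... | no ne = ne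

      Πf≢0 : sum f ≢ 0#
      Πf≢0 = product≢0 f f≢0

      Πf≡ : sum f ≡ sum g * sum f
      Πf≡ = trans (sum-permute f π) (trans (sum-cong-≋ fπ) (∑-distrib-+ g f))

      g-i₀ : g i₀ ≡ 1#
      g-i₀ with from i₀ ≟ 0#
      ... | yes _ = refl
      ... | no ne = contradiction (strictlyInverseʳ 0#) ne

      g-rest : ∀ j → g (Fin.punchIn i₀ j) ≡ a
      g-rest j with from (Fin.punchIn i₀ j) ≟ 0#
      ... | yes e = contradiction (trans (sym (strictlyInverseˡ _)) (cong to e)) (Finₚ.punchInᵢ≢i i₀ j)
      ... | no _ = refl

      Πg≡a^n : sum g ≡ a ^ n
      Πg≡a^n = trans (sum-remove {i = i₀} g) (trans (cong₂ _*_ g-i₀ (trans (sum-cong-≋ g-rest) (sum-replicate n))) (*-identityˡ _))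

    fermat′ : ∀ N → ∣ ≡.setoid F ∣≡ N → ∀ x → x ^ N ≡ x
    fermat′ ℕ.zero c x with () ← Inverse.to c x
    fermat′ (ℕ.suc n) c x with x ≟ 0#
    ... | yes refl = zeroˡ _
    ... | no x≢0 = trans (cong (x *_) (fermat c x≢0)) (*-identityʳ x)

  frob : ℕ → F → F
  frob ℕ.zero x = x
  frob (ℕ.suc n) x = frob n x ^ 3

  frob≡^ : ∀ n x → frob n x ≡ x ^ (3 ℕ.^ n)
  frob≡^ ℕ.zero x = sym (*-identityʳ x)
  frob≡^ (ℕ.suc n) x = trans (cong (_^ 3) (frob≡^ n x)) (trans (^-assocʳ x (3 ℕ.^ n) 3) (cong (x ^_) (ℕₚ.*-comm (3 ℕ.^ n) 3)))

  frob-+ : ∀ m n x → frob (m ℕ.+ n) x ≡ frob m (frob n x)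
  frob-+ ℕ.zero n x = refl
  frob-+ (ℕ.suc m) n x = cong (_^ 3) (frob-+ m n x)

  frob-r : ∀ x → frob r x ≡ x
  frob-r x = trans (frob≡^ r x) (fermat′ q cardinality x)

  root : F → F
  root = frob r′

  root-cubed : ∀ x → root x ^ 3 ≡ x
  root-cubed = frob-r

  root-of-cube : ∀ x → root (x ^ 3) ≡ x
  root-of-cube x = trans (sym (frob-+ r′ 1 x)) (trans (cong (λ n → frob n x) (ℕₚ.+-comm r′ 1)) (frob-r x))

  cube-injective : ∀ {x y} → x ^ 3 ≡ y ^ 3 → x ≡ y
  cube-injective e = trans (sym (root-of-cube _)) (trans (cong root e) (root-of-cube _))

  root-ε : ∀ x → x ^ Construction.ε 𝔽 ≡ root x
  root-ε x = trans (cong (x ^_) (trans (cong (DivMod._/ 3) (ℕₚ.*-comm 3 (3 ℕ.^ r′))) (DivMod.m*n/n≡m (3 ℕ.^ r′) 3))) (sym (frob≡^ r′ x))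

  mkAut : ∀ {θ : F → F} → (∀ x y → θ (x + y) ≡ θ x + θ y) → (∀ x y → θ (x * y) ≡ θ x * θ y) →
          (∀ {x y} → θ x ≡ θ y → x ≡ y) → (∀ y → ∃ λ x → θ x ≡ y) → IsAut θ
  mkAut {θ} θ+ θ* injective surjective = record
    { isRingMonomorphism = record
      { isRingHomomorphism = record
        { isSemiringHomomorphism = record
          { isNearSemiringHomomorphism = record
            { +-isMonoidHomomorphism = record
              { isMagmaHomomorphism = record
                { isRelHomomorphism = record { cong = cong θ }
                ; homo = θ+ }
              ; ε-homo = θ0 }
            ; *-homo = θ* }
          ; 1#-homo = *-cancelˡ θ1≢0 (trans (sym (θ* _ _)) (trans (cong θ (*-identityˡ 1#)) (sym (*-identityʳ _)))) }
        ; -‿homo = λ x → inverseʳ-unique _ _ (trans (sym (θ+ _ _)) (trans (cong θ (-‿inverseʳ x)) θ0)) }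
      ; injective = injective }
    ; surjective = λ y → let x , e = surjective y in x , λ { refl → e }
    }
    where
    open GroupProperties +-group using (identityʳ-unique; inverseʳ-unique)
    θ0 : θ 0# ≡ 0#
    θ0 = identityʳ-unique _ _ (trans (sym (θ+ _ _)) (cong θ (+-identityˡ 0#)))
    θ1≢0 : θ 1# ≢ 0#
    θ1≢0 e = 1≢0 (injective (trans e (sym θ0)))

  frob-add : ∀ n x y → frob n (x + y) ≡ frob n x + frob n y
  frob-add ℕ.zero x y = refl
  frob-add (ℕ.suc n) x y = trans (cong (_^ 3) (frob-add n x y))
    (solve 2 (λ x y → (x :+ y) :^ 3 := x :^ 3 :+ y :^ 3) refl (frob n x) (frob n y))

  frob-mult : ∀ n x y → frob n (x * y) ≡ frob n x * frob n y
  frob-mult ℕ.zero x y = refl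
  frob-mult (ℕ.suc n) x y = trans (cong (_^ 3) (frob-mult n x y)) (^-distrib-* _ _ 3)

  frob-injective : ∀ n {x y} → frob n x ≡ frob n y → x ≡ y
  frob-injective ℕ.zero e = e
  frob-injective (ℕ.suc n) e = frob-injective n (cube-injective e)

  frob-surjective : ∀ n y → ∃ λ x → frob n x ≡ y
  frob-surjective ℕ.zero y = y , refl
  frob-surjective (ℕ.suc n) y = let x , e = frob-surjective n (root y) in x , trans (cong (_^ 3) e) (root-cubed y)

  frob-aut : ∀ n → IsAut (frob n)
  frob-aut n = mkAut (frob-add n) (frob-mult n) (frob-injective n) (frob-surjective n)

  module Aut {θ : F → F} (aut : IsAut θ) where
    open IsRingIsomorphism aut public using (+-homo; *-homo; -‿homo; 0#-homo; 1#-homo; injective; surjective)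

    ^-homo : ∀ x n → θ (x ^ n) ≡ θ x ^ n
    ^-homo x ℕ.zero = 1#-homo
    ^-homo x (ℕ.suc n) = trans (*-homo x (x ^ n)) (cong (θ x *_) (^-homo x n))

    frob-homo : ∀ n x → θ (frob n x) ≡ frob n (θ x)
    frob-homo ℕ.zero x = refl
    frob-homo (ℕ.suc n) x = trans (^-homo _ 3) (cong (_^ 3) (frob-homo n x))

    coefficient : ∀ t → θ ⟦ t ⟧₃ ≡ ⟦ t ⟧₃
    coefficient 0₃ = 0#-homo
    coefficient 1₃ = 1#-homo
    coefficient 2₃ = trans (-‿homo 1#) (cong -_ 1#-homo)

    inverse : F → F
    inverse y = proj₁ (surjective y)

    inverseʳ : ∀ y → θ (inverse y) ≡ y
    inverseʳ y = proj₂ (surjective y) refl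

  aut-id : IsAut id
  aut-id = frob-aut 0

_⊎-∣∣_ : ∀ {S T m n} → ∣ S ∣≡ m → ∣ T ∣≡ n → ∣ S ⊎ₛ T ∣≡ (m ℕ.+ n)
_⊎-∣∣_ {S} {T} {m} {n} c d = record
  { to = go
  ; from = λ k → back (Fin.splitAt m k)
  ; to-cong = λ { (Sum.inj₁ e) → cong (λ i → Fin._↑ˡ_ i n) (C.to-cong e) ; (Sum.inj₂ e) → cong (m Fin.↑ʳ_) (D.to-cong e) }
  ; from-cong = λ { refl → Setoid.refl (S ⊎ₛ T) }
  ; inverse = (λ { {k} e → trans (forth (Fin.splitAt m k) e) (Finₚ.join-splitAt m n k) })
            , λ { {inj₁ x} refl → subst (λ z → Setoid._≈_ (S ⊎ₛ T) (back z) (inj₁ x)) (sym (Finₚ.splitAt-↑ˡ m (C.to x) n)) (Sum.inj₁ (C.strictlyInverseʳ x))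
                ; {inj₂ y} refl → subst (λ z → Setoid._≈_ (S ⊎ₛ T) (back z) (inj₂ y)) (sym (Finₚ.splitAt-↑ʳ m n (D.to y))) (Sum.inj₂ (D.strictlyInverseʳ y)) }
  }
  where
  module C = Inverse c
  module D = Inverse d
  go : Setoid.Carrier (S ⊎ₛ T) → Fin (m ℕ.+ n)
  go (inj₁ x) = Fin._↑ˡ_ (C.to x) n
  go (inj₂ y) = m Fin.↑ʳ D.to y
  back : Fin m ⊎ Fin n → Setoid.Carrier (S ⊎ₛ T)
  back (inj₁ i) = inj₁ (C.from i)
  back (inj₂ j) = inj₂ (D.from j)
  forth : ∀ s {z} → Setoid._≈_ (S ⊎ₛ T) z (back s) →
          go z ≡ Fin.join m n s
  forth (inj₁ i) (Sum.inj₁ e) = cong (λ i → Fin._↑ˡ_ i n) (C.inverseˡ e)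
  forth (inj₂ j) (Sum.inj₂ e) = cong (m Fin.↑ʳ_) (D.inverseˡ e)

module Automorphisms (r′ : ℕ) (𝔽 : FiniteField (3 ℕ.^ ℕ.suc r′)) where
  open FieldTheory r′ 𝔽
  open ≡.≡-Reasoning

  ev : ∀ {n} → Vec F n → F → F
  ev [] x = 0#
  ev (c ∷ cs) x = c + x * ev cs x

  private
    quot : ∀ {n} → F → Vec F (ℕ.suc n) → Vec F n
    quot a (c ∷ []) = []
    quot a (c ∷ d ∷ cs) = ev (d ∷ cs) a ∷ quot a (d ∷ cs)

    division : ∀ {n} a (cs : Vec F (ℕ.suc n)) x → ev cs x ≡ (x - a) * ev (quot a cs) x + ev cs a
    division a (c ∷ []) x = trans (cong (c +_) (zeroʳ x)) (sym (trans (cong₂ _+_ (zeroʳ _) (cong (c +_) (zeroʳ a))) (+-identityˡ _)))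
    division a (c ∷ d ∷ cs) x = trans (cong (λ z → c + x * z) (division a (d ∷ cs) x))
      (solve 5 (λ c x a e p → c :+ x :* ((x :- a) :* e :+ p) := (x :- a) :* (p :+ x :* e) :+ (c :+ a :* p)) refl
        c x a (ev (quot a (d ∷ cs)) x) (ev (d ∷ cs) a))

    zero-quot : ∀ {n} a (cs : Vec F (ℕ.suc n)) → ev cs a ≡ 0# → (∀ i → lookup (quot a cs) i ≡ 0#) → ∀ i → lookup cs i ≡ 0#
    zero-quot a (c ∷ []) e _ zero = trans (sym (trans (cong (c +_) (zeroʳ a)) (+-identityʳ c))) e
    zero-quot a (c ∷ d ∷ cs) e z zero = trans (sym (trans (cong (λ y → c + a * y) (z zero)) (trans (cong (c +_) (zeroʳ a)) (+-identityʳ c)))) e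
    zero-quot a (c ∷ d ∷ cs) e z (suc i) = zero-quot a (d ∷ cs) (z zero) (z ∘ suc) i

  vanishing : ∀ {n} (cs : Vec F n) (ρ : Fin n → F) → (∀ {i j} → ρ i ≡ ρ j → i ≡ j) → (∀ i → ev cs (ρ i) ≡ 0#) →
              ∀ i → lookup cs i ≡ 0#
  vanishing {ℕ.suc n} cs ρ ρ-inj z = zero-quot a cs (z zero)
    (vanishing (quot a cs) (ρ ∘ suc) (λ e → Finₚ.suc-injective (ρ-inj e)) λ i → *-zero
      (λ e → contradiction (ρ-inj (difference e)) λ ())
      (trans (sym (trans (division a cs (ρ (suc i))) (trans (cong ((ρ (suc i) - a) * ev (quot a cs) (ρ (suc i)) +_) (z zero)) (+-identityʳ _)))) (z (suc i))))
    where a = ρ zero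

  private
    monomial : ∀ k → Vec F (ℕ.suc k)
    monomial ℕ.zero = 1# ∷ []
    monomial (ℕ.suc k) = 0# ∷ monomial k

    ev-monomial : ∀ k x → ev (monomial k) x ≡ x ^ k
    ev-monomial ℕ.zero x = trans (cong (1# +_) (zeroʳ x)) (+-identityʳ 1#)
    ev-monomial (ℕ.suc k) x = trans (+-identityˡ _) (cong (x *_) (ev-monomial k x))

    -1≢0 : - 1# ≢ 0#
    -1≢0 e = 1≢0 (trans (sym (+-identityʳ 1#)) (trans (cong (1# +_) (sym e)) (-‿inverseʳ 1#)))

    FixedBy : ℕ → Setoid 0ℓ 0ℓ
    FixedBy n = subsetoid (≡.setoid F) (λ x → frob n x ≡ x)

    3^≡ : ∀ n → ∃ λ k → 3 ℕ.^ ℕ.suc n ≡ ℕ.suc (ℕ.suc k)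
    3^≡ ℕ.zero = 1 , refl
    3^≡ (ℕ.suc n) with 3^≡ n
    ... | k , e = _ , cong (3 ℕ.*_) e

    fixed-≤ : ∀ n {M} → ∣ FixedBy (ℕ.suc n) ∣≡ M → M ℕ.≤ 3 ℕ.^ ℕ.suc n
    fixed-≤ n {M} c with 3^≡ n
    ... | k , e = ℕₚ.≮⇒≥ λ d<M → -1≢0 (vanishing (0# ∷ - 1# ∷ monomial k) (ρ d<M)
        (λ eq → Finₚ.inject≤-injective _ _ _ _ (trans (sym (Inverse.strictlyInverseˡ c _))
          (trans (Inverse.to-cong c eq) (Inverse.strictlyInverseˡ c _))))
        (λ i → root-of (proj₁ (Inverse.from c (inject d<M i))) (proj₂ (Inverse.from c (inject d<M i))))
        (suc zero))
      where
      inject : 3 ℕ.^ ℕ.suc n ℕ.< M → Fin (3 ℕ.+ k) → Fin M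
      inject d<M i = Fin.inject≤ i (subst (ℕ._< M) e d<M)

      ρ : 3 ℕ.^ ℕ.suc n ℕ.< M → Fin (3 ℕ.+ k) → F
      ρ d<M i = proj₁ (Inverse.from c (inject d<M i))

      root-of : ∀ x → frob (ℕ.suc n) x ≡ x → ev (0# ∷ - 1# ∷ monomial k) x ≡ 0#
      root-of x fx = begin
        0# + x * (- 1# + x * ev (monomial k) x)  ≡⟨ cong (λ z → 0# + x * (- 1# + x * z)) (ev-monomial k x) ⟩
        0# + x * (- 1# + x * x ^ k)              ≡⟨ solve 2 (λ x p → con 0₃ :+ x :* (con 2₃ :+ x :* p) := x :* (x :* p) :- x) refl x (x ^ k) ⟩
        x ^ ℕ.suc (ℕ.suc k) - x                  ≡⟨ cong (_- x) (trans (cong (x ^_) (sym e)) (trans (sym (frob≡^ (ℕ.suc n) x)) fx)) ⟩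
        x - x                                    ≡⟨ -‿inverseʳ x ⟩
        0#                                       ∎

    FixedBelow : ℕ → Setoid 0ℓ 0ℓ
    FixedBelow m = subsetoid (≡.setoid F) (λ x → ∃ λ i → i ℕ.< m × frob (ℕ.suc i) x ≡ x)

    fixedBelow? : ∀ m x → Dec (∃ λ i → i ℕ.< m × frob (ℕ.suc i) x ≡ x)
    fixedBelow? m x = map′ (λ { (i , e) → toℕ i , Finₚ.toℕ<n i , e })
      (λ { (i , i<m , e) → Fin.fromℕ< i<m , trans (cong (λ j → frob (ℕ.suc j) x) (Finₚ.toℕ-fromℕ< i<m)) e })
      (Finₚ.any? λ (i : Fin m) → frob (ℕ.suc (toℕ i)) x ≟ x)

    fixedBelow-≤ : ∀ m {M} → ∣ FixedBelow m ∣≡ M → M ℕ.< 3 ℕ.^ ℕ.suc m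
    fixedBelow-≤ ℕ.zero {ℕ.zero} c = ℕ.s≤s ℕ.z≤n
    fixedBelow-≤ ℕ.zero {ℕ.suc M} c with () ← proj₁ (proj₂ (proj₂ (Inverse.from c zero)))
    fixedBelow-≤ (ℕ.suc m) {M} c = ℕₚ.<-≤-trans (ℕₚ.≤-<-trans (injection⇒≤ c (d ⊎-∣∣ d′) {h} (h-cong , h-injective))
        (ℕₚ.+-mono-<-≤ (fixedBelow-≤ m d) (fixed-≤ m d′)))
        (ℕₚ.+-monoʳ-≤ (3 ℕ.^ ℕ.suc m) (ℕₚ.m≤m+n (3 ℕ.^ ℕ.suc m) _))
      where
      lower = subset-finite {≡.setoid F} F-finite (fixedBelow? m) (λ { refl p → p })
      d = proj₂ lower
      top = subset-finite {≡.setoid F} F-finite (λ x → frob (ℕ.suc m) x ≟ x) (λ { refl p → p })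
      d′ = proj₂ top
      T = FixedBelow m ⊎ₛ FixedBy (ℕ.suc m)

      place : ∀ x → Dec (frob (ℕ.suc m) x ≡ x) → (∃ λ i → i ℕ.< ℕ.suc m × frob (ℕ.suc i) x ≡ x) → Setoid.Carrier T
      place x (yes e) _ = inj₂ (x , e)
      place x (no ne) (i , i<1+m , e) with ℕₚ.m<1+n⇒m<n∨m≡n i<1+m
      ... | inj₁ i<m = inj₁ (x , i , i<m , e)
      ... | inj₂ refl = contradiction e ne

      h : Setoid.Carrier (FixedBelow (ℕ.suc m)) → Setoid.Carrier T
      h (x , p) = place x (frob (ℕ.suc m) x ≟ x) p

      place-cong : ∀ x D p p′ → Setoid._≈_ T (place x D p) (place x D p′)
      place-cong x (yes e) p p′ = Sum.inj₂ refl
      place-cong x (no ne) (i , i< , e) (i′ , i′< , e′) with ℕₚ.m<1+n⇒m<n∨m≡n i< | ℕₚ.m<1+n⇒m<n∨m≡n i′<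
      ... | inj₁ _ | inj₁ _ = Sum.inj₁ refl
      ... | inj₂ refl | _ = contradiction e ne
      ... | inj₁ _ | inj₂ refl = contradiction e′ ne

      h-cong : ∀ {x y} → proj₁ x ≡ proj₁ y → Setoid._≈_ T (h x) (h y)
      h-cong {x , p} {.x , p′} refl = place-cong x (frob (ℕ.suc m) x ≟ x) p p′

      value : Setoid.Carrier T → F
      value (inj₁ x) = proj₁ x
      value (inj₂ x) = proj₁ x

      value-cong : ∀ {s t} → Setoid._≈_ T s t → value s ≡ value t
      value-cong (Sum.inj₁ e) = e
      value-cong (Sum.inj₂ e) = e

      value-place : ∀ x D p → value (place x D p) ≡ x
      value-place x (yes e) p = refl
      value-place x (no ne) (i , i< , e) with ℕₚ.m<1+n⇒m<n∨m≡n i<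
      ... | inj₁ _ = refl
      ... | inj₂ refl = contradiction e ne

      h-injective : ∀ {x y} → Setoid._≈_ T (h x) (h y) → proj₁ x ≡ proj₁ y
      h-injective {x , p} {y , p′} e = trans (sym (value-place x (frob (ℕ.suc m) x ≟ x) p)) (trans (value-cong e) (value-place y (frob (ℕ.suc m) y ≟ y) p′))

  ∃-primitive : ∃ λ x → ∀ i → i ℕ.< r′ → frob (ℕ.suc i) x ≢ x
  ∃-primitive with ∃? {≡.setoid F} F-finite (λ x → ¬? (fixedBelow? r′ x)) (λ { refl p → p })
  ... | yes (x , ∄) = x , λ i i<r′ e → ∄ (i , i<r′ , e)
  ... | no none = contradiction (fixedBelow-≤ r′ {q} (∣∣-via everything cardinality)) (ℕₚ.<-irrefl refl)
    where
    everything : Inverse (FixedBelow r′) (≡.setoid F)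
    everything = record
      { to = proj₁
      ; from = λ x → x , decidable-stable (fixedBelow? r′ x) (λ ∄ → none (x , ∄))
      ; to-cong = id ; from-cong = id
      ; inverse = id , sym ∘ sym
      }

  private
    p : F
    p = proj₁ ∃-primitive

    conjugate : Fin r → F
    conjugate i = frob (toℕ i) p

    conjugate-< : ∀ {i j : Fin r} → toℕ i ℕ.< toℕ j → conjugate i ≢ conjugate j
    conjugate-< {i} {j} i<j e = proj₂ ∃-primitive k (ℕₚ.<-≤-trans (ℕₚ.m<m+n k (ℕ.s≤s ℕ.z≤n)) k+1≤)
      (sym (frob-injective (toℕ i) (trans e (trans (cong (λ n → frob n p) (sym j≡)) (frob-+ (toℕ i) (ℕ.suc k) p)))))
      where
      k = toℕ j ℕ.∸ ℕ.suc (toℕ i)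
      j≡ : toℕ i ℕ.+ ℕ.suc k ≡ toℕ j
      j≡ = trans (ℕₚ.+-suc (toℕ i) k) (ℕₚ.m+[n∸m]≡n i<j)
      k+1≤ : k ℕ.+ 1 ℕ.≤ r′
      k+1≤ = ℕₚ.≤-trans (ℕₚ.≤-reflexive (ℕₚ.+-comm k 1)) (ℕₚ.≤-trans (ℕₚ.m≤n+m (ℕ.suc k) (toℕ i))
        (ℕₚ.≤-trans (ℕₚ.≤-reflexive j≡) (ℕ.s≤s⁻¹ (Finₚ.toℕ<n j))))

    conjugate-injective : ∀ {i j} → conjugate i ≡ conjugate j → i ≡ j
    conjugate-injective {i} {j} e with ℕₚ.<-cmp (toℕ i) (toℕ j)
    ... | tri< i<j _ _ = contradiction e (conjugate-< i<j)
    ... | tri≈ _ i≡j _ = Finₚ.toℕ-injective i≡j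
    ... | tri> _ _ j<i = contradiction (sym e) (conjugate-< j<i)

    ev₃ : ∀ {n} → Vec (Fin 3) n → F → F
    ev₃ ts = ev (Vec.map ⟦_⟧₃ ts)

    aut-ev : ∀ {θ n} → IsAut θ → (ts : Vec (Fin 3) n) → ∀ x → θ (ev₃ ts x) ≡ ev₃ ts (θ x)
    aut-ev aut [] x = Aut.0#-homo aut
    aut-ev aut (t ∷ ts) x = trans (Aut.+-homo aut _ _) (cong₂ _+_ (Aut.coefficient aut t)
      (trans (Aut.*-homo aut _ _) (cong (_ *_) (aut-ev aut ts x))))

    minus : Fin 3 → Fin 3 → Fin 3
    minus s t = Solver₃.add s (Solver₃.neg t)

    ⟦minus⟧ : ∀ s t → ⟦ minus s t ⟧₃ ≡ ⟦ s ⟧₃ - ⟦ t ⟧₃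
    ⟦minus⟧ s t = trans (Solver₃.add-homo s _) (cong (⟦ s ⟧₃ +_) (Solver₃.neg-homo t))

    minus-zero : ∀ s t → ⟦ minus s t ⟧₃ ≡ 0# → s ≡ t
    minus-zero 0₃ 0₃ _ = refl
    minus-zero 0₃ 1₃ e = contradiction e -1≢0
    minus-zero 0₃ 2₃ e = contradiction e 1≢0
    minus-zero 1₃ 0₃ e = contradiction e 1≢0
    minus-zero 1₃ 1₃ _ = refl
    minus-zero 1₃ 2₃ e = contradiction e -1≢0
    minus-zero 2₃ 0₃ e = contradiction e -1≢0
    minus-zero 2₃ 1₃ e = contradiction e 1≢0
    minus-zero 2₃ 2₃ _ = refl

    ev-minus : ∀ {n} (ss ts : Vec (Fin 3) n) x → ev₃ (Vec.zipWith minus ss ts) x ≡ ev₃ ss x - ev₃ ts x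
    ev-minus [] [] x = sym (-‿inverseʳ 0#)
    ev-minus (s ∷ ss) (t ∷ ts) x = trans (cong₂ (λ y z → y + x * z) (⟦minus⟧ s t) (ev-minus ss ts x))
      (solve 5 (λ s t x a b → s :- t :+ x :* (a :- b) := s :+ x :* a :- (t :+ x :* b)) refl ⟦ s ⟧₃ ⟦ t ⟧₃ x (ev₃ ss x) (ev₃ ts x))

    ev₃-injective : ∀ (ss ts : Vec (Fin 3) r) → ev₃ ss p ≡ ev₃ ts p → ∀ i → lookup ss i ≡ lookup ts i
    ev₃-injective ss ts e i = minus-zero _ _ (trans (sym (trans (Vecₚ.lookup-map i ⟦_⟧₃ us)
        (cong ⟦_⟧₃ (Vecₚ.lookup-zipWith minus i ss ts))))
      (vanishing (Vec.map ⟦_⟧₃ us) conjugate conjugate-injective (λ j → trans (sym (aut-ev (frob-aut (toℕ j)) us p))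
        (trans (cong (frob (toℕ j)) (trans (ev-minus ss ts p) (trans (cong (_- ev₃ ts p) e) (-‿inverseʳ _))))
          (Aut.0#-homo (frob-aut (toℕ j))))) i))
      where us = Vec.zipWith minus ss ts

    digits : Fin q → Vec (Fin 3) r
    digits k = Vec.tabulate (Fin.finToFun {3} {r} k)

    digits-injective : ∀ {k l} → (∀ i → lookup (digits k) i ≡ lookup (digits l) i) → k ≡ l
    digits-injective {k} {l} e = trans (sym (Finₚ.funToFin-finToFin {r} {3} k)) (trans (funToFin-cong r λ i →
      trans (sym (Vecₚ.lookup∘tabulate (Fin.finToFun {3} {r} k) i)) (trans (e i) (Vecₚ.lookup∘tabulate (Fin.finToFun {3} {r} l) i)))
      (Finₚ.funToFin-finToFin {r} {3} l))
      where
      funToFin-cong : ∀ n {f g : Fin n → Fin 3} → (∀ i → f i ≡ g i) → Fin.funToFin f ≡ Fin.funToFin g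
      funToFin-cong ℕ.zero _ = refl
      funToFin-cong (ℕ.suc n) f≗g = cong₂ Fin.combine (f≗g zero) (funToFin-cong n (f≗g ∘ suc))

    generated-by-p : ∀ y → ∃ λ ts → ev₃ {r} ts p ≡ y
    generated-by-p y = let k , e = injection⇒surjection {≡.setoid (Fin q)} {≡.setoid F}
                             (record { to = id ; from = id ; to-cong = id ; from-cong = id ; inverse = id , id }) cardinality ℕₚ.≤-refl
                             {λ k → ev₃ (digits k) p}
                             ((λ { refl → refl }) , λ {k} {l} e → digits-injective (ev₃-injective (digits k) (digits l) e)) y
                       in digits k , e

    -- A monic polynomial of degree r over ℤ/3 that vanishes at p, hence at all conjugates of p.
    minimal : Vec F (ℕ.suc r)
    minimal = Vec.map -_ (Vec.map ⟦_⟧₃ (proj₁ (generated-by-p (p ^ r)))) ∷ʳ 1#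

    ev-∷ʳ : ∀ {n} (cs : Vec F n) x → ev (Vec.map -_ cs ∷ʳ 1#) x ≡ x ^ n - ev cs x
    ev-∷ʳ [] x = solve 1 (λ x → con 1₃ :+ x :* con 0₃ := con 1₃ :- con 0₃) refl x
    ev-∷ʳ (c ∷ cs) x = trans (cong (λ z → - c + x * z) (ev-∷ʳ cs x))
      (solve 4 (λ c x m e → :- c :+ x :* (m :- e) := x :* m :- (c :+ x :* e)) refl c x (x ^ (Vec.length cs)) (ev cs x))

    minimal-root : ∀ {θ} → IsAut θ → ev minimal (θ p) ≡ 0#
    minimal-root {θ} aut = let ts , e = generated-by-p (p ^ r) in begin
      ev minimal (θ p)              ≡⟨ ev-∷ʳ (Vec.map ⟦_⟧₃ ts) (θ p) ⟩
      θ p ^ r - ev₃ ts (θ p)        ≡⟨ cong (λ z → θ p ^ r - z) (trans (sym (aut-ev aut ts p)) (trans (cong θ e) (Aut.^-homo aut p r))) ⟩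
      θ p ^ r - θ p ^ r             ≡⟨ -‿inverseʳ _ ⟩
      0#                            ∎

    last≡1 : ∀ {n} (cs : Vec F n) → lookup (cs ∷ʳ 1#) (fromℕ n) ≡ 1#
    last≡1 [] = refl
    last≡1 (c ∷ cs) = last≡1 cs

  aut⇒frob : ∀ {θ} → IsAut θ → ∃ λ (i : Fin r) → ∀ x → θ x ≡ frob (toℕ i) x
  aut⇒frob {θ} aut with Finₚ.any? (λ i → θ p ≟ conjugate i)
  ... | yes (i , e) = i , λ x → let ts , ev≡x = generated-by-p x in begin
    θ x                          ≡⟨ cong θ ev≡x ⟨
    θ (ev₃ ts p)                 ≡⟨ aut-ev aut ts p ⟩
    ev₃ ts (θ p)                 ≡⟨ cong (ev₃ ts) e ⟩
    ev₃ ts (frob (toℕ i) p)      ≡⟨ aut-ev (frob-aut (toℕ i)) ts p ⟨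
    frob (toℕ i) (ev₃ ts p)      ≡⟨ cong (frob (toℕ i)) ev≡x ⟩
    frob (toℕ i) x               ∎
  ... | no ∄ = contradiction (trans (sym (last≡1 (Vec.map -_ (Vec.map ⟦_⟧₃ (proj₁ (generated-by-p (p ^ r)))))))
      (vanishing minimal ρ ρ-injective ρ-root (fromℕ r))) 1≢0
    where
    ρ : Fin (ℕ.suc r) → F
    ρ zero = θ p
    ρ (suc i) = conjugate i

    ρ-injective : ∀ {i j} → ρ i ≡ ρ j → i ≡ j
    ρ-injective {zero} {zero} _ = refl
    ρ-injective {zero} {suc j} e = contradiction (j , e) ∄
    ρ-injective {suc i} {zero} e = contradiction (i , sym e) ∄
    ρ-injective {suc i} {suc j} e = cong suc (conjugate-injective e)

    ρ-root : ∀ i → ev minimal (ρ i) ≡ 0#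
    ρ-root zero = minimal-root aut
    ρ-root (suc i) = minimal-root (frob-aut (toℕ i))

record Acts (H : Group 0ℓ 0ℓ) (X : Set) : Set where
  open Group H using (Carrier; _≈_; _∙_; ε; _⁻¹; inverseˡ; inverseʳ)
  field
    act : Carrier → X → X
    act-cong : ∀ {g h} → g ≈ h → ∀ x → act g x ≡ act h x
    act-ε : ∀ x → act ε x ≡ x
    act-∙ : ∀ g h x → act (g ∙ h) x ≡ act h (act g x)

  abstract
    act-inverseˡ : ∀ g x → act g (act (g ⁻¹) x) ≡ x
    act-inverseˡ g x = trans (sym (act-∙ (g ⁻¹) g x)) (trans (act-cong (inverseˡ g) x) (act-ε x))

    act-inverseʳ : ∀ g x → act (g ⁻¹) (act g x) ≡ x
    act-inverseʳ g x = trans (sym (act-∙ g (g ⁻¹) x)) (trans (act-cong (inverseʳ g) x) (act-ε x))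

  perm : Carrier → X ↔ X
  perm g = mk↔ₛ′ (act g) (act (g ⁻¹)) (act-inverseˡ g) (act-inverseʳ g)

module Permutations (r′ : ℕ) (𝔽 : FiniteField (3 ℕ.^ ℕ.suc r′)) where
  open FieldTheory r′ 𝔽
  open Construction 𝔽 using (Ω)
  open ≡.≡-Reasoning
  open Inverse using (to; from; strictlyInverseˡ; strictlyInverseʳ)

  perm-injective : ∀ {X : Set} (π : X ↔ X) {x y} → to π x ≡ to π y → x ≡ y
  perm-injective π e = trans (sym (strictlyInverseʳ π _)) (trans (cong (from π) e) (strictlyInverseʳ π _))

  ,≡ : ∀ {A B : Set} {a a′ : A} {b b′ : B} → (a , b) ≡ (a′ , b′) → a ≡ a′ × b ≡ b′
  ,≡ refl = refl , refl

  root-mult : ∀ x y → root (x * y) ≡ root x * root y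
  root-mult = frob-mult r′

  ρ : F → F
  ρ x = root x ^ 2

  ρ-exponent : ∀ x → x ^ (2 ℕ.* Construction.ε 𝔽) ≡ ρ x
  ρ-exponent x = trans (cong (x ^_) (ℕₚ.*-comm 2 (Construction.ε 𝔽)))
    (trans (sym (^-assocʳ x (Construction.ε 𝔽) 2)) (cong (_^ 2) (root-ε x)))

  ρ-mult : ∀ x y → ρ (x * y) ≡ ρ x * ρ y
  ρ-mult x y = trans (cong (_^ 2) (root-mult x y)) (^-distrib-* _ _ 2)

  ρ-1 : ρ 1# ≡ 1#
  ρ-1 = trans (cong (_^ 2) (Aut.1#-homo (frob-aut r′))) (solve 0 (con 1₃ :^ 2 := con 1₃) refl)

  ρ-aut : ∀ {θ} → IsAut θ → ∀ x → θ (ρ x) ≡ ρ (θ x)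
  ρ-aut aut x = trans (Aut.^-homo aut _ 2) (cong (_^ 2) (Aut.frob-homo aut r′ x))

  e₁ e₂ : F²
  e₁ = 1# , 0#
  e₂ = 0# , 1#

  det : F² → F² → F
  det (p , p′) (s , s′) = p * s′ - s * p′

  module Γ = Group (Subgroup.group ΓL₂)

  fun : Γ.Carrier → F² → F²
  fun f = to (proj₁ f)

  field-aut : Γ.Carrier → F → F
  field-aut f = proj₁ (proj₂ f)

  module Semilinear (f : Γ.Carrier) where
    θ : F → F
    θ = field-aut f
    aut : IsAut θ
    aut = proj₁ (proj₂ (proj₂ f))
    open Aut aut public
    add : ∀ u v → fun f (u ⊕ v) ≡ fun f u ⊕ fun f v
    add = proj₁ (proj₂ (proj₂ (proj₂ f)))
    scale : ∀ k v → fun f (k • v) ≡ θ k • fun f v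
    scale = proj₂ (proj₂ (proj₂ (proj₂ f)))

    p p′ s s′ : F
    p = proj₁ (fun f e₁)
    p′ = proj₂ (fun f e₁)
    s = proj₁ (fun f e₂)
    s′ = proj₂ (fun f e₂)

    basis : ∀ x y → x • e₁ ⊕ y • e₂ ≡ (x , y)
    basis x y = cong₂ _,_ (solve 2 (λ x y → x :* con 1₃ :+ y :* con 0₃ := x) refl x y)
                          (solve 2 (λ x y → x :* con 0₃ :+ y :* con 1₃ := y) refl x y)

    formula : ∀ x y → fun f (x , y) ≡ (p * θ x + s * θ y , p′ * θ x + s′ * θ y)
    formula x y = begin
      fun f (x , y)                             ≡⟨ cong (fun f) (basis x y) ⟨
      fun f (x • e₁ ⊕ y • e₂)                   ≡⟨ add _ _ ⟩
      fun f (x • e₁) ⊕ fun f (y • e₂)           ≡⟨ cong₂ _⊕_ (scale x e₁) (scale y e₂) ⟩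
      θ x • fun f e₁ ⊕ θ y • fun f e₂           ≡⟨ cong₂ _,_ (cong₂ _+_ (*-comm _ _) (*-comm _ _)) (cong₂ _+_ (*-comm _ _) (*-comm _ _)) ⟩
      (p * θ x + s * θ y , p′ * θ x + s′ * θ y) ∎

    zero-fixed : fun f (0# , 0#) ≡ (0# , 0#)
    zero-fixed = trans (formula 0# 0#) (cong₂ _,_ (zeros p s) (zeros p′ s′))
      where
      zeros : ∀ k l → k * θ 0# + l * θ 0# ≡ 0#
      zeros k l = trans (cong₂ (λ y z → k * y + l * z) 0#-homo 0#-homo)
        (solve 2 (λ k l → k :* con 0₃ :+ l :* con 0₃ := con 0₃) refl k l)

    nonzero² : ∀ {v} → v ≢ (0# , 0#) → fun f v ≢ (0# , 0#)
    nonzero² v≢0 e = v≢0 (perm-injective (proj₁ f) (trans e (sym zero-fixed)))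

  δet : Γ.Carrier → F
  δet f = det (fun f e₁) (fun f e₂)

  e₁≢0 : e₁ ≢ (0# , 0#)
  e₁≢0 e = 1≢0 (proj₁ (,≡ e))

  e₂≢0 : e₂ ≢ (0# , 0#)
  e₂≢0 e = 1≢0 (proj₂ (,≡ e))

  •-cancel : ∀ {k l v} → v ≢ (0# , 0#) → k • v ≡ l • v → k ≡ l
  •-cancel {k} {l} {x , y} v≢0 e with x ≟ 0# | y ≟ 0#
  ... | yes refl | yes refl = contradiction refl v≢0
  ... | no x≢0 | _ = *-cancelˡ x≢0 (trans (*-comm x k) (trans (proj₁ (,≡ e)) (*-comm l x)))
  ... | yes _ | no y≢0 = *-cancelˡ y≢0 (trans (*-comm y k) (trans (proj₂ (,≡ e)) (*-comm l y)))

  field-aut-cong : ∀ {f g} → f Γ.≈ g → ∀ x → field-aut f x ≡ field-aut g x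
  field-aut-cong {f} {g} f≈g x = •-cancel (Semilinear.nonzero² f e₁≢0)
    (trans (sym (Semilinear.scale f x e₁)) (trans (f≈g _) (trans (Semilinear.scale g x e₁) (cong (field-aut g x •_) (sym (f≈g e₁))))))

  δet-∙ : ∀ f g → δet (f Γ.∙ g) ≡ δet g * field-aut g (δet f)
  δet-∙ f g = begin
    det (fun g (fun f e₁)) (fun g (fun f e₂))
      ≡⟨ cong₂ det (G.formula F.p F.p′) (G.formula F.s F.s′) ⟩
    det (G.p * G.θ F.p + G.s * G.θ F.p′ , G.p′ * G.θ F.p + G.s′ * G.θ F.p′)
        (G.p * G.θ F.s + G.s * G.θ F.s′ , G.p′ * G.θ F.s + G.s′ * G.θ F.s′)
      ≡⟨ solve 8 (λ p p′ s s′ a a′ b b′ →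
           (p :* a :+ s :* a′) :* (p′ :* b :+ s′ :* b′) :- (p :* b :+ s :* b′) :* (p′ :* a :+ s′ :* a′)
             := (p :* s′ :- s :* p′) :* (a :* b′ :- b :* a′))
           refl G.p G.p′ G.s G.s′ (G.θ F.p) (G.θ F.p′) (G.θ F.s) (G.θ F.s′) ⟩
    δet g * (G.θ F.p * G.θ F.s′ - G.θ F.s * G.θ F.p′)
      ≡⟨ cong (δet g *_) (trans (G.+-homo _ _) (cong₂ _+_ (G.*-homo _ _) (trans (G.-‿homo _) (cong -_ (G.*-homo _ _))))) ⟨
    δet g * G.θ (δet f) ∎
    where
    module F = Semilinear f
    module G = Semilinear g

  δet-ε : δet Γ.ε ≡ 1#
  δet-ε = solve 0 (con 1₃ :* con 1₃ :- con 0₃ :* con 0₃ := con 1₃) refl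

  δet-cong : ∀ {f g} → f Γ.≈ g → δet f ≡ δet g
  δet-cong f≈g = cong₂ det (f≈g e₁) (f≈g e₂)

  δet≢0 : ∀ f → δet f ≢ 0#
  δet≢0 f e = factorʳ≢0 (λ z → 1≢0 (trans (sym (trans (sym (δet-∙ f (f Γ.⁻¹))) (trans (δet-cong {f Γ.∙ f Γ.⁻¹} {Γ.ε} (Γ.inverseʳ f)) δet-ε))) z))
    (trans (cong (field-aut (f Γ.⁻¹)) e) (Semilinear.0#-homo (f Γ.⁻¹)))

  infixl 6 _⊞_
  _⊞_ : Ω → Ω → Ω
  (a , b , c) ⊞ (u , v , w) = a + u , b + v , c + w

  triple≡ : ∀ {a a′ b b′ c c′ : F} → a ≡ a′ → b ≡ b′ → c ≡ c′ → (a , b , c) ≡ (a′ , b′ , c′)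
  triple≡ refl refl refl = refl

  K₁ : Group 0ℓ 0ℓ
  K₁ = Direct.group +-group (Direct.group +-group +-group)

  translations : Acts K₁ Ω
  translations = record
    { act = λ t x → x ⊞ t
    ; act-cong = λ { (refl , refl , refl) _ → refl }
    ; act-ε = λ _ → triple≡ (+-identityʳ _) (+-identityʳ _) (+-identityʳ _)
    ; act-∙ = λ _ _ _ → triple≡ (sym (+-assoc _ _ _)) (sym (+-assoc _ _ _)) (sym (+-assoc _ _ _))
    }

  lift : Γ.Carrier → Ω → Ω
  lift f (a , b , c) = proj₁ (fun f (a , b)) , proj₂ (fun f (a , b)) , ρ (δet f) * field-aut f c

  lifts : Acts (Subgroup.group ΓL₂) Ω
  lifts = record
    { act = lift
    ; act-cong = λ { {f} {g} f≈g (a , b , c) → triple≡ (cong proj₁ (f≈g _)) (cong proj₂ (f≈g _))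
        (cong₂ _*_ (cong ρ (δet-cong {f} {g} f≈g)) (field-aut-cong {f} {g} f≈g c)) }
    ; act-ε = λ { (_ , _ , c) → triple≡ refl refl (trans (cong (_* c) (trans (cong ρ δet-ε) ρ-1)) (*-identityˡ c)) }
    ; act-∙ = λ { f g (a , b , c) → triple≡ refl refl (begin
        ρ (δet (f Γ.∙ g)) * field-aut g (field-aut f c)
          ≡⟨ cong (_* field-aut g (field-aut f c)) (trans (cong ρ (δet-∙ f g)) (ρ-mult _ _)) ⟩
        ρ (δet g) * ρ (field-aut g (δet f)) * field-aut g (field-aut f c)
          ≡⟨ *-assoc _ _ _ ⟩
        ρ (δet g) * (ρ (field-aut g (δet f)) * field-aut g (field-aut f c))
          ≡⟨ cong (λ z → ρ (δet g) * (z * field-aut g (field-aut f c))) (ρ-aut (Semilinear.aut g) _) ⟨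
        ρ (δet g) * (field-aut g (ρ (δet f)) * field-aut g (field-aut f c))
          ≡⟨ cong (ρ (δet g) *_) (Semilinear.*-homo g _ _) ⟨
        ρ (δet g) * field-aut g (ρ (δet f) * field-aut f c) ∎) }
    }

  lift-⊞ : ∀ f x t → lift f (x ⊞ t) ≡ lift f x ⊞ lift f t
  lift-⊞ f (a , b , c) (u , v , w) = triple≡ (cong proj₁ (add _ _)) (cong proj₂ (add _ _))
    (trans (cong (ρ (δet f) *_) (+-homo c w)) (distribˡ _ _ _))
    where open Semilinear f

  lift-0 : ∀ f → lift f (0# , 0# , 0#) ≡ (0# , 0# , 0#)
  lift-0 f = triple≡ (cong proj₁ zero-fixed) (cong proj₂ zero-fixed) (trans (cong (ρ (δet f) *_) 0#-homo) (zeroʳ _))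
    where open Semilinear f

  -- G₁, as the set of maps x ↦ lift f x + t.
  factorisation₁ : Factorisation (Sym Ω) K₁ (Subgroup.group ΓL₂)
  factorisation₁ = record
    { i = Acts.perm translations
    ; j = Acts.perm lifts
    ; _◃_ = λ t f → lift f t
    ; i-cong = λ e → Acts.act-cong translations e
    ; i-homo = λ k l → Acts.act-∙ translations k l
    ; i-injective = λ e → let p , q = ,≡ (e (0# , 0# , 0#)) ; q , r = ,≡ q in cancel p , cancel q , cancel r
    ; j-cong = λ {f} {g} e → Acts.act-cong lifts {f} {g} e
    ; j-homo = λ f g → Acts.act-∙ lifts f g
    ; twist = λ t f x → lift-⊞ f x t
    ; disjoint = λ f t e → λ { (a , b) →
        let ez = trans (sym (lift-0 f)) (e (0# , 0# , 0#)) ; p , q = ,≡ ez ; q , r = ,≡ q ; p′ , q′ = ,≡ (e (a , b , 0#)) ; q′ , r′ = ,≡ q′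
        in cong₂ _,_ (trans p′ (trans (cong (a +_) (drop p)) (+-identityʳ a))) (trans q′ (trans (cong (b +_) (drop q)) (+-identityʳ b))) }
    }
    where
    cancel : ∀ {x y} → 0# + x ≡ 0# + y → x ≡ y
    cancel e = trans (sym (+-identityˡ _)) (trans e (+-identityˡ _))
    drop : ∀ {x} → 0# ≡ 0# + x → x ≡ 0#
    drop e = trans (sym (+-identityˡ _)) (sym e)

  UT : Subgroup (Sym F²)
  UT = record
    { Member = λ f → Σ (f ∈ Subgroup.Member ΓL₂) λ _ → proj₂ (to f e₁) ≡ 0#
    ; resp = λ { {f} {g} f≈g (f∈ , e) → Subgroup.resp ΓL₂ {f} {g} f≈g f∈ , trans (cong proj₂ (sym (f≈g e₁))) e }
    ; ε∈ = Subgroup.ε∈ ΓL₂ , refl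
    ; ∙∈ = λ { {f} {g} (f∈ , e) (g∈ , e′) → Subgroup.∙∈ ΓL₂ {f} {g} f∈ g∈ , (begin
        proj₂ (to g (to f e₁))          ≡⟨ cong (λ z → proj₂ (to g (proj₁ (to f e₁) , z))) e ⟩
        proj₂ (to g (proj₁ (to f e₁) , 0#)) ≡⟨ line (g , g∈) e′ _ ⟩
        0#                              ∎) }
    ; ⁻¹∈ = λ { {f} (f∈ , e) → Subgroup.⁻¹∈ ΓL₂ {f} f∈ , back (f , f∈) e }
    }
    where
    line : ∀ f → Semilinear.p′ f ≡ 0# → ∀ x → proj₂ (fun f (x , 0#)) ≡ 0#
    line f e x = trans (cong proj₂ (formula x 0#)) (trans (cong₂ (λ y z → y * θ x + s′ * z) e 0#-homo)
      (solve 2 (λ t s → con 0₃ :* t :+ s :* con 0₃ := con 0₃) refl (θ x) s′))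
      where open Semilinear f

    back : ∀ f → Semilinear.p′ f ≡ 0# → proj₂ (fun (f Γ.⁻¹) e₁) ≡ 0#
    back f e = injective (trans (*-zero s′≢0 (begin
      s′ * θ y                   ≡⟨ solve 2 (λ t s → s := con 0₃ :* t :+ s) refl (θ x) (s′ * θ y) ⟩
      0# * θ x + s′ * θ y        ≡⟨ cong (λ z → z * θ x + s′ * θ y) e ⟨
      p′ * θ x + s′ * θ y        ≡⟨ cong proj₂ (formula x y) ⟨
      proj₂ (fun f (fun (f Γ.⁻¹) e₁)) ≡⟨ cong proj₂ (strictlyInverseˡ (proj₁ f) e₁) ⟩
      0#                         ∎)) (sym 0#-homo))
      where
      open Semilinear f
      x = proj₁ (fun (f Γ.⁻¹) e₁)
      y = proj₂ (fun (f Γ.⁻¹) e₁)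
      s′≢0 : s′ ≢ 0#
      s′≢0 z = δet≢0 f (trans (cong₂ (λ u v → p * u - s * v) z e) (solve 2 (λ p s → p :* con 0₃ :- s :* con 0₃ := con 0₃) refl p s))

  module UT = Group (Subgroup.group UT)

  UT⇒Γ : UT.Carrier → Γ.Carrier
  UT⇒Γ (f , f∈ , _) = f , f∈

  -- The image of a triangular map under G₂ → Sym Ω, in terms of the cube roots
  -- L, M, S of its entries l, m, s.
  module Triangular (f : UT.Carrier) where
    open Semilinear (UT⇒Γ f) public
    lower≡0 : p′ ≡ 0#
    lower≡0 = proj₂ (proj₂ f)
    L M S : F
    L = root p
    M = root s′
    S = root s
    L³ : L ^ 3 ≡ p
    L³ = root-cubed p
    M³ : M ^ 3 ≡ s′
    M³ = root-cubed s′
    S³ : S ^ 3 ≡ s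
    S³ = root-cubed s

    diagonal : δet (UT⇒Γ f) ≡ p * s′
    diagonal = trans (cong (λ z → p * s′ - s * z) lower≡0) (solve 2 (λ x s → x :- s :* con 0₃ := x) refl (p * s′) s)

    p≢0 : p ≢ 0#
    p≢0 = factorˡ≢0 (λ e → δet≢0 (UT⇒Γ f) (trans diagonal e))

    s′≢0 : s′ ≢ 0#
    s′≢0 = factorʳ≢0 (λ e → δet≢0 (UT⇒Γ f) (trans diagonal e))

    formula′ : ∀ x y → fun (UT⇒Γ f) (x , y) ≡ (p * θ x + s * θ y , s′ * θ y)
    formula′ x y = trans (formula x y) (cong (p * θ x + s * θ y ,_) (trans (cong (λ z → z * θ x + s′ * θ y) lower≡0)
      (solve 2 (λ t u → con 0₃ :* t :+ u := u) refl (θ x) (s′ * θ y))))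

  twisted : F → F → F → Ω → Ω
  twisted L M S (a , b , c) =
    L ^ 3 * M ^ 3 * a + S ^ 3 * M ^ 3 * b ^ 2 + S * L ^ 2 * M ^ 3 * c , M ^ 3 * b , L ^ 2 * M ^ 4 * c

  twist : UT.Carrier → Ω → Ω
  twist f (a , b , c) = twisted L M S (θ a , θ b , θ c)
    where open Triangular f

  twists : Acts (Subgroup.group UT) Ω
  twists = record
    { act = twist
    ; act-cong = λ { {f} {g} f≈g (a , b , c) → trans
        (cong (twisted (Triangular.L f) (Triangular.M f) (Triangular.S f)) (triple≡ (θ-cong {f} {g} f≈g a) (θ-cong {f} {g} f≈g b) (θ-cong {f} {g} f≈g c)))
        (cong₃ (λ L M S → twisted L M S _) (cong (root ∘ proj₁) (f≈g e₁)) (cong (root ∘ proj₂) (f≈g e₂)) (cong (root ∘ proj₁) (f≈g e₂))) }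
    ; act-ε = λ { (a , b , c) → trans (cong₃ (λ L M S → twisted L M S (a , b , c)) (R.1#-homo) (R.1#-homo) (R.0#-homo))
        (triple≡
          (solve 3 (λ a b c → con 1₃ :^ 3 :* con 1₃ :^ 3 :* a :+ con 0₃ :^ 3 :* con 1₃ :^ 3 :* b :^ 2 :+ con 0₃ :* con 1₃ :^ 2 :* con 1₃ :^ 3 :* c := a) refl a b c)
          (solve 1 (λ b → con 1₃ :^ 3 :* b := b) refl b)
          (solve 1 (λ c → con 1₃ :^ 2 :* con 1₃ :^ 4 :* c := c) refl c)) }
    ; act-∙ = λ { f g (a , b , c) → compose f g a b c }
    }
    where
    module R = Aut (frob-aut r′)
    cong₃ : ∀ {B : Set} (h : F → F → F → B) {x x′ y y′ z z′} → x ≡ x′ → y ≡ y′ → z ≡ z′ → h x y z ≡ h x′ y′ z′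
    cong₃ h refl refl refl = refl

    θ-cong : ∀ {f g : UT.Carrier} → f UT.≈ g → ∀ x → field-aut (UT⇒Γ f) x ≡ field-aut (UT⇒Γ g) x
    θ-cong {f} {g} = field-aut-cong {UT⇒Γ f} {UT⇒Γ g}

    compose : ∀ f g a b c → twist (f UT.∙ g) (a , b , c) ≡ twist g (twist f (a , b , c))
    compose f g a b c = begin
      twisted (root (proj₁ (fun g′ (fun f′ e₁)))) (root (proj₂ (fun g′ (fun f′ e₂)))) (root (proj₁ (fun g′ (fun f′ e₂)))) x
        ≡⟨ cong₃ (λ L M S → twisted L M S x) L″ M″ S″ ⟩
      twisted (G.L * Lᵍ) (G.M * Mᵍ) (G.L * Sᵍ + G.S * Mᵍ) x
        ≡⟨ triple≡
          (solve 9 (λ L M S L′ M′ S′ a b c →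
            (L :* L′) :^ 3 :* (M :* M′) :^ 3 :* a :+ (L :* S′ :+ S :* M′) :^ 3 :* (M :* M′) :^ 3 :* b :^ 2
              :+ (L :* S′ :+ S :* M′) :* (L :* L′) :^ 2 :* (M :* M′) :^ 3 :* c :=
            L :^ 3 :* M :^ 3 :* (L′ :^ 3 :* M′ :^ 3 :* a :+ S′ :^ 3 :* M′ :^ 3 :* b :^ 2 :+ S′ :* L′ :^ 2 :* M′ :^ 3 :* c)
              :+ S :^ 3 :* M :^ 3 :* (M′ :^ 3 :* b) :^ 2 :+ S :* L :^ 2 :* M :^ 3 :* (L′ :^ 2 :* M′ :^ 4 :* c))
            refl G.L G.M G.S Lᵍ Mᵍ Sᵍ (G.θ (F.θ a)) (G.θ (F.θ b)) (G.θ (F.θ c)))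
          (solve 3 (λ M M′ b → (M :* M′) :^ 3 :* b := M :^ 3 :* (M′ :^ 3 :* b)) refl G.M Mᵍ (G.θ (F.θ b)))
          (solve 5 (λ L M L′ M′ c → (L :* L′) :^ 2 :* (M :* M′) :^ 4 :* c := L :^ 2 :* M :^ 4 :* (L′ :^ 2 :* M′ :^ 4 :* c))
            refl G.L G.M Lᵍ Mᵍ (G.θ (F.θ c))) ⟩
      twisted G.L G.M G.S (twisted Lᵍ Mᵍ Sᵍ x)
        ≡⟨ cong (twisted G.L G.M G.S) (triple≡ first (G*^ F.M 3 (F.θ b)) third) ⟨
      twisted G.L G.M G.S (G.θ (proj₁ y) , G.θ (proj₁ (proj₂ y)) , G.θ (proj₂ (proj₂ y))) ∎
      where
      module F = Triangular f
      module G = Triangular g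
      f′ = UT⇒Γ f
      g′ = UT⇒Γ g
      x = G.θ (F.θ a) , G.θ (F.θ b) , G.θ (F.θ c)
      y = twist f (a , b , c)
      Lᵍ = G.θ F.L
      Mᵍ = G.θ F.M
      Sᵍ = G.θ F.S

      root-θ : ∀ z → root (G.θ z) ≡ G.θ (root z)
      root-θ z = sym (G.frob-homo r′ z)

      L″ : root (proj₁ (fun g′ (fun f′ e₁))) ≡ G.L * Lᵍ
      L″ = begin
        root (proj₁ (fun g′ (F.p , F.p′)))    ≡⟨ cong (root ∘ proj₁) (G.formula′ F.p F.p′) ⟩
        root (G.p * G.θ F.p + G.s * G.θ F.p′) ≡⟨ cong (λ z → root (G.p * G.θ F.p + G.s * z)) (trans (cong G.θ F.lower≡0) G.0#-homo) ⟩
        root (G.p * G.θ F.p + G.s * 0#)       ≡⟨ cong root (solve 2 (λ x s → x :+ s :* con 0₃ := x) refl (G.p * G.θ F.p) G.s) ⟩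
        root (G.p * G.θ F.p)                  ≡⟨ trans (root-mult _ _) (cong (G.L *_) (root-θ F.p)) ⟩
        G.L * Lᵍ                              ∎

      M″ : root (proj₂ (fun g′ (fun f′ e₂))) ≡ G.M * Mᵍ
      M″ = trans (cong (root ∘ proj₂) (G.formula′ F.s F.s′)) (trans (root-mult _ _) (cong (G.M *_) (root-θ F.s′)))

      S″ : root (proj₁ (fun g′ (fun f′ e₂))) ≡ G.L * Sᵍ + G.S * Mᵍ
      S″ = trans (cong (root ∘ proj₁) (G.formula′ F.s F.s′)) (trans (frob-add r′ _ _)
        (cong₂ _+_ (trans (root-mult _ _) (cong (G.L *_) (root-θ F.s))) (trans (root-mult _ _) (cong (G.S *_) (root-θ F.s′)))))

      G*^ : ∀ k n z → G.θ (k ^ n * z) ≡ G.θ k ^ n * G.θ z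
      G*^ k n z = trans (G.*-homo _ _) (cong (_* G.θ z) (G.^-homo k n))

      G*^^ : ∀ k m l n z → G.θ (k ^ m * l ^ n * z) ≡ G.θ k ^ m * G.θ l ^ n * G.θ z
      G*^^ k m l n z = trans (G.*-homo _ _) (cong (_* G.θ z) (trans (G*^ k m (l ^ n)) (cong (G.θ k ^ m *_) (G.^-homo l n))))

      first : G.θ (proj₁ y) ≡ proj₁ (twisted Lᵍ Mᵍ Sᵍ x)
      first = trans (G.+-homo _ _) (cong₂ _+_ (trans (G.+-homo _ _) (cong₂ _+_ (G*^^ F.L 3 F.M 3 (F.θ a))
          (trans (G*^^ F.S 3 F.M 3 (F.θ b ^ 2)) (cong (Sᵍ ^ 3 * Mᵍ ^ 3 *_) (G.^-homo (F.θ b) 2)))))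
        (trans (G.*-homo _ _) (cong (_* G.θ (F.θ c)) (trans (G.*-homo _ _) (cong₂ _*_
          (trans (G.*-homo _ _) (cong (Sᵍ *_) (G.^-homo F.L 2))) (G.^-homo F.M 3))))))

      third : G.θ (proj₂ (proj₂ y)) ≡ proj₂ (proj₂ (twisted Lᵍ Mᵍ Sᵍ x))
      third = G*^^ F.L 2 F.M 4 (F.θ c)

module Stabilisers (r′ : ℕ) (𝔽 : FiniteField (3 ℕ.^ ℕ.suc r′)) where
  open FieldTheory r′ 𝔽
  open Permutations r′ 𝔽
  open Construction 𝔽 using (Ω)
  open ≡.≡-Reasoning

  shear : GroupAction (Direct.group +-group +-group) +-group
  shear = record
    { _◃_ = λ { (x , y) e → x + e * y , y }
    ; ◃-cong = λ { (refl , refl) refl → refl , refl }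
    ; ◃-homo = λ { (x , y) (x′ , y′) e → solve 5 (λ x y x′ y′ e → x :+ x′ :+ e :* (y :+ y′) := x :+ e :* y :+ (x′ :+ e :* y′)) refl x y x′ y′ e , refl }
    ; ◃-ε = λ { (x , y) → solve 2 (λ x y → x :+ con 0₃ :* y := x) refl x y , refl }
    ; ◃-∙ = λ { (x , y) d e → solve 4 (λ x y d e → x :+ (d :+ e) :* y := x :+ d :* y :+ e :* y) refl x y d e , refl }
    }

  U K₂ : Group 0ℓ 0ℓ
  U = Direct.group +-group +-group ⋊ +-group [ shear ]
  K₂ = Direct.group +-group U

  unipotent : Group.Carrier K₂ → Ω → Ω
  unipotent (n , e , x , y) (a , b , c) = a + e * b + x , b + y , c + n

  unipotents : Acts K₂ Ω
  unipotents = record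
    { act = unipotent
    ; act-cong = λ { (refl , refl , refl , refl) _ → refl }
    ; act-ε = λ { (a , b , c) → triple≡ (solve 2 (λ a b → a :+ con 0₃ :* b :+ con 0₃ := a) refl a b) (+-identityʳ b) (+-identityʳ c) }
    ; act-∙ = λ { (n , e , x , y) (n′ , e′ , x′ , y′) (a , b , c) → triple≡
        (solve 7 (λ a b e x y e′ x′ → a :+ (e :+ e′) :* b :+ (x :+ e′ :* y :+ x′) := a :+ e :* b :+ x :+ e′ :* (b :+ y) :+ x′) refl a b e x y e′ x′)
        (sym (+-assoc b y y′)) (sym (+-assoc c n n′)) }
    }

  conjugate : Group.Carrier K₂ → UT.Carrier → Group.Carrier K₂
  conjugate (n , e , x , y) f =
    let x′ , y′ , n′ = twist f (x , y , n) in n′ , L ^ 3 * θ e - S ^ 3 * θ y , x′ , y′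
    where open Triangular f

  private
    0Ω : Ω
    0Ω = 0# , 0# , 0#

    unipotent-0 : ∀ n e x y → unipotent (n , e , x , y) 0Ω ≡ (x , y , n)
    unipotent-0 n e x y = triple≡ (solve 2 (λ e x → con 0₃ :+ e :* con 0₃ :+ x := x) refl e x) (+-identityˡ y) (+-identityˡ n)

    twist-0 : ∀ f → twist f 0Ω ≡ 0Ω
    twist-0 f = trans (cong (twisted L M S) (triple≡ 0#-homo 0#-homo 0#-homo)) (triple≡
      (solve 3 (λ L M S → L :^ 3 :* M :^ 3 :* con 0₃ :+ S :^ 3 :* M :^ 3 :* con 0₃ :^ 2 :+ S :* L :^ 2 :* M :^ 3 :* con 0₃ := con 0₃) refl L M S)
      (zeroʳ _) (zeroʳ _))
      where open Triangular f

    twist-unipotent : ∀ k f x → twist f (unipotent k x) ≡ unipotent (conjugate k f) (twist f x)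
    twist-unipotent (n , e , x , y) f (a , b , c) = trans
      (cong (twisted L M S) (triple≡ (trans (+-homo _ _) (cong (_+ θ x) (trans (+-homo _ _) (cong (θ a +_) (*-homo e b))))) (+-homo b y) (+-homo c n)))
      (triple≡
        (solve 10 (λ L M S a b c e x y n →
          L :^ 3 :* M :^ 3 :* (a :+ e :* b :+ x) :+ S :^ 3 :* M :^ 3 :* (b :+ y) :^ 2 :+ S :* L :^ 2 :* M :^ 3 :* (c :+ n) :=
          L :^ 3 :* M :^ 3 :* a :+ S :^ 3 :* M :^ 3 :* b :^ 2 :+ S :* L :^ 2 :* M :^ 3 :* c :+ (L :^ 3 :* e :- S :^ 3 :* y) :* (M :^ 3 :* b)
            :+ (L :^ 3 :* M :^ 3 :* x :+ S :^ 3 :* M :^ 3 :* y :^ 2 :+ S :* L :^ 2 :* M :^ 3 :* n))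
          refl L M S (θ a) (θ b) (θ c) (θ e) (θ x) (θ y) (θ n))
        (distribˡ _ _ _) (distribˡ _ _ _))
      where open Triangular f

    twist-disjoint : ∀ f k → (∀ x → twist f x ≡ unipotent k x) → f UT.≈ UT.ε
    twist-disjoint f (n , e , x , y) eq (a , b) = trans (formula′ a b) (cong₂ _,_
        (begin
          p * θ a + s * θ b   ≡⟨ cong₂ (λ u v → u * θ a + v * θ b) p≡1 s≡0 ⟩
          1# * θ a + 0# * θ b ≡⟨ solve 2 (λ a b → con 1₃ :* a :+ con 0₃ :* b := a) refl (θ a) (θ b) ⟩
          θ a                 ≡⟨ θ≡id a ⟩
          a                   ∎)
        (second b))
      where
      open Triangular f
      origin : (0# , 0# , 0#) ≡ (x , y , n)
      origin = trans (sym (twist-0 f)) (trans (eq 0Ω) (unipotent-0 n e x y))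
      x≡0 : x ≡ 0#
      x≡0 = sym (proj₁ (,≡ origin))
      y≡0 : y ≡ 0#
      y≡0 = sym (proj₁ (,≡ (proj₂ (,≡ origin))))

      second : ∀ b → s′ * θ b ≡ b
      second b = trans (cong (_* θ b) (sym M³)) (trans (proj₁ (,≡ (proj₂ (,≡ (eq (0# , b , 0#)))))) (trans (cong (b +_) y≡0) (+-identityʳ b)))
      s′≡1 : s′ ≡ 1#
      s′≡1 = trans (sym (*-identityʳ s′)) (trans (cong (s′ *_) (sym 1#-homo)) (second 1#))
      θ≡id : ∀ b → θ b ≡ b
      θ≡id b = trans (sym (*-identityˡ _)) (trans (cong (_* θ b) (sym s′≡1)) (second b))

      first : ∀ a b → L ^ 3 * a + S ^ 3 * b ^ 2 ≡ a + e * b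
      first a b = begin
        L ^ 3 * a + S ^ 3 * b ^ 2
          ≡⟨ solve 5 (λ L S a b z → L :* a :+ S :* b :^ 2 := L :* con 1₃ :* a :+ S :* con 1₃ :* b :^ 2 :+ z :* con 0₃) refl (L ^ 3) (S ^ 3) a b (S * L ^ 2 * M ^ 3) ⟩
        L ^ 3 * 1# * a + S ^ 3 * 1# * b ^ 2 + S * L ^ 2 * M ^ 3 * 0#
          ≡⟨ cong (λ m → L ^ 3 * m * a + S ^ 3 * m * b ^ 2 + S * L ^ 2 * M ^ 3 * 0#) (trans M³ s′≡1) ⟨
        L ^ 3 * M ^ 3 * a + S ^ 3 * M ^ 3 * b ^ 2 + S * L ^ 2 * M ^ 3 * 0#
          ≡⟨ cong proj₁ (cong (twisted L M S) (triple≡ (θ≡id a) (θ≡id b) (0#-homo))) ⟨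
        proj₁ (twist f (a , b , 0#))
          ≡⟨ cong proj₁ (eq (a , b , 0#)) ⟩
        a + e * b + x
          ≡⟨ trans (cong (a + e * b +_) x≡0) (+-identityʳ _) ⟩
        a + e * b ∎

      p≡1 : p ≡ 1#
      p≡1 = trans (sym L³) (trans (solve 2 (λ l s → l := l :* con 1₃ :+ s :* con 0₃ :^ 2) refl (L ^ 3) (S ^ 3)) (trans (first 1# 0#) (solve 1 (λ e → con 1₃ :+ e :* con 0₃ := con 1₃) refl e)))

      -- The coefficient of b² is read off from the values at b = 1 and b = -1.
      s≡0 : s ≡ 0#
      s≡0 = trans (sym S³) (begin
        S ^ 3 ≡⟨ solve 2 (λ l s → s := :- (l :* con 0₃ :+ s :* con 1₃ :^ 2) :+ (:- (l :* con 0₃ :+ s :* con 2₃ :^ 2))) refl (L ^ 3) (S ^ 3) ⟩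
        - (L ^ 3 * 0# + S ^ 3 * 1# ^ 2) + - (L ^ 3 * 0# + S ^ 3 * (- 1#) ^ 2) ≡⟨ cong₂ (λ u v → - u + - v) (first 0# 1#) (first 0# (- 1#)) ⟩
        - (0# + e * 1#) + - (0# + e * - 1#) ≡⟨ solve 1 (λ e → :- (con 0₃ :+ e :* con 1₃) :+ (:- (con 0₃ :+ e :* con 2₃)) := con 0₃) refl e ⟩
        0# ∎)

  -- G₂, as the set of products of a twisted triangular map and an element of Q.
  factorisation₂ : Factorisation (Sym Ω) K₂ (Subgroup.group UT)
  factorisation₂ = record
    { i = Acts.perm unipotents
    ; j = Acts.perm twists
    ; _◃_ = conjugate
    ; i-cong = λ e → Acts.act-cong unipotents e
    ; i-homo = λ k l → Acts.act-∙ unipotents k l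
    ; i-injective = λ { {n , e , x , y} {n′ , e′ , x′ , y′} eq →
        let p , z = ,≡ (trans (sym (unipotent-0 n e x y)) (trans (eq 0Ω) (unipotent-0 n′ e′ x′ y′)))
            q , w = ,≡ z
            t = proj₁ (,≡ (eq (0# , 1# , 0#)))
        in w , shears p t , p , q }
    ; j-cong = λ {f} {g} e → Acts.act-cong twists {f} {g} e
    ; j-homo = λ f g → Acts.act-∙ twists f g
    ; twist = λ k f x → twist-unipotent k f x
    ; disjoint = twist-disjoint
    }
    where
    shears : ∀ {e e′ x x′} → x ≡ x′ → 0# + e * 1# + x ≡ 0# + e′ * 1# + x′ → e ≡ e′
    shears {e} {e′} {x} refl t = modulo 1# t (solve 3 (λ e e′ x → e := e′ :+ con 1₃ :* (con 0₃ :+ e :* con 1₃ :+ x :- (con 0₃ :+ e′ :* con 1₃ :+ x))) refl e e′ x)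

  module F₁ = Factorisation factorisation₁
  module F₂ = Factorisation factorisation₂

  matrix : ∀ {θ} → IsAut θ → ∀ a b c d → a * d - b * c ≢ 0# → Γ.Carrier
  matrix {θ} aut a b c d Δ≢0 = mk↔ₛ′ forward backward forward-backward backward-forward , θ , aut , additive , scales
    where
    open Aut aut
    k = proj₁ (recip Δ≢0)
    kΔ≡1 = proj₂ (recip Δ≢0)
    forward backward : F² → F²
    forward (x , y) = a * θ x + b * θ y , c * θ x + d * θ y
    backward (x , y) = inverse (k * (d * x - b * y)) , inverse (k * (a * y - c * x))
    abstract
      forward-backward : ∀ v → forward (backward v) ≡ v
      forward-backward (x , y) = cong₂ _,_
        (trans (cong₂ (λ s t → a * s + b * t) (inverseʳ _) (inverseʳ _)) (modulo x kΔ≡1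
          (solve 7 (λ a b c d k x y → a :* (k :* (d :* x :- b :* y)) :+ b :* (k :* (a :* y :- c :* x)) := x :+ x :* (k :* (a :* d :- b :* c) :- con 1₃)) refl a b c d k x y)))
        (trans (cong₂ (λ s t → c * s + d * t) (inverseʳ _) (inverseʳ _)) (modulo y kΔ≡1
          (solve 7 (λ a b c d k x y → c :* (k :* (d :* x :- b :* y)) :+ d :* (k :* (a :* y :- c :* x)) := y :+ y :* (k :* (a :* d :- b :* c) :- con 1₃)) refl a b c d k x y)))
      backward-forward : ∀ v → backward (forward v) ≡ v
      backward-forward (x , y) = cong₂ _,_
        (injective (trans (inverseʳ _) (modulo (θ x) kΔ≡1
          (solve 7 (λ a b c d k x y → k :* (d :* (a :* x :+ b :* y) :- b :* (c :* x :+ d :* y)) := x :+ x :* (k :* (a :* d :- b :* c) :- con 1₃)) refl a b c d k (θ x) (θ y)))))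
        (injective (trans (inverseʳ _) (modulo (θ y) kΔ≡1
          (solve 7 (λ a b c d k x y → k :* (a :* (c :* x :+ d :* y) :- c :* (a :* x :+ b :* y)) := y :+ y :* (k :* (a :* d :- b :* c) :- con 1₃)) refl a b c d k (θ x) (θ y)))))
      additive : ∀ u v → forward (u ⊕ v) ≡ forward u ⊕ forward v
      additive (x , y) (x′ , y′) = cong₂ _,_ (row a b) (row c d)
        where
        row : ∀ a b → a * θ (x + x′) + b * θ (y + y′) ≡ a * θ x + b * θ y + (a * θ x′ + b * θ y′)
        row a b = trans (cong₂ (λ s t → a * s + b * t) (+-homo x x′) (+-homo y y′))
          (solve 6 (λ a b x y x′ y′ → a :* (x :+ x′) :+ b :* (y :+ y′) := a :* x :+ b :* y :+ (a :* x′ :+ b :* y′)) refl a b (θ x) (θ y) (θ x′) (θ y′))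
      scales : ∀ l v → forward (l • v) ≡ θ l • forward v
      scales l (x , y) = cong₂ _,_ (row a b) (row c d)
        where
        row : ∀ a b → a * θ (l * x) + b * θ (l * y) ≡ θ l * (a * θ x + b * θ y)
        row a b = trans (cong₂ (λ s t → a * s + b * t) (*-homo l x) (*-homo l y))
          (solve 5 (λ a b x y l → a :* (l :* x) :+ b :* (l :* y) := l :* (a :* x :+ b :* y)) refl a b (θ x) (θ y) (θ l))

  module _ {θ : F → F} (aut : IsAut θ) (a b c d : F) (Δ≢0 : a * d - b * c ≢ 0#) where
    private
      m = matrix aut a b c d Δ≢0

    matrix-e₁ : fun m e₁ ≡ (a , c)
    matrix-e₁ = cong₂ _,_ (entry a b) (entry c d)
      where
      entry : ∀ a b → a * θ 1# + b * θ 0# ≡ a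
      entry a b = trans (cong₂ (λ s t → a * s + b * t) (Aut.1#-homo aut) (Aut.0#-homo aut)) (solve 2 (λ a b → a :* con 1₃ :+ b :* con 0₃ := a) refl a b)

    matrix-e₂ : fun m e₂ ≡ (b , d)
    matrix-e₂ = cong₂ _,_ (entry a b) (entry c d)
      where
      entry : ∀ a b → a * θ 0# + b * θ 1# ≡ b
      entry a b = trans (cong₂ (λ s t → a * s + b * t) (Aut.0#-homo aut) (Aut.1#-homo aut)) (solve 2 (λ a b → a :* con 0₃ :+ b :* con 1₃ := b) refl a b)

    lift-matrix : ∀ x y z → lift m (x , y , z) ≡ (a * θ x + b * θ y , c * θ x + d * θ y , ρ (a * d - b * c) * θ z)
    lift-matrix x y z = triple≡ refl refl (cong (λ t → ρ t * θ z) (cong₂ det matrix-e₁ matrix-e₂))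

  triangular-det : ∀ l s m → l * m ≢ 0# → l * m - s * 0# ≢ 0#
  triangular-det l s m lm≢0 e = lm≢0 (trans (solve 3 (λ l s m → l :* m := l :* m :- s :* con 0₃) refl l s m) e)

  triangular : ∀ {θ} → IsAut θ → ∀ l s m → l * m ≢ 0# → UT.Carrier
  triangular aut l s m lm≢0 = proj₁ f , proj₂ f , cong proj₂ (matrix-e₁ aut l s 0# m (triangular-det l s m lm≢0))
    where
    f = matrix aut l s 0# m (triangular-det l s m lm≢0)

  ρ-lm² : ∀ l m → ρ (l * m ^ 2) ≡ root l ^ 2 * root m ^ 4
  ρ-lm² l m = trans (cong (_^ 2) (trans (root-mult l (m ^ 2)) (cong (root l *_) (Aut.^-homo (frob-aut r′) m 2))))
    (solve 2 (λ L M → (L :* M :^ 2) :^ 2 := L :^ 2 :* M :^ 4) refl (root l) (root m))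

  twist-triangular : ∀ {θ} (aut : IsAut θ) l s m (lm≢0 : l * m ≢ 0#) a b c → twist (triangular aut l s m lm≢0) (a , b , c) ≡
    (l * m * θ a + s * m * θ b ^ 2 + root s * root l ^ 2 * m * θ c , m * θ b , ρ (l * m ^ 2) * θ c)
  twist-triangular {θ} aut l s m lm≢0 a b c = begin
    twist (triangular aut l s m lm≢0) (a , b , c)
      ≡⟨ cong₂ (λ u v → twisted (root (proj₁ u)) (root (proj₂ v)) (root (proj₁ v)) (θ a , θ b , θ c)) (matrix-e₁ aut l s 0# m (triangular-det l s m lm≢0)) (matrix-e₂ aut l s 0# m (triangular-det l s m lm≢0)) ⟩
    twisted (root l) (root m) (root s) (θ a , θ b , θ c)
      ≡⟨ triple≡ (cong₂ _+_ (cong₂ _+_ (cong₂ (λ u v → u * v * θ a) (root-cubed l) (root-cubed m)) (cong₂ (λ u v → u * v * θ b ^ 2) (root-cubed s) (root-cubed m)))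
             (cong (λ v → root s * root l ^ 2 * v * θ c) (root-cubed m))) (cong (_* θ b) (root-cubed m)) (cong (_* θ c) (sym (ρ-lm² l m))) ⟩
    _ ∎

module Products (r′ : ℕ) (𝔽 : FiniteField (3 ℕ.^ ℕ.suc r′)) where
  open FieldTheory r′ 𝔽
  open Automorphisms r′ 𝔽 using (aut⇒frob)
  open Permutations r′ 𝔽
  open Stabilisers r′ 𝔽
  open Construction 𝔽 using (Ω; Perm; α; β; γ; δ; τ; σ; A; S; T; E; Φ; M; Q; G₁; G₂)
  open Subsets (Sym Ω) using (⟨_⟩; gen; unit; mul; _⊙_) renaming (resp to ⟨resp⟩)
  open ≡.≡-Reasoning
  open Inverse using (to)
  private module P = Group (Sym Ω)

  private
    𝒢₁ 𝒢₂ : Pred Perm 0ℓ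
    𝒢₁ = Subgroup.Member F₁.image
    𝒢₂ = Subgroup.Member F₂.image

    ⊙⊆ : ∀ {X Y : Pred Perm 0ℓ} (H : Subgroup (Sym Ω)) → (∀ g → X g → g ∈ Subgroup.Member H) → (∀ g → Y g → g ∈ Subgroup.Member H) →
         ∀ g → (X ⊙ Y) g → g ∈ Subgroup.Member H
    ⊙⊆ H X⊆ Y⊆ g (x , y , x∈ , y∈ , e) = Subgroup.resp H {x P.∙ y} {g} (λ z → sym (e z)) (Subgroup.∙∈ H {x} {y} (X⊆ x x∈) (Y⊆ y y∈))


  one-nonzero : 1# * 1# ≢ 0#
  one-nonzero e = 1≢0 (trans (sym (*-identityˡ 1#)) e)

  γΓ : F → Γ.Carrier
  γΓ e = matrix aut-id 1# e 0# 1# (triangular-det 1# e 1# one-nonzero)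

  private
    δ-det : 0# * 0# - 1# * - 1# ≢ 0#
    δ-det e = 1≢0 (trans (solve 0 (con 1₃ := con 0₃ :* con 0₃ :- con 1₃ :* con 2₃) refl) e)

  δΓ : Γ.Carrier
  δΓ = matrix aut-id 0# 1# (- 1#) 0# δ-det

  diagonalΓ : ∀ l m → l * m ≢ 0# → Γ.Carrier
  diagonalΓ l m lm≢0 = matrix aut-id l 0# 0# m (triangular-det l 0# m lm≢0)

  frobeniusΓ : ℕ → Γ.Carrier
  frobeniusΓ i = matrix (frob-aut i) 1# 0# 0# 1# (triangular-det 1# 0# 1# one-nonzero)

  lift-γ : ∀ e a b c → lift (γΓ e) (a , b , c) ≡ (a + e * b , b , c)
  lift-γ e a b c = trans (lift-matrix aut-id 1# e 0# 1# (triangular-det 1# e 1# one-nonzero) a b c) (triple≡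
    (cong (_+ e * b) (*-identityˡ a)) (solve 2 (λ a b → con 0₃ :* a :+ con 1₃ :* b := b) refl a b)
    (trans (cong (λ z → ρ z * c) (solve 1 (λ e → con 1₃ :* con 1₃ :- e :* con 0₃ := con 1₃) refl e)) (trans (cong (_* c) ρ-1) (*-identityˡ c))))

  lift-δ : ∀ a b c → lift δΓ (a , b , c) ≡ (b , - a , c)
  lift-δ a b c = trans (lift-matrix aut-id 0# 1# (- 1#) 0# δ-det a b c) (triple≡
    (solve 2 (λ a b → con 0₃ :* a :+ con 1₃ :* b := b) refl a b) (solve 2 (λ a b → con 2₃ :* a :+ con 0₃ :* b := :- a) refl a b)
    (trans (cong (λ z → ρ z * c) (solve 0 (con 0₃ :* con 0₃ :- con 1₃ :* con 2₃ := con 1₃) refl)) (trans (cong (_* c) ρ-1) (*-identityˡ c))))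

  lift-diagonal : ∀ l m (lm≢0 : l * m ≢ 0#) a b c → lift (diagonalΓ l m lm≢0) (a , b , c) ≡ (l * a , m * b , ρ (l * m) * c)
  lift-diagonal l m lm≢0 a b c = trans (lift-matrix aut-id l 0# 0# m (triangular-det l 0# m lm≢0) a b c) (triple≡
    (solve 3 (λ l a b → l :* a :+ con 0₃ :* b := l :* a) refl l a b) (solve 3 (λ m a b → con 0₃ :* a :+ m :* b := m :* b) refl m a b)
    (cong (λ z → ρ z * c) (solve 2 (λ l m → l :* m :- con 0₃ :* con 0₃ := l :* m) refl l m)))

  lift-frobenius : ∀ i a b c → lift (frobeniusΓ i) (a , b , c) ≡ (frob i a , frob i b , frob i c)
  lift-frobenius i a b c = trans (lift-matrix (frob-aut i) 1# 0# 0# 1# (triangular-det 1# 0# 1# one-nonzero) a b c) (triple≡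
    (solve 2 (λ a b → con 1₃ :* a :+ con 0₃ :* b := a) refl (frob i a) (frob i b)) (solve 2 (λ a b → con 0₃ :* a :+ con 1₃ :* b := b) refl (frob i a) (frob i b))
    (trans (cong (λ z → ρ z * frob i c) (solve 0 (con 1₃ :* con 1₃ :- con 0₃ :* con 0₃ := con 1₃) refl)) (trans (cong (_* frob i c) ρ-1) (*-identityˡ _))))

  lift∈𝒢₁ : ∀ f {g} → (∀ x → to g x ≡ lift f x) → g ∈ 𝒢₁
  lift∈𝒢₁ f e = f , (0# , 0# , 0#) , λ x → trans (e x) (sym (Acts.act-ε translations (lift f x)))

  α⊆𝒢₁ : ∀ {u v w g} → g ∈ α u v w → g ∈ 𝒢₁
  α⊆𝒢₁ {u} {v} {w} e = Γ.ε , (u , v , w) , λ x → trans (e x) (cong (_⊞ (u , v , w)) (sym (Acts.act-ε lifts x)))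

  γ⊆𝒢₁ : ∀ {e g} → g ∈ γ e → g ∈ 𝒢₁
  γ⊆𝒢₁ {e} {g} g∈ = lift∈𝒢₁ (γΓ e) {g} λ { (a , b , c) → trans (g∈ _) (sym (lift-γ e a b c)) }

  δ⊆𝒢₁ : ∀ {g} → g ∈ δ → g ∈ 𝒢₁
  δ⊆𝒢₁ {g} g∈ = lift∈𝒢₁ δΓ {g} λ { (a , b , c) → trans (g∈ _) (sym (lift-δ a b c)) }

  β⊆𝒢₁ : ∀ {l m g} → l * m ≢ 0# → g ∈ β l m → g ∈ 𝒢₁
  β⊆𝒢₁ {l} {m} {g} lm≢0 g∈ = lift∈𝒢₁ (diagonalΓ l m lm≢0) {g} λ { (a , b , c) → trans (g∈ _)
    (trans (triple≡ refl refl (cong (_* c) (ρ-exponent (l * m)))) (sym (lift-diagonal l m lm≢0 a b c))) }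

  σ⊆𝒢₁ : ∀ {g} → g ∈ σ → g ∈ 𝒢₁
  σ⊆𝒢₁ {g} g∈ = lift∈𝒢₁ (frobeniusΓ 1) {g} λ { (a , b , c) → trans (g∈ _) (sym (lift-frobenius 1 a b c)) }

  cube-nonzero : ∀ {m} → m ≢ 0# → m ^ 2 * m ≢ 0#
  cube-nonzero m≢0 = *-nonzero (^-nonzero 2 m≢0) m≢0

  inverse-nonzero : ∀ {m m⁻¹} → m * m⁻¹ ≡ 1# → m * m⁻¹ ≢ 0#
  inverse-nonzero e z = 1≢0 (trans (sym e) z)

  G₁⊆𝒢₁ : G₁ ⊆ 𝒢₁
  G₁⊆𝒢₁ {g} = ⊙⊆ {A ⊙ M ⊙ S} {Φ} F₁.image (⊙⊆ {A ⊙ M} {S} F₁.image (⊙⊆ {A} {M} F₁.image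
    (λ _ → ⟨⟩-least F₁.image (λ { {g} (u , v , w , g∈) → α⊆𝒢₁ {u} {v} {w} {g} g∈ }))
    (λ _ → ⟨⟩-least F₁.image λ
      { (inj₁ C∈) → ⟨⟩-least F₁.image (λ { {g} (e , g∈) → γ⊆𝒢₁ {e} {g} g∈ }) C∈
      ; (inj₂ (inj₁ D∈)) → ⟨⟩-least F₁.image (λ {g} → δ⊆𝒢₁ {g}) D∈
      ; (inj₂ (inj₂ T∈)) → ⟨⟩-least F₁.image (λ { {g} (m , m⁻¹ , e , g∈) → β⊆𝒢₁ {m} {m⁻¹} {g} (inverse-nonzero e) g∈ }) T∈ }))
    (λ _ → ⟨⟩-least F₁.image (λ { {g} (m , m≢0 , g∈) → β⊆𝒢₁ {m ^ 2} {m} {g} (cube-nonzero m≢0) g∈ })))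
    (λ _ → ⟨⟩-least F₁.image (λ {g} → σ⊆𝒢₁ {g})) g

  private
    j-∙∈ : ∀ {X} f g → F₁.j f ∈ ⟨ X ⟩ → F₁.j g ∈ ⟨ X ⟩ → F₁.j (f Γ.∙ g) ∈ ⟨ X ⟩
    j-∙∈ f g f∈ g∈ = ⟨resp⟩ {x = F₁.j f P.∙ F₁.j g} {y = F₁.j (f Γ.∙ g)} (λ x → sym (F₁.j-homo f g x)) (mul {x = F₁.j f} {y = F₁.j g} f∈ g∈)

    j-≈∈ : ∀ {X} f g → f Γ.≈ g → F₁.j f ∈ ⟨ X ⟩ → F₁.j g ∈ ⟨ X ⟩
    j-≈∈ f g f≈g = ⟨resp⟩ {x = F₁.j f} {y = F₁.j g} (F₁.j-cong {f} {g} f≈g)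

    γ∈M : ∀ e → F₁.j (γΓ e) ∈ M
    γ∈M e = gen {x = F₁.j (γΓ e)} (inj₁ (gen {x = F₁.j (γΓ e)} (e , λ { (x , y , z) → lift-γ e x y z })))

    δ∈M : F₁.j δΓ ∈ M
    δ∈M = gen {x = F₁.j δΓ} (inj₂ (inj₁ (gen {x = F₁.j δΓ} λ { (x , y , z) → lift-δ x y z })))

    diagonal∈β : ∀ l m lm≢0 → F₁.j (diagonalΓ l m lm≢0) ∈ β l m
    diagonal∈β l m lm≢0 (x , y , z) = trans (lift-diagonal l m lm≢0 x y z) (triple≡ refl refl (cong (_* z) (sym (ρ-exponent (l * m)))))

    T∈M : ∀ l m (lm≡1 : l * m ≡ 1#) → F₁.j (diagonalΓ l m (inverse-nonzero lm≡1)) ∈ M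
    T∈M l m lm≡1 = gen {x = t} (inj₂ (inj₂ (gen {x = t} (l , m , lm≡1 , diagonal∈β l m (inverse-nonzero lm≡1)))))
      where t = F₁.j (diagonalΓ l m (inverse-nonzero lm≡1))

    frobenius∈Φ : ∀ i → F₁.j (frobeniusΓ i) ∈ Φ
    frobenius∈Φ ℕ.zero = ⟨resp⟩ {x = P.ε} {y = F₁.j (frobeniusΓ 0)} (λ { (a , b , c) → sym (lift-frobenius 0 a b c) }) unit
    frobenius∈Φ (ℕ.suc i) = ⟨resp⟩ {x = F₁.j (frobeniusΓ i) P.∙ F₁.j (frobeniusΓ 1)} {y = F₁.j (frobeniusΓ (ℕ.suc i))}
      (λ { (a , b , c) → trans (cong (lift (frobeniusΓ 1)) (lift-frobenius i a b c)) (trans (lift-frobenius 1 (frob i a) (frob i b) (frob i c)) (sym (lift-frobenius (ℕ.suc i) a b c))) })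
      (mul {x = F₁.j (frobeniusΓ i)} {y = F₁.j (frobeniusΓ 1)} (frobenius∈Φ i)
        (gen {x = F₁.j (frobeniusΓ 1)} λ { (a , b , c) → lift-frobenius 1 a b c }))

    special∈M : ∀ a b c d (e : a * d - b * c ≡ 1#) (≢0 : a * d - b * c ≢ 0#) → Dec (c ≡ 0#) → F₁.j (matrix aut-id a b c d ≢0) ∈ M
    special∈M a b c d e ≢0 (yes refl) = j-≈∈ (t Γ.∙ γΓ (a * b)) (matrix aut-id a b 0# d ≢0) product
        (j-∙∈ t (γΓ (a * b)) (T∈M a d ad≡1) (γ∈M (a * b)))
      where
      ad≡1 : a * d ≡ 1#
      ad≡1 = trans (solve 3 (λ a b d → a :* d := a :* d :- b :* con 0₃) refl a b d) e
      ad≢0 = inverse-nonzero ad≡1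
      t = diagonalΓ a d ad≢0
      product : t Γ.∙ γΓ (a * b) Γ.≈ matrix aut-id a b 0# d ≢0
      product (x , y) = cong₂ _,_
        (modulo (b * y) ad≡1 (solve 5 (λ a b d x y → con 1₃ :* (a :* x :+ con 0₃ :* y) :+ a :* b :* (con 0₃ :* x :+ d :* y) := a :* x :+ b :* y :+ b :* y :* (a :* d :- con 1₃)) refl a b d x y))
        (solve 4 (λ a d x y → con 0₃ :* (a :* x :+ con 0₃ :* y) :+ con 1₃ :* (con 0₃ :* x :+ d :* y) := con 0₃ :* x :+ d :* y) refl a d x y)
    -- The Bruhat decomposition of a matrix outside the Borel subgroup.
    special∈M a b c d e ≢0 (no c≢0) = j-≈∈ (γΓ (d * k) Γ.∙ δΓ Γ.∙ t Γ.∙ γΓ (a * k)) m product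
        (j-∙∈ (γΓ (d * k) Γ.∙ δΓ Γ.∙ t) (γΓ (a * k)) (j-∙∈ (γΓ (d * k) Γ.∙ δΓ) t (j-∙∈ (γΓ (d * k)) δΓ (γ∈M (d * k)) δ∈M) (T∈M (- k) (- c) kc)) (γ∈M (a * k)))
      where
      m = matrix aut-id a b c d ≢0
      k = proj₁ (recip c≢0)
      kc≡1 = proj₂ (recip c≢0)
      kc : - k * - c ≡ 1#
      kc = trans (solve 2 (λ k c → :- k :* :- c := k :* c) refl k c) kc≡1
      t = diagonalΓ (- k) (- c) (inverse-nonzero kc)
      product : γΓ (d * k) Γ.∙ δΓ Γ.∙ t Γ.∙ γΓ (a * k) Γ.≈ m
      product (x , y) = cong₂ _,_
        (trans (solve 6 (λ a c d k x y →
            let x₁ = con 1₃ :* x :+ d :* k :* y ; y₁ = con 0₃ :* x :+ con 1₃ :* y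
                x₂ = con 0₃ :* x₁ :+ con 1₃ :* y₁ ; y₂ = con 2₃ :* x₁ :+ con 0₃ :* y₁
                x₃ = :- k :* x₂ :+ con 0₃ :* y₂ ; y₃ = con 0₃ :* x₂ :+ :- c :* y₂
            in con 1₃ :* x₃ :+ a :* k :* y₃ := a :* (k :* c) :* x :+ (a :* d :* (k :* c) :- con 1₃) :* k :* y) refl a c d k x y)
          (trans (cong (λ z → a * z * x + (a * d * z - 1#) * k * y) kc≡1)
          (trans (solve 5 (λ a d k x y → a :* con 1₃ :* x :+ (a :* d :* con 1₃ :- con 1₃) :* k :* y := a :* x :+ (a :* d :- con 1₃) :* k :* y) refl a d k x y)
          (trans (cong (λ z → a * x + (a * d - z) * k * y) (sym e))
            (modulo (b * y) kc≡1 (solve 7 (λ a b c d k x y → a :* x :+ (a :* d :- (a :* d :- b :* c)) :* k :* y := a :* x :+ b :* y :+ b :* y :* (k :* c :- con 1₃)) refl a b c d k x y))))))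
        (trans (solve 6 (λ a c d k x y →
            let x₁ = con 1₃ :* x :+ d :* k :* y ; y₁ = con 0₃ :* x :+ con 1₃ :* y
                x₂ = con 0₃ :* x₁ :+ con 1₃ :* y₁ ; y₂ = con 2₃ :* x₁ :+ con 0₃ :* y₁
                x₃ = :- k :* x₂ :+ con 0₃ :* y₂ ; y₃ = con 0₃ :* x₂ :+ :- c :* y₂
            in con 0₃ :* x₃ :+ con 1₃ :* y₃ := c :* x :+ d :* (k :* c) :* y) refl a c d k x y)
          (trans (cong (λ z → c * x + d * z * y) kc≡1) (cong (λ z → c * x + z * y) (*-identityʳ d))))

    InMSΦ : Perm → Set
    InMSΦ g = ∃₂ λ m s → ∃ λ φ → m ∈ M × s ∈ S × φ ∈ Φ × g P.≈ m P.∙ s P.∙ φ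

    lift∈MSΦ : ∀ f i → (∀ x → field-aut f x ≡ frob i x) → InMSΦ (F₁.j f)
    lift∈MSΦ f i θ≡ = F₁.j fₘ , F₁.j fₛ , F₁.j (frobeniusΓ i)
        , special∈M a b c d unimodular (λ z → 1≢0 (trans (sym unimodular) z)) (c ≟ 0#)
        , gen {x = F₁.j fₛ} (μ , μ≢0 , diagonal∈β (μ ^ 2) μ (cube-nonzero μ≢0))
        , frobenius∈Φ i
        , λ x → trans (F₁.j-cong {f} {fₘ Γ.∙ fₛ Γ.∙ frobeniusΓ i} decomposed x)
            (trans (F₁.j-homo (fₘ Γ.∙ fₛ) (frobeniusΓ i) x) (cong (lift (frobeniusΓ i)) (F₁.j-homo fₘ fₛ x)))
      where
      open Semilinear f
      a₀ = inverse p
      b₀ = inverse s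
      c₀ = inverse p′
      d₀ = inverse s′
      Δ = a₀ * d₀ - b₀ * c₀
      θΔ : θ Δ ≡ δet f
      θΔ = trans (+-homo _ _) (cong₂ _+_ (trans (*-homo _ _) (cong₂ _*_ (inverseʳ p) (inverseʳ s′)))
        (trans (-‿homo _) (cong -_ (trans (*-homo _ _) (cong₂ _*_ (inverseʳ s) (inverseʳ p′))))))
      Δ≢0 : Δ ≢ 0#
      Δ≢0 e = δet≢0 f (trans (sym θΔ) (trans (cong θ e) 0#-homo))
      μ = root Δ
      μ≢0 : μ ≢ 0#
      μ≢0 e = Δ≢0 (trans (sym (root-cubed Δ)) (trans (cong (_^ 3) e) (solve 0 (con 0₃ :^ 3 := con 0₃) refl)))
      ν = proj₁ (recip μ≢0)
      νμ≡1 = proj₂ (recip μ≢0)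
      a = ν ^ 2 * a₀
      b = ν ^ 2 * b₀
      c = ν * c₀
      d = ν * d₀
      unimodular : a * d - b * c ≡ 1#
      unimodular = begin
        a * d - b * c        ≡⟨ solve 5 (λ ν a b c d → ν :^ 2 :* a :* (ν :* d) :- ν :^ 2 :* b :* (ν :* c) := ν :^ 3 :* (a :* d :- b :* c)) refl ν a₀ b₀ c₀ d₀ ⟩
        ν ^ 3 * Δ            ≡⟨ cong (ν ^ 3 *_) (root-cubed Δ) ⟨
        ν ^ 3 * μ ^ 3        ≡⟨ ^-distrib-* ν μ 3 ⟨
        (ν * μ) ^ 3          ≡⟨ cong (_^ 3) νμ≡1 ⟩
        1# ^ 3               ≡⟨ solve 0 (con 1₃ :^ 3 := con 1₃) refl ⟩
        1#                   ∎
      fₘ = matrix aut-id a b c d (λ z → 1≢0 (trans (sym unimodular) z))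
      fₛ = diagonalΓ (μ ^ 2) μ (cube-nonzero μ≢0)
      decomposed : f Γ.≈ fₘ Γ.∙ fₛ Γ.∙ frobeniusΓ i
      decomposed (x , y) = sym (trans (cong₂ _,_
          (trans (solve 2 (λ a b → con 1₃ :* a :+ con 0₃ :* b := a) refl (frob i X) (frob i Y)) (trans (sym (θ≡ X)) (trans (cong θ X≡) (image a₀ b₀))))
          (trans (solve 2 (λ a b → con 0₃ :* a :+ con 1₃ :* b := b) refl (frob i X) (frob i Y)) (trans (sym (θ≡ Y)) (trans (cong θ Y≡) (image c₀ d₀)))))
        (trans (cong₂ _,_ (cong₂ (λ u v → u * θ x + v * θ y) (inverseʳ p) (inverseʳ s)) (cong₂ (λ u v → u * θ x + v * θ y) (inverseʳ p′) (inverseʳ s′)))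
          (sym (formula x y))))
        where
        X = proj₁ (fun (fₘ Γ.∙ fₛ) (x , y))
        Y = proj₂ (fun (fₘ Γ.∙ fₛ) (x , y))
        image : ∀ u v → θ (u * x + v * y) ≡ θ u * θ x + θ v * θ y
        image u v = trans (+-homo _ _) (cong₂ _+_ (*-homo u x) (*-homo v y))
        one : (ν * μ) ^ 2 ≡ 1#
        one = trans (cong (_^ 2) νμ≡1) (solve 0 (con 1₃ :^ 2 := con 1₃) refl)
        X≡ : X ≡ a₀ * x + b₀ * y
        X≡ = modulo (a₀ * x + b₀ * y) one (solve 8 (λ a b c d x y μ ν →
          μ :^ 2 :* (ν :^ 2 :* a :* x :+ ν :^ 2 :* b :* y) :+ con 0₃ :* (ν :* c :* x :+ ν :* d :* y)
            := a :* x :+ b :* y :+ (a :* x :+ b :* y) :* ((ν :* μ) :^ 2 :- con 1₃)) refl a₀ b₀ c₀ d₀ x y μ ν)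
        Y≡ : Y ≡ c₀ * x + d₀ * y
        Y≡ = modulo (c₀ * x + d₀ * y) νμ≡1 (solve 8 (λ a b c d x y μ ν →
          con 0₃ :* (ν :^ 2 :* a :* x :+ ν :^ 2 :* b :* y) :+ μ :* (ν :* c :* x :+ ν :* d :* y)
            := c :* x :+ d :* y :+ (c :* x :+ d :* y) :* (ν :* μ :- con 1₃)) refl a₀ b₀ c₀ d₀ x y μ ν)

  𝒢₁⊆G₁ : 𝒢₁ ⊆ G₁
  𝒢₁⊆G₁ {g} (f , t , e) = assemble (lift∈MSΦ f (toℕ (proj₁ (aut⇒frob (Semilinear.aut f)))) (proj₂ (aut⇒frob (Semilinear.aut f))))
    where
    t′ = lift (f Γ.⁻¹) t
    assemble : InMSΦ (F₁.j f) → g ∈ G₁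
    assemble (m , s , φ , m∈ , s∈ , φ∈ , f≈) = F₁.i t′ P.∙ m P.∙ s , φ
      , (F₁.i t′ P.∙ m , s , (F₁.i t′ , m , gen {x = F₁.i t′} (proj₁ t′ , proj₁ (proj₂ t′) , proj₂ (proj₂ t′) , λ _ → refl) , m∈ , λ _ → refl) , s∈ , λ _ → refl)
      , φ∈ , λ x → trans (e x) (trans (F₁.reorder f t x) (f≈ (x ⊞ t′)))

  diagonalᵁ : ∀ l m → l * m ≢ 0# → UT.Carrier
  diagonalᵁ l m = triangular aut-id l 0# m

  unipotentᵁ : F → UT.Carrier
  unipotentᵁ d = triangular aut-id 1# d 1# one-nonzero

  frobeniusᵁ : ℕ → UT.Carrier
  frobeniusᵁ i = triangular (frob-aut i) 1# 0# 1# one-nonzero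

  private
    root-0 : root 0# ≡ 0#
    root-0 = Aut.0#-homo (frob-aut r′)

    root-1 : root 1# ≡ 1#
    root-1 = Aut.1#-homo (frob-aut r′)

  twist-diagonal : ∀ l m (lm≢0 : l * m ≢ 0#) a b c → twist (diagonalᵁ l m lm≢0) (a , b , c) ≡ (l * m * a , m * b , ρ (l * m ^ 2) * c)
  twist-diagonal l m lm≢0 a b c = trans (twist-triangular aut-id l 0# m lm≢0 a b c) (triple≡
    (trans (cong (λ z → l * m * a + 0# * m * b ^ 2 + z * root l ^ 2 * m * c) root-0)
      (solve 6 (λ l m a b c L → l :* m :* a :+ con 0₃ :* m :* b :^ 2 :+ con 0₃ :* L :^ 2 :* m :* c := l :* m :* a) refl l m a b c (root l)))
    refl refl)

  twist-τ : ∀ d a b c → twist (unipotentᵁ d) (a , b , c) ≡ (a + d * b ^ 2 + root d * c , b , c)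
  twist-τ d a b c = trans (twist-triangular aut-id 1# d 1# one-nonzero a b c) (triple≡
    (trans (cong (λ z → 1# * 1# * a + d * 1# * b ^ 2 + root d * z ^ 2 * 1# * c) root-1)
      (solve 5 (λ d a b c D → con 1₃ :* con 1₃ :* a :+ d :* con 1₃ :* b :^ 2 :+ D :* con 1₃ :^ 2 :* con 1₃ :* c := a :+ d :* b :^ 2 :+ D :* c) refl d a b c (root d)))
    (*-identityˡ b)
    (trans (cong (λ z → ρ z * c) (solve 0 (con 1₃ :* con 1₃ :^ 2 := con 1₃) refl)) (trans (cong (_* c) ρ-1) (*-identityˡ c))))

  twist-frobenius : ∀ i a b c → twist (frobeniusᵁ i) (a , b , c) ≡ (frob i a , frob i b , frob i c)
  twist-frobenius i a b c = trans (twist-triangular (frob-aut i) 1# 0# 1# one-nonzero a b c) (triple≡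
    (trans (cong (λ z → 1# * 1# * frob i a + 0# * 1# * frob i b ^ 2 + z * root 1# ^ 2 * 1# * frob i c) root-0)
      (solve 4 (λ a b c L → con 1₃ :* con 1₃ :* a :+ con 0₃ :* con 1₃ :* b :^ 2 :+ con 0₃ :* L :^ 2 :* con 1₃ :* c := a) refl (frob i a) (frob i b) (frob i c) (root 1#)))
    (*-identityˡ _)
    (trans (cong (λ z → ρ z * frob i c) (solve 0 (con 1₃ :* con 1₃ :^ 2 := con 1₃) refl)) (trans (cong (_* frob i c) ρ-1) (*-identityˡ _))))

  twist∈𝒢₂ : ∀ f {g} → (∀ x → to g x ≡ twist f x) → g ∈ 𝒢₂
  twist∈𝒢₂ f e = f , (0# , 0# , 0# , 0#) , λ x → trans (e x) (sym (Acts.act-ε unipotents (twist f x)))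

  unipotent∈𝒢₂ : ∀ k {g} → (∀ x → to g x ≡ unipotent k x) → g ∈ 𝒢₂
  unipotent∈𝒢₂ k e = UT.ε , k , λ x → trans (e x) (cong (unipotent k) (sym (Acts.act-ε twists x)))

  unipotent-α : ∀ u v w x → unipotent (w , 0# , u , v) x ≡ x ⊞ (u , v , w)
  unipotent-α u v w (a , b , c) = triple≡ (solve 3 (λ a b u → a :+ con 0₃ :* b :+ u := a :+ u) refl a b u) refl refl

  unipotent-γ : ∀ e a b c → unipotent (0# , e , 0# , 0#) (a , b , c) ≡ (a + e * b , b , c)
  unipotent-γ e a b c = triple≡ (+-identityʳ _) (+-identityʳ b) (+-identityʳ c)

  α⊆𝒢₂ : ∀ {u v w g} → g ∈ α u v w → g ∈ 𝒢₂
  α⊆𝒢₂ {u} {v} {w} {g} e = unipotent∈𝒢₂ (w , 0# , u , v) {g} λ x → trans (e x) (sym (unipotent-α u v w x))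

  γ⊆𝒢₂ : ∀ {e g} → g ∈ γ e → g ∈ 𝒢₂
  γ⊆𝒢₂ {e} {g} g∈ = unipotent∈𝒢₂ (0# , e , 0# , 0#) {g} λ { (a , b , c) → trans (g∈ (a , b , c)) (sym (unipotent-γ e a b c)) }

  -- The element β l m of G₂ comes from the diagonal matrix with entries l / m and m.
  β⊆𝒢₂ : ∀ {k m g} → k * m ≢ 0# → g ∈ β (k * m) m → g ∈ 𝒢₂
  β⊆𝒢₂ {k} {m} {g} km≢0 g∈ = twist∈𝒢₂ (diagonalᵁ k m km≢0) {g} λ { (a , b , c) → trans (g∈ (a , b , c))
    (trans (triple≡ refl refl (cong (_* c) (trans (ρ-exponent (k * m * m)) (cong ρ (solve 2 (λ k m → k :* m :* m := k :* m :^ 2) refl k m)))))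
      (sym (twist-diagonal k m km≢0 a b c))) }

  τ⊆𝒢₂ : ∀ {d g} → g ∈ τ d → g ∈ 𝒢₂
  τ⊆𝒢₂ {d} {g} g∈ = twist∈𝒢₂ (unipotentᵁ d) {g} λ { (a , b , c) → trans (g∈ (a , b , c))
    (trans (triple≡ (cong (λ z → a + d * b ^ 2 + z * c) (root-ε d)) refl refl) (sym (twist-τ d a b c))) }

  σ⊆𝒢₂ : ∀ {g} → g ∈ σ → g ∈ 𝒢₂
  σ⊆𝒢₂ {g} g∈ = twist∈𝒢₂ (frobeniusᵁ 1) {g} λ { (a , b , c) → trans (g∈ (a , b , c)) (sym (twist-frobenius 1 a b c)) }

  S⊆𝒢₂ : ∀ {m g} → m ≢ 0# → g ∈ β (m ^ 2) m → g ∈ 𝒢₂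
  S⊆𝒢₂ {m} {g} m≢0 g∈ = β⊆𝒢₂ {m} {m} {g} (*-nonzero m≢0 m≢0) λ { (a , b , c) → trans (g∈ (a , b , c))
    (cong (λ z → z * a , m * b , (z * m) ^ (2 ℕ.* Construction.ε 𝔽) * c) (cong (m *_) (*-identityʳ m))) }

  T⊆𝒢₂ : ∀ {m m⁻¹ g} → m * m⁻¹ ≡ 1# → g ∈ β m m⁻¹ → g ∈ 𝒢₂
  T⊆𝒢₂ {m} {m⁻¹} {g} e g∈ = β⊆𝒢₂ {m ^ 2} {m⁻¹} {g} (λ z → factorˡ≢0 (inverse-nonzero e) (trans (sym m≡) z)) λ { (a , b , c) → trans (g∈ (a , b , c))
    (cong (λ z → z * a , m⁻¹ * b , (z * m⁻¹) ^ (2 ℕ.* Construction.ε 𝔽) * c) (sym m≡)) }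
    where
    m≡ : m ^ 2 * m⁻¹ ≡ m
    m≡ = modulo m e (solve 2 (λ m k → m :^ 2 :* k := m :+ m :* (m :* k :- con 1₃)) refl m m⁻¹)

  G₂⊆𝒢₂ : G₂ ⊆ 𝒢₂
  G₂⊆𝒢₂ {g} = ⊙⊆ {Q ⊙ S ⊙ E ⊙ T} {Φ} F₂.image (⊙⊆ {Q ⊙ S ⊙ E} {T} F₂.image (⊙⊆ {Q ⊙ S} {E} F₂.image (⊙⊆ {Q} {S} F₂.image
    (λ _ → ⟨⟩-least F₂.image λ
      { (inj₁ A∈) → ⟨⟩-least F₂.image (λ { {g} (u , v , w , g∈) → α⊆𝒢₂ {u} {v} {w} {g} g∈ }) A∈
      ; (inj₂ C∈) → ⟨⟩-least F₂.image (λ { {g} (e , g∈) → γ⊆𝒢₂ {e} {g} g∈ }) C∈ })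
    (λ _ → ⟨⟩-least F₂.image (λ { {g} (m , m≢0 , g∈) → S⊆𝒢₂ {m} {g} m≢0 g∈ })))
    (λ _ → ⟨⟩-least F₂.image (λ { {g} (d , g∈) → τ⊆𝒢₂ {d} {g} g∈ })))
    (λ _ → ⟨⟩-least F₂.image (λ { {g} (m , m⁻¹ , e , g∈) → T⊆𝒢₂ {m} {m⁻¹} {g} e g∈ })))
    (λ _ → ⟨⟩-least F₂.image (λ {g} → σ⊆𝒢₂ {g})) g

  private
    frobeniusᵁ∈Φ : ∀ i → F₂.j (frobeniusᵁ i) ∈ Φ
    frobeniusᵁ∈Φ i = ⟨resp⟩ {x = F₁.j (frobeniusΓ i)} {y = F₂.j (frobeniusᵁ i)}
      (λ { (a , b , c) → trans (lift-frobenius i a b c) (sym (twist-frobenius i a b c)) }) (frobenius∈Φ i)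

    diagonalᵁ∈β : ∀ k m {l} (km≢0 : k * m ≢ 0#) → k * m ≡ l → F₂.j (diagonalᵁ k m km≢0) ∈ β l m
    diagonalᵁ∈β k m km≢0 refl (a , b , c) = trans (twist-diagonal k m km≢0 a b c) (triple≡ refl refl
      (cong (_* c) (trans (cong ρ (solve 2 (λ k m → k :* m :^ 2 := k :* m :* m) refl k m)) (sym (ρ-exponent (k * m * m))))))

    S∈ : ∀ x (xx≢0 : x * x ≢ 0#) → F₂.j (diagonalᵁ x x xx≢0) ∈ S
    S∈ x xx≢0 = gen {x = F₂.j (diagonalᵁ x x xx≢0)} (x , factorˡ≢0 xx≢0 , diagonalᵁ∈β x x xx≢0 (cong (x *_) (sym (*-identityʳ x))))

    E∈ : ∀ d → F₂.j (unipotentᵁ d) ∈ E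
    E∈ d = gen {x = F₂.j (unipotentᵁ d)} (d , λ { (a , b , c) → trans (twist-τ d a b c) (triple≡ (cong (λ z → a + d * b ^ 2 + z * c) (sym (root-ε d))) refl refl) })

    T∈ : ∀ y z (yyz≢0 : y ^ 2 * z ≢ 0#) → y * z ≡ 1# → F₂.j (diagonalᵁ (y ^ 2) z yyz≢0) ∈ T
    T∈ y z yyz≢0 yz≡1 = gen {x = F₂.j (diagonalᵁ (y ^ 2) z yyz≢0)} (y , z , yz≡1 , diagonalᵁ∈β (y ^ 2) z yyz≢0
      (modulo y yz≡1 (solve 2 (λ m k → m :^ 2 :* k := m :+ m :* (m :* k :- con 1₃)) refl y z)))

    InSETΦ : Perm → Set
    InSETΦ g = ∃₂ λ s e → ∃₂ λ t φ → s ∈ S × e ∈ E × t ∈ T × φ ∈ Φ × g P.≈ s P.∙ e P.∙ t P.∙ φ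

    twist∈SETΦ : ∀ f i → (∀ x → field-aut (UT⇒Γ f) x ≡ frob i x) → InSETΦ (F₂.j f)
    twist∈SETΦ f i θ≡ = F₂.j fₛ , F₂.j fₑ , F₂.j fₜ , F₂.j (frobeniusᵁ i)
        , S∈ x xx≢0 , E∈ d , T∈ y z yyz≢0 yz≡1
        , frobeniusᵁ∈Φ i
        , λ x → trans (F₂.j-cong {f} {fₛ UT.∙ fₑ UT.∙ fₜ UT.∙ frobeniusᵁ i} decomposed x)
            (trans (F₂.j-homo (fₛ UT.∙ fₑ UT.∙ fₜ) (frobeniusᵁ i) x) (cong (twist (frobeniusᵁ i))
              (trans (F₂.j-homo (fₛ UT.∙ fₑ) fₜ x) (cong (twist fₜ) (F₂.j-homo fₛ fₑ x)))))
      where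
      open Triangular f using (θ; p; s; s′; p≢0; s′≢0; +-homo; *-homo; inverse; inverseʳ; 0#-homo; formula′)
      a₀ = inverse p
      b₀ = inverse s
      d₀ = inverse s′
      a₀≢0 : a₀ ≢ 0#
      a₀≢0 e = p≢0 (trans (sym (inverseʳ p)) (trans (cong θ e) 0#-homo))
      d₀≢0 : d₀ ≢ 0#
      d₀≢0 e = s′≢0 (trans (sym (inverseʳ s′)) (trans (cong θ e) 0#-homo))
      y³ = a₀ * proj₁ (recip d₀≢0)
      y = root y³
      y≢0 : y ≢ 0#
      y≢0 e = *-nonzero a₀≢0 (factorˡ≢0 (λ z → 1≢0 (trans (sym (proj₂ (recip d₀≢0))) z)))
        (trans (sym (root-cubed y³)) (trans (cong (_^ 3) e) (solve 0 (con 0₃ :^ 3 := con 0₃) refl)))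
      y³d₀ : y ^ 3 * d₀ ≡ a₀
      y³d₀ = trans (cong (_* d₀) (root-cubed y³)) (trans (*-assoc a₀ _ d₀) (trans (cong (a₀ *_) (proj₂ (recip d₀≢0))) (*-identityʳ a₀)))
      z = proj₁ (recip y≢0)
      yz≡1 : y * z ≡ 1#
      yz≡1 = trans (*-comm y z) (proj₂ (recip y≢0))
      yyz : y ^ 2 * z ≡ y
      yyz = modulo y yz≡1 (solve 2 (λ m k → m :^ 2 :* k := m :+ m :* (m :* k :- con 1₃)) refl y z)
      yyz≢0 : y ^ 2 * z ≢ 0#
      yyz≢0 e = y≢0 (trans (sym yyz) e)
      x = d₀ * y
      x≢0 : x ≢ 0#
      x≢0 = *-nonzero d₀≢0 y≢0
      xx≢0 : x * x ≢ 0#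
      xx≢0 = *-nonzero x≢0 x≢0
      d = b₀ * proj₁ (recip a₀≢0)
      a₀d : a₀ * d ≡ b₀
      a₀d = trans (solve 3 (λ a b k → a :* (b :* k) := b :* (k :* a)) refl a₀ b₀ _) (trans (cong (b₀ *_) (proj₂ (recip a₀≢0))) (*-identityʳ b₀))
      fₛ = diagonalᵁ x x xx≢0
      fₑ = unipotentᵁ d
      fₜ = diagonalᵁ (y ^ 2) z yyz≢0
      decomposed : f UT.≈ fₛ UT.∙ fₑ UT.∙ fₜ UT.∙ frobeniusᵁ i
      decomposed (u , v) = sym (trans (cong₂ _,_
          (trans (solve 2 (λ a b → con 1₃ :* a :+ con 0₃ :* b := a) refl (frob i X) (frob i Y)) (trans (sym (θ≡ X)) (trans (cong θ X≡)
            (trans (+-homo _ _) (cong₂ _+_ (trans (*-homo a₀ u) (cong (_* θ u) (inverseʳ p))) (trans (*-homo b₀ v) (cong (_* θ v) (inverseʳ s))))))))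
          (trans (solve 2 (λ a b → con 0₃ :* a :+ con 1₃ :* b := b) refl (frob i X) (frob i Y)) (trans (sym (θ≡ Y)) (trans (cong θ Y≡)
            (trans (*-homo d₀ v) (cong (_* θ v) (inverseʳ s′)))))))
        (sym (formula′ u v)))
        where
        w = fun (UT⇒Γ (fₛ UT.∙ fₑ UT.∙ fₜ)) (u , v)
        X = proj₁ w
        Y = proj₂ w
        X≡ : X ≡ a₀ * u + b₀ * v
        X≡ = trans (solve 6 (λ d₀ y d z u v →
            let x = d₀ :* y ; u₁ = x :* u :+ con 0₃ :* v ; v₁ = con 0₃ :* u :+ x :* v
                u₂ = con 1₃ :* u₁ :+ d :* v₁ ; v₂ = con 0₃ :* u₁ :+ con 1₃ :* v₁
            in y :^ 2 :* u₂ :+ con 0₃ :* v₂ := (y :^ 3 :* d₀) :* u :+ (y :^ 3 :* d₀) :* d :* v) refl d₀ y d z u v)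
          (trans (cong (λ t → t * u + t * d * v) y³d₀) (cong (λ t → a₀ * u + t * v) a₀d))
        Y≡ : Y ≡ d₀ * v
        Y≡ = modulo (d₀ * v) yz≡1 (solve 6 (λ d₀ y d z u v →
            let x = d₀ :* y ; u₁ = x :* u :+ con 0₃ :* v ; v₁ = con 0₃ :* u :+ x :* v
                u₂ = con 1₃ :* u₁ :+ d :* v₁ ; v₂ = con 0₃ :* u₁ :+ con 1₃ :* v₁
            in con 0₃ :* u₂ :+ z :* v₂ := d₀ :* v :+ d₀ :* v :* (y :* z :- con 1₃)) refl d₀ y d z u v)

    unipotent∈Q : ∀ k → F₂.i k ∈ Q
    unipotent∈Q k = ⟨resp⟩ {x = F₂.i c P.∙ F₂.i a} {y = F₂.i k} factor
        (mul {x = F₂.i c} {y = F₂.i a}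
          (gen {x = F₂.i c} (inj₂ (gen {x = F₂.i c} (e , λ { (a , b , c) → unipotent-γ e a b c }))))
          (gen {x = F₂.i a} (inj₁ (gen {x = F₂.i a} (u , v , n , unipotent-α u v n)))))
      where
      n = proj₁ k
      e = proj₁ (proj₂ k)
      u = proj₁ (proj₂ (proj₂ k))
      v = proj₂ (proj₂ (proj₂ k))
      c a : Group.Carrier K₂
      c = 0# , e , 0# , 0#
      a = n , 0# , u , v
      factor : ∀ x → unipotent a (unipotent c x) ≡ unipotent k x
      factor (x , y , z) = trans (cong (unipotent a) (unipotent-γ e x y z)) (unipotent-α u v n (x + e * y , y , z))

  𝒢₂⊆G₂ : 𝒢₂ ⊆ G₂
  𝒢₂⊆G₂ {g} (f , k , eq) = assemble (twist∈SETΦ f (toℕ (proj₁ (aut⇒frob (Semilinear.aut (UT⇒Γ f))))) (proj₂ (aut⇒frob (Semilinear.aut (UT⇒Γ f)))))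
    where
    k′ = conjugate k (f UT.⁻¹)
    assemble : InSETΦ (F₂.j f) → g ∈ G₂
    assemble (s , e , t , φ , s∈ , e∈ , t∈ , φ∈ , f≈) = F₂.i k′ P.∙ s P.∙ e P.∙ t , φ
      , (F₂.i k′ P.∙ s P.∙ e , t , (F₂.i k′ P.∙ s , e , (F₂.i k′ , s , unipotent∈Q k′ , s∈ , λ _ → refl) , e∈ , λ _ → refl) , t∈ , λ _ → refl)
      , φ∈ , λ x → trans (eq x) (trans (F₂.reorder f k x) (f≈ (unipotent k′ x)))

module CosetVertices (G : Group 0ℓ 0ℓ) (H₁ H₂ : Subgroup G) where
  open Group G renaming (refl to ≈-refl; sym to ≈-sym; trans to ≈-trans)
  open GroupProperties G
  open Subsets G using (rightCoset; ⟨_⟩)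
  open CosetGraph G (Subgroup.Member H₁) (Subgroup.Member H₂)
  open Graph Δ
  open ActionOn action
  private module V = Setoid vertices

  -- true stands for the vertices H₁g and false for the vertices H₂g.
  H : Bool → Subgroup G
  H true = H₁
  H false = H₂

  vertex : Bool → Carrier → Vertex
  vertex true = inj₁
  vertex false = inj₂

  side : ∀ z → ∃₂ λ s g → z ≡ vertex s g
  side (inj₁ g) = true , g , refl
  side (inj₂ g) = false , g , refl

  vertex-· : ∀ s g k → vertex s g · k ≡ vertex s (g ∙ k)
  vertex-· true g k = refl
  vertex-· false g k = refl

  private
    cosets⇒ : ∀ (K : Subgroup G) {g h} → rightCoset (Subgroup.Member K) g ≐ rightCoset (Subgroup.Member K) h → g // h ∈ Subgroup.Member K
    cosets⇒ K {g} {h} (g⊆h , _) with g⊆h (ε , Subgroup.ε∈ K , ≈-sym (identityˡ g))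
    ... | k , k∈ , g≈kh = Subgroup.resp K (≈-sym (≈-trans (∙-congʳ g≈kh) (//-rightDividesʳ h k))) k∈

    cosets⇐ : ∀ (K : Subgroup G) {g h} → g // h ∈ Subgroup.Member K → rightCoset (Subgroup.Member K) g ≐ rightCoset (Subgroup.Member K) h
    cosets⇐ K {g} {h} m = included m , included (Subgroup.resp K (⁻¹-anti-homo-// g h) (Subgroup.⁻¹∈ K m))
      where
      included : ∀ {g h} → g // h ∈ Subgroup.Member K → rightCoset (Subgroup.Member K) g ⊆ rightCoset (Subgroup.Member K) h
      included {g} {h} m (k , k∈ , x≈) = k ∙ (g // h) , Subgroup.∙∈ K k∈ m
        , ≈-trans x≈ (≈-trans (∙-congˡ (≈-sym (//-rightDividesˡ h g))) (≈-sym (assoc _ _ _)))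

    through : ∀ (K : Subgroup G) {x g l} → l ∈ Subgroup.Member K → x ≈ l ∙ g → g // x ∈ Subgroup.Member K
    through K {x} {g} {l} l∈ x≈ = Subgroup.resp K (≈-sym (≈-trans (∙-congˡ (≈-trans (⁻¹-cong x≈) (⁻¹-anti-homo-∙ l g))) (\\-leftDividesˡ g _))) (Subgroup.⁻¹∈ K l∈)

    own : ∀ (K : Subgroup G) g → g ∈ rightCoset (Subgroup.Member K) g
    own K g = ε , Subgroup.ε∈ K , ≈-sym (identityˡ g)

  vertex-≈⇒ : ∀ s {g h} → vertex s g ≈ᵥ vertex s h → g // h ∈ Subgroup.Member (H s)
  vertex-≈⇒ true (Sum.inj₁ e) = cosets⇒ H₁ e
  vertex-≈⇒ false (Sum.inj₂ e) = cosets⇒ H₂ e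

  vertex-≈⇐ : ∀ s {g h} → g // h ∈ Subgroup.Member (H s) → vertex s g ≈ᵥ vertex s h
  vertex-≈⇐ true m = Sum.inj₁ (cosets⇐ H₁ m)
  vertex-≈⇐ false m = Sum.inj₂ (cosets⇐ H₂ m)

  vertex-cong : ∀ s {g h} → g ≈ h → vertex s g ≈ᵥ vertex s h
  vertex-cong s {g} {h} e = vertex-≈⇐ s (Subgroup.resp (H s) (≈-sym (x≈y⇒x∙y⁻¹≈ε e)) (Subgroup.ε∈ (H s)))

  neighbour⇒ : ∀ s {h y} → vertex s h ~ y → ∃ λ k → k ∈ Subgroup.Member (H s) × y ≈ᵥ vertex (not s) (k ∙ h)
  neighbour⇒ true {h} {inj₂ g} (x , (k , k∈ , x≈) , l , l∈ , x≈′) = k , k∈ , vertex-≈⇐ false (Subgroup.resp H₂ (∙-congˡ (⁻¹-cong x≈)) (through H₂ l∈ x≈′))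
  neighbour⇒ false {h} {inj₁ g} (x , (l , l∈ , x≈′) , k , k∈ , x≈) = k , k∈ , vertex-≈⇐ true (Subgroup.resp H₁ (∙-congˡ (⁻¹-cong x≈)) (through H₁ l∈ x≈′))

  neighbour⇐ : ∀ s {h k} → k ∈ Subgroup.Member (H s) → vertex s h ~ vertex (not s) (k ∙ h)
  neighbour⇐ true {h} {k} k∈ = k ∙ h , (k , k∈ , ≈-refl) , own H₂ (k ∙ h)
  neighbour⇐ false {h} {k} k∈ = k ∙ h , own H₁ (k ∙ h) , (k , k∈ , ≈-refl)

  connected : (∀ g → g ∈ ⟨ Subgroup.Member H₁ ∪ Subgroup.Member H₂ ⟩) → Connected
  connected generates u v = reversed (path u) ◅◅ path v
    where
    Step = λ x y → x ≈ᵥ y ⊎ x ~ y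

    reversed : ∀ {x y} → Star Step x y → Star Step y x
    reversed = Star.reverse (λ { (inj₁ e) → inj₁ (V.sym e) ; {x} {y} (inj₂ a) → inj₂ (~-sym {x} {y} a) })

    translate : ∀ {x y} g → Star Step x y → Star Step (x · g) (y · g)
    translate g = gmap (_· g) (λ { (inj₁ e) → inj₁ (·-cong e ≈-refl) ; {x} {y} (inj₂ a) → inj₂ (·-~ {x} {y} g a) })

    o : Vertex
    o = vertex true ε

    -- The elements moving o to a vertex in its component form a subgroup containing both factors.
    reachable : Subgroup G
    reachable = record
      { Member = λ g → Star Step o (o · g)
      ; resp = λ g≈h p → p ◅◅ inj₁ (·-cong (V.refl {o}) g≈h) ◅ done
      ; ε∈ = inj₁ (V.sym (·-ε o)) ◅ done
      ; ∙∈ = λ {g} {h} p q → q ◅◅ (translate h p ◅◅ inj₁ (V.sym (·-∙ o g h)) ◅ done)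
      ; ⁻¹∈ = λ {g} p → inj₁ (V.trans (V.sym (·-ε o)) (V.trans (·-cong (V.refl {o}) (≈-sym (inverseʳ g))) (·-∙ o g (g ⁻¹)))) ◅ reversed (translate (g ⁻¹) p)
      }

    factors : ∀ {g} → g ∈ Subgroup.Member H₁ ∪ Subgroup.Member H₂ → Star Step o (o · g)
    factors {g} (inj₁ g∈) = inj₁ (vertex-≈⇐ true {ε} {ε ∙ g} (Subgroup.resp H₁ (≈-sym (≈-trans (∙-congˡ (⁻¹-cong (identityˡ g))) (identityˡ _))) (Subgroup.⁻¹∈ H₁ g∈))) ◅ done
    factors {g} (inj₂ g∈) = inj₂ (neighbour⇐ true {ε} {ε} (Subgroup.ε∈ H₁))
      ◅ inj₁ (vertex-≈⇐ false {ε ∙ ε} {g ∙ ε} (Subgroup.resp H₂ (≈-sym (≈-trans (∙-cong (identityˡ ε) (⁻¹-cong (identityʳ g))) (identityˡ _))) (Subgroup.⁻¹∈ H₂ g∈)))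
      ◅ inj₂ (~-sym {vertex true (ε ∙ g)} {vertex false (g ∙ ε)} (g ∙ ε , (ε , Subgroup.ε∈ H₁ , ≈-trans (identityʳ g) (≈-sym (≈-trans (identityˡ _) (identityˡ g)))) , own H₂ (g ∙ ε))) ◅ done

    to-side : ∀ s g → Star Step o (vertex s g)
    to-side true g = ⟨⟩-least reachable factors (generates g) ◅◅ inj₁ (vertex-cong true (identityˡ g)) ◅ done
    to-side false g = to-side true g ◅◅ inj₂ (neighbour⇐ true {g} {ε} (Subgroup.ε∈ H₁)) ◅ inj₁ (vertex-cong false (identityˡ g)) ◅ done

    path : ∀ v → Star Step o v
    path v with side v
    ... | s , g , refl = to-side s g

module Arcs {Δ : Graph} {G : Group 0ℓ 0ℓ} (action : ActionOn Δ G) where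
  open Graph Δ
  open ActionOn action
  open GGraph action
  private
    module G = Group G
    module V = Setoid vertices

  ·-cancel : ∀ {u v} g → u · g ≈ᵥ v · g → u ≈ᵥ v
  ·-cancel {u} {v} g e = V.trans (V.sym (undo u)) (V.trans (·-cong e G.refl) (undo v))
    where
    undo : ∀ u → u · g · g G.⁻¹ ≈ᵥ u
    undo u = V.trans (V.sym (·-∙ u g (g G.⁻¹))) (V.trans (·-cong V.refl (G.inverseʳ g)) (·-ε u))

  ~-resp-≈ : ∀ {u u′ v v′} → u ≈ᵥ u′ → v ≈ᵥ v′ → u ~ v → u′ ~ v′
  ~-resp-≈ {u} {u′} {v} {v′} e e′ a = proj₂ ~-resp {v′} {u} {u′} e (proj₁ ~-resp {u} {v} {v′} e′ a)

  translate : ∀ {s z z′} k → z · k ≈ᵥ z′ → Arc s z → Arc s z′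
  translate k zk≈z′ a = record
    { at = λ i → Arc.at a i · k
    ; origin = V.trans (·-cong (Arc.origin a) G.refl) zk≈z′
    ; path = λ i → ·-~ k (Arc.path a i)
    ; straight = λ i j e eq → Arc.straight a i j e (·-cancel k eq)
    }

  initial : ∀ {s z} → Arc (ℕ.suc s) z → Arc s z
  initial a = record
    { at = Arc.at a ∘ inject₁
    ; origin = Arc.origin a
    ; path = λ i → Arc.path a (inject₁ i)
    ; straight = λ i j e → Arc.straight a (inject₁ i) (inject₁ j) (trans (Finₚ.toℕ-inject₁ j) (trans e (cong (2 ℕ.+_) (sym (Finₚ.toℕ-inject₁ i)))))
    }

  -- Arcs are built up at their end, so a list of vertices stands for the arc read backwards.
  vertexAt : ∀ {s} → Vec Vertex (ℕ.suc s) → Fin (ℕ.suc s) → Vertex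
  vertexAt {ℕ.zero} (v ∷ []) _ = v
  vertexAt {ℕ.suc s} (v ∷ vs) i with view i
  ... | ‵fromℕ = v
  ... | ‵inj₁ {i = j} _ = vertexAt vs j

  vertexAt-last : ∀ {s} (vs : Vec Vertex (ℕ.suc s)) → vertexAt vs (fromℕ s) ≡ Vec.head vs
  vertexAt-last {ℕ.zero} (v ∷ []) = refl
  vertexAt-last {ℕ.suc s} (v ∷ vs) rewrite view-fromℕ (ℕ.suc s) = refl

  Reaches : ∀ s → Vertex → Vec Vertex (ℕ.suc s) → Set
  Reaches s z vs = ∀ (a : Arc s z) → ∃ λ g → ∀ i → Arc.at a i · g ≈ᵥ vertexAt vs i

  Different : ∀ {n} → Vec Vertex n → Vertex → Set
  Different [] y = ⊤
  Different (v ∷ _) y = ¬ (v ≈ᵥ y)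

  Fixes : G.Carrier → Vertex → Set
  Fixes g v = v · g ≈ᵥ v

  Extends : ∀ {s} → Vec Vertex (ℕ.suc s) → Vertex → Set
  Extends (v ∷ vs) w = ∀ y → v ~ y → Different vs y → ∃ λ g → VAll.All (Fixes g) (v ∷ vs) × y · g ≈ᵥ w

  reaches-start : ∀ {z} → Reaches 0 z (z ∷ [])
  reaches-start a = G.ε , λ { zero → V.trans (·-ε _) (Arc.origin a) }

  private
    fixes-at : ∀ {s g} (vs : Vec Vertex (ℕ.suc s)) → VAll.All (Fixes g) vs → ∀ i → Fixes g (vertexAt vs i)
    fixes-at {ℕ.zero} (v ∷ []) (f ∷ []) i = f
    fixes-at {ℕ.suc s} (v ∷ vs) (f ∷ fs) i with view i
    ... | ‵fromℕ = f
    ... | ‵inj₁ {i = j} _ = fixes-at vs fs j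

    different : ∀ {s} (vs : Vec Vertex s) v {y} → (∀ i → ℕ.suc (toℕ i) ≡ s → ¬ (vertexAt (v ∷ vs) i ≈ᵥ y)) → Different vs y
    different [] v _ = tt
    different {ℕ.suc s} (w ∷ ws) v h e = h (inject₁ (fromℕ s)) (cong ℕ.suc (trans (Finₚ.toℕ-inject₁ (fromℕ s)) (Finₚ.toℕ-fromℕ s)))
      (subst (λ u → u ≈ᵥ _) (sym second-last) e)
      where
      second-last : vertexAt (v ∷ w ∷ ws) (inject₁ (fromℕ s)) ≡ w
      second-last rewrite view-inject₁ (fromℕ s) = vertexAt-last (w ∷ ws)

  reaches-∷ : ∀ {s z vs w} → Reaches s z vs → Extends vs w → Reaches (ℕ.suc s) z (w ∷ vs)
  reaches-∷ {s} {z} {v ∷ vs} {w} reaches extends a with reaches (initial a)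
  ... | g , e with extends (Arc.at a (fromℕ (ℕ.suc s)) · g)
      (~-resp-≈ (V.trans (e (fromℕ s)) (V.reflexive (vertexAt-last (v ∷ vs)))) V.refl (·-~ g (Arc.path a (fromℕ s))))
      (different vs v λ i i+1≡s v≈ → Arc.straight a (inject₁ i) (fromℕ (ℕ.suc s))
        (cong ℕ.suc (trans (Finₚ.toℕ-fromℕ s) (trans (sym i+1≡s) (cong ℕ.suc (sym (Finₚ.toℕ-inject₁ i))))))
        (·-cancel g (V.trans (e i) v≈)))
  ...   | h , fixed , moved = g G.∙ h , λ i → V.trans (·-∙ _ g h) (place i)
    where
    place : ∀ i → Arc.at a i · g · h ≈ᵥ vertexAt (w ∷ v ∷ vs) i
    place i with view i
    ... | ‵fromℕ = moved
    ... | ‵inj₁ {i = j} _ = V.trans (·-cong (e j) G.refl) (fixes-at (v ∷ vs) fixed j)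

  reaches-shift : ∀ {s z vs ws} → Reaches s z vs → ∀ k → VPw.Pointwise (λ v w → v · k ≈ᵥ w) vs ws → Reaches s z ws
  reaches-shift {s} {z} reaches k vs≈ws a = let g , e = reaches a in g G.∙ k , λ i →
    V.trans (·-∙ _ g k) (V.trans (·-cong (e i) G.refl) (at vs≈ws i))
    where
    at : ∀ {s} {vs ws : Vec Vertex (ℕ.suc s)} → VPw.Pointwise (λ v w → v · k ≈ᵥ w) vs ws → ∀ i → vertexAt vs i · k ≈ᵥ vertexAt ws i
    at {ℕ.zero} {v ∷ []} {w ∷ []} (e ∷ []) i = e
    at {ℕ.suc s} {v ∷ vs} {w ∷ ws} (e ∷ es) i with view i
    ... | ‵fromℕ = e
    ... | ‵inj₁ {i = j} _ = at es j

  reaches⇒transitive : ∀ {s z vs} → Reaches s z vs → ∀ {z′} k → z′ · k ≈ᵥ z → TransitiveOnArcsFrom s z′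
  reaches⇒transitive {s} {z} {vs} reaches {z′} k z′k≈z a b = x , fixes , moves
    where
    g = k G.∙ proj₁ (reaches (translate k z′k≈z a))
    h = k G.∙ proj₁ (reaches (translate k z′k≈z b))
    x = g G.∙ h G.⁻¹
    moves : ∀ i → Arc.at a i · x ≈ᵥ Arc.at b i
    moves i = ·-cancel h (V.trans (V.sym (·-∙ _ x h)) (V.trans (·-cong V.refl (GroupProperties.//-rightDividesˡ G h g))
      (V.trans (·-∙ _ k _) (V.trans (proj₂ (reaches (translate k z′k≈z a)) i)
        (V.sym (V.trans (·-∙ _ k _) (proj₂ (reaches (translate k z′k≈z b)) i)))))))
    fixes : z′ · x ≈ᵥ z′
    fixes = V.trans (·-cong (V.sym (Arc.origin a)) G.refl) (V.trans (moves zero) (Arc.origin b))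

  extends-init : ∀ {n v w u} (vs : Vec Vertex n) x → Extends (v ∷ w ∷ (vs ∷ʳ x)) u → Extends (v ∷ w ∷ vs) u
  extends-init vs x extends y v~y w≉y with extends y v~y w≉y
  ... | g , f ∷ f′ ∷ fs , e = g , f ∷ f′ ∷ all-init vs fs , e
    where
    all-init : ∀ {n} (vs : Vec Vertex n) → VAll.All (Fixes g) (vs ∷ʳ x) → VAll.All (Fixes g) vs
    all-init [] _ = []
    all-init (v ∷ vs) (f ∷ fs) = f ∷ all-init vs fs

module Lines (r′ : ℕ) (𝔽 : FiniteField (3 ℕ.^ ℕ.suc r′)) where
  open FieldTheory r′ 𝔽
  open Permutations r′ 𝔽
  open ≡.≡-Reasoning

  infix 4 _∥_
  _∥_ : F² → F² → Set
  u ∥ v = det u v ≡ 0#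

  det-fun : ∀ f u v → det (fun f u) (fun f v) ≡ δet f * field-aut f (det u v)
  det-fun f (a , a′) (b , b′) = begin
    det (fun f (a , a′)) (fun f (b , b′))
      ≡⟨ cong₂ det (formula a a′) (formula b b′) ⟩
    det (p * θ a + s * θ a′ , p′ * θ a + s′ * θ a′) (p * θ b + s * θ b′ , p′ * θ b + s′ * θ b′)
      ≡⟨ solve 8 (λ p p′ s s′ a a′ b b′ →
           (p :* a :+ s :* a′) :* (p′ :* b :+ s′ :* b′) :- (p :* b :+ s :* b′) :* (p′ :* a :+ s′ :* a′)
             := (p :* s′ :- s :* p′) :* (a :* b′ :- b :* a′))
           refl p p′ s s′ (θ a) (θ a′) (θ b) (θ b′) ⟩
    δet f * (θ a * θ b′ - θ b * θ a′)
      ≡⟨ cong (δet f *_) (trans (+-homo _ _) (cong₂ _+_ (*-homo _ _) (trans (-‿homo _) (cong -_ (*-homo _ _))))) ⟨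
    δet f * θ (a * b′ - b * a′) ∎
    where open Semilinear f

  ∥-fun⁺ : ∀ f {u v} → u ∥ v → fun f u ∥ fun f v
  ∥-fun⁺ f {u} {v} e = trans (det-fun f u v) (trans (cong (λ z → δet f * field-aut f z) e) (trans (cong (δet f *_) (Semilinear.0#-homo f)) (zeroʳ _)))

  ∥-fun⁻ : ∀ f {u v} → fun f u ∥ fun f v → u ∥ v
  ∥-fun⁻ f {u} {v} e = Semilinear.injective f (trans (*-zero (δet≢0 f) (trans (sym (det-fun f u v)) e)) (sym (Semilinear.0#-homo f)))

  ∥-divide : ∀ f g {u v} → fun f u ∥ fun g v → fun (f Γ.∙ g Γ.⁻¹) u ∥ v
  ∥-divide f g {u} {v} e = ∥-fun⁻ g (subst (_∥ fun g v) (sym (Inverse.strictlyInverseˡ (proj₁ g) (fun f u))) e)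

  ∥-multiply : ∀ f g {u v} → fun (f Γ.∙ g Γ.⁻¹) u ∥ v → fun f u ∥ fun g v
  ∥-multiply f g {u} {v} e = subst (_∥ fun g v) (Inverse.strictlyInverseˡ (proj₁ g) (fun f u)) (∥-fun⁺ g e)

  IsScalar : Γ.Carrier → Set
  IsScalar f = ∀ v → fun f v ≡ Semilinear.p f • v

  scalar⇒∥ : ∀ f → IsScalar f → ∀ v → fun f v ∥ v
  scalar⇒∥ f scalar (x , y) = trans (cong (λ w → det w (x , y)) (scalar (x , y)))
    (solve 3 (λ p x y → p :* x :* y :- x :* (p :* y) := con 0₃) refl (Semilinear.p f) x y)

  scalar-nonzero : ∀ f → IsScalar f → Semilinear.p f ≢ 0#
  scalar-nonzero f scalar e = Semilinear.nonzero² f e₁≢0 (trans (scalar e₁) (trans (cong (_• e₁) e) (cong₂ _,_ (zeroˡ _) (zeroˡ _))))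

  ∥⇒scalar : ∀ f → Semilinear.p′ f ≡ 0# → (∀ x → fun f (x , 1#) ∥ (x , 1#)) → IsScalar f
  ∥⇒scalar f p′≡0 lines (x , y) = begin
    fun f (x , y)                                 ≡⟨ formula x y ⟩
    (p * θ x + s * θ y , p′ * θ x + s′ * θ y)     ≡⟨ cong₂ (λ a b → p * θ x + a * θ y , b * θ x + s′ * θ y) s≡0 p′≡0 ⟩
    (p * θ x + 0# * θ y , 0# * θ x + s′ * θ y)    ≡⟨ cong₂ (λ a b → p * a + 0# * θ y , 0# * θ x + s′ * b) (θ≡id x) (θ≡id y) ⟩
    (p * x + 0# * θ y , 0# * θ x + s′ * y)        ≡⟨ cong (λ a → p * x + 0# * θ y , 0# * θ x + a * y) (sym p≡s′) ⟩
    (p * x + 0# * θ y , 0# * θ x + p * y)         ≡⟨ cong₂ _,_ (solve 3 (λ p x t → p :* x :+ con 0₃ :* t := p :* x) refl p x (θ y)) (solve 3 (λ p y t → con 0₃ :* t :+ p :* y := p :* y) refl p y (θ x)) ⟩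
    p • (x , y)                                   ∎
    where
    open Semilinear f
    s≡0 : s ≡ 0#
    s≡0 = trans (solve 2 (λ s t → s := s :* con 1₃ :- con 0₃ :* t) refl s s′) (lines 0#)
    equation : ∀ x → p * θ x ≡ x * s′
    equation x = difference (trans (solve 3 (λ p x s′ → p :- x :* s′ := (p :+ con 0₃ :* con 1₃) :* con 1₃ :- x :* (con 0₃ :* p :+ s′ :* con 1₃)) refl (p * θ x) x s′)
      (trans (cong (λ z → (p * θ x + 0# * 1#) * 1# - x * (z + s′ * 1#)) (trans (zeroˡ _) (sym (zeroˡ (θ x)))))
      (trans (cong₂ (λ a b → (p * θ x + a * 1#) * 1# - x * (b * θ x + s′ * 1#)) (sym s≡0) (sym p′≡0))
      (trans (cong (λ t → (p * θ x + s * t) * 1# - x * (p′ * θ x + s′ * t)) (sym 1#-homo))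
        (trans (cong (λ v → det v (x , 1#)) (sym (formula x 1#))) (lines x))))))
    p≡s′ : p ≡ s′
    p≡s′ = trans (sym (trans (cong (p *_) 1#-homo) (*-identityʳ p))) (trans (equation 1#) (*-identityˡ s′))
    p≢0 : p ≢ 0#
    p≢0 e = nonzero² e₁≢0 (cong₂ _,_ e p′≡0)
    θ≡id : ∀ x → θ x ≡ x
    θ≡id x = *-cancelˡ p≢0 (trans (equation x) (trans (*-comm x s′) (cong (_* x) (sym p≡s′))))

  -- inj₂ tt is the point at infinity, the line of e₁.
  slope : F² → F ⊎ ⊤
  slope (x , y) with y ≟ 0#
  ... | yes _ = inj₂ tt
  ... | no y≢0 = inj₁ (x * proj₁ (recip y≢0))

  private
    divide : ∀ {x y} (y≢0 : y ≢ 0#) → x * proj₁ (recip y≢0) * y ≡ x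
    divide {x} {y} y≢0 = trans (*-assoc x _ y) (trans (cong (x *_) (proj₂ (recip y≢0))) (*-identityʳ x))

  slope⇒∥ : ∀ {u v} → slope u ≡ slope v → u ∥ v
  slope⇒∥ {x , y} {x′ , y′} e with y ≟ 0# | y′ ≟ 0#
  slope⇒∥ {x , y} {x′ , y′} e | yes refl | yes refl = solve 2 (λ x x′ → x :* con 0₃ :- x′ :* con 0₃ := con 0₃) refl x x′
  slope⇒∥ {x , y} {x′ , y′} e | no y≢0 | no y′≢0 = trans (cong₂ (λ a b → a * y′ - b * y) (sym (divide y≢0)) (trans (sym (divide y′≢0)) (cong (_* y′) (sym (inj₁-injective e)))))
    (solve 3 (λ c y y′ → c :* y :* y′ :- c :* y′ :* y := con 0₃) refl (x * proj₁ (recip y≢0)) y y′)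
    where
    inj₁-injective : ∀ {a b : F} → _≡_ {A = F ⊎ ⊤} (inj₁ a) (inj₁ b) → a ≡ b
    inj₁-injective refl = refl

  ∥⇒slope : ∀ {u v} → u ≢ (0# , 0#) → v ≢ (0# , 0#) → u ∥ v → slope u ≡ slope v
  ∥⇒slope {x , y} {x′ , y′} u≢0 v≢0 e with y ≟ 0# | y′ ≟ 0#
  ... | yes _ | yes _ = refl
  ... | yes refl | no y′≢0 = contradiction (cong (_, 0#) (*-zero y′≢0 (trans (solve 3 (λ x x′ y′ → y′ :* x := x :* y′ :- x′ :* con 0₃) refl x x′ y′) e))) u≢0
  ... | no y≢0 | yes refl = contradiction (cong (_, 0#) (*-zero y≢0 (trans (solve 3 (λ x x′ y → y :* x′ := :- (x :* con 0₃ :- x′ :* y)) refl x x′ y) (trans (cong -_ e) -0#≈0#)))) v≢0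
  ... | no y≢0 | no y′≢0 = cong inj₁ (*-cancelˡ y≢0 (*-cancelˡ y′≢0 (begin
      y′ * (y * (x * k))     ≡⟨ solve 4 (λ y′ y x k → y′ :* (y :* (x :* k)) := x :* k :* y :* y′) refl y′ y x k ⟩
      x * k * y * y′         ≡⟨ cong (_* y′) (divide y≢0) ⟩
      x * y′                 ≡⟨ difference e ⟩
      x′ * y                 ≡⟨ cong (_* y) (divide y′≢0) ⟨
      x′ * k′ * y′ * y       ≡⟨ solve 4 (λ y′ y x k → x :* k :* y′ :* y := y′ :* (y :* (x :* k))) refl y′ y x′ k′ ⟩
      y′ * (y * (x′ * k′))   ∎)))
    where
    k = proj₁ (recip y≢0)
    k′ = proj₁ (recip y′≢0)

  slope-affine : ∀ x → slope (x , 1#) ≡ inj₁ x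
  slope-affine x with 1# ≟ 0#
  ... | yes e = contradiction e 1≢0
  ... | no 1≢0′ = cong inj₁ (trans (sym (*-identityʳ _)) (divide 1≢0′))

  slope-e₁ : slope e₁ ≡ inj₂ tt
  slope-e₁ with 0# ≟ 0#
  ... | yes _ = refl
  ... | no 0≢0 = contradiction refl 0≢0

module LocalStructure (r′ : ℕ) (𝔽 : FiniteField (3 ℕ.^ ℕ.suc r′)) (G : Group 0ℓ 0ℓ) (H₁ H₂ : Subgroup G) where
  open FieldTheory r′ 𝔽 hiding (_-_)
  open Permutations r′ 𝔽
  open Lines r′ 𝔽
  open CosetVertices G H₁ H₂ public
  open Group G renaming (refl to ≈-refl; sym to ≈-sym; trans to ≈-trans)
  open GroupProperties G
  open Subgroup
  open CosetGraph G (Member H₁) (Member H₂)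
  open Graph Δ
  open ActionOn action
  open GGraph action
  private module V = Setoid vertices

  -- H acts on F² modulo its normal subgroup of all k with lin k ≈ 1, and the
  -- neighbours of the vertex H correspond to the images of the line of base.
  record Linear (s : Bool) : Set where
    field
      base : F²
      base≢0 : base ≢ (0# , 0#)
      lin : ∀ k → k ∈ Member (H s) → Γ.Carrier
      lin-cong : ∀ k k′ m m′ → k ≈ k′ → lin k m Γ.≈ lin k′ m′
      lin-∙ : ∀ k k′ m m′ m″ → lin (k ∙ k′) m″ Γ.≈ lin k m Γ.∙ lin k′ m′
      meets⇒ : ∀ k m → k ∈ Member (H (not s)) → fun (lin k m) base ∥ base
      meets⇐ : ∀ k m → fun (lin k m) base ∥ base → k ∈ Member (H (not s))
      upper : ∀ k m → fun (lin k m) base ∥ base → Semilinear.p′ (lin k m) ≡ 0#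
      affine : ∀ x → ∃₂ λ k m → fun (lin k m) base ≡ (x , 1#)

  module Side {s : Bool} (L : Linear s) (h : Carrier) where
    open Linear L

    z : Vertex
    z = vertex s h

    conj : Carrier → Carrier
    conj g = h ∙ g ∙ h ⁻¹

    conj-cong : ∀ {g g′} → g ≈ g′ → conj g ≈ conj g′
    conj-cong e = ∙-congʳ (∙-congˡ e)

    conj-∙ : ∀ g g′ → conj (g ∙ g′) ≈ conj g ∙ conj g′
    conj-∙ g g′ = ≈-trans (∙-congʳ (≈-trans (≈-sym (assoc h g g′)) (∙-congʳ (≈-sym (//-rightDividesˡ h (h ∙ g))))))
      (≈-trans (∙-congʳ (assoc (h ∙ g ∙ h ⁻¹) h g′)) (assoc _ _ _))

    unconj : Carrier → Carrier
    unconj k = h ⁻¹ ∙ (k ∙ h)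

    conj-unconj : ∀ k → conj (unconj k) ≈ k
    conj-unconj k = ≈-trans (∙-congʳ (\\-leftDividesˡ h (k ∙ h))) (//-rightDividesʳ h k)

    unconj-conj : ∀ g → unconj (conj g) ≈ g
    unconj-conj g = ≈-trans (∙-congˡ (//-rightDividesˡ h (h ∙ g))) (\\-leftDividesʳ h g)

    conj-injective : ∀ {g g′} → conj g ≈ conj g′ → g ≈ g′
    conj-injective {g} {g′} e = ∙-cancelˡ h g g′ (∙-cancelʳ (h ⁻¹) _ _ e)

    Stab : Subgroup G
    Stab = stabiliser z

    stab⇒ : ∀ g → g ∈ Member Stab → conj g ∈ Member (H s)
    stab⇒ g e = vertex-≈⇒ s (subst (_≈ᵥ z) (vertex-· s h g) e)

    stab⇐ : ∀ g → conj g ∈ Member (H s) → g ∈ Member Stab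
    stab⇐ g m = subst (_≈ᵥ z) (sym (vertex-· s h g)) (vertex-≈⇐ s m)

    unconj∈ : ∀ k → k ∈ Member (H s) → conj (unconj k) ∈ Member (H s)
    unconj∈ k = resp (H s) (≈-sym (conj-unconj k))

    Stab≅ : group Stab ≅ group (H s)
    Stab≅ = mk≅ {group Stab} {group (H s)} (λ { (g , m) → conj g , stab⇒ g m }) conj-cong
      (λ { (g , _) (g′ , _) → conj-∙ g g′ }) conj-injective
      (λ { (k , m) → (unconj k , stab⇐ (unconj k) (unconj∈ k m)) , conj-unconj k })

    line : ∀ k → k ∈ Member (H s) → F²
    line k m = fun (lin k m) base

    line≢0 : ∀ k m → line k m ≢ (0# , 0#)
    line≢0 k m = Semilinear.nonzero² (lin k m) base≢0

    line-∙ : ∀ k k′ m m′ m″ → line (k ∙ k′) m″ ≡ fun (lin k′ m′) (line k m)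
    line-∙ k k′ m m′ m″ = lin-∙ k k′ m m′ m″ base

    line-cong : ∀ k k′ m m′ → k ≈ k′ → line k m ≡ line k′ m′
    line-cong k k′ m m′ e = lin-cong k k′ m m′ e base

    private
      //∈ : ∀ k k′ → k ∈ Member (H s) → k′ ∈ Member (H s) → k // k′ ∈ Member (H s)
      //∈ k k′ m m′ = ∙∈ (H s) m (⁻¹∈ (H s) m′)

      shifted : ∀ k k′ → (k ∙ h) // (k′ ∙ h) ≈ k // k′
      shifted k k′ = ≈-trans (∙-congˡ (⁻¹-anti-homo-∙ k′ h)) (≈-trans (≈-sym (assoc _ _ _)) (∙-congʳ (//-rightDividesʳ h k)))

      line-// : ∀ k k′ m m′ → fun (lin k′ m′) (line (k // k′) (//∈ k k′ m m′)) ≡ line k m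
      line-// k k′ m m′ = trans (sym (line-∙ (k // k′) k′ (//∈ k k′ m m′) m′ (∙∈ (H s) (//∈ k k′ m m′) m′)))
        (line-cong _ k _ m (//-rightDividesˡ k′ k))

    same⇒∥ : ∀ k k′ m m′ → vertex (not s) (k ∙ h) ≈ᵥ vertex (not s) (k′ ∙ h) → line k m ∥ line k′ m′
    same⇒∥ k k′ m m′ e = subst (_∥ line k′ m′) (line-// k k′ m m′) (∥-fun⁺ (lin k′ m′)
      (meets⇒ (k // k′) (//∈ k k′ m m′) (resp (H (not s)) (shifted k k′) (vertex-≈⇒ (not s) e))))

    ∥⇒same : ∀ k k′ m m′ → line k m ∥ line k′ m′ → vertex (not s) (k ∙ h) ≈ᵥ vertex (not s) (k′ ∙ h)
    ∥⇒same k k′ m m′ e = vertex-≈⇐ (not s) (resp (H (not s)) (≈-sym (shifted k k′)) (meets⇐ (k // k′) (//∈ k k′ m m′)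
      (∥-fun⁻ (lin k′ m′) (subst (_∥ line k′ m′) (sym (line-// k k′ m m′)) e))))

    neighbour-· : ∀ k g → vertex (not s) (k ∙ h) · g ≈ᵥ vertex (not s) (k ∙ conj g ∙ h)
    neighbour-· k g = V.trans (V.reflexive (vertex-· (not s) (k ∙ h) g)) (vertex-cong (not s)
      (≈-trans (assoc k h g) (≈-trans (∙-congˡ (≈-sym (//-rightDividesˡ h (h ∙ g)))) (≈-sym (assoc _ _ _)))))

    ℓ : ∀ g → g ∈ Member Stab → Γ.Carrier
    ℓ g m = lin (conj g) (stab⇒ g m)

    ℓ-cong : ∀ g g′ m m′ → g ≈ g′ → ℓ g m Γ.≈ ℓ g′ m′
    ℓ-cong g g′ m m′ e = lin-cong (conj g) (conj g′) _ _ (conj-cong e)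

    ℓ-∙ : ∀ g g′ m m′ m″ → ℓ (g ∙ g′) m″ Γ.≈ ℓ g m Γ.∙ ℓ g′ m′
    ℓ-∙ g g′ m m′ m″ = Γ.trans {ℓ (g ∙ g′) m″} {lin (conj g ∙ conj g′) c} {ℓ g m Γ.∙ ℓ g′ m′}
      (lin-cong (conj (g ∙ g′)) (conj g ∙ conj g′) _ c (conj-∙ g g′)) (lin-∙ (conj g) (conj g′) _ _ c)
      where c = ∙∈ (H s) (stab⇒ g m) (stab⇒ g′ m′)

    agree⇒ : ∀ g g′ m m′ → (∀ y → z ~ y → y · g ≈ᵥ y · g′) → ∀ k n → fun (ℓ g m) (line k n) ∥ fun (ℓ g′ m′) (line k n)
    agree⇒ g g′ m m′ agree k n = subst₂′ (line-∙ k (conj g) n (stab⇒ g m) kg) (line-∙ k (conj g′) n (stab⇒ g′ m′) kg′)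
      (same⇒∥ (k ∙ conj g) (k ∙ conj g′) kg kg′ (V.trans (V.sym (neighbour-· k g)) (V.trans (agree _ (neighbour⇐ s n)) (neighbour-· k g′))))
      where
      kg = ∙∈ (H s) n (stab⇒ g m)
      kg′ = ∙∈ (H s) n (stab⇒ g′ m′)
      subst₂′ : ∀ {u u′ v v′} → u ≡ u′ → v ≡ v′ → u ∥ v → u′ ∥ v′
      subst₂′ refl refl e = e

    agree⇐ : ∀ g g′ m m′ → (∀ v → fun (ℓ g m) v ∥ fun (ℓ g′ m′) v) → ∀ y → z ~ y → y · g ≈ᵥ y · g′
    agree⇐ g g′ m m′ agree y z~y with neighbour⇒ s z~y
    ... | k , n , y≈ = V.trans (·-cong y≈ ≈-refl) (V.trans (neighbour-· k g) (V.trans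
        (∥⇒same (k ∙ conj g) (k ∙ conj g′) kg kg′ (subst₂′ (line-∙ k (conj g) n (stab⇒ g m) kg) (line-∙ k (conj g′) n (stab⇒ g′ m′) kg′) (agree (line k n))))
        (V.sym (V.trans (·-cong y≈ ≈-refl) (neighbour-· k g′)))))
      where
      kg = ∙∈ (H s) n (stab⇒ g m)
      kg′ = ∙∈ (H s) n (stab⇒ g′ m′)
      subst₂′ : ∀ {u u′ v v′} → u ≡ u′ → v ≡ v′ → u′ ∥ v′ → u ∥ v
      subst₂′ refl refl e = e

    ℓ-ε : ∀ m → ℓ ε m Γ.≈ Γ.ε
    ℓ-ε m = GroupProperties.identityʳ-unique (group ΓL₂) (ℓ ε m) (ℓ ε m)
      (λ v → sym (trans (ℓ-cong ε (ε ∙ ε) m (∙∈ Stab {ε} {ε} m m) (≈-sym (identityˡ ε)) v)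
        (ℓ-∙ ε ε m m (∙∈ Stab {ε} {ε} m m) v)))

    line-ε : ∀ m → line ε m ∥ base
    line-ε m = meets⇒ ε m (ε∈ (H (not s)))

    agree⇒scalar : ∀ g m → (∀ y → z ~ y → y · g ≈ᵥ y) → IsScalar (ℓ g m)
    agree⇒scalar g m fixed = ∥⇒scalar (ℓ g m) (upper (conj g) (stab⇒ g m) (meets⇒ (conj g) (stab⇒ g m) at-base)) λ x →
        let k , n , e = affine x in subst (λ v → fun (ℓ g m) v ∥ v) e (fixes k n)
      where
      fixes : ∀ k n → fun (ℓ g m) (line k n) ∥ line k n
      fixes k n = subst (_∥ line k n) (line-∙ k (conj g) n (stab⇒ g m) (∙∈ (H s) n (stab⇒ g m)))
        (same⇒∥ (k ∙ conj g) k (∙∈ (H s) n (stab⇒ g m)) n (V.trans (V.sym (neighbour-· k g)) (fixed _ (neighbour⇐ s n))))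
      at-base : conj g ∈ Member (H (not s))
      at-base = resp (H (not s)) (≈-trans (∙-congˡ ε⁻¹≈ε) (identityʳ _)) (resp (H (not s)) (∙-congʳ (identityˡ (conj g)))
        (resp (H (not s)) (shifted (ε ∙ conj g) ε) (vertex-≈⇒ (not s) (V.trans (V.sym (neighbour-· ε g)) (fixed _ (neighbour⇐ s (ε∈ (H s))))))))

    scalar⇒kernel : ∀ g m → IsScalar (ℓ g m) → g ∈ Member (kernel z)
    scalar⇒kernel g m scalar = m , λ y z~y → V.trans (agree⇐ g ε m (ε∈ Stab) (λ v → ∥-trivial v) y z~y) (·-ε y)
      where
      ∥-trivial : ∀ v → fun (ℓ g m) v ∥ fun (ℓ ε (ε∈ Stab)) v
      ∥-trivial v = subst (fun (ℓ g m) v ∥_) (sym (ℓ-ε (ε∈ Stab) v)) (scalar⇒∥ (ℓ g m) scalar v)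

    kernel⇒scalar : ∀ g (m : g ∈ Member (kernel z)) → IsScalar (ℓ g (proj₁ m))
    kernel⇒scalar g (m , fixed) = agree⇒scalar g m fixed

module LocalGroups (r′ : ℕ) (𝔽 : FiniteField (3 ℕ.^ ℕ.suc r′)) (G : Group 0ℓ 0ℓ) (H₁ H₂ : Subgroup G) where
  open FieldTheory r′ 𝔽 hiding (_-_)
  open Permutations r′ 𝔽
  open Lines r′ 𝔽
  open Stabilisers r′ 𝔽 using (triangular; matrix-e₁; matrix-e₂; triangular-det)
  open LocalStructure r′ 𝔽 G H₁ H₂
  open Group G renaming (refl to ≈-refl; sym to ≈-sym; trans to ≈-trans)
  open GroupProperties G
  open Subgroup
  open CosetGraph G (Member H₁) (Member H₂)
  open Graph Δ
  open ActionOn action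
  open GGraph action
  private
    module V = Setoid vertices
    module ΓP = GroupProperties (group ΓL₂)

  Radical : ∀ {s} → Linear s → Pred Carrier 0ℓ
  Radical {s} L k = Σ (k ∈ Member (H s)) λ m → Linear.lin L k m Γ.≈ Γ.ε

  module Core {s : Bool} (L : Linear s) (h : Carrier) where
    open Side L h

    ℓ-⁻¹ : ∀ g m m′ → ℓ (g ⁻¹) m′ Γ.≈ ℓ g m Γ.⁻¹
    ℓ-⁻¹ g m m′ = ΓP.inverseʳ-unique (ℓ g m) (ℓ (g ⁻¹) m′) (λ v → trans (sym (ℓ-∙ g (g ⁻¹) m m′ (∙∈ Stab {g} {g ⁻¹} m m′) v))
      (trans (ℓ-cong (g ∙ g ⁻¹) ε (∙∈ Stab {g} {g ⁻¹} m m′) (ε∈ Stab) (inverseʳ g) v) (ℓ-ε (ε∈ Stab) v)))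

    ℓ-// : ∀ g g′ m m′ m″ → ℓ (g // g′) m″ Γ.≈ ℓ g m Γ.∙ ℓ g′ m′ Γ.⁻¹
    ℓ-// g g′ m m′ m″ v = trans (ℓ-∙ g (g′ ⁻¹) m (⁻¹∈ Stab {g′} m′) m″ v) (ℓ-⁻¹ g′ m′ (⁻¹∈ Stab {g′} m′) _)

    O : Subgroup G
    O = record
      { Member = λ g → Σ (g ∈ Member Stab) λ m → ℓ g m Γ.≈ Γ.ε
      ; resp = λ { {g} {g′} e (m , t) → resp Stab {g} {g′} e m , λ v → trans (ℓ-cong g′ g _ m (≈-sym e) v) (t v) }
      ; ε∈ = ε∈ Stab , ℓ-ε (ε∈ Stab)
      ; ∙∈ = λ { {g} {g′} (m , t) (m′ , t′) → ∙∈ Stab {g} {g′} m m′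
          , λ v → trans (ℓ-∙ g g′ m m′ _ v) (trans (t′ _) (t v)) }
      ; ⁻¹∈ = λ { {g} (m , t) → ⁻¹∈ Stab {g} m , λ v → trans (ℓ-⁻¹ g m _ v)
          (trans (sym (cong (Inverse.from (proj₁ (ℓ g m))) (t v))) (Inverse.strictlyInverseʳ (proj₁ (ℓ g m)) v)) }
      }

    O⇒Radical : ∀ g → g ∈ Member O → Radical L (conj g)
    O⇒Radical g (m , t) = stab⇒ g m , t

    Radical⇒O : ∀ g → Radical L (conj g) → g ∈ Member O
    Radical⇒O g (n , t) = stab⇐ g n , λ v → trans (Linear.lin-cong L (conj g) (conj g) _ n ≈-refl v) (t v)

    unconj∈O : ∀ k → Radical L k → unconj k ∈ Member O
    unconj∈O k (n , t) = Radical⇒O (unconj k) (unconj∈ k n , λ v → trans (Linear.lin-cong L (conj (unconj k)) k _ n (conj-unconj k) v) (t v))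

    O-scalar : ∀ g (o : g ∈ Member O) → IsScalar (ℓ g (proj₁ o))
    O-scalar g (m , t) v = trans (t v) (sym (trans (cong (_• v) (cong proj₁ (t e₁))) (cong₂ _,_ (*-identityˡ _) (*-identityˡ _))))

    O⊴Stab : ∀ {g k} → g ∈ Member Stab → k ∈ Member O → g ⁻¹ ∙ k ∙ g ∈ Member O
    O⊴Stab {g} {k} m (n , t) = ∙∈ Stab {g ⁻¹ ∙ k} {g} (∙∈ Stab {g ⁻¹} {k} g⁻¹ n) m , λ v →
        trans (ℓ-∙ (g ⁻¹ ∙ k) g (∙∈ Stab {g ⁻¹} {k} g⁻¹ n) m _ v)
          (trans (cong (fun (ℓ g m)) (trans (ℓ-∙ (g ⁻¹) k g⁻¹ n (∙∈ Stab {g ⁻¹} {k} g⁻¹ n) v) (trans (t _) (ℓ-⁻¹ g m g⁻¹ v))))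
            (Inverse.strictlyInverseˡ (proj₁ (ℓ g m)) v))
      where
      g⁻¹ = ⁻¹∈ Stab {g} m

    -- A normal 3-subgroup of the kernel acts on F² by scalars. The product of
    -- all these scalars is multiplied by c^(3^n) when the subgroup is
    -- translated by an element with scalar c, so c^(3^n) = 1 and c = 1.
    largest : ∀ P → P ⊴ kernel z → IsPGroup 3 P → P ≤ₛ O
    largest P (P≤ , _) (n , c) {g} g∈ = proj₁ (P≤ g∈) , λ v →
        trans (kernel⇒scalar g (P≤ g∈) v) (trans (cong (_• v) (frob-injective n (trans (trans (frob≡^ n _) power≡1) (sym (Aut.1#-homo (frob-aut n))))))
          (cong₂ _,_ (*-identityˡ _) (*-identityˡ _)))
      where
      module P = Group (group P)
      ℓᴾ : P.Carrier → Γ.Carrier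
      ℓᴾ (x , x∈) = ℓ x (proj₁ (P≤ x∈))
      a : P.Carrier → F
      a x = Semilinear.p (ℓᴾ x)

      a-∙ : ∀ x y → a (x P.∙ y) ≡ a x * a y
      a-∙ x@(x₁ , x∈) y@(y₁ , y∈) = begin
        proj₁ (fun (ℓᴾ (x P.∙ y)) e₁)     ≡⟨ cong proj₁ (ℓ-∙ x₁ y₁ (proj₁ (P≤ x∈)) (proj₁ (P≤ y∈)) (proj₁ (P≤ (∙∈ P x∈ y∈))) e₁) ⟩
        proj₁ (fun (ℓᴾ y) (fun (ℓᴾ x) e₁)) ≡⟨ cong (proj₁ ∘ fun (ℓᴾ y)) (kernel⇒scalar x₁ (P≤ x∈) e₁) ⟩
        proj₁ (fun (ℓᴾ y) (a x • e₁))     ≡⟨ cong proj₁ (kernel⇒scalar y₁ (P≤ y∈) (a x • e₁)) ⟩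
        a y * (a x * 1#)                  ≡⟨ cong (a y *_) (*-identityʳ (a x)) ⟩
        a y * a x                         ≡⟨ *-comm _ _ ⟩
        a x * a y                         ∎
        where open ≡.≡-Reasoning

      a-cong : ∀ {x y} → x P.≈ y → a x ≡ a y
      a-cong {x , x∈} {y , y∈} e = cong proj₁ (ℓ-cong x y (proj₁ (P≤ x∈)) (proj₁ (P≤ y∈)) e e₁)

      Πa : F
      Πa = Π (a ∘ Inverse.from c)

      Πa≢0 : Πa ≢ 0#
      Πa≢0 = product≢0 (a ∘ Inverse.from c) (λ i → let x , x∈ = Inverse.from c i in scalar-nonzero (ℓ x (proj₁ (P≤ x∈))) (kernel⇒scalar x (P≤ x∈)))

      power≡1 : a (g , g∈) ^ (3 ℕ.^ n) ≡ 1#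
      power≡1 = *-cancelˡ Πa≢0 (trans (*-comm Πa _) (trans (sym (sum-shift *-commutativeMonoid (a ∘ Inverse.from c) (translation {group P} c (g , g∈)) (a (g , g∈))
        (λ i → trans (a-cong {Inverse.from c (Inverse.to c ((g , g∈) P.∙ Inverse.from c i))} {(g , g∈) P.∙ Inverse.from c i} (Inverse.strictlyInverseʳ c _)) (a-∙ (g , g∈) (Inverse.from c i))))) (sym (*-identityʳ Πa))))

    radical-inverse : Inverse (order (group O)) (subsetoid setoid (Radical L))
    radical-inverse = record
      { to = λ { (g , o) → conj g , O⇒Radical g o }
      ; from = λ { (k , ρ) → unconj k , unconj∈O k ρ }
      ; to-cong = conj-cong
      ; from-cong = λ e → ∙-congˡ (∙-congʳ e)
      ; inverse = (λ {k} e → ≈-trans (conj-cong e) (conj-unconj (proj₁ k))) , (λ {g} e → ≈-trans (∙-congˡ (∙-congʳ e)) (unconj-conj (proj₁ g)))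
      }

    isPCore : ∀ {n} → ∣ subsetoid setoid (Radical L) ∣≡ (3 ℕ.^ n) → IsPCore 3 (kernel z) O
    isPCore {n} c = record
      { normal = (λ {g} o → scalar⇒kernel g (proj₁ o) (O-scalar g o)) , λ {g} {k} m o → O⊴Stab {g} {k} (proj₁ m) o
      ; isP = n , ∣∣-via radical-inverse c
      ; largest = largest
      }

    SelfCentralising : Set
    SelfCentralising = ∀ k → k ∈ Member (H s) → (∀ o → Radical L o → k ∙ o ≈ o ∙ k) → Radical L k

    centraliser⊆O : SelfCentralising → centraliser Stab O ⊆ Member O
    centraliser⊆O self {g} (m , commutes) = Radical⇒O g (self (conj g) (stab⇒ g m) λ o ρ →
      ≈-trans (∙-congˡ (≈-sym (conj-unconj o))) (≈-trans (≈-sym (conj-∙ g (unconj o)))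
        (≈-trans (conj-cong (commutes {unconj o} (unconj∈O o ρ))) (≈-trans (conj-∙ (unconj o) g) (∙-congʳ (conj-unconj o))))))

    count : ∀ {X : Set} {n} → ∣ ≡.setoid X ∣≡ n → (code : ∀ k → k ∈ Member (H s) → X) →
            (∀ k k′ m m′ → line k m ∥ line k′ m′ → code k m ≡ code k′ m′) →
            (∀ k k′ m m′ → code k m ≡ code k′ m′ → line k m ∥ line k′ m′) →
            (∀ x → ∃₂ λ k m → code k m ≡ x) → ∣ neighbours z ∣≡ n
    count {X} c code ∥⇒code code⇒∥ surjective = ∣∣-via {neighbours z} {≡.setoid X} coded c
      where
      at : ∀ {y} → z ~ y → ∃ λ k → k ∈ Member (H s) × y ≈ᵥ vertex (not s) (k ∙ h)
      at = neighbour⇒ s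
      codeAt : Setoid.Carrier (neighbours z) → X
      codeAt (y , a) = code (proj₁ (at {y} a)) (proj₁ (proj₂ (at {y} a)))
      decode : X → Setoid.Carrier (neighbours z)
      decode x = vertex (not s) (proj₁ (surjective x) ∙ h) , neighbour⇐ s (proj₁ (proj₂ (surjective x)))
      codeAt-cong : ∀ {u v} → proj₁ u ≈ᵥ proj₁ v → codeAt u ≡ codeAt v
      codeAt-cong {u , a} {v , b} e = ∥⇒code _ _ _ _ (same⇒∥ _ _ _ _ (V.trans (V.sym (proj₂ (proj₂ (at {u} a)))) (V.trans e (proj₂ (proj₂ (at {v} b))))))
      codeAt-decode : ∀ x → codeAt (decode x) ≡ x
      codeAt-decode x = trans (∥⇒code _ _ _ _ (same⇒∥ _ _ _ _ (V.sym (proj₂ (proj₂ (at {proj₁ (decode x)} (proj₂ (decode x)))))))) (proj₂ (proj₂ (surjective x)))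
      decode-codeAt : ∀ u → proj₁ (decode (codeAt u)) ≈ᵥ proj₁ u
      decode-codeAt (u , a) = V.trans (∥⇒same _ _ _ _ (code⇒∥ _ _ _ _ (proj₂ (proj₂ (surjective (codeAt (u , a))))))) (V.sym (proj₂ (proj₂ (at {u} a))))
      coded : Inverse (neighbours z) (≡.setoid X)
      coded = record
        { to = codeAt ; from = decode ; to-cong = λ {u} {v} → codeAt-cong {u} {v} ; from-cong = λ { refl → V.refl }
        ; inverse = (λ {x} {u} e → trans (codeAt-cong {u} {decode x} e) (codeAt-decode x))
                  , λ { {u} refl → decode-codeAt u }
        }

    private
      fixes-// : ∀ g g′ → (∀ y → z ~ y → y · g ≈ᵥ y · g′) → ∀ y → z ~ y → y · (g // g′) ≈ᵥ y
      fixes-// g g′ agree y z~y = V.trans (·-∙ y g (g′ ⁻¹)) (V.trans (·-cong (agree y z~y) ≈-refl)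
        (V.trans (V.sym (·-∙ y g′ (g′ ⁻¹))) (V.trans (·-cong (V.refl {y}) (inverseʳ g′)) (·-ε y))))

      equal-mod-scalars : ∀ f f′ → f Γ.≈ f′ → Group._≈_ PΓL₂ f f′
      equal-mod-scalars f f′ e = 1# , 1≢0 , λ v → trans (cong (Inverse.from (proj₁ f′)) (e v))
        (trans (Inverse.strictlyInverseʳ (proj₁ f′) v) (sym (cong₂ _,_ (*-identityˡ _) (*-identityˡ _))))

    agree⇒scalar-// : ∀ g g′ m m′ → (∀ y → z ~ y → y · g ≈ᵥ y · g′) → IsScalar (ℓ g m Γ.∙ ℓ g′ m′ Γ.⁻¹)
    agree⇒scalar-// g g′ m m′ agree v = trans (sym (ℓ-// g g′ m m′ n v)) (trans (agree⇒scalar (g // g′) n (fixes-// g g′ agree) v)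
      (cong (_• v) (cong proj₁ (ℓ-// g g′ m m′ n e₁))))
      where n = ∙∈ Stab {g} {g′ ⁻¹} m (⁻¹∈ Stab {g′} m′)

    scalar-//⇒agree : ∀ g g′ m m′ → (∃ λ c → ∀ v → fun (ℓ g m Γ.∙ ℓ g′ m′ Γ.⁻¹) v ≡ c • v) → ∀ y → z ~ y → y · g ≈ᵥ y · g′
    scalar-//⇒agree g g′ m m′ (c , scalar) = agree⇐ g g′ m m′ λ v → ∥-multiply (ℓ g m) (ℓ g′ m′) (trans (cong (λ w → det w v) (scalar v))
      (solve 3 (λ p x y → p :* x :* y :- x :* (p :* y) := con 0₃) refl c (proj₁ v) (proj₂ v)))

    localGroup≅PΓL₂ : (∀ f → ∃₂ λ k m → Linear.lin L k m Γ.≈ f) → localGroup z ≅ PΓL₂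
    localGroup≅PΓL₂ onto = mk≅ {localGroup z} {PΓL₂} (λ { (g , m) → ℓ g m })
      (λ { {g , m} {g′ , m′} agree → let sc = agree⇒scalar-// g g′ m m′ agree in _ , scalar-nonzero (ℓ g m Γ.∙ ℓ g′ m′ Γ.⁻¹) sc , sc })
      (λ { (g , m) (g′ , m′) → equal-mod-scalars (ℓ (g ∙ g′) (∙∈ Stab {g} {g′} m m′)) (ℓ g m Γ.∙ ℓ g′ m′) (ℓ-∙ g g′ m m′ (∙∈ Stab {g} {g′} m m′)) })
      (λ { {g , m} {g′ , m′} (c , _ , sc) → scalar-//⇒agree g g′ m m′ (c , sc) })
      (λ f → let k , n , e = onto f in (unconj k , stab⇐ (unconj k) (unconj∈ k n))
        , equal-mod-scalars (ℓ (unconj k) (stab⇐ (unconj k) (unconj∈ k n))) f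
            (λ v → trans (Linear.lin-cong L (conj (unconj k)) k _ n (conj-unconj k) v) (e v)))

  affineAct : UT.Carrier → F → F
  affineAct f x = (p * θ x + s) * proj₁ (recip s′≢0)
    where open Triangular f

  private
    affine-equation : ∀ f x → affineAct f x * Triangular.s′ f ≡ Triangular.p f * Triangular.θ f x + Triangular.s f
    affine-equation f x = trans (*-assoc _ _ _) (trans (cong ((p * θ x + s) *_) (proj₂ (recip s′≢0))) (*-identityʳ _))
      where open Triangular f

    affine-unique : ∀ f x y → y * Triangular.s′ f ≡ Triangular.p f * Triangular.θ f x + Triangular.s f → affineAct f x ≡ y
    affine-unique f x y e = *-cancelˡ s′≢0 (trans (*-comm s′ _) (trans (affine-equation f x) (trans (sym e) (*-comm y s′))))
      where open Triangular f

    fun-affine : ∀ f x → fun (UT⇒Γ f) (x , 1#) ≡ (affineAct f x * Triangular.s′ f , Triangular.s′ f)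
    fun-affine f x = trans (formula′ x 1#) (cong₂ _,_
      (trans (cong (λ t → p * θ x + s * t) 1#-homo) (trans (cong (p * θ x +_) (*-identityʳ s)) (sym (affine-equation f x))))
      (trans (cong (s′ *_) 1#-homo) (*-identityʳ s′)))
      where open Triangular f

  affine-∥⇒≡ : ∀ f f′ x x′ → fun (UT⇒Γ f) (x , 1#) ∥ fun (UT⇒Γ f′) (x′ , 1#) → affineAct f x ≡ affineAct f′ x′
  affine-∥⇒≡ f f′ x x′ e = *-cancelˡ (*-nonzero (Triangular.s′≢0 f) (Triangular.s′≢0 f′)) (difference (trans
    (solve 4 (λ a b u v → u :* v :* a :+ :- (u :* v :* b) := a :* u :* v :- b :* v :* u) refl (affineAct f x) (affineAct f′ x′) (Triangular.s′ f) (Triangular.s′ f′))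
    (trans (sym (cong₂ det (fun-affine f x) (fun-affine f′ x′))) e)))

  affine-≡⇒∥ : ∀ f f′ x x′ → affineAct f x ≡ affineAct f′ x′ → fun (UT⇒Γ f) (x , 1#) ∥ fun (UT⇒Γ f′) (x′ , 1#)
  affine-≡⇒∥ f f′ x x′ e = trans (cong₂ det (fun-affine f x) (trans (fun-affine f′ x′) (cong (λ a → a * Triangular.s′ f′ , Triangular.s′ f′) (sym e))))
    (solve 3 (λ a u v → a :* u :* v :- a :* v :* u := con 0₃) refl (affineAct f x) (Triangular.s′ f) (Triangular.s′ f′))

  private
    ∥-refl : ∀ v → v ∥ v
    ∥-refl (x , y) = solve 2 (λ x y → x :* y :- x :* y := con 0₃) refl x y

  affines : Acts (group UT) F
  affines = record
    { act = affineAct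
    ; act-cong = λ {f} {g} e x → affine-∥⇒≡ f g x x (subst (_∥ fun (UT⇒Γ g) (x , 1#)) (sym (e (x , 1#))) (∥-refl (fun (UT⇒Γ g) (x , 1#))))
    ; act-ε = λ x → affine-unique UT.ε x x (solve 1 (λ x → x :* con 1₃ := con 1₃ :* x :+ con 0₃) refl x)
    ; act-∙ = λ f g x → affine-∥⇒≡ (f UT.∙ g) g x (affineAct f x) (∥-fun⁺ (UT⇒Γ g) (subst (_∥ (affineAct f x , 1#)) (sym (fun-affine f x))
        (solve 2 (λ y s → y :* s :* con 1₃ :- y :* s := con 0₃) refl (affineAct f x) (Triangular.s′ f))))
    }

  affine∈AΓL₁ : ∀ f → Acts.perm affines f ∈ Member AΓL₁
  affine∈AΓL₁ f = p * k , s * k , θ , *-nonzero p≢0 (factorˡ≢0 (λ e → 1≢0 (trans (sym (proj₂ (recip s′≢0))) e))) , aut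
      , λ x → solve 4 (λ p t s k → (p :* t :+ s) :* k := p :* k :* t :+ s :* k) refl p (θ x) s k
    where
    open Triangular f
    k = proj₁ (recip s′≢0)

  module Borel {s : Bool} (L : Linear s) (h : Carrier) (base≡e₂ : Linear.base L ≡ e₂)
               (lower≡0 : ∀ k m → Semilinear.p′ (Linear.lin L k m) ≡ 0#)
               (onto : ∀ f → ∃₂ λ k m → Linear.lin L k m Γ.≈ UT⇒Γ f) where
    open Side L h
    open Core L h

    linᵁ : ∀ k → k ∈ Member (H s) → UT.Carrier
    linᵁ k m = proj₁ (Linear.lin L k m) , proj₂ (Linear.lin L k m) , lower≡0 k m

    private
      ℓᵁ : ∀ g → g ∈ Member Stab → UT.Carrier
      ℓᵁ g m = linᵁ (conj g) (stab⇒ g m)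

      line≡ : ∀ k m → line k m ≡ fun (UT⇒Γ (linᵁ k m)) (0# , 1#)
      line≡ k m = cong (fun (Linear.lin L k m)) base≡e₂

    count-affine : ∀ {n} → ∣ ≡.setoid F ∣≡ n → ∣ neighbours z ∣≡ n
    count-affine c = count c (λ k m → affineAct (linᵁ k m) 0#)
      (λ k k′ m m′ e → affine-∥⇒≡ (linᵁ k m) (linᵁ k′ m′) 0# 0# (subst (_∥ fun (UT⇒Γ (linᵁ k′ m′)) (0# , 1#)) (line≡ k m) (subst (line k m ∥_) (line≡ k′ m′) e)))
      (λ k k′ m m′ e → subst (_∥ line k′ m′) (sym (line≡ k m)) (subst (fun (UT⇒Γ (linᵁ k m)) (0# , 1#) ∥_) (sym (line≡ k′ m′)) (affine-≡⇒∥ (linᵁ k m) (linᵁ k′ m′) 0# 0# e)))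
      λ x → let k , m , e = Linear.affine L x in k , m
        , trans (affine-∥⇒≡ (linᵁ k m) UT.ε 0# x (subst (_∥ (x , 1#)) (sym (trans (sym (line≡ k m)) e)) (∥-refl (x , 1#)))) (Acts.act-ε affines x)

    private
      agree⇒affine : ∀ g g′ m m′ → (∀ y → z ~ y → y · g ≈ᵥ y · g′) → ∀ x → affineAct (ℓᵁ g m) x ≡ affineAct (ℓᵁ g′ m′) x
      agree⇒affine g g′ m m′ agree x = let k , n , e = Linear.affine L x in
        affine-∥⇒≡ (ℓᵁ g m) (ℓᵁ g′ m′) x x (subst (λ v → fun (ℓ g m) v ∥ fun (ℓ g′ m′) v) e (agree⇒ g g′ m m′ agree k n))

      affine⇒agree : ∀ g g′ m m′ → (∀ x → affineAct (ℓᵁ g m) x ≡ affineAct (ℓᵁ g′ m′) x) → ∀ y → z ~ y → y · g ≈ᵥ y · g′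
      affine⇒agree g g′ m m′ e = scalar-//⇒agree g g′ m m′ (_ , ∥⇒scalar (ℓ g m Γ.∙ ℓ g′ m′ Γ.⁻¹)
        (proj₂ (proj₂ (ℓᵁ g m UT.∙ ℓᵁ g′ m′ UT.⁻¹)))
        (λ x → ∥-divide (ℓ g m) (ℓ g′ m′) (affine-≡⇒∥ (ℓᵁ g m) (ℓᵁ g′ m′) x x (e x))))

    localGroup≅AΓL₁ : localGroup z ≅ group AΓL₁
    localGroup≅AΓL₁ = mk≅ {localGroup z} {group AΓL₁} (λ { (g , m) → Acts.perm affines (ℓᵁ g m) , affine∈AΓL₁ (ℓᵁ g m) })
      (λ { {g , m} {g′ , m′} → agree⇒affine g g′ m m′ })
      (λ { (g , m) (g′ , m′) x → trans (Acts.act-cong affines {ℓᵁ (g ∙ g′) (∙∈ Stab {g} {g′} m m′)} {ℓᵁ g m UT.∙ ℓᵁ g′ m′} (ℓ-∙ g g′ m m′ (∙∈ Stab {g} {g′} m m′)) x)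
          (Acts.act-∙ affines (ℓᵁ g m) (ℓᵁ g′ m′) x) })
      (λ { {g , m} {g′ , m′} → affine⇒agree g g′ m m′ })
      (λ { (π , a , b , θ , a≢0 , aut , π≡) →
          let a1≢0 = λ e → a≢0 (trans (sym (*-identityʳ a)) e)
              f = triangular aut a b 1# a1≢0
              k , n , e = onto f
              m = stab⇐ (unconj k) (unconj∈ k n)
          in (unconj k , m) , λ x → trans
              (Acts.act-cong affines {ℓᵁ (unconj k) m} {f} (λ v → trans (Linear.lin-cong L (conj (unconj k)) k _ n (conj-unconj k) v) (e v)) x)
              (trans (affine-unique f x (a * θ x + b) (trans (cong ((a * θ x + b) *_) (cong proj₂ (matrix-e₂ aut a b 0# 1# (triangular-det a b 1# a1≢0))))
                (trans (*-identityʳ _) (cong₂ (λ u v → u * θ x + v) (sym (cong proj₁ (matrix-e₁ aut a b 0# 1# (triangular-det a b 1# a1≢0)))) (sym (cong proj₁ (matrix-e₂ aut a b 0# 1# (triangular-det a b 1# a1≢0))))))))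
                (sym (π≡ x))) })

  module Projective {s : Bool} (L : Linear s) (h : Carrier) (base≡e₁ : Linear.base L ≡ e₁) where
    open Side L h
    open Core L h

    private
      one : ∣ ≡.setoid ⊤ ∣≡ 1
      one = record { to = λ _ → zero ; from = λ _ → tt ; to-cong = λ _ → refl ; from-cong = λ _ → refl
                   ; inverse = (λ { {zero} _ → refl }) , λ _ → refl }

      points : Inverse (≡.setoid (F ⊎ ⊤)) (≡.setoid F ⊎ₛ ≡.setoid ⊤)
      points = record { to = id ; from = id ; to-cong = λ { refl → Setoid.refl (≡.setoid F ⊎ₛ ≡.setoid ⊤) } ; from-cong = back
                      ; inverse = (λ { refl → Setoid.refl (≡.setoid F ⊎ₛ ≡.setoid ⊤) }) , back }
        where
        back : ∀ {u v} → Setoid._≈_ (≡.setoid F ⊎ₛ ≡.setoid ⊤) u v → u ≡ v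
        back (Sum.inj₁ refl) = refl
        back (Sum.inj₂ refl) = refl

    count-projective : ∣ neighbours z ∣≡ (q ℕ.+ 1)
    count-projective = count (∣∣-via points (cardinality ⊎-∣∣ one)) (λ k m → slope (line k m))
      (λ k k′ m m′ → ∥⇒slope (line≢0 k m) (line≢0 k′ m′)) (λ k k′ m m′ → slope⇒∥ {line k m} {line k′ m′})
      λ { (inj₁ x) → let k , m , e = Linear.affine L x in k , m , trans (cong slope e) (slope-affine x)
        ; (inj₂ tt) → ε , ε∈ (H s) , trans (∥⇒slope (line≢0 ε (ε∈ (H s))) e₁≢0 (subst (line ε (ε∈ (H s)) ∥_) base≡e₁ (line-ε (ε∈ (H s))))) slope-e₁ }

module Amalgam (r′ : ℕ) (𝔽 : FiniteField (3 ℕ.^ ℕ.suc r′)) where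
  open FieldTheory r′ 𝔽
  open Permutations r′ 𝔽
  open Stabilisers r′ 𝔽
  open Products r′ 𝔽
  open Lines r′ 𝔽
  open Construction 𝔽 using (Ω; Perm; G₁; G₂)
  open ≡.≡-Reasoning

  𝐆 : Group 0ℓ 0ℓ
  𝐆 = Construction.G 𝔽

  private
    module 𝐆 = Group 𝐆
    module P = Group (Sym Ω)

  H₁ H₂ : Subgroup 𝐆
  H₁ = record
    { Member = λ g → proj₁ g ∈ G₁
    ; resp = λ {g} {h} e m → 𝒢₁⊆G₁ {proj₁ h} (Subgroup.resp F₁.image {proj₁ g} {proj₁ h} e (G₁⊆𝒢₁ {proj₁ g} m))
    ; ε∈ = 𝒢₁⊆G₁ {P.ε} (Subgroup.ε∈ F₁.image)
    ; ∙∈ = λ {g} {h} m n → 𝒢₁⊆G₁ {proj₁ g P.∙ proj₁ h} (Subgroup.∙∈ F₁.image {proj₁ g} {proj₁ h} (G₁⊆𝒢₁ {proj₁ g} m) (G₁⊆𝒢₁ {proj₁ h} n))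
    ; ⁻¹∈ = λ {g} m → 𝒢₁⊆G₁ {proj₁ g P.⁻¹} (Subgroup.⁻¹∈ F₁.image {proj₁ g} (G₁⊆𝒢₁ {proj₁ g} m))
    }
  H₂ = record
    { Member = λ g → proj₁ g ∈ G₂
    ; resp = λ {g} {h} e m → 𝒢₂⊆G₂ {proj₁ h} (Subgroup.resp F₂.image {proj₁ g} {proj₁ h} e (G₂⊆𝒢₂ {proj₁ g} m))
    ; ε∈ = 𝒢₂⊆G₂ {P.ε} (Subgroup.ε∈ F₂.image)
    ; ∙∈ = λ {g} {h} m n → 𝒢₂⊆G₂ {proj₁ g P.∙ proj₁ h} (Subgroup.∙∈ F₂.image {proj₁ g} {proj₁ h} (G₂⊆𝒢₂ {proj₁ g} m) (G₂⊆𝒢₂ {proj₁ h} n))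
    ; ⁻¹∈ = λ {g} m → 𝒢₂⊆G₂ {proj₁ g P.⁻¹} (Subgroup.⁻¹∈ F₂.image {proj₁ g} (G₂⊆𝒢₂ {proj₁ g} m))
    }

  open Subsets (Sym Ω) using (gen)

  element₁ : ∀ g → g ∈ Subgroup.Member F₁.image → 𝐆.Carrier
  element₁ g m = g , gen {x = g} (inj₁ (𝒢₁⊆G₁ {g} m))

  element₂ : ∀ g → g ∈ Subgroup.Member F₂.image → 𝐆.Carrier
  element₂ g m = g , gen {x = g} (inj₂ (𝒢₂⊆G₂ {g} m))

  open LocalStructure r′ 𝔽 𝐆 H₁ H₂ public

  private
    left-zero : ∀ a b → a * 0# - 1# * b ≡ 0# → b ≡ 0#
    left-zero a b e = trans (solve 2 (λ a b → b := :- (a :* con 0₃ :- con 1₃ :* b)) refl a b) (trans (cong -_ e) -0#≈0#)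

    cancelʳ : ∀ {x y z} → x + z ≡ y + z → x ≡ y
    cancelʳ {x} {y} {z} e = trans (solve 2 (λ x z → x := x :+ z :- z) refl x z) (trans (cong (_- z) e) (solve 2 (λ y z → y :+ z :- z := y) refl y z))

    -- The second coordinate of an element of G₂ does not depend on the first one.
    meets₁⇒ : ∀ (g : Perm) (m : g ∈ Subgroup.Member F₁.image) → g ∈ Subgroup.Member F₂.image → fun (proj₁ m) e₁ ∥ e₁
    meets₁⇒ g (f , (u , v , w) , e) (f₂ , (n , d , x , y) , e₂) = trans (cong (λ z → p * 0# - 1# * z) p′≡0) (solve 1 (λ a → a :* con 0₃ :- con 1₃ :* con 0₃ := con 0₃) refl p)
      where
      open Semilinear f
      second : Ω → F
      second z = proj₁ (proj₂ z)
      p′≡0 : p′ ≡ 0#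
      p′≡0 = trans (cancelʳ {p′} {proj₂ (fun f (0# , 0#))} {v} (trans (sym (cong second (e (1# , 0# , 0#)))) (trans (cong second (e₂ (1# , 0# , 0#)))
        (trans (sym (cong second (e₂ (0# , 0# , 0#)))) (cong second (e (0# , 0# , 0#))))))) (cong proj₂ zero-fixed)

    meets₁⇐ : ∀ (g : Perm) (m : g ∈ Subgroup.Member F₁.image) → fun (proj₁ m) e₁ ∥ e₁ → g ∈ Subgroup.Member F₂.image
    meets₁⇐ g (f , (u , v , w) , e) upper = triangular aut (p * k) 0# s′ pks′≢0 , (w , s * k , u , v) , λ { (a , b , c) → trans (e (a , b , c)) (sym (equal a b c)) }
      where
      fᵁ : UT.Carrier
      fᵁ = proj₁ f , proj₂ f , left-zero _ _ upper
      open Triangular fᵁ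
      k = proj₁ (recip s′≢0)
      ks′≡1 = proj₂ (recip s′≢0)
      pks′ : p * k * s′ ≡ p
      pks′ = trans (*-assoc p k s′) (trans (cong (p *_) ks′≡1) (*-identityʳ p))
      pks′≢0 : p * k * s′ ≢ 0#
      pks′≢0 z = p≢0 (trans (sym pks′) z)
      equal : ∀ a b c → unipotent (w , s * k , u , v) (twist (triangular aut (p * k) 0# s′ pks′≢0) (a , b , c)) ≡ lift f (a , b , c) ⊞ (u , v , w)
      equal a b c = trans (cong (unipotent (w , s * k , u , v)) (twist-triangular aut (p * k) 0# s′ pks′≢0 a b c)) (triple≡
        (cong (_+ u) (begin
          p * k * s′ * θ a + 0# * s′ * θ b ^ 2 + root 0# * root (p * k) ^ 2 * s′ * θ c + s * k * (s′ * θ b)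
            ≡⟨ cong₂ (λ y z → y * θ a + 0# * s′ * θ b ^ 2 + z * root (p * k) ^ 2 * s′ * θ c + s * k * (s′ * θ b)) pks′ (Aut.0#-homo (frob-aut r′)) ⟩
          p * θ a + 0# * s′ * θ b ^ 2 + 0# * root (p * k) ^ 2 * s′ * θ c + s * k * (s′ * θ b)
            ≡⟨ modulo (s * θ b) ks′≡1 (solve 8 (λ p s s′ k R a b c → p :* a :+ con 0₃ :* s′ :* b :^ 2 :+ con 0₃ :* R :^ 2 :* s′ :* c :+ s :* k :* (s′ :* b)
                 := p :* a :+ s :* b :+ s :* b :* (k :* s′ :- con 1₃)) refl p s s′ k (root (p * k)) (θ a) (θ b) (θ c)) ⟩
          p * θ a + s * θ b  ≡⟨ cong proj₁ (formula′ a b) ⟨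
          proj₁ (fun f (a , b)) ∎))
        (cong (_+ v) (sym (cong proj₂ (formula′ a b))))
        (cong (λ z → ρ z * θ c + w) (trans (solve 3 (λ p k s′ → p :* k :* s′ :^ 2 := p :* k :* s′ :* s′) refl p k s′) (trans (cong (_* s′) pks′) (sym diagonal)))))

    -- An element of G₁ is affine, so the coefficient of b² in its first coordinate vanishes.
    meets₂⇒ : ∀ (g : Perm) (m : g ∈ Subgroup.Member F₂.image) → g ∈ Subgroup.Member F₁.image → fun (UT⇒Γ (proj₁ m)) e₂ ∥ e₂
    meets₂⇒ g (f , (n , d , x , y) , e) (f₁ , (u , v , w) , e′) = trans (cong (λ z → z * 1# - 0# * s′) s≡0) (solve 1 (λ t → con 0₃ :* con 1₃ :- con 0₃ :* t := con 0₃) refl s′)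
      where
      open Triangular f
      module A = Semilinear f₁
      value : ∀ t → A.s * ⟦ t ⟧₃ + u ≡ S ^ 3 * M ^ 3 * ⟦ t ⟧₃ ^ 2 + d * (M ^ 3 * ⟦ t ⟧₃) + x
      value t = begin
        A.s * b + u  ≡⟨ cong (_+ u) (solve 3 (λ p s b → s :* b := p :* con 0₃ :+ s :* b) refl A.p A.s b) ⟩
        A.p * 0# + A.s * b + u  ≡⟨ cong₂ (λ y z → A.p * y + A.s * z + u) (A.0#-homo) (A.coefficient t) ⟨
        A.p * A.θ 0# + A.s * A.θ b + u  ≡⟨ cong (λ z → proj₁ z + u) (A.formula 0# b) ⟨
        proj₁ (fun f₁ (0# , b)) + u   ≡⟨ trans (sym (cong proj₁ (e′ (0# , b , 0#)))) (cong proj₁ (e (0# , b , 0#))) ⟩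
        proj₁ (unipotent (n , d , x , y) (twisted L M S (θ 0# , θ b , θ 0#)))
          ≡⟨ cong₂ (λ z₁ z₂ → proj₁ (unipotent (n , d , x , y) (twisted L M S (z₁ , z₂ , z₁)))) 0#-homo (coefficient t) ⟩
        L ^ 3 * M ^ 3 * 0# + S ^ 3 * M ^ 3 * b ^ 2 + S * L ^ 2 * M ^ 3 * 0# + d * (M ^ 3 * b) + x
          ≡⟨ solve 6 (λ L M S b d x → L :^ 3 :* M :^ 3 :* con 0₃ :+ S :^ 3 :* M :^ 3 :* b :^ 2 :+ S :* L :^ 2 :* M :^ 3 :* con 0₃ :+ d :* (M :^ 3 :* b) :+ x
               := S :^ 3 :* M :^ 3 :* b :^ 2 :+ d :* (M :^ 3 :* b) :+ x) refl L M S b d x ⟩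
        S ^ 3 * M ^ 3 * b ^ 2 + d * (M ^ 3 * b) + x ∎
        where b = ⟦ t ⟧₃
      S³M³≡0 : S ^ 3 * M ^ 3 ≡ 0#
      S³M³≡0 = begin
        S ^ 3 * M ^ 3
          ≡⟨ solve 4 (λ S M d x → S :* M := :- ((S :* M :* con 0₃ :^ 2 :+ d :* (M :* con 0₃) :+ x) :+ (S :* M :* con 1₃ :^ 2 :+ d :* (M :* con 1₃) :+ x) :+ (S :* M :* con 2₃ :^ 2 :+ d :* (M :* con 2₃) :+ x)))
               refl (S ^ 3) (M ^ 3) d x ⟩
        - ((S ^ 3 * M ^ 3 * 0# ^ 2 + d * (M ^ 3 * 0#) + x) + (S ^ 3 * M ^ 3 * 1# ^ 2 + d * (M ^ 3 * 1#) + x) + (S ^ 3 * M ^ 3 * (- 1#) ^ 2 + d * (M ^ 3 * - 1#) + x))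
          ≡⟨ cong -_ (cong₂ _+_ (cong₂ _+_ (value 0₃) (value 1₃)) (value 2₃)) ⟨
        - ((A.s * 0# + u) + (A.s * 1# + u) + (A.s * - 1# + u))
          ≡⟨ solve 2 (λ s u → :- ((s :* con 0₃ :+ u) :+ (s :* con 1₃ :+ u) :+ (s :* con 2₃ :+ u)) := con 0₃) refl A.s u ⟩
        0# ∎
      s≡0 : s ≡ 0#
      s≡0 = *-zero s′≢0 (trans (*-comm s′ s) (trans (cong₂ _*_ (sym S³) (sym M³)) S³M³≡0))

    meets₂⇐ : ∀ (g : Perm) (m : g ∈ Subgroup.Member F₂.image) → fun (UT⇒Γ (proj₁ m)) e₂ ∥ e₂ → g ∈ Subgroup.Member F₁.image
    meets₂⇐ g (f , (n , d , x , y) , e) diag = matrix aut (p * s′) (d * s′) 0# s′ Δ≢0 , (x , y , n) , λ { (a , b , c) → trans (e (a , b , c)) (equal a b c) }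
      where
      open Triangular f
      s≡0 : s ≡ 0#
      s≡0 = trans (solve 2 (λ s t → s := s :* con 1₃ :- con 0₃ :* t) refl s s′) diag
      S≡0 : S ≡ 0#
      S≡0 = trans (cong root s≡0) (Aut.0#-homo (frob-aut r′))
      Δ≡ : p * s′ * s′ - d * s′ * 0# ≡ p * s′ ^ 2
      Δ≡ = solve 3 (λ p s′ d → p :* s′ :* s′ :- d :* s′ :* con 0₃ := p :* s′ :^ 2) refl p s′ d
      Δ≢0 : p * s′ * s′ - d * s′ * 0# ≢ 0#
      Δ≢0 z = *-nonzero p≢0 (^-nonzero 2 s′≢0) (trans (sym Δ≡) z)
      equal : ∀ a b c → unipotent (n , d , x , y) (twist f (a , b , c)) ≡ lift (matrix aut (p * s′) (d * s′) 0# s′ Δ≢0) (a , b , c) ⊞ (x , y , n)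
      equal a b c = sym (trans (cong (_⊞ (x , y , n)) (lift-matrix aut (p * s′) (d * s′) 0# s′ Δ≢0 a b c)) (triple≡
        (cong (_+ x) (begin
          p * s′ * θ a + d * s′ * θ b
            ≡⟨ cong₂ (λ y z → y * z * θ a + d * z * θ b) L³ M³ ⟨
          L ^ 3 * M ^ 3 * θ a + d * M ^ 3 * θ b
            ≡⟨ solve 6 (λ L M d a b c → L :^ 3 :* M :^ 3 :* a :+ d :* M :^ 3 :* b := L :^ 3 :* M :^ 3 :* a :+ con 0₃ :^ 3 :* M :^ 3 :* b :^ 2 :+ con 0₃ :* L :^ 2 :* M :^ 3 :* c :+ d :* (M :^ 3 :* b)) refl L M d (θ a) (θ b) (θ c) ⟩
          L ^ 3 * M ^ 3 * θ a + 0# ^ 3 * M ^ 3 * θ b ^ 2 + 0# * L ^ 2 * M ^ 3 * θ c + d * (M ^ 3 * θ b)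
            ≡⟨ cong (λ z → L ^ 3 * M ^ 3 * θ a + z ^ 3 * M ^ 3 * θ b ^ 2 + z * L ^ 2 * M ^ 3 * θ c + d * (M ^ 3 * θ b)) S≡0 ⟨
          L ^ 3 * M ^ 3 * θ a + S ^ 3 * M ^ 3 * θ b ^ 2 + S * L ^ 2 * M ^ 3 * θ c + d * (M ^ 3 * θ b) ∎))
        (cong (_+ y) (trans (solve 3 (λ a b m → con 0₃ :* a :+ m :* b := m :* b) refl (θ a) (θ b) s′) (cong (_* θ b) (sym M³))))
        (cong (λ z → z * θ c + n) (trans (cong ρ Δ≡) (ρ-lm² p s′)))))

  𝓛₁ : Linear true
  𝓛₁ = record
    { base = e₁ ; base≢0 = e₁≢0
    ; lin = λ k m → proj₁ (G₁⊆𝒢₁ {proj₁ k} m)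
    ; lin-cong = λ k k′ m m′ e → proj₁ (F₁.part-cong {proj₁ k} {proj₁ k′} (G₁⊆𝒢₁ {proj₁ k} m) (G₁⊆𝒢₁ {proj₁ k′} m′) e)
    ; lin-∙ = λ k k′ m m′ m″ → proj₁ (F₁.part-cong {proj₁ k P.∙ proj₁ k′} {proj₁ k P.∙ proj₁ k′} (G₁⊆𝒢₁ {proj₁ k P.∙ proj₁ k′} m″)
        (Subgroup.∙∈ F₁.image {proj₁ k} {proj₁ k′} (G₁⊆𝒢₁ {proj₁ k} m) (G₁⊆𝒢₁ {proj₁ k′} m′)) (λ _ → refl))
    ; meets⇒ = λ k m n → meets₁⇒ (proj₁ k) (G₁⊆𝒢₁ {proj₁ k} m) (G₂⊆𝒢₂ {proj₁ k} n)
    ; meets⇐ = λ k m e → 𝒢₂⊆G₂ {proj₁ k} (meets₁⇐ (proj₁ k) (G₁⊆𝒢₁ {proj₁ k} m) e)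
    ; upper = λ k m e → left-zero _ _ e
    ; affine = λ x → let k , m , e = onto₁′ (f x) in k , m , trans (e e₁) (matrix-e₁ aut-id x (- 1#) 1# 0# (det≢0 x))
    }
    where
    det≢0 : ∀ x → x * 0# - - 1# * 1# ≢ 0#
    det≢0 x e = 1≢0 (trans (solve 1 (λ x → con 1₃ := x :* con 0₃ :- con 2₃ :* con 1₃) refl x) e)
    f : F → Γ.Carrier
    f x = matrix aut-id x (- 1#) 1# 0# (det≢0 x)
    onto₁′ : ∀ f → ∃₂ λ (k : 𝐆.Carrier) (m : proj₁ k ∈ G₁) → proj₁ (G₁⊆𝒢₁ {proj₁ k} m) Γ.≈ f
    onto₁′ f = element₁ (F₁.j f) (F₁.j∈ f) , 𝒢₁⊆G₁ {F₁.j f} (F₁.j∈ f)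
      , proj₁ (F₁.part-cong {F₁.j f} {F₁.j f} (G₁⊆𝒢₁ {F₁.j f} (𝒢₁⊆G₁ {F₁.j f} (F₁.j∈ f))) (F₁.j∈ f) (λ _ → refl))

  onto₁ : ∀ f → ∃₂ λ k m → Linear.lin 𝓛₁ k m Γ.≈ f
  onto₁ f = element₁ (F₁.j f) (F₁.j∈ f) , 𝒢₁⊆G₁ {F₁.j f} (F₁.j∈ f)
    , proj₁ (F₁.part-cong {F₁.j f} {F₁.j f} (G₁⊆𝒢₁ {F₁.j f} (𝒢₁⊆G₁ {F₁.j f} (F₁.j∈ f))) (F₁.j∈ f) (λ _ → refl))

  𝓛₂ : Linear false
  𝓛₂ = record
    { base = e₂ ; base≢0 = e₂≢0
    ; lin = λ k m → UT⇒Γ (proj₁ (G₂⊆𝒢₂ {proj₁ k} m))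
    ; lin-cong = λ k k′ m m′ e → proj₁ (F₂.part-cong {proj₁ k} {proj₁ k′} (G₂⊆𝒢₂ {proj₁ k} m) (G₂⊆𝒢₂ {proj₁ k′} m′) e)
    ; lin-∙ = λ k k′ m m′ m″ → proj₁ (F₂.part-cong {proj₁ k P.∙ proj₁ k′} {proj₁ k P.∙ proj₁ k′} (G₂⊆𝒢₂ {proj₁ k P.∙ proj₁ k′} m″)
        (Subgroup.∙∈ F₂.image {proj₁ k} {proj₁ k′} (G₂⊆𝒢₂ {proj₁ k} m) (G₂⊆𝒢₂ {proj₁ k′} m′)) (λ _ → refl))
    ; meets⇒ = λ k m n → meets₂⇒ (proj₁ k) (G₂⊆𝒢₂ {proj₁ k} m) (G₁⊆𝒢₁ {proj₁ k} n)
    ; meets⇐ = λ k m e → 𝒢₁⊆G₁ {proj₁ k} (meets₂⇐ (proj₁ k) (G₂⊆𝒢₂ {proj₁ k} m) e)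
    ; upper = λ k m _ → proj₂ (proj₂ (proj₁ (G₂⊆𝒢₂ {proj₁ k} m)))
    ; affine = λ x → let k , m , e = onto₂′ (unipotentᵁ x) in k , m , trans (e e₂) (matrix-e₂ aut-id 1# x 0# 1# (triangular-det 1# x 1# one-nonzero))
    }
    where
    onto₂′ : ∀ f → ∃₂ λ (k : 𝐆.Carrier) (m : proj₁ k ∈ G₂) → proj₁ (G₂⊆𝒢₂ {proj₁ k} m) UT.≈ f
    onto₂′ f = element₂ (F₂.j f) (F₂.j∈ f) , 𝒢₂⊆G₂ {F₂.j f} (F₂.j∈ f)
      , proj₁ (F₂.part-cong {F₂.j f} {F₂.j f} (G₂⊆𝒢₂ {F₂.j f} (𝒢₂⊆G₂ {F₂.j f} (F₂.j∈ f))) (F₂.j∈ f) (λ _ → refl))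

  lower₂≡0 : ∀ k m → Semilinear.p′ (Linear.lin 𝓛₂ k m) ≡ 0#
  lower₂≡0 k m = proj₂ (proj₂ (proj₁ (G₂⊆𝒢₂ {proj₁ k} m)))

  onto₂ : ∀ f → ∃₂ λ k m → Linear.lin 𝓛₂ k m Γ.≈ UT⇒Γ f
  onto₂ f = element₂ (F₂.j f) (F₂.j∈ f) , 𝒢₂⊆G₂ {F₂.j f} (F₂.j∈ f)
    , proj₁ (F₂.part-cong {F₂.j f} {F₂.j f} (G₂⊆𝒢₂ {F₂.j f} (𝒢₂⊆G₂ {F₂.j f} (F₂.j∈ f))) (F₂.j∈ f) (λ _ → refl))

module PushingUp (r′ : ℕ) (𝔽 : FiniteField (3 ℕ.^ ℕ.suc r′)) where
  open FieldTheory r′ 𝔽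
  open Permutations r′ 𝔽
  open Stabilisers r′ 𝔽
  open Products r′ 𝔽
  open Lines r′ 𝔽
  open Construction 𝔽 using (Ω; Perm; G₁; G₂)
  open Amalgam r′ 𝔽
  open LocalGroups r′ 𝔽 𝐆 H₁ H₂
  open CosetGraph 𝐆 (Subgroup.Member H₁) (Subgroup.Member H₂)
  open Graph Δ
  open GGraph action
  open ≡.≡-Reasoning
  private
    module 𝐆 = Group 𝐆
    module P = Group (Sym Ω)

  _×≡_ : ∀ {A B : Set} {m n} → ∣ ≡.setoid A ∣≡ m → ∣ ≡.setoid B ∣≡ n → ∣ ≡.setoid (A × B) ∣≡ (m ℕ.* n)
  _×≡_ {A} {B} c d = ∣∣-via record { to = id ; from = id ; to-cong = λ { refl → refl , refl } ; from-cong = λ { (refl , refl) → refl } ; inverse = (λ { refl → refl , refl }) , λ { (refl , refl) → refl } } (c ×-∣∣ d)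

  private
    ∣+∣ : ∣ order +-group ∣≡ q
    ∣+∣ = ∣∣-via record { to = id ; from = id ; to-cong = id ; from-cong = id ; inverse = id , id } cardinality

    ∣Ω∣′ : ∣ order K₁ ∣≡ (q ℕ.* (q ℕ.* q))
    ∣Ω∣′ = ∣∣-via record { to = id ; from = id ; to-cong = id ; from-cong = id ; inverse = id , id } (∣+∣ ×-∣∣ (∣+∣ ×-∣∣ ∣+∣))

    ∣K₂∣′ : ∣ order K₂ ∣≡ (q ℕ.* (q ℕ.* (q ℕ.* q)))
    ∣K₂∣′ = ∣∣-via record { to = id ; from = id ; to-cong = id ; from-cong = id ; inverse = id , id } (∣+∣ ×-∣∣ (∣+∣ ×-∣∣ (∣+∣ ×-∣∣ ∣+∣)))

  ∣K₁∣ : ∣ order K₁ ∣≡ (q ℕ.^ 3)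
  ∣K₁∣ = subst (λ n → ∣ order K₁ ∣≡ n) (cong (λ n → q ℕ.* (q ℕ.* n)) (sym (ℕₚ.*-identityʳ q))) ∣Ω∣′

  ∣K₂∣ : ∣ order K₂ ∣≡ (q ℕ.^ 4)
  ∣K₂∣ = subst (λ n → ∣ order K₂ ∣≡ n) (cong (λ n → q ℕ.* (q ℕ.* (q ℕ.* n))) (sym (ℕₚ.*-identityʳ q))) ∣K₂∣′

  +-elementaryAbelian : IsElementaryAbelian 3 +-group
  +-elementaryAbelian = +-comm , solve 1 (λ x → x :+ (x :+ (x :+ con 0₃)) := con 0₃) refl

  K₁-elementaryAbelian : IsElementaryAbelian 3 K₁
  K₁-elementaryAbelian = (λ { (a , b , c) (u , v , w) → +-comm a u , +-comm b v , +-comm c w })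
    , λ { (a , b , c) → triple a , triple b , triple c }
    where triple = proj₂ +-elementaryAbelian

  module _ {K B : Group 0ℓ 0ℓ} (𝓕 : Factorisation (Sym Ω) K B) (X : Pred Perm 0ℓ) (X⊆ : ∀ g → g ∈ X → g ∈ Subgroup.Member (Factorisation.image 𝓕))
           (⊆X : ∀ g → g ∈ Subgroup.Member (Factorisation.image 𝓕) → g ∈ X) (element : ∀ g → g ∈ Subgroup.Member (Factorisation.image 𝓕) → 𝐆.Carrier)
           (element≡ : ∀ g m → proj₁ (element g m) P.≈ g) (X-resp : ∀ g h → g P.≈ h → g ∈ X → h ∈ X) where
    private
      module 𝓕 = Factorisation 𝓕
      module K = Group K
      module B = Group B

    InRadical : Pred 𝐆.Carrier 0ℓ
    InRadical k = Σ (proj₁ k ∈ X) λ m → proj₁ (X⊆ (proj₁ k) m) B.≈ B.ε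

    radical-element : ∀ t → InRadical (element (𝓕.i t) (𝓕.i∈ t))
    radical-element t = m , proj₁ (𝓕.part-cong {proj₁ (element (𝓕.i t) (𝓕.i∈ t))} {𝓕.i t} (X⊆ _ m) (𝓕.i∈ t) (element≡ (𝓕.i t) (𝓕.i∈ t)))
      where m = X-resp (𝓕.i t) (proj₁ (element (𝓕.i t) (𝓕.i∈ t))) (P.sym {proj₁ (element (𝓕.i t) (𝓕.i∈ t))} {𝓕.i t} (element≡ (𝓕.i t) (𝓕.i∈ t))) (⊆X (𝓕.i t) (𝓕.i∈ t))

    radical≈ : ∀ k → (ρ : InRadical k) → proj₁ k P.≈ 𝓕.i (proj₁ (proj₂ (X⊆ (proj₁ k) (proj₁ ρ))))
    radical≈ k (m , e) = P.trans {proj₁ k} {𝓕.j (proj₁ x) P.∙ 𝓕.i t} {𝓕.i t} (proj₂ (proj₂ x))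
      (λ y → cong (Inverse.to (𝓕.i t)) (P.trans {𝓕.j (proj₁ x)} {𝓕.j B.ε} {P.ε} (𝓕.j-cong e) 𝓕.j-ε y))
      where
      x = X⊆ (proj₁ k) m
      t = proj₁ (proj₂ x)

    radical-card : ∀ {n} → ∣ order K ∣≡ n → ∣ subsetoid 𝐆.setoid InRadical ∣≡ n
    radical-card c = ∣∣-via {subsetoid 𝐆.setoid InRadical} {order K} (record
      { to = part
      ; from = λ t → element (𝓕.i t) (𝓕.i∈ t) , radical-element t
      ; to-cong = λ {x} {y} e → proj₂ (𝓕.part-cong {proj₁ (proj₁ x)} {proj₁ (proj₁ y)} (X⊆ _ (proj₁ (proj₂ x))) (X⊆ _ (proj₁ (proj₂ y))) e)
      ; from-cong = λ {s} {t} e → P.trans {el s} {𝓕.i s} {el t} (element≡ _ _) (P.trans {𝓕.i s} {𝓕.i t} {el t} (𝓕.i-cong e) (P.sym {el t} {𝓕.i t} (element≡ _ _)))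
      ; inverse = (λ {t} {x} e → proj₂ (𝓕.part-cong {proj₁ (proj₁ x)} {𝓕.i t} (X⊆ _ (proj₁ (proj₂ x))) (𝓕.i∈ t) (P.trans {proj₁ (proj₁ x)} {el t} {𝓕.i t} e (element≡ _ _))))
                , λ {x} {t} e → P.trans {el t} {𝓕.i t} {proj₁ (proj₁ x)} (element≡ _ _) (P.trans {𝓕.i t} {𝓕.i (part x)} {proj₁ (proj₁ x)} (𝓕.i-cong e)
                    (P.sym {proj₁ (proj₁ x)} {𝓕.i (part x)} (radical≈ (proj₁ x) (proj₂ x))))
      }) c
      where
      el : K.Carrier → Perm
      el t = proj₁ (element (𝓕.i t) (𝓕.i∈ t))
      part : Setoid.Carrier (subsetoid 𝐆.setoid InRadical) → K.Carrier
      part (k , m , _) = proj₁ (proj₂ (X⊆ (proj₁ k) m))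

  private
    X₁⊆ = λ g → G₁⊆𝒢₁ {g}
    ⊆X₁ = λ g → 𝒢₁⊆G₁ {g}
    X₂⊆ = λ g → G₂⊆𝒢₂ {g}
    ⊆X₂ = λ g → 𝒢₂⊆G₂ {g}
    resp₁ : ∀ g h → g P.≈ h → g ∈ G₁ → h ∈ G₁
    resp₁ g h e m = ⊆X₁ h (Subgroup.resp F₁.image {g} {h} e (X₁⊆ g m))
    resp₂ : ∀ g h → g P.≈ h → g ∈ G₂ → h ∈ G₂
    resp₂ g h e m = ⊆X₂ h (Subgroup.resp F₂.image {g} {h} e (X₂⊆ g m))

  ∣Radical₁∣ : ∣ subsetoid 𝐆.setoid (Radical 𝓛₁) ∣≡ (3 ℕ.^ (r ℕ.* 3))
  ∣Radical₁∣ = subst (λ n → ∣ subsetoid 𝐆.setoid (Radical 𝓛₁) ∣≡ n) (ℕₚ.^-*-assoc 3 r 3)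
    (radical-card factorisation₁ G₁ X₁⊆ ⊆X₁ element₁ (λ _ _ _ → refl) resp₁ ∣K₁∣)

  ∣Radical₂∣ : ∣ subsetoid 𝐆.setoid (Radical 𝓛₂) ∣≡ (3 ℕ.^ (r ℕ.* 4))
  ∣Radical₂∣ = subst (λ n → ∣ subsetoid 𝐆.setoid (Radical 𝓛₂) ∣≡ n) (ℕₚ.^-*-assoc 3 r 4)
    (radical-card factorisation₂ G₂ X₂⊆ ⊆X₂ element₂ (λ _ _ _ → refl) resp₂ ∣K₂∣)

  self-centralising₁ : Core.SelfCentralising 𝓛₁ 𝐆.ε
  self-centralising₁ k m commutes = m , fixes
    where
    f = proj₁ (X₁⊆ (proj₁ k) m)
    t₀ = proj₁ (proj₂ (X₁⊆ (proj₁ k) m))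
    k≈ = proj₂ (proj₂ (X₁⊆ (proj₁ k) m))
    cancel : ∀ {x y z : F} → 0# + z + x ≡ y + z → x ≡ y
    cancel {x} {y} {z} e = trans (solve 2 (λ x z → x := con 0₃ :+ z :+ x :- z) refl x z) (trans (cong (_- z) e) (solve 2 (λ y z → y :+ z :- z := y) refl y z))
    at-0 : ∀ t → (0# , 0# , 0#) ⊞ t₀ ⊞ t ≡ lift f ((0# , 0# , 0#) ⊞ t) ⊞ t₀
    at-0 t = trans (cong (λ x → x ⊞ t₀ ⊞ t) (sym (lift-0 f))) (trans (cong (_⊞ t) (sym (k≈ (0# , 0# , 0#))))
      (trans (commutes (element₁ (F₁.i t) (F₁.i∈ t)) (radical-element factorisation₁ G₁ X₁⊆ ⊆X₁ element₁ (λ _ _ _ → refl) resp₁ t) (0# , 0# , 0#)) (k≈ ((0# , 0# , 0#) ⊞ t))))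
    fixes : f Γ.≈ Γ.ε
    fixes (a , b) = sym (cong₂ _,_ (cancel (trans (proj₁ (,≡ (at-0 (a , b , 0#)))) (cong (λ v → proj₁ (fun f v) + proj₁ t₀) zero+)))
        (cancel (trans (proj₁ (,≡ (proj₂ (,≡ (at-0 (a , b , 0#)))))) (cong (λ v → proj₂ (fun f v) + proj₁ (proj₂ t₀)) zero+))))
      where
      zero+ : (0# + a , 0# + b) ≡ (a , b)
      zero+ = cong₂ _,_ (+-identityˡ a) (+-identityˡ b)

  self-centralising₂ : Core.SelfCentralising 𝓛₂ 𝐆.ε
  self-centralising₂ k m commutes = m , λ { (a , b) → trans (formula′ a b) (cong₂ _,_
      (begin
        p * θ a + s * θ b    ≡⟨ cong₂ (λ u v → u * θ a + v * θ b) p≡1 s≡0 ⟩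
        1# * θ a + 0# * θ b  ≡⟨ solve 2 (λ a b → con 1₃ :* a :+ con 0₃ :* b := a) refl (θ a) (θ b) ⟩
        θ a                  ≡⟨ θ≡id a ⟩
        a                    ∎)
      (second b)) }
    where
    f = proj₁ (X₂⊆ (proj₁ k) m)
    n = proj₁ (proj₁ (proj₂ (X₂⊆ (proj₁ k) m)))
    d = proj₁ (proj₂ (proj₁ (proj₂ (X₂⊆ (proj₁ k) m))))
    x = proj₁ (proj₂ (proj₂ (proj₁ (proj₂ (X₂⊆ (proj₁ k) m)))))
    y = proj₂ (proj₂ (proj₂ (proj₁ (proj₂ (X₂⊆ (proj₁ k) m)))))
    κ = proj₁ (proj₂ (X₂⊆ (proj₁ k) m))
    k≈ = proj₂ (proj₂ (X₂⊆ (proj₁ k) m))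
    open Triangular f

    commute : ∀ u v z → unipotent (0# , 0# , u , v) (unipotent κ (twist f z)) ≡ unipotent κ (twist f (unipotent (0# , 0# , u , v) z))
    commute u v z = trans (cong (unipotent (0# , 0# , u , v)) (sym (k≈ z)))
      (trans (commutes (element₂ (F₂.i t) (F₂.i∈ t)) (radical-element factorisation₂ G₂ X₂⊆ ⊆X₂ element₂ (λ _ _ _ → refl) resp₂ t) z) (k≈ (unipotent t z)))
      where
      t : Group.Carrier K₂
      t = 0# , 0# , u , v

    second : ∀ b → s′ * θ b ≡ b
    second b = trans (cong (_* θ b) (sym M³)) (trans (cong (M ^ 3 *_) (cong θ (sym (+-identityˡ b)))) (sym (trans
      (solve 3 (λ b y m → b := con 0₃ :+ b :+ con 0₃ :* y :* m) refl b y (M ^ 3)) (trans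
      (solve 3 (λ b y z → con 0₃ :+ b :+ con 0₃ :* y :* z := z :* con 0₃ :+ y :+ b :- y) refl b y (M ^ 3))
      (trans (cong (λ z → M ^ 3 * z + y + b - y) (sym 0#-homo))
        (trans (cong (_- y) (proj₁ (,≡ (proj₂ (,≡ (commute 0# b (0# , 0# , 0#)))))))
          (solve 2 (λ z y → z :+ y :- y := z) refl (M ^ 3 * θ (0# + b)) y)))))))
    s′≡1 : s′ ≡ 1#
    s′≡1 = trans (sym (*-identityʳ s′)) (trans (cong (s′ *_) (sym 1#-homo)) (second 1#))
    θ≡id : ∀ b → θ b ≡ b
    θ≡id b = trans (sym (*-identityˡ _)) (trans (cong (_* θ b) (sym s′≡1)) (second b))

    first : ∀ b u v → p * 0# + s * b ^ 2 + d * b + x + 0# * b + u ≡ p * u + s * (b + v) ^ 2 + d * (b + v) + x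
    first b u v = begin
      p * 0# + s * b ^ 2 + d * b + x + 0# * b + u
        ≡⟨ solve 8 (λ p s d x b u z y → p :* con 0₃ :+ s :* b :^ 2 :+ d :* b :+ x :+ con 0₃ :* b :+ u
             := p :* con 1₃ :* con 0₃ :+ s :* con 1₃ :* b :^ 2 :+ z :* con 0₃ :+ d :* (con 1₃ :* b) :+ x :+ con 0₃ :* (con 1₃ :* b :+ y) :+ u) refl p s d x b u (S * L ^ 2 * M ^ 3) y ⟩
      p * 1# * 0# + s * 1# * b ^ 2 + S * L ^ 2 * M ^ 3 * 0# + d * (1# * b) + x + 0# * (1# * b + y) + u
        ≡⟨ cong proj₁ (trans (cong (λ w → unipotent (0# , 0# , u , v) (unipotent κ w)) (sym (evaluate 0# b))) (trans (commute u v (0# , b , 0#)) (cong (unipotent κ)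
             (trans (cong (twist f) (triple≡ (solve 2 (λ b u → con 0₃ :+ con 0₃ :* b :+ u := u) refl b u) refl (+-identityˡ 0#))) (evaluate u (b + v)))))) ⟩
      p * 1# * u + s * 1# * (b + v) ^ 2 + S * L ^ 2 * M ^ 3 * 0# + d * (1# * (b + v)) + x
        ≡⟨ solve 7 (λ p s d x c u z → p :* con 1₃ :* u :+ s :* con 1₃ :* c :^ 2 :+ z :* con 0₃ :+ d :* (con 1₃ :* c) :+ x := p :* u :+ s :* c :^ 2 :+ d :* c :+ x) refl p s d x (b + v) u (S * L ^ 2 * M ^ 3) ⟩
      p * u + s * (b + v) ^ 2 + d * (b + v) + x ∎
      where
      evaluate : ∀ a b → twist f (a , b , 0#) ≡ (p * 1# * a + s * 1# * b ^ 2 + S * L ^ 2 * M ^ 3 * 0# , 1# * b , L ^ 2 * M ^ 4 * 0#)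
      evaluate a b = trans (cong (twisted L M S) (triple≡ (θ≡id a) (θ≡id b) 0#-homo)) (triple≡
        (cong (_+ S * L ^ 2 * M ^ 3 * 0#) (cong₂ _+_ (cong₂ (λ l m → l * m * a) L³ (trans M³ s′≡1)) (cong₂ (λ l m → l * m * b ^ 2) S³ (trans M³ s′≡1))))
        (cong (_* b) (trans M³ s′≡1)) refl)

    p≡1 : p ≡ 1#
    p≡1 = sym (trans (solve 4 (λ p s d x → con 1₃ := p :* con 0₃ :+ s :* con 0₃ :^ 2 :+ d :* con 0₃ :+ x :+ con 0₃ :* con 0₃ :+ con 1₃ :- x) refl p s d x)
      (trans (cong (_- x) (first 0# 1# 0#)) (solve 4 (λ p s d x → p :* con 1₃ :+ s :* (con 0₃ :+ con 0₃) :^ 2 :+ d :* (con 0₃ :+ con 0₃) :+ x :- x := p) refl p s d x)))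

    s≡0 : s ≡ 0#
    s≡0 = begin
      s
        ≡⟨ solve 4 (λ p s d x → s := :- ((p :* con 0₃ :+ s :* (con 0₃ :+ con 1₃) :^ 2 :+ d :* (con 0₃ :+ con 1₃) :+ x) :+ (p :* con 0₃ :+ s :* (con 0₃ :+ con 2₃) :^ 2 :+ d :* (con 0₃ :+ con 2₃) :+ x) :+ x)) refl p s d x ⟩
      - ((p * 0# + s * (0# + 1#) ^ 2 + d * (0# + 1#) + x) + (p * 0# + s * (0# + - 1#) ^ 2 + d * (0# + - 1#) + x) + x)
        ≡⟨ cong₂ (λ u v → - (u + v + x)) (first 0# 0# 1#) (first 0# 0# (- 1#)) ⟨
      - ((p * 0# + s * 0# ^ 2 + d * 0# + x + 0# * 0# + 0#) + (p * 0# + s * 0# ^ 2 + d * 0# + x + 0# * 0# + 0#) + x)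
        ≡⟨ solve 4 (λ p s d x → :- ((p :* con 0₃ :+ s :* con 0₃ :^ 2 :+ d :* con 0₃ :+ x :+ con 0₃ :* con 0₃ :+ con 0₃) :+ (p :* con 0₃ :+ s :* con 0₃ :^ 2 :+ d :* con 0₃ :+ x :+ con 0₃ :* con 0₃ :+ con 0₃) :+ x) := con 0₃) refl p s d x ⟩
      0# ∎

  localCharacteristic : LocalCharacteristic 3
  localCharacteristic (inj₁ h) = O , isPCore {r ℕ.* 3} ∣Radical₁∣ , centraliser⊆O self-centralising₁
    where open Core 𝓛₁ h
  localCharacteristic (inj₂ h) = O , isPCore {r ℕ.* 4} ∣Radical₂∣ , centraliser⊆O self-centralising₂
    where open Core 𝓛₂ h

  private
    Radical₁⊆Radical₂ : ∀ k → Radical 𝓛₁ k → Radical 𝓛₂ k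
    Radical₁⊆Radical₂ k ρ = ⊆X₂ (proj₁ k) m , proj₁ (F₂.part-cong {proj₁ k} {proj₁ k} (X₂⊆ (proj₁ k) (⊆X₂ (proj₁ k) m)) m (λ _ → refl))
      where
      t = proj₁ (proj₂ (X₁⊆ (proj₁ k) (proj₁ ρ)))
      m : proj₁ k ∈ Subgroup.Member F₂.image
      m = α⊆𝒢₂ {proj₁ t} {proj₁ (proj₂ t)} {proj₂ (proj₂ t)} {proj₁ k} (radical≈ factorisation₁ G₁ X₁⊆ ⊆X₁ element₁ (λ _ _ _ → refl) resp₁ k ρ)

  pushingUpType : PushingUpType 3
  pushingUpType = vertex true 𝐆.ε , vertex false 𝐆.ε , (𝐆.ε , (𝐆.ε , Subgroup.ε∈ H₁ , λ _ → refl) , 𝐆.ε , Subgroup.ε∈ H₂ , λ _ → refl) , localCharacteristic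
    , O₁.O , O₂.O , O₁.isPCore {r ℕ.* 3} ∣Radical₁∣ , O₂.isPCore {r ℕ.* 4} ∣Radical₂∣
    , λ {g} o → O₂.Radical⇒O g (Radical₁⊆Radical₂ (Side.conj 𝓛₁ 𝐆.ε g) (O₁.O⇒Radical g o))
    where
    module O₁ = Core 𝓛₁ 𝐆.ε
    module O₂ = Core 𝓛₂ 𝐆.ε

permutation-code : ∀ {A : Set} {n} → ∣ ≡.setoid A ∣≡ n → A ↔ A → Fin (n ℕ.^ n)
permutation-code {n = n} c π = Fin.funToFin {n} {n} λ i → Inverse.to c (Inverse.to π (Inverse.from c i))

private
  funToFin-cong : ∀ m {n} {f g : Fin m → Fin n} → (∀ i → f i ≡ g i) → Fin.funToFin f ≡ Fin.funToFin g
  funToFin-cong ℕ.zero _ = refl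
  funToFin-cong (ℕ.suc m) f≗g = cong₂ Fin.combine (f≗g zero) (funToFin-cong m (f≗g ∘ suc))

permutation-code-cong : ∀ {A : Set} {n} (c : ∣ ≡.setoid A ∣≡ n) (π π′ : A ↔ A) → (∀ x → Inverse.to π x ≡ Inverse.to π′ x) →
                        permutation-code c π ≡ permutation-code c π′
permutation-code-cong {n = n} c π π′ e = funToFin-cong n λ i → cong (Inverse.to c) (e _)

permutation-code-injective : ∀ {A : Set} {n} (c : ∣ ≡.setoid A ∣≡ n) (π π′ : A ↔ A) →
                             permutation-code c π ≡ permutation-code c π′ → ∀ x → Inverse.to π x ≡ Inverse.to π′ x
permutation-code-injective {A} {n} c π π′ e x = subst (λ y → Inverse.to π y ≡ Inverse.to π′ y) (Inverse.strictlyInverseʳ c x)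
  (∣∣-injective c (trans (sym (Finₚ.finToFun-funToFin (value π) i)) (trans (cong (λ k → Fin.finToFun {n} {n} k i) e) (Finₚ.finToFun-funToFin (value π′) i))))
  where
  i = Inverse.to c x
  value : A ↔ A → Fin n → Fin n
  value π i = Inverse.to c (Inverse.to π (Inverse.from c i))

listed-by : ∀ {G : Group 0ℓ 0ℓ} {P : Pred (Group.Carrier G) 0ℓ} {X : Set} {n} → ∣ ≡.setoid X ∣≡ n → (f : X → Group.Carrier G) →
            (∀ x → P (f x)) → (∀ g → P g → ∃ λ x → Group._≈_ G g (f x)) → Listed {G} P
listed-by {G} {P} {X} {n} c f P-f covers = n , f ∘ Inverse.from c , P-f ∘ Inverse.from c , λ g p →
  let x , e = covers g p in Inverse.to c x , Group.trans G e (Group.reflexive G (cong f (sym (Inverse.strictlyInverseʳ c x))))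

module Finiteness (r′ : ℕ) (𝔽 : FiniteField (3 ℕ.^ ℕ.suc r′)) where
  open FieldTheory r′ 𝔽
  open Automorphisms r′ 𝔽 using (aut⇒frob)
  open Permutations r′ 𝔽
  open Stabilisers r′ 𝔽
  open Products r′ 𝔽
  open Lines r′ 𝔽
  open Construction 𝔽 using (Ω; Perm; G₁; G₂)
  open Amalgam r′ 𝔽
  open PushingUp r′ 𝔽 using (_×≡_)
  open CosetGraph 𝐆 (Subgroup.Member H₁) (Subgroup.Member H₂)
  open Graph Δ
  open ActionOn action
  open GGraph action
  private
    module 𝐆 = Group 𝐆
    module P = Group (Sym Ω)
    module V = Setoid vertices

    ∣r∣ : ∣ ≡.setoid (Fin r) ∣≡ r
    ∣r∣ = record { to = id ; from = id ; to-cong = id ; from-cong = id ; inverse = id , id }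

    c = cardinality

    abstract
      Ω-finite : Finite (≡.setoid Ω)
      Ω-finite = _ , c ×≡ (c ×≡ c)

    ∣Ω∣ : ∣ ≡.setoid Ω ∣≡ proj₁ Ω-finite
    ∣Ω∣ = proj₂ Ω-finite

  _≟ᴾ_ : Decidable P._≈_
  g ≟ᴾ h = map′ (permutation-code-injective ∣Ω∣ g h) (permutation-code-cong ∣Ω∣ g h) (permutation-code ∣Ω∣ g Finₚ.≟ permutation-code ∣Ω∣ h)

  private
    Parameters : Set
    Parameters = Fin r × F × F × F × F × F × F × F

    ∣Parameters∣ : ∣ ≡.setoid Parameters ∣≡ _
    ∣Parameters∣ = ∣r∣ ×≡ (c ×≡ (c ×≡ (c ×≡ (c ×≡ (c ×≡ (c ×≡ c))))))

    from₁ : ∀ (i : Fin r) a b c d t → Dec (a * d - b * c ≡ 0#) → Perm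
    from₁ i a b c d t (yes _) = P.ε
    from₁ i a b c d t (no ≢0) = F₁.j (matrix (frob-aut (toℕ i)) a b c d ≢0) P.∙ F₁.i t

    from₁∈ : ∀ i a b c d t D → from₁ i a b c d t D ∈ G₁
    from₁∈ i a b c d t (yes _) = 𝒢₁⊆G₁ {P.ε} (Subgroup.ε∈ F₁.image)
    from₁∈ i a b c d t (no ≢0) = 𝒢₁⊆G₁ {F₁.j f P.∙ F₁.i t} (f , t , λ _ → refl)
      where f = matrix (frob-aut (toℕ i)) a b c d ≢0

    from₁-covers : ∀ g (m : g ∈ Subgroup.Member F₁.image) (i : Fin r) → (∀ x → field-aut (proj₁ m) x ≡ frob (toℕ i) x) →
      ∀ D → g P.≈ from₁ i (Semilinear.p (proj₁ m)) (Semilinear.s (proj₁ m)) (Semilinear.p′ (proj₁ m)) (Semilinear.s′ (proj₁ m)) (proj₁ (proj₂ m)) D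
    from₁-covers g (f , t , e) i θ≡ (yes ≡0) = contradiction ≡0 (δet≢0 f)
    from₁-covers g (f , t , e) i θ≡ (no ≢0) x = trans (e x) (cong (_⊞ t) (Acts.act-cong lifts {f} {matrix (frob-aut (toℕ i)) p s p′ s′ ≢0}
        (λ { (a , b) → trans (formula a b) (cong₂ (λ u v → p * u + s * v , p′ * u + s′ * v) (θ≡ a) (θ≡ b)) }) x))
      where open Semilinear f

  abstract
    listed₁ : Listed {Sym Ω} G₁
    listed₁ = listed-by {Sym Ω} ∣Parameters∣
      (λ { (i , a , b , c , d , t) → from₁ i a b c d t ((a * d - b * c) ≟ 0#) })
      (λ { (i , a , b , c , d , t) → from₁∈ i a b c d t ((a * d - b * c) ≟ 0#) })
      (λ g m → let n = G₁⊆𝒢₁ {g} m ; f = proj₁ n ; i , θ≡ = aut⇒frob (Semilinear.aut f) in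
        (i , Semilinear.p f , Semilinear.s f , Semilinear.p′ f , Semilinear.s′ f , proj₁ (proj₂ n))
        , from₁-covers g n i θ≡ ((Semilinear.p f * Semilinear.s′ f - Semilinear.s f * Semilinear.p′ f) ≟ 0#))

  private
    from₂ : ∀ (i : Fin r) l s m k → Dec (l * m ≡ 0#) → Perm
    from₂ i l s m k (yes _) = P.ε
    from₂ i l s m k (no ≢0) = F₂.j (triangular (frob-aut (toℕ i)) l s m ≢0) P.∙ F₂.i k

    from₂∈ : ∀ i l s m k D → from₂ i l s m k D ∈ G₂
    from₂∈ i l s m k (yes _) = 𝒢₂⊆G₂ {P.ε} (Subgroup.ε∈ F₂.image)
    from₂∈ i l s m k (no ≢0) = 𝒢₂⊆G₂ {F₂.j f P.∙ F₂.i k} (f , k , λ _ → refl)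
      where f = triangular (frob-aut (toℕ i)) l s m ≢0

    from₂-covers : ∀ g (m : g ∈ Subgroup.Member F₂.image) (i : Fin r) → (∀ x → field-aut (UT⇒Γ (proj₁ m)) x ≡ frob (toℕ i) x) →
      ∀ D → g P.≈ from₂ i (Triangular.p (proj₁ m)) (Triangular.s (proj₁ m)) (Triangular.s′ (proj₁ m)) (proj₁ (proj₂ m)) D
    from₂-covers g (f , k , e) i θ≡ (yes ≡0) = contradiction ≡0 (*-nonzero (Triangular.p≢0 f) (Triangular.s′≢0 f))
    from₂-covers g (f , k , e) i θ≡ (no ≢0) x = trans (e x) (cong (unipotent k) (Acts.act-cong twists {f} {triangular (frob-aut (toℕ i)) p s s′ ≢0}
        (λ { (a , b) → trans (formula′ a b) (cong₂ _,_ (cong₂ (λ u v → p * u + s * v) (θ≡ a) (θ≡ b))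
          (trans (cong (s′ *_) (θ≡ b)) (solve 3 (λ a b m → m :* b := con 0₃ :* a :+ m :* b) refl (frob (toℕ i) a) (frob (toℕ i) b) s′))) }) x))
      where open Triangular f

  abstract
    listed₂ : Listed {Sym Ω} G₂
    listed₂ = listed-by {Sym Ω} (∣r∣ ×≡ (c ×≡ (c ×≡ (c ×≡ (c ×≡ (c ×≡ (c ×≡ c)))))))
      (λ { (i , l , s , m , k) → from₂ i l s m k ((l * m) ≟ 0#) })
      (λ { (i , l , s , m , k) → from₂∈ i l s m k ((l * m) ≟ 0#) })
      (λ g m → let n = G₂⊆𝒢₂ {g} m ; f = proj₁ n ; i , θ≡ = aut⇒frob (Semilinear.aut (UT⇒Γ f)) in
        (i , Triangular.p f , Triangular.s f , Triangular.s′ f , proj₁ (proj₂ n))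
        , from₂-covers g n i θ≡ ((Triangular.p f * Triangular.s′ f) ≟ 0#))

  private
    resp₁ : ∀ {g h} → g P.≈ h → g ∈ G₁ → h ∈ G₁
    resp₁ {g} {h} e m = 𝒢₁⊆G₁ {h} (Subgroup.resp F₁.image {g} {h} e (G₁⊆𝒢₁ {g} m))
    resp₂ : ∀ {g h} → g P.≈ h → g ∈ G₂ → h ∈ G₂
    resp₂ {g} {h} e m = 𝒢₂⊆G₂ {h} (Subgroup.resp F₂.image {g} {h} e (G₂⊆𝒢₂ {g} m))

    open Subsets (Sym Ω) using (⟨_⟩; generated)

    n₁ = proj₁ listed₁
    n₂ = proj₁ listed₂

    gs⊎ : Fin n₁ ⊎ Fin n₂ → Perm
    gs⊎ (inj₁ i) = proj₁ (proj₂ listed₁) i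
    gs⊎ (inj₂ i) = proj₁ (proj₂ listed₂) i

    gs : Fin (n₁ ℕ.+ n₂) → Perm
    gs a = gs⊎ (Fin.splitAt n₁ a)

    gs-index : ∀ x → ∃ λ a → gs a ≡ gs⊎ x
    gs-index x = Fin.join n₁ n₂ x , cong gs⊎ (Finₚ.splitAt-join n₁ n₂ x)

    index : ∀ g → (g ∈ G₁ ⊎ g ∈ G₂) → ∃ λ a → g P.≈ gs a
    index g m = proj₁ (gs-index (proj₁ (covered m))) , λ x → trans (proj₂ (covered m) x) (cong (λ π → Inverse.to π x) (sym (proj₂ (gs-index (proj₁ (covered m))))))
      where
      covered : (g ∈ G₁ ⊎ g ∈ G₂) → ∃ λ y → g P.≈ gs⊎ y
      covered (inj₁ m) = let i , e = proj₂ (proj₂ (proj₂ listed₁)) g m in inj₁ i , e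
      covered (inj₂ m) = let i , e = proj₂ (proj₂ (proj₂ listed₂)) g m in inj₂ i , e

    gs⊎∈ : ∀ x → gs⊎ x ∈ G₁ ⊎ gs⊎ x ∈ G₂
    gs⊎∈ (inj₁ i) = inj₁ (proj₁ (proj₂ (proj₂ listed₁)) i)
    gs⊎∈ (inj₂ i) = inj₂ (proj₁ (proj₂ (proj₂ listed₂)) i)

    gs⁻¹ : ∀ a → ∃ λ b → gs a P.⁻¹ P.≈ gs b
    gs⁻¹ a = index (gs a P.⁻¹) (invert (gs⊎∈ (Fin.splitAt n₁ a)))
      where
      invert : gs a ∈ G₁ ⊎ gs a ∈ G₂ → (gs a P.⁻¹) ∈ G₁ ⊎ (gs a P.⁻¹) ∈ G₂
      invert (inj₁ m) = inj₁ (𝒢₁⊆G₁ {gs a P.⁻¹} (Subgroup.⁻¹∈ F₁.image {gs a} (G₁⊆𝒢₁ {gs a} m)))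
      invert (inj₂ m) = inj₂ (𝒢₂⊆G₂ {gs a P.⁻¹} (Subgroup.⁻¹∈ F₂.image {gs a} (G₂⊆𝒢₂ {gs a} m)))

    code-cong : ∀ {g h} → g P.≈ h → permutation-code ∣Ω∣ g ≡ permutation-code ∣Ω∣ h
    code-cong {g} {h} = permutation-code-cong ∣Ω∣ g h

    code-injective : ∀ {g h} → permutation-code ∣Ω∣ g ≡ permutation-code ∣Ω∣ h → g P.≈ h
    code-injective {g} {h} = permutation-code-injective ∣Ω∣ g h

    Gens : Pred Perm 0ℓ
    Gens = Generators {Sym Ω} (permutation-code ∣Ω∣) (λ {g} {h} → code-cong {g} {h}) (λ {g} {h} → code-injective {g} {h}) gs gs⁻¹

    open Subsets (Sym Ω) using (gen) renaming (resp to ⟨resp⟩)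

    listed : Listed {Sym Ω} ⟨ G₁ ∪ G₂ ⟩
    listed = listed-≐ {Sym Ω} {⟨ Gens ⟩} {⟨ G₁ ∪ G₂ ⟩}
      (⟨⟩-least {Sym Ω} {Gens} (generated (G₁ ∪ G₂)) (λ { {g} (a , e) → ⟨resp⟩ {x = gs a} {y = g} (λ x → sym (e x)) (gen {x = gs a} (gs⊎∈ (Fin.splitAt n₁ a))) }))
      (⟨⟩-least {Sym Ω} {G₁ ∪ G₂} (generated Gens) (λ {g} m → gen {x = g} (index g m)))
      (generated-listed {Sym Ω} (permutation-code ∣Ω∣) (λ {g} {h} → code-cong {g} {h}) (λ {g} {h} → code-injective {g} {h}) gs gs⁻¹)

  𝐆-finite : Finite (order 𝐆)
  𝐆-finite = listed-finite {Sym Ω} _≟ᴾ_ (generated (G₁ ∪ G₂)) listed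

  H? : ∀ s (g : 𝐆.Carrier) → Dec (g ∈ Subgroup.Member (H s))
  H? true g = listed-dec {Sym Ω} _≟ᴾ_ listed₁ (λ {g} {h} → resp₁ {g} {h}) (proj₁ g)
  H? false g = listed-dec {Sym Ω} _≟ᴾ_ listed₂ (λ {g} {h} → resp₂ {g} {h}) (proj₁ g)


  _≟ⱽ_ : Decidable _≈ᵥ_
  inj₁ g ≟ⱽ inj₁ h = map′ (vertex-≈⇐ true {g} {h}) (vertex-≈⇒ true {g} {h}) (H? true (g 𝐆.// h))
  inj₁ g ≟ⱽ inj₂ h = no λ ()
  inj₂ g ≟ⱽ inj₁ h = no λ ()
  inj₂ g ≟ⱽ inj₂ h = map′ (vertex-≈⇐ false {g} {h}) (vertex-≈⇒ false {g} {h}) (H? false (g 𝐆.// h))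

  vertices-finite : Finite vertices
  vertices-finite = covered⇒finite {vertices} _≟ⱽ_ {List.map inj₁ gs′ List.++ List.map inj₂ gs′} covers
    where
    gs′ = ∣∣-list {order 𝐆} (proj₂ 𝐆-finite)
    covers : ∀ v → Any (v ≈ᵥ_) (List.map inj₁ gs′ List.++ List.map inj₂ gs′)
    covers (inj₁ g) = Anyₚ.++⁺ˡ (Anyₚ.map⁺ (Any.map (λ {h} → vertex-cong true {g} {h}) (∣∣-covers {order 𝐆} (proj₂ 𝐆-finite) g)))
    covers (inj₂ g) = Anyₚ.++⁺ʳ (List.map inj₁ gs′) (Anyₚ.map⁺ (Any.map (λ {h} → vertex-cong false {g} {h}) (∣∣-covers {order 𝐆} (proj₂ 𝐆-finite) g)))

  locallyFinite : LocallyFinite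
  locallyFinite z = subset-finite {order 𝐆} 𝐆-finite (λ g → (z · g) ≟ⱽ z) (λ {g} {h} → Subgroup.resp (stabiliser z) {g} {h})

  connected′ : Connected
  connected′ = connected generates
    where
    open Subsets 𝐆 using () renaming (⟨_⟩ to ⟪_⟫; gen to gen′; resp to resp′; unit to unit′; mul to mul′; inv to inv′)
    open Subsets (Sym Ω) using (unit; mul; inv)
    X : Pred 𝐆.Carrier 0ℓ
    X = Subgroup.Member H₁ ∪ Subgroup.Member H₂
    generates′ : ∀ {g} → g ∈ ⟨ G₁ ∪ G₂ ⟩ → ∀ m → (g , m) ∈ ⟪ X ⟫
    generates′ {g} (gen x) m = gen′ {x = g , m} x
    generates′ {g} (⟨resp⟩ {x = h} e m′) m = resp′ {x = h , m′} {y = g , m} e (generates′ m′ m′)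
    generates′ unit m = resp′ {x = 𝐆.ε} {y = P.ε , m} (λ _ → refl) unit′
    generates′ (mul {x = x} {y = y} a b) m = resp′ {x = (x , a) 𝐆.∙ (y , b)} {y = x P.∙ y , m} (λ _ → refl) (mul′ {x = x , a} {y = y , b} (generates′ a a) (generates′ b b))
    generates′ (inv {x = x} a) m = resp′ {x = (x , a) 𝐆.⁻¹} {y = x P.⁻¹ , m} (λ _ → refl) (inv′ {x = x , a} (generates′ a a))
    generates : ∀ g → g ∈ ⟪ X ⟫
    generates (g , m) = generates′ m m

  private
    o₁ o₂ : Vertex
    o₁ = vertex true 𝐆.ε
    o₂ = vertex false 𝐆.ε

    Trivial : 𝐆.Carrier → Set
    Trivial g = ∀ v → v · g ≈ᵥ v

    trivial-conj : ∀ g h → Trivial g → Trivial (h 𝐆.⁻¹ 𝐆.∙ (g 𝐆.∙ h))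
    trivial-conj g h t v = V.trans (·-∙ v (h 𝐆.⁻¹) (g 𝐆.∙ h)) (V.trans (·-∙ _ g h) (V.trans (·-cong (t (v · (h 𝐆.⁻¹))) (𝐆.refl {h}))
      (V.trans (V.sym (·-∙ v (h 𝐆.⁻¹) h)) (V.trans (·-cong (V.refl {v}) (𝐆.inverseˡ h)) (·-ε v)))))

    -- An element of G₁ with scalar part c that also acts as a scalar on the
    -- neighbours of G₂ has c = s′ and c = p s′ with p = s′, so c = 1.
    trivial-translation : ∀ g → Trivial g → ∃ λ t → ∀ x → Inverse.to (proj₁ g) x ≡ x ⊞ t
    trivial-translation g triv = t , λ x → trans (k≈ x) (cong (_⊞ t) (trans (F₁.j-cong {f} {Γ.ε} f≈ε x) (Acts.act-ε lifts x)))
      where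
      module S₁ = Side 𝓛₁ 𝐆.ε
      module S₂ = Side 𝓛₂ 𝐆.ε
      sc₁ : IsScalar (S₁.ℓ g (triv o₁))
      sc₁ = S₁.agree⇒scalar g (triv o₁) (λ y _ → triv y)
      sc₂ : IsScalar (S₂.ℓ g (triv o₂))
      sc₂ = S₂.agree⇒scalar g (triv o₂) (λ y _ → triv y)
      m₁ = G₁⊆𝒢₁ {proj₁ (S₁.conj g)} (S₁.stab⇒ g (triv o₁))
      m₂ = G₂⊆𝒢₂ {proj₁ (S₂.conj g)} (S₂.stab⇒ g (triv o₂))
      f = proj₁ m₁
      t = proj₁ (proj₂ m₁)
      k≈ : ∀ x → Inverse.to (proj₁ g) x ≡ lift f x ⊞ t
      k≈ = proj₂ (proj₂ m₁)
      f₂ = proj₁ m₂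
      κ = proj₁ (proj₂ m₂)
      open Triangular f₂ using (p; s; s′; L; M; S; L³; M³; 0#-homo; 1#-homo; s′≢0; formula′)
      c₁ = Semilinear.p f
      s′≡p : s′ ≡ p
      s′≡p = trans (cong proj₂ (sc₂ e₂)) (*-identityʳ p)
      same : ∀ x → lift f x ⊞ t ≡ unipotent κ (twist f₂ x)
      same x = trans (sym (k≈ x)) (proj₂ (proj₂ m₂) x)
      n = proj₁ κ
      d = proj₁ (proj₂ κ)
      u = proj₁ (proj₂ (proj₂ κ))
      v = proj₂ (proj₂ (proj₂ κ))
      twist-at : ∀ (a b : Fin 3) → twist f₂ (⟦ a ⟧₃ , ⟦ b ⟧₃ , 0#) ≡ twisted L M S (⟦ a ⟧₃ , ⟦ b ⟧₃ , 0#)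
      twist-at a b = cong (twisted L M S) (triple≡ (Triangular.coefficient f₂ a) (Triangular.coefficient f₂ b) 0#-homo)
      lift-at : ∀ a b → lift f (a , b , 0#) ≡ (c₁ * a , c₁ * b , 0#)
      lift-at a b = triple≡ (cong proj₁ (sc₁ (a , b))) (cong proj₂ (sc₁ (a , b))) (trans (cong (ρ (δet f) *_) (Semilinear.0#-homo f)) (zeroʳ _))
      at : ∀ (a b : Fin 3) → (c₁ * ⟦ a ⟧₃ , c₁ * ⟦ b ⟧₃ , 0#) ⊞ t ≡ unipotent κ (twisted L M S (⟦ a ⟧₃ , ⟦ b ⟧₃ , 0#))
      at a b = trans (cong (_⊞ t) (sym (lift-at ⟦ a ⟧₃ ⟦ b ⟧₃))) (trans (same (⟦ a ⟧₃ , ⟦ b ⟧₃ , 0#)) (cong (unipotent κ) (twist-at a b)))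
      first : ∀ a b → proj₁ ((c₁ * ⟦ a ⟧₃ , c₁ * ⟦ b ⟧₃ , 0#) ⊞ t) ≡ proj₁ (unipotent κ (twisted L M S (⟦ a ⟧₃ , ⟦ b ⟧₃ , 0#)))
      first a b = proj₁ (,≡ (at a b))
      second : ∀ a b → c₁ * ⟦ b ⟧₃ + proj₁ (proj₂ t) ≡ M ^ 3 * ⟦ b ⟧₃ + v
      second a b = proj₁ (,≡ (proj₂ (,≡ (at a b))))
      subtract : ∀ {x y x′ y′} → x ≡ y → x′ ≡ y′ → x - x′ ≡ y - y′
      subtract refl refl = refl
      c₁≡s′ : c₁ ≡ s′
      c₁≡s′ = trans (solve 2 (λ c t → c := c :* con 1₃ :+ t :- (c :* con 0₃ :+ t)) refl c₁ (proj₁ (proj₂ t)))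
        (trans (subtract (second 0₃ 1₃) (second 0₃ 0₃)) (trans (solve 2 (λ c t → c :* con 1₃ :+ t :- (c :* con 0₃ :+ t) := c) refl (M ^ 3) v) M³))
      c₁≡ps′ : c₁ ≡ p * s′
      c₁≡ps′ = trans (solve 2 (λ c t → c := c :* con 1₃ :+ t :- (c :* con 0₃ :+ t)) refl c₁ (proj₁ t))
        (trans (subtract (first 1₃ 0₃) (first 0₃ 0₃)) (trans (solve 6 (λ L M S d u κ →
            (L :* M :* con 1₃ :+ S :* M :* con 0₃ :^ 2 :+ κ :* con 0₃ :+ d :* (M :* con 0₃) :+ u)
              :- (L :* M :* con 0₃ :+ S :* M :* con 0₃ :^ 2 :+ κ :* con 0₃ :+ d :* (M :* con 0₃) :+ u) := L :* M)
            refl (L ^ 3) (M ^ 3) (S ^ 3) d u (S * L ^ 2 * M ^ 3)) (cong₂ _*_ L³ M³)))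
      c₁≡1 : c₁ ≡ 1#
      c₁≡1 = trans c₁≡s′ (*-cancelˡ s′≢0 (trans (cong (_* s′) s′≡p) (trans (sym c₁≡ps′) (trans c₁≡s′ (sym (*-identityʳ s′))))))
      f≈ε : f Γ.≈ Γ.ε
      f≈ε w = trans (sc₁ w) (trans (cong (_• w) c₁≡1) (cong₂ _,_ (*-identityˡ _) (*-identityˡ _)))

    abstract
      trivial⇒translation : ∀ g → Trivial g → ∃ λ t → ∀ x → Inverse.to (proj₁ g) x ≡ x ⊞ t
      trivial⇒translation = trivial-translation

    translation-of : ∀ g → Trivial g → Ω
    translation-of g triv = proj₁ (trivial⇒translation g triv)

    commuted : ∀ g h triv x → Inverse.to (proj₁ h) (x ⊞ translation-of g triv) ≡ Inverse.to (proj₁ h) x ⊞ translation-of (h 𝐆.⁻¹ 𝐆.∙ (g 𝐆.∙ h)) (trivial-conj g h triv)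
    commuted g h triv x = trans (cong (Inverse.to (proj₁ h)) (trans (sym (proj₂ (trivial⇒translation g triv) x))
        (cong (Inverse.to (proj₁ g)) (sym (Inverse.strictlyInverseʳ (proj₁ h) x)))))
      (proj₂ (trivial⇒translation (h 𝐆.⁻¹ 𝐆.∙ (g 𝐆.∙ h)) (trivial-conj g h triv)) (Inverse.to (proj₁ h) x))

    τ₁ δ₁ : 𝐆.Carrier
    τ₁ = element₂ (F₂.j (unipotentᵁ 1#)) (F₂.j∈ (unipotentᵁ 1#))
    δ₁ = element₁ (F₁.j δΓ) (F₁.j∈ δΓ)

    -- Conjugating a translation (u , v , w) in the kernel of the action by τ₁
    -- gives v ≡ 0 and the translation (u + w , 0 , w); conjugating by δ gives u ≡ 0.
    second≡0 : ∀ g triv → proj₁ (proj₂ (translation-of g triv)) ≡ 0# × proj₁ (translation-of (τ₁ 𝐆.⁻¹ 𝐆.∙ (g 𝐆.∙ τ₁)) (trivial-conj g τ₁ triv)) ≡ proj₁ (translation-of g triv) + proj₂ (proj₂ (translation-of g triv))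
    second≡0 g triv = v≡0 , sym (trans (solve 3 (λ u w R → u :+ w := u :+ con 1₃ :* (con 0₃ :+ con 0₃) :^ 2 :+ con 1₃ :* w) refl u w (root 1#))
        (trans (cong₂ (λ a b → u + 1# * (0# + a) ^ 2 + b * w) (sym v≡0) (sym root-1)) (trans (solve 4 (λ u v w R → u :+ con 1₃ :* (con 0₃ :+ v) :^ 2 :+ R :* w := con 0₃ :+ u :+ con 1₃ :* (con 0₃ :+ v) :^ 2 :+ R :* (con 0₃ :+ w)) refl u v w (root 1#))
          (trans (at 0#) (solve 2 (λ u′ R → con 0₃ :+ con 1₃ :* con 0₃ :^ 2 :+ R :* con 0₃ :+ u′ := u′) refl u′ (root 1#))))))
      where
      t = translation-of g triv
      u = proj₁ t
      v = proj₁ (proj₂ t)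
      w = proj₂ (proj₂ t)
      u′ = proj₁ (translation-of (τ₁ 𝐆.⁻¹ 𝐆.∙ (g 𝐆.∙ τ₁)) (trivial-conj g τ₁ triv))
      root-1 : root 1# ≡ 1#
      root-1 = Aut.1#-homo (frob-aut r′)
      at : ∀ b → 0# + u + 1# * (b + v) ^ 2 + root 1# * (0# + w) ≡ 0# + 1# * b ^ 2 + root 1# * 0# + u′
      at b = proj₁ (,≡ (trans (sym (twist-τ 1# (0# + u) (b + v) (0# + w))) (trans (commuted g τ₁ triv (0# , b , 0#)) (cong (_⊞ translation-of (τ₁ 𝐆.⁻¹ 𝐆.∙ (g 𝐆.∙ τ₁)) (trivial-conj g τ₁ triv)) (twist-τ 1# 0# b 0#)))))
      v≡0 : v ≡ 0#
      v≡0 = trans (solve 4 (λ u v w R → v := :- ((con 0₃ :+ u :+ con 1₃ :* (con 1₃ :+ v) :^ 2 :+ R :* (con 0₃ :+ w)) :- (con 0₃ :+ u :+ con 1₃ :* (con 0₃ :+ v) :^ 2 :+ R :* (con 0₃ :+ w)) :- con 1₃)) refl u v w (root 1#))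
        (trans (cong₂ (λ x y → - (x - y - 1#)) (at 1#) (at 0#)) (solve 2 (λ u′ R → :- ((con 0₃ :+ con 1₃ :* con 1₃ :^ 2 :+ R :* con 0₃ :+ u′) :- (con 0₃ :+ con 1₃ :* con 0₃ :^ 2 :+ R :* con 0₃ :+ u′) :- con 1₃) := con 0₃) refl u′ (root 1#)))

    first≡0 : ∀ g triv → proj₁ (translation-of g triv) ≡ 0#
    first≡0 g triv = trans (solve 1 (λ u → u := :- (:- (con 0₃ :+ u))) refl u) (trans (cong -_ (trans at (trans (cong (- 0# +_) (proj₁ (second≡0 _ (trivial-conj g δ₁ triv)))) (trans (+-identityʳ _) -0#≈0#)))) -0#≈0#)
      where
      t = translation-of g triv
      u = proj₁ t
      at : - (0# + u) ≡ - 0# + proj₁ (proj₂ (translation-of (δ₁ 𝐆.⁻¹ 𝐆.∙ (g 𝐆.∙ δ₁)) (trivial-conj g δ₁ triv)))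
      at = proj₁ (,≡ (proj₂ (,≡ (trans (sym (lift-δ (0# + u) (0# + proj₁ (proj₂ t)) (0# + proj₂ (proj₂ t)))) (trans (commuted g δ₁ triv (0# , 0# , 0#))
        (cong (_⊞ translation-of (δ₁ 𝐆.⁻¹ 𝐆.∙ (g 𝐆.∙ δ₁)) (trivial-conj g δ₁ triv)) (lift-δ 0# 0# 0#)))))))

  faithful : ∀ g → (∀ v → v · g ≈ᵥ v) → g 𝐆.≈ 𝐆.ε
  faithful g triv x = trans (proj₂ (trivial⇒translation g triv) x) (trans (cong (x ⊞_) (triple≡ u≡0 (proj₁ (second≡0 g triv)) w≡0))
      (triple≡ (+-identityʳ _) (+-identityʳ _) (+-identityʳ _)))
    where
    u≡0 = first≡0 g triv
    w≡0 : proj₂ (proj₂ (translation-of g triv)) ≡ 0#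
    w≡0 = trans (sym (+-identityˡ _)) (trans (cong (_+ proj₂ (proj₂ (translation-of g triv))) (sym u≡0))
      (trans (sym (proj₂ (second≡0 g triv))) (first≡0 (τ₁ 𝐆.⁻¹ 𝐆.∙ (g 𝐆.∙ τ₁)) (trivial-conj g τ₁ triv))))

  isGGraph : IsGGraph
  isGGraph = vertices-finite , connected′ , faithful

module ArcTransitivity (r′ : ℕ) (𝔽 : FiniteField (3 ℕ.^ ℕ.suc r′)) where
  open FieldTheory r′ 𝔽
  open Permutations r′ 𝔽
  open Stabilisers r′ 𝔽
  open Products r′ 𝔽
  open Lines r′ 𝔽
  open Construction 𝔽 using (Ω)
  open Amalgam r′ 𝔽
  open CosetGraph 𝐆 (Subgroup.Member H₁) (Subgroup.Member H₂)
  open Graph Δ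
  open ActionOn action
  open GGraph action
  open Arcs action
  open Group 𝐆 using (_≈_; _∙_; ε; _⁻¹; ∙-congʳ; ∙-congˡ; inverseʳ; inverseˡ) renaming (Carrier to 𝐆ᶜ; refl to ≈-refl; sym to ≈-sym; trans to ≈-trans)
  open GroupProperties 𝐆 using (//-rightDividesʳ; \\-leftDividesʳ)
  private
    module V = Setoid vertices
    module P = Group (Sym Ω)

    _∈ᴴ_ : 𝐆ᶜ → Bool → Set
    g ∈ᴴ s = g ∈ Subgroup.Member (H s)

    fixes : ∀ s h g k → k ∈ᴴ s → h ∙ g ≈ k ∙ h → Fixes g (vertex s h)
    fixes s h g k k∈ e = subst (_≈ᵥ vertex s h) (sym (vertex-· s h g)) (vertex-≈⇐ s {h ∙ g} {h} (Subgroup.resp (H s) {k} {h ∙ g ∙ h ⁻¹}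
      (≈-sym {h ∙ g ∙ h ⁻¹} {k} (≈-trans {h ∙ g ∙ h ⁻¹} {k ∙ h ∙ h ⁻¹} {k} (∙-congʳ {h ⁻¹} {h ∙ g} {k ∙ h} e) (//-rightDividesʳ h k))) k∈))

    passes : ∀ h h′ g g′ g″ → h ∙ g ≈ g′ ∙ h → h′ ∙ g′ ≈ g″ ∙ h′ → h′ ∙ h ∙ g ≈ g″ ∙ (h′ ∙ h)
    passes h h′ g g′ g″ e e′ = ≈-trans {h′ ∙ h ∙ g} {h′ ∙ g′ ∙ h} {g″ ∙ (h′ ∙ h)}
      (≈-trans {h′ ∙ h ∙ g} {h′ ∙ (g′ ∙ h)} {h′ ∙ g′ ∙ h} (∙-congˡ {h′} {h ∙ g} {g′ ∙ h} e) (λ _ → refl)) (∙-congʳ {h} {h′ ∙ g′} {g″ ∙ h′} e′)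

    α : Ω → 𝐆ᶜ
    α t = element₁ (F₁.i t) (F₁.i∈ t)

    α∈ : ∀ s t → α t ∈ᴴ s
    α∈ true t = 𝒢₁⊆G₁ {F₁.i t} (F₁.i∈ t)
    α∈ false t = 𝒢₂⊆G₂ {F₁.i t} (α⊆𝒢₂ {proj₁ t} {proj₁ (proj₂ t)} {proj₂ (proj₂ t)} {F₁.i t} (λ _ → refl))

    δ τ τ⁻ : 𝐆ᶜ
    δ = element₁ (F₁.j δΓ) (F₁.j∈ δΓ)
    τ = element₂ (F₂.j (unipotentᵁ 1#)) (F₂.j∈ (unipotentᵁ 1#))
    τ⁻ = τ ⁻¹

    δ∈ : δ ∈ᴴ true
    δ∈ = 𝒢₁⊆G₁ {F₁.j δΓ} (F₁.j∈ δΓ)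

    τ∈ : τ ∈ᴴ false
    τ∈ = 𝒢₂⊆G₂ {F₂.j (unipotentᵁ 1#)} (F₂.j∈ (unipotentᵁ 1#))

    τ⁻-commutes : ∀ g g′ → g ∙ τ ≈ τ ∙ g′ → τ⁻ ∙ g ≈ g′ ∙ τ⁻
    τ⁻-commutes g g′ e = ≈-trans {τ⁻ ∙ g} {τ⁻ ∙ (g ∙ τ ∙ τ⁻)} {g′ ∙ τ⁻} (∙-congˡ {τ⁻} {g} {g ∙ τ ∙ τ⁻} (≈-sym {g ∙ τ ∙ τ⁻} {g} (//-rightDividesʳ τ g)))
      (≈-trans {τ⁻ ∙ (g ∙ τ ∙ τ⁻)} {τ⁻ ∙ (τ ∙ (g′ ∙ τ⁻))} {g′ ∙ τ⁻} (∙-congˡ {τ⁻} {g ∙ τ ∙ τ⁻} {τ ∙ (g′ ∙ τ⁻)} (∙-congʳ {τ⁻} {g ∙ τ} {τ ∙ g′} e)) (\\-leftDividesʳ τ (g′ ∙ τ⁻)))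

    δ-act : ∀ a b c → Inverse.to (proj₁ δ) (a , b , c) ≡ (b , - a , c)
    δ-act = lift-δ

    τ-act : ∀ a b c → Inverse.to (proj₁ τ) (a , b , c) ≡ (a + b ^ 2 + c , b , c)
    τ-act a b c = trans (twist-τ 1# a b c) (triple≡ (cong₂ (λ x y → a + x + y) (*-identityˡ _) (trans (cong (_* c) (Aut.1#-homo (frob-aut r′))) (*-identityˡ c))) refl refl)

    -- The element a = τ α₁ τ⁻¹ of Q, whose linear part is γ v.
    module Shear (v : F) where
      κ : Group.Carrier K₂
      κ = 0# , v , - (v ^ 2) , v

      a : 𝐆ᶜ
      a = element₂ (F₂.i κ) (F₂.i∈ κ)

      a-act : ∀ x y z → Inverse.to (proj₁ a) (x , y , z) ≡ (x + v * y + - (v ^ 2) , y + v , z)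
      a-act x y z = triple≡ refl refl (+-identityʳ z)

      a∈𝒢₁ : proj₁ a ∈ Subgroup.Member F₁.image
      a∈𝒢₁ = γΓ v , (- (v ^ 2) , v , 0#) , λ { (x , y , z) → sym (cong (_⊞ (- (v ^ 2) , v , 0#)) (lift-γ v x y z)) }

      a∈ : ∀ s → a ∈ᴴ s
      a∈ true = 𝒢₁⊆G₁ {proj₁ a} a∈𝒢₁
      a∈ false = 𝒢₂⊆G₂ {proj₁ a} (F₂.i∈ κ)

      lin-a : Linear.lin 𝓛₁ a (a∈ true) Γ.≈ γΓ v
      lin-a = proj₁ (F₁.part-cong {proj₁ a} {proj₁ a} (G₁⊆𝒢₁ {proj₁ a} (a∈ true)) a∈𝒢₁ (λ _ → refl))

      α₁ α₂ α₃ : 𝐆ᶜ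
      α₁ = α (0# , v , 0#)
      α₂ = α (- v , 0# , 0#)
      α₃ = α (0# , - v , 0#)

      τ⁻a : τ⁻ ∙ a ≈ α₁ ∙ τ⁻
      τ⁻a = τ⁻-commutes a α₁ λ { (x , y , z) → trans (cong (Inverse.to (proj₁ τ)) (a-act x y z)) (trans (τ-act _ _ _)
        (trans (triple≡ (solve 4 (λ x y z v → x :+ v :* y :+ :- (v :^ 2) :+ (y :+ v) :^ 2 :+ z := x :+ y :^ 2 :+ z :+ con 0₃) refl x y z v) refl (sym (+-identityʳ z)))
          (sym (cong (_⊞ (0# , v , 0#)) (τ-act x y z))))) }

      δα₁ : δ ∙ α₁ ≈ α₂ ∙ δ
      δα₁ (x , y , z) = trans (cong (_⊞ (0# , v , 0#)) (δ-act x y z)) (trans (triple≡ refl (solve 2 (λ x v → :- x :+ v := :- (x :+ :- v)) refl x v) refl)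
        (trans (triple≡ refl refl refl) (sym (δ-act (x + - v) (y + 0#) (z + 0#)))))

      τ⁻α₂ : τ⁻ ∙ α₂ ≈ α₂ ∙ τ⁻
      τ⁻α₂ = τ⁻-commutes α₂ α₂ λ { (x , y , z) → trans (τ-act (x + - v) (y + 0#) (z + 0#)) (trans
        (triple≡ (solve 4 (λ x y z v → x :+ :- v :+ (y :+ con 0₃) :^ 2 :+ (z :+ con 0₃) := x :+ y :^ 2 :+ z :+ :- v) refl x y z v) refl refl)
        (sym (cong (_⊞ (- v , 0# , 0#)) (τ-act x y z)))) }

      δα₂ : δ ∙ α₂ ≈ α₃ ∙ δ
      δα₂ (x , y , z) = trans (cong (_⊞ (- v , 0# , 0#)) (δ-act x y z)) (trans (triple≡ refl (solve 1 (λ x → :- x :+ con 0₃ := :- (x :+ con 0₃)) refl x) refl)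
        (sym (δ-act (x + 0#) (y + - v) (z + 0#))))

    -- s is β μ² μ, and b is its conjugate β μ μ² under δ.
    module Diagonal (μ k : F) (kμ≡1 : k * μ ≡ 1#) where
      μ≢0 : μ ≢ 0#
      μ≢0 = factorʳ≢0 (λ e → 1≢0 (trans (sym kμ≡1) e))
      μμ≢0 : μ * μ ≢ 0#
      μμ≢0 = *-nonzero μ≢0 μ≢0
      kμ² : k * μ ^ 2 ≡ μ
      kμ² = modulo μ kμ≡1 (solve 2 (λ k m → k :* m :^ 2 := m :+ m :* (k :* m :- con 1₃)) refl k μ)
      kμ²≢0 : k * μ ^ 2 ≢ 0#
      kμ²≢0 e = μ≢0 (trans (sym kμ²) e)
      bᵁ : UT.Carrier
      bᵁ = diagonalᵁ k (μ ^ 2) kμ²≢0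

      s b : 𝐆ᶜ
      s = element₂ (F₂.j (diagonalᵁ μ μ μμ≢0)) (F₂.j∈ (diagonalᵁ μ μ μμ≢0))
      b = element₂ (F₂.j bᵁ) (F₂.j∈ bᵁ)

      s-act : ∀ x y z → Inverse.to (proj₁ s) (x , y , z) ≡ (μ ^ 2 * x , μ * y , ρ (μ ^ 2 * μ) * z)
      s-act x y z = trans (twist-diagonal μ μ μμ≢0 x y z) (triple≡ (cong (_* x) (cong (μ *_) (sym (*-identityʳ μ)))) refl (cong (λ t → ρ t * z) (*-comm μ (μ ^ 2))))

      b-act : ∀ x y z → Inverse.to (proj₁ b) (x , y , z) ≡ (μ * x , μ ^ 2 * y , ρ (μ ^ 2 * μ) * z)
      b-act x y z = trans (twist-diagonal k (μ ^ 2) kμ²≢0 x y z) (triple≡ (cong (_* x) kμ²) refl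
        (cong (λ t → ρ t * z) (modulo (μ ^ 3) kμ≡1 (solve 2 (λ k m → k :* (m :^ 2) :^ 2 := m :^ 2 :* m :+ m :^ 3 :* (k :* m :- con 1₃)) refl k μ))))

      s∈ : ∀ t → s ∈ᴴ t
      s∈ true = 𝒢₁⊆G₁ {proj₁ s} (lift∈𝒢₁ (diagonalΓ (μ ^ 2) μ (cube-nonzero μ≢0)) {proj₁ s} λ { (x , y , z) →
        trans (s-act x y z) (sym (lift-diagonal (μ ^ 2) μ (cube-nonzero μ≢0) x y z)) })
      s∈ false = 𝒢₂⊆G₂ {proj₁ s} (F₂.j∈ (diagonalᵁ μ μ μμ≢0))

      μμ²≢0 : μ * μ ^ 2 ≢ 0#
      μμ²≢0 = *-nonzero μ≢0 (^-nonzero 2 μ≢0)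

      b∈ : ∀ t → b ∈ᴴ t
      b∈ true = 𝒢₁⊆G₁ {proj₁ b} (lift∈𝒢₁ (diagonalΓ μ (μ ^ 2) μμ²≢0) {proj₁ b} λ { (x , y , z) →
        trans (b-act x y z) (trans (triple≡ refl refl (cong (λ t → ρ t * z) (*-comm (μ ^ 2) μ))) (sym (lift-diagonal μ (μ ^ 2) μμ²≢0 x y z))) })
      b∈ false = 𝒢₂⊆G₂ {proj₁ b} (F₂.j∈ bᵁ)

      lin-b : Linear.lin 𝓛₂ b (b∈ false) Γ.≈ UT⇒Γ bᵁ
      lin-b = proj₁ (F₂.part-cong {proj₁ b} {proj₁ b} (G₂⊆𝒢₂ {proj₁ b} (b∈ false)) (F₂.j∈ bᵁ) (λ _ → refl))

      δb : δ ∙ b ≈ s ∙ δ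
      δb (x , y , z) = trans (cong (Inverse.to (proj₁ b)) (δ-act x y z)) (trans (b-act y (- x) z) (trans
        (triple≡ refl (solve 2 (λ m x → m :^ 2 :* :- x := :- (m :^ 2 :* x)) refl μ x) refl)
        (sym (trans (cong (Inverse.to (proj₁ δ)) (s-act x y z)) (δ-act _ _ _)))))

      δs : δ ∙ s ≈ b ∙ δ
      δs (x , y , z) = trans (cong (Inverse.to (proj₁ s)) (δ-act x y z)) (trans (s-act y (- x) z) (trans
        (triple≡ refl (solve 2 (λ m x → m :* :- x := :- (m :* x)) refl μ x) refl)
        (sym (trans (cong (Inverse.to (proj₁ δ)) (b-act x y z)) (δ-act _ _ _)))))

      ρ-cube : ρ (μ ^ 2 * μ) ≡ μ ^ 2
      ρ-cube = cong (_^ 2) (trans (cong root (solve 1 (λ m → m :^ 2 :* m := m :^ 3) refl μ)) (root-of-cube μ))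

      τ⁻s : τ⁻ ∙ s ≈ s ∙ τ⁻
      τ⁻s = τ⁻-commutes s s λ { (x , y , z) → trans (cong (Inverse.to (proj₁ τ)) (s-act x y z)) (trans (τ-act _ _ _) (trans
        (triple≡ (trans (cong (λ t → μ ^ 2 * x + (μ * y) ^ 2 + t * z) ρ-cube) (solve 4 (λ m x y z → m :^ 2 :* x :+ (m :* y) :^ 2 :+ m :^ 2 :* z := m :^ 2 :* (x :+ y :^ 2 :+ z)) refl μ x y z)) refl refl)
        (sym (trans (cong (Inverse.to (proj₁ s)) (τ-act x y z)) (s-act _ _ _))))) }

    module S₁ = Side 𝓛₁ ε
    module S₂ = Side 𝓛₂ ε

    x₁ x₂ : Vertex
    x₁ = vertex true ε
    x₂ = vertex false ε

    from-base : ∀ {s y} → vertex s ε ~ y → ∃ λ k → k ∈ᴴ s × y ≈ᵥ vertex (not s) k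
    from-base {s} {y} a = proj₁ n , proj₁ (proj₂ n) , V.trans (proj₂ (proj₂ n)) (vertex-cong (not s) {proj₁ n ∙ ε} {proj₁ n} (λ _ → refl))
      where n = neighbour⇒ s {ε} {y} a

    move : ∀ {s} (L : Linear s) {y} k k∈ g g∈ h h∈ → y ≈ᵥ vertex (not s) k →
           fun (Linear.lin L g g∈) (Side.line L ε k k∈) ∥ Side.line L ε h h∈ → y · g ≈ᵥ vertex (not s) h
    move {s} L {y} k k∈ g g∈ h h∈ y≈ e = V.trans (·-cong {y} {vertex (not s) k} {g} {g} y≈ (≈-refl {g})) (V.trans (V.reflexive (vertex-· (not s) k g))
      (V.trans (vertex-cong (not s) {k ∙ g} {k ∙ g ∙ ε} (λ _ → refl)) (V.trans
        (S.∥⇒same (k ∙ g) h kg h∈ (subst (_∥ S.line h h∈) (sym (S.line-∙ k g k∈ g∈ kg)) e))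
        (vertex-cong (not s) {h ∙ ε} {h} (λ _ → refl)))))
      where
      module S = Side L ε
      kg : (k ∙ g) ∈ᴴ s
      kg = Subgroup.∙∈ (H s) {k} {g} k∈ g∈

    δ⁻∈ : (δ ⁻¹) ∈ᴴ true
    δ⁻∈ = Subgroup.⁻¹∈ H₁ {δ} δ∈

    line-δ⁻ : S₁.line (δ ⁻¹) δ⁻∈ ≡ (0# , 1#)
    line-δ⁻ = perm-injective (proj₁ δΓ) (trans (trans (sym (lin-δ (S₁.line (δ ⁻¹) δ⁻∈))) (trans (sym (S₁.line-∙ (δ ⁻¹) δ δ⁻∈ δ∈ n)) (trans
        (S₁.line-cong ((δ ⁻¹) ∙ δ) ε n (Subgroup.ε∈ H₁) (inverseˡ δ)) lin-ε)))
        (sym (cong₂ _,_ (solve 0 (con 0₃ :* con 0₃ :+ con 1₃ :* con 1₃ := con 1₃) refl) (solve 0 (con 2₃ :* con 0₃ :+ con 0₃ :* con 1₃ := con 0₃) refl))))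
      where
      n = Subgroup.∙∈ H₁ {δ ⁻¹} {δ} δ⁻∈ δ∈
      lin-δ : Linear.lin 𝓛₁ δ δ∈ Γ.≈ δΓ
      lin-δ = proj₁ (F₁.part-cong {F₁.j δΓ} {F₁.j δΓ} (G₁⊆𝒢₁ {F₁.j δΓ} δ∈) (F₁.j∈ δΓ) (λ _ → refl))
      lin-ε : S₁.line ε (Subgroup.ε∈ H₁) ≡ e₁
      lin-ε = proj₁ (F₁.part-cong {P.ε} {P.ε} (G₁⊆𝒢₁ {P.ε} (Subgroup.ε∈ H₁)) (Subgroup.ε∈ F₁.image) (λ _ → refl)) e₁

    line-τ : S₂.line τ τ∈ ≡ (1# , 1#)
    line-τ = trans (proj₁ (F₂.part-cong {proj₁ τ} {proj₁ τ} (G₂⊆𝒢₂ {proj₁ τ} τ∈) (F₂.j∈ (unipotentᵁ 1#)) (λ _ → refl)) e₂)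
      (matrix-e₂ aut-id 1# 1# 0# 1# (triangular-det 1# 1# 1# one-nonzero))

    L₅ : Vec Vertex 6
    L₅ = x₁ ∷ x₂ ∷ vertex true τ⁻ ∷ vertex false (δ ∙ τ⁻) ∷ vertex true (τ⁻ ∙ (δ ∙ τ⁻)) ∷ vertex false (δ ∙ (τ⁻ ∙ (δ ∙ τ⁻))) ∷ []

    L₄ : Vec Vertex 5
    L₄ = x₂ ∷ x₁ ∷ vertex false δ ∷ vertex true (τ⁻ ∙ δ) ∷ vertex false (δ ∙ (τ⁻ ∙ δ)) ∷ []

    step₅ : ∀ y → ¬ (x₂ ≈ᵥ y) → ∀ k → k ∈ᴴ true → y ≈ᵥ vertex false k → ∃ λ g → VAll.All (Fixes g) L₅ × y · g ≈ᵥ vertex false (δ ⁻¹)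
    step₅ y x₂≉y k k∈ y≈ = a
        , fixes true ε a a (a∈ true) (λ _ → refl)
        ∷ fixes false ε a a (a∈ false) (λ _ → refl)
        ∷ fixes true τ⁻ a α₁ (α∈ true _) τ⁻a
        ∷ fixes false (δ ∙ τ⁻) a α₂ (α∈ false _) p₂
        ∷ fixes true (τ⁻ ∙ (δ ∙ τ⁻)) a α₂ (α∈ true _) p₃
        ∷ fixes false (δ ∙ (τ⁻ ∙ (δ ∙ τ⁻))) a α₃ (α∈ false _) (passes (τ⁻ ∙ (δ ∙ τ⁻)) δ a α₂ α₃ p₃ δα₂)
        ∷ []
        , move 𝓛₁ {y} k k∈ a (a∈ true) (δ ⁻¹) δ⁻∈ y≈ (trans (cong₂ det (lin-a (u , w)) line-δ⁻) aligned)
      where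
      u = proj₁ (S₁.line k k∈)
      w = proj₂ (S₁.line k k∈)
      w≢0 : w ≢ 0#
      w≢0 e = x₂≉y (V.sym (V.trans y≈ (V.trans (V.trans (vertex-cong false {k} {k ∙ ε} (λ _ → refl)) (S₁.∥⇒same k ε k∈ (Subgroup.ε∈ H₁)
        (trans (cong (det (u , w)) line-ε₁) (trans (cong (λ z → u * 0# - 1# * z) e) (solve 1 (λ u → u :* con 0₃ :- con 1₃ :* con 0₃ := con 0₃) refl u))))) (vertex-cong false {ε ∙ ε} {ε} (λ _ → refl)))))
        where
        line-ε₁ : S₁.line ε (Subgroup.ε∈ H₁) ≡ e₁
        line-ε₁ = proj₁ (F₁.part-cong {P.ε} {P.ε} (G₁⊆𝒢₁ {P.ε} (Subgroup.ε∈ H₁)) (Subgroup.ε∈ F₁.image) (λ _ → refl)) e₁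
      v = - (u * proj₁ (recip w≢0))
      open Shear v
      aligned : det (1# * u + v * w , 0# * u + 1# * w) (0# , 1#) ≡ 0#
      aligned = trans (solve 3 (λ u w k → (con 1₃ :* u :+ :- (u :* k) :* w) :* con 1₃ :- con 0₃ :* (con 0₃ :* u :+ con 1₃ :* w) := u :* (con 1₃ :- k :* w)) refl u w (proj₁ (recip w≢0)))
        (trans (cong (λ z → u * (1# - z)) (proj₂ (recip w≢0))) (solve 1 (λ u → u :* (con 1₃ :- con 1₃) := con 0₃) refl u))
      p₂ : δ ∙ τ⁻ ∙ a ≈ α₂ ∙ (δ ∙ τ⁻)
      p₂ = passes τ⁻ δ a α₁ α₂ τ⁻a δα₁
      p₃ : τ⁻ ∙ (δ ∙ τ⁻) ∙ a ≈ α₂ ∙ (τ⁻ ∙ (δ ∙ τ⁻))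
      p₃ = passes (δ ∙ τ⁻) τ⁻ a α₂ α₂ p₂ τ⁻α₂

    extends₅ : Extends L₅ (vertex false (δ ⁻¹))
    extends₅ y x₁~y x₂≉y = step₅ y x₂≉y (proj₁ n) (proj₁ (proj₂ n)) (proj₂ (proj₂ n))
      where n = from-base {true} {y} x₁~y

    step₄ : ∀ y → ¬ (x₁ ≈ᵥ y) → ∀ k → k ∈ᴴ false → y ≈ᵥ vertex true k → ∃ λ g → VAll.All (Fixes g) L₄ × y · g ≈ᵥ vertex true τ
    step₄ y x₁≉y k k∈ y≈ = b
        , fixes false ε b b (b∈ false) (λ _ → refl)
        ∷ fixes true ε b b (b∈ true) (λ _ → refl)
        ∷ fixes false δ b s (s∈ false) δb
        ∷ fixes true (τ⁻ ∙ δ) b s (s∈ true) p₁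
        ∷ fixes false (δ ∙ (τ⁻ ∙ δ)) b b (b∈ false) (passes (τ⁻ ∙ δ) δ b s b p₁ δs)
        ∷ []
        , move 𝓛₂ {y} k k∈ b (b∈ false) τ τ∈ y≈ (trans (cong₂ det (lin-b (u , w)) line-τ) aligned)
      where
      u = proj₁ (S₂.line k k∈)
      w = proj₂ (S₂.line k k∈)
      w≢0 : w ≢ 0#
      w≢0 = Triangular.s′≢0 (proj₁ (G₂⊆𝒢₂ {proj₁ k} k∈))
      u≢0 : u ≢ 0#
      u≢0 e = x₁≉y (V.sym (V.trans y≈ (V.trans (V.trans (vertex-cong true {k} {k ∙ ε} (λ _ → refl)) (S₂.∥⇒same k ε k∈ (Subgroup.ε∈ H₂)
        (trans (cong (det (u , w)) line-ε₂) (trans (cong (λ z → z * 1# - 0# * w) e) (solve 1 (λ w → con 0₃ :* con 1₃ :- con 0₃ :* w := con 0₃) refl w))))) (vertex-cong true {ε ∙ ε} {ε} (λ _ → refl)))))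
        where
        line-ε₂ : S₂.line ε (Subgroup.ε∈ H₂) ≡ e₂
        line-ε₂ = proj₁ (F₂.part-cong {P.ε} {P.ε} (G₂⊆𝒢₂ {P.ε} (Subgroup.ε∈ H₂)) (Subgroup.ε∈ F₂.image) (λ _ → refl)) e₂
      -- b multiplies the slope u / w by μ⁻³.
      μ³ = u * proj₁ (recip w≢0)
      μ = root μ³
      μ³w : μ ^ 3 * w ≡ u
      μ³w = trans (cong (_* w) (root-cubed μ³)) (trans (*-assoc u _ w) (trans (cong (u *_) (proj₂ (recip w≢0))) (*-identityʳ u)))
      μ≢0 : μ ≢ 0#
      μ≢0 e = u≢0 (trans (sym μ³w) (trans (cong (λ m → m ^ 3 * w) e) (solve 1 (λ w → con 0₃ :^ 3 :* w := con 0₃) refl w)))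
      k′ = proj₁ (recip μ≢0)
      k′μ≡1 = proj₂ (recip μ≢0)
      open Diagonal μ k′ k′μ≡1 hiding (μ≢0)
      aligned : det (k′ * u + 0# * w , 0# * u + μ ^ 2 * w) (1# , 1#) ≡ 0#
      aligned = trans (cong (λ z → (k′ * z + 0# * w) * 1# - 1# * (0# * z + μ ^ 2 * w)) (sym μ³w))
        (trans (solve 3 (λ k m w → (k :* (m :^ 3 :* w) :+ con 0₃ :* w) :* con 1₃ :- con 1₃ :* (con 0₃ :* (m :^ 3 :* w) :+ m :^ 2 :* w) := m :^ 2 :* w :* (k :* m :- con 1₃)) refl k′ μ w)
          (trans (cong (λ z → μ ^ 2 * w * (z - 1#)) k′μ≡1) (solve 2 (λ m w → m :^ 2 :* w :* (con 1₃ :- con 1₃) := con 0₃) refl μ w)))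
      p₁ : τ⁻ ∙ δ ∙ b ≈ s ∙ (τ⁻ ∙ δ)
      p₁ = passes δ τ⁻ b s s δb τ⁻s

    extends₄ : Extends L₄ (vertex true τ)
    extends₄ y x₂~y x₁≉y = step₄ y x₁≉y (proj₁ n) (proj₁ (proj₂ n)) (proj₂ (proj₂ n))
      where n = from-base {false} {y} x₂~y

    extends₀ : ∀ s → Extends (vertex s ε ∷ []) (vertex (not s) ε)
    extends₀ s y a _ = k ⁻¹ , fixes s ε (k ⁻¹) (k ⁻¹) (Subgroup.⁻¹∈ (H s) {k} k∈) (λ _ → refl) ∷ []
      , V.trans (·-cong {y} {vertex (not s) k} {k ⁻¹} {k ⁻¹} y≈ (≈-refl {k ⁻¹})) (V.trans (V.reflexive (vertex-· (not s) k (k ⁻¹))) (vertex-cong (not s) {k ∙ k ⁻¹} {ε} (inverseʳ k)))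
      where
      n = from-base {s} {y} a
      k = proj₁ n
      k∈ = proj₁ (proj₂ n)
      y≈ = proj₂ (proj₂ n)

    return : ∀ s h → h ∈ᴴ s → vertex s h ≈ᵥ vertex s ε
    return s h h∈ = vertex-≈⇐ s {h} {ε} (Subgroup.resp (H s) {h} {h ∙ ε ⁻¹} (λ _ → refl) h∈)

    δ-back : vertex false (δ ⁻¹) · δ ≈ᵥ x₂
    δ-back = vertex-cong false {(δ ⁻¹) ∙ δ} {ε} (inverseˡ δ)

    τ-back : vertex true τ · τ⁻ ≈ᵥ x₁
    τ-back = vertex-cong true {τ ∙ τ⁻} {ε} (inverseʳ τ)

    x₁δ : x₁ · δ ≈ᵥ x₁
    x₁δ = return true (ε ∙ δ) (Subgroup.resp H₁ {δ} {ε ∙ δ} (λ _ → refl) δ∈)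

    x₂τ : x₂ · τ⁻ ≈ᵥ x₂
    x₂τ = return false (ε ∙ τ⁻) (Subgroup.resp H₂ {τ⁻} {ε ∙ τ⁻} (λ _ → refl) (Subgroup.⁻¹∈ H₂ {τ} τ∈))

    shift : ∀ s h k → vertex s h · k ≈ᵥ vertex s (h ∙ k)
    shift s h k = V.reflexive (vertex-· s h k)

    moved : ∀ s k → vertex s ε · k ≈ᵥ vertex s k
    moved s k = V.trans (shift s ε k) (vertex-cong s {ε ∙ k} {k} (λ _ → refl))

    reassociate : ∀ s h h′ k → vertex s (h ∙ h′) · k ≈ᵥ vertex s (h ∙ (h′ ∙ k))
    reassociate s h h′ k = V.trans (shift s (h ∙ h′) k) (vertex-cong s {h ∙ h′ ∙ k} {h ∙ (h′ ∙ k)} (λ _ → refl))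

    reassociate₃ : ∀ s h h′ h″ k → vertex s (h ∙ (h′ ∙ h″)) · k ≈ᵥ vertex s (h ∙ (h′ ∙ (h″ ∙ k)))
    reassociate₃ s h h′ h″ k = V.trans (shift s (h ∙ (h′ ∙ h″)) k) (vertex-cong s {h ∙ (h′ ∙ h″) ∙ k} {h ∙ (h′ ∙ (h″ ∙ k))} (λ _ → refl))

    -- Along an arc, the last vertex is moved back to x₁ or x₂ by δ or τ⁻ after
    -- every step; the arcs from x₁ use initial segments of the frames L₄ and L₅.
    from-x₂-1 : Reaches 1 x₂ (x₁ ∷ x₂ ∷ [])
    from-x₂-1 = reaches-∷ reaches-start (extends₀ false)

    from-x₂-2 : Reaches 2 x₂ (x₂ ∷ x₁ ∷ vertex false δ ∷ [])
    from-x₂-2 = reaches-shift (reaches-∷ from-x₂-1 (extends-init [] _ (extends-init (_ ∷ []) _ (extends-init (_ ∷ _ ∷ []) _ (extends-init (_ ∷ _ ∷ _ ∷ []) _ extends₅))))) δ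
      (δ-back ∷ x₁δ ∷ moved false δ ∷ [])

    from-x₂-3 : Reaches 3 x₂ (x₁ ∷ x₂ ∷ vertex true τ⁻ ∷ vertex false (δ ∙ τ⁻) ∷ [])
    from-x₂-3 = reaches-shift (reaches-∷ from-x₂-2 (extends-init (_ ∷ []) _ (extends-init (_ ∷ _ ∷ []) _ extends₄))) τ⁻
      (τ-back ∷ x₂τ ∷ moved true τ⁻ ∷ shift false δ τ⁻ ∷ [])

    from-x₂-4 : Reaches 4 x₂ L₄
    from-x₂-4 = reaches-shift (reaches-∷ from-x₂-3 (extends-init (_ ∷ _ ∷ []) _ (extends-init (_ ∷ _ ∷ _ ∷ []) _ extends₅))) δ
      (δ-back ∷ x₁δ ∷ moved false δ ∷ shift true τ⁻ δ ∷ reassociate false δ τ⁻ δ ∷ [])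

    from-x₂-5 : Reaches 5 x₂ L₅
    from-x₂-5 = reaches-shift (reaches-∷ from-x₂-4 extends₄) τ⁻
      (τ-back ∷ x₂τ ∷ moved true τ⁻ ∷ shift false δ τ⁻ ∷ reassociate true τ⁻ δ τ⁻ ∷ reassociate₃ false δ τ⁻ δ τ⁻ ∷ [])

    from-x₂-6 : Reaches 6 x₂ (vertex false (δ ⁻¹) ∷ L₅)
    from-x₂-6 = reaches-∷ from-x₂-5 extends₅

    from-x₁-1 : Reaches 1 x₁ (x₂ ∷ x₁ ∷ [])
    from-x₁-1 = reaches-∷ reaches-start (extends₀ true)

    from-x₁-2 : Reaches 2 x₁ (x₁ ∷ x₂ ∷ vertex true τ⁻ ∷ [])
    from-x₁-2 = reaches-shift (reaches-∷ from-x₁-1 (extends-init [] _ (extends-init (_ ∷ []) _ (extends-init (_ ∷ _ ∷ []) _ extends₄)))) τ⁻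
      (τ-back ∷ x₂τ ∷ moved true τ⁻ ∷ [])

    from-x₁-3 : Reaches 3 x₁ (x₂ ∷ x₁ ∷ vertex false δ ∷ vertex true (τ⁻ ∙ δ) ∷ [])
    from-x₁-3 = reaches-shift (reaches-∷ from-x₁-2 (extends-init (_ ∷ []) _ (extends-init (_ ∷ _ ∷ []) _ (extends-init (_ ∷ _ ∷ _ ∷ []) _ extends₅)))) δ
      (δ-back ∷ x₁δ ∷ moved false δ ∷ shift true τ⁻ δ ∷ [])

    from-x₁-4 : Reaches 4 x₁ (x₁ ∷ x₂ ∷ vertex true τ⁻ ∷ vertex false (δ ∙ τ⁻) ∷ vertex true (τ⁻ ∙ (δ ∙ τ⁻)) ∷ [])
    from-x₁-4 = reaches-shift (reaches-∷ from-x₁-3 (extends-init (_ ∷ _ ∷ []) _ extends₄)) τ⁻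
      (τ-back ∷ x₂τ ∷ moved true τ⁻ ∷ shift false δ τ⁻ ∷ reassociate true τ⁻ δ τ⁻ ∷ [])

    from-x₁-5 : Reaches 5 x₁ (vertex false (δ ⁻¹) ∷ x₁ ∷ x₂ ∷ vertex true τ⁻ ∷ vertex false (δ ∙ τ⁻) ∷ vertex true (τ⁻ ∙ (δ ∙ τ⁻)) ∷ [])
    from-x₁-5 = reaches-∷ from-x₁-4 (extends-init (_ ∷ _ ∷ _ ∷ []) _ extends₅)

    home : ∀ s h → vertex s h · (h ⁻¹) ≈ᵥ vertex s ε
    home s h = V.trans (shift s h (h ⁻¹)) (vertex-cong s {h ∙ h ⁻¹} {ε} (inverseʳ h))

  transitive₆ : ∀ h → TransitiveOnArcsFrom 6 (vertex false h)
  transitive₆ h = reaches⇒transitive {vs = vertex false (δ ⁻¹) ∷ L₅} from-x₂-6 {vertex false h} (h ⁻¹) (home false h)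

  locallyArcTransitive : LocallyArcTransitive 5
  locallyArcTransitive (inj₁ h) = reaches⇒transitive {vs = vertex false (δ ⁻¹) ∷ x₁ ∷ x₂ ∷ vertex true τ⁻ ∷ vertex false (δ ∙ τ⁻) ∷ vertex true (τ⁻ ∙ (δ ∙ τ⁻)) ∷ []} from-x₁-5 {vertex true h} (h ⁻¹) (home true h)
  locallyArcTransitive (inj₂ h) = reaches⇒transitive {vs = L₅} from-x₂-5 {vertex false h} (h ⁻¹) (home false h)

≅-⋊ : ∀ {K B B′ : Group 0ℓ 0ℓ} (φ : GroupAction K B) → B′ ≅ B → Σ (GroupAction K B′) λ φ′ → K ⋊ B [ φ ] ≅ K ⋊ B′ [ φ′ ]
≅-⋊ {K} {B} {B′} φ (f , fi) = φ′ , ≅-sym {K ⋊ B′ [ φ′ ]} {K ⋊ B [ φ ]} (mk≅ {K ⋊ B′ [ φ′ ]} {K ⋊ B [ φ ]}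
    (λ { (b , k) → f b , k }) (λ { (e , e′) → f.⟦⟧-cong e , e′ }) (λ _ _ → f.∙-homo _ _ , Group.refl K)
    (λ { (e , e′) → f.injective e , e′ }) (λ { (b , k) → let b′ , e = f.surjective b in (b′ , k) , e (Group.refl B′) , Group.refl K }))
  where
  module f = IsGroupIsomorphism fi
  module K = Group K
  open GroupAction φ
  φ′ : GroupAction K B′
  φ′ = record
    { _◃_ = λ k b → k ◃ f b
    ; ◃-cong = λ e e′ → ◃-cong e (f.⟦⟧-cong e′)
    ; ◃-homo = λ m n b → ◃-homo m n (f b)
    ; ◃-ε = λ n → K.trans (◃-cong K.refl f.ε-homo) (◃-ε n)
    ; ◃-∙ = λ n g h → K.trans (◃-cong K.refl (f.∙-homo g h)) (◃-∙ n (f g) (f h))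
    }

prime-power-≤ : ∀ r k m → ¬ 3 ∣ m → 3 ℕ.^ r ∣ 3 ℕ.^ k ℕ.* m → r ℕ.≤ k
prime-power-≤ ℕ.zero k m 3∤m d = ℕ.z≤n
prime-power-≤ (ℕ.suc r) ℕ.zero m 3∤m d = contradiction (ℕ∣.∣-trans (ℕ∣.m∣m*n (3 ℕ.^ r)) (subst (3 ℕ.^ ℕ.suc r ∣_) (ℕₚ.*-identityˡ m) d)) 3∤m
prime-power-≤ (ℕ.suc r) (ℕ.suc k) m 3∤m d = ℕ.s≤s (prime-power-≤ r k m 3∤m (ℕ∣.*-cancelˡ-∣ 3 (subst (3 ℕ.^ ℕ.suc r ∣_) (ℕₚ.*-assoc 3 (3 ℕ.^ k) m) d)))

module Sylow (r′ : ℕ) (𝔽 : FiniteField (3 ℕ.^ ℕ.suc r′)) where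
  open FieldTheory r′ 𝔽 hiding (_-_)
  open CommutativeRing commutativeRing using (_-_)
  open Permutations r′ 𝔽
  open Stabilisers r′ 𝔽
  open Subgroup
  open Inverse using (to)
  open ≡.≡-Reasoning
  private
    module Π = Group (Sym F²)

  SL⊆ΓL : ∀ f → f ∈ Member SL₂ → f ∈ Member ΓL₂
  SL⊆ΓL f (a , b , c , d , _ , e) = id , aut-id
    , (λ { (x , y) (x′ , y′) → trans (e _ _) (trans (cong₂ _,_ (row+ a b x y x′ y′) (row+ c d x y x′ y′)) (sym (cong₂ _⊕_ (e x y) (e x′ y′)))) })
    , (λ { l (x , y) → trans (e _ _) (trans (cong₂ _,_ (row* a b l x y) (row* c d l x y)) (sym (cong (l •_) (e x y)))) })
    where
    row+ : ∀ a b x y x′ y′ → a * (x + x′) + b * (y + y′) ≡ a * x + b * y + (a * x′ + b * y′)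
    row+ = solve 6 (λ a b x y x′ y′ → a :* (x :+ x′) :+ b :* (y :+ y′) := a :* x :+ b :* y :+ (a :* x′ :+ b :* y′)) refl
    row* : ∀ a b l x y → a * (l * x) + b * (l * y) ≡ l * (a * x + b * y)
    row* = solve 5 (λ a b l x y → a :* (l :* x) :+ b :* (l :* y) := l :* (a :* x :+ b :* y)) refl

  toΓ : ∀ f → f ∈ Member SL₂ → Γ.Carrier
  toΓ f m = f , SL⊆ΓL f m

  δet-SL : ∀ f m → δet (toΓ f m) ≡ 1#
  δet-SL f m@(a , b , c , d , ad-bc , e) = trans (cong₂ det (e 1# 0#) (e 0# 1#))
    (trans (solve 4 (λ a b c d → (a :* con 1₃ :+ b :* con 0₃) :* (c :* con 0₃ :+ d :* con 1₃) :- (a :* con 0₃ :+ b :* con 1₃) :* (c :* con 1₃ :+ d :* con 0₃)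
      := a :* d :- b :* c) refl a b c d) ad-bc)

  tr : (F² ↔ F²) → F
  tr f = proj₁ (to f e₁) + proj₂ (to f e₂)

  tr-cube : ∀ f → f ∈ Member SL₂ → tr (f Π.∙ (f Π.∙ f)) ≡ tr f ^ 3
  tr-cube f m = trans (cong₂ (λ u v → proj₁ u + proj₂ v)
      (trans (cong (to f) (formula p p′)) (formula _ _)) (trans (cong (to f) (formula s s′)) (formula _ _)))
      (solve 4 (λ p p′ s s′ →
        p :* (p :* p :+ s :* p′) :+ s :* (p′ :* p :+ s′ :* p′) :+ (p′ :* (p :* s :+ s :* s′) :+ s′ :* (p′ :* s :+ s′ :* s′))
          := (p :+ s′) :^ 3) refl p p′ s s′)
    where open Semilinear (toΓ f m)

  -- A nontrivial element 1 + N of S₀ has N² = 0, and tr(N N′) = 0 for all 1 + N′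
  -- in S₀ because all traces are 2; hence N′ annihilates the kernel of N.
  module _ (S₀ : Subgroup (Sym F²)) (S₀≤ : S₀ ≤ₛ SL₂) {k : ℕ} (c : ∣ order (group S₀) ∣≡ (3 ℕ.^ k)) where
    private
      module S = Group (group S₀)
      open Mult S.monoid using (×-assocˡ) renaming (_×_ to _·_)

      tr-power : ∀ n x → tr (proj₁ ((3 ℕ.^ n) · x)) ≡ frob n (tr (proj₁ x))
      tr-power ℕ.zero x = refl
      tr-power (ℕ.suc n) x = trans (tr-cong (proj₁ ((3 ℕ.^ ℕ.suc n) · x)) (proj₁ (3 · y)) (S.sym {3 · y} {(3 ℕ.^ ℕ.suc n) · x} (×-assocˡ x 3 (3 ℕ.^ n))))
        (trans (tr-cube (proj₁ y) (S₀≤ (proj₂ y))) (cong (_^ 3) (tr-power n x)))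
        where
        y = (3 ℕ.^ n) · x
        tr-cong : ∀ f g → f Π.≈ g → tr f ≡ tr g
        tr-cong f g e = cong₂ (λ u v → proj₁ u + proj₂ v) (e e₁) (e e₂)

      trace : ∀ f → f ∈ Member S₀ → tr f ≡ - 1#
      trace f m = frob-injective k (trans (sym (tr-power k (f , m))) (trans
        (cong₂ (λ u v → proj₁ u + proj₂ v) (power-order {group S₀} c (f , m) e₁) (power-order {group S₀} c (f , m) e₂))
        (trans (solve 0 (con 1₃ :+ con 1₃ := con 2₃) refl) (sym (Aut.coefficient (frob-aut k) 2₃)))))

    commonly-fixed : ∀ f → f ∈ Member S₀ → ¬ (f Π.≈ Π.ε) → ∃ λ v → v ≢ (0# , 0#) × (∀ g → g ∈ Member S₀ → to g v ≡ v)
    commonly-fixed f f∈ f≉ε = choose ((a ≟ 0#) ×-dec (b ≟ 0#))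
      where
      open Semilinear (toΓ f (S₀≤ f∈)) using (formula) renaming (p to p₀; p′ to c₀; s to b; s′ to d₀)
      a = p₀ - 1#

      module Other (g : F² ↔ F²) (g∈ : g ∈ Member S₀) where
        open Semilinear (toΓ g (S₀≤ g∈)) using () renaming (p to p₁; p′ to c₁; s to b₁; s′ to d₁; formula to formula₁) public
        a₁ : F
        a₁ = p₁ - 1#
        d₁≡ : d₁ ≡ 1# - a₁
        d₁≡ = trans (solve 2 (λ p d → d := p :+ d :- p) refl p₁ d₁) (trans (cong (_- p₁) (trace g g∈)) (solve 1 (λ p → con 2₃ :- p := con 1₃ :- (p :- con 1₃)) refl p₁))
        nilpotent : a₁ * a₁ + b₁ * c₁ ≡ 0#
        nilpotent = trans (solve 3 (λ p b c → (p :- con 1₃) :* (p :- con 1₃) :+ b :* c := con 1₃ :- (p :* (con 1₃ :- (p :- con 1₃)) :- b :* c)) refl p₁ b₁ c₁)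
          (trans (cong (λ z → 1# - (p₁ * z - b₁ * c₁)) (sym d₁≡)) (trans (cong (λ z → 1# - z) (δet-SL g (S₀≤ g∈))) (solve 0 (con 1₃ :- con 1₃ := con 0₃) refl)))
        image : ∀ x y → to g (x , y) ≡ (x + (a₁ * x + b₁ * y) , y + (c₁ * x - a₁ * y))
        image x y = trans (formula₁ x y) (cong₂ _,_ (solve 4 (λ p b x y → p :* x :+ b :* y := x :+ ((p :- con 1₃) :* x :+ b :* y)) refl p₁ b₁ x y)
          (trans (cong (λ z → c₁ * x + z * y) d₁≡) (solve 4 (λ a c x y → c :* x :+ (con 1₃ :- a) :* y := y :+ (c :* x :- a :* y)) refl a₁ c₁ x y)))
      module f = Other f f∈

      orthogonal : ∀ g g∈ → let open Other g g∈ in a * a₁ + a * a₁ + b * c₁ + c₀ * b₁ ≡ 0#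
      orthogonal g g∈ = trans (solve 6 (λ a b c a₁ b₁ c₁ → a :* a₁ :+ a :* a₁ :+ b :* c₁ :+ c :* b₁
            := (con 1₃ :+ a :+ (a₁ :* (con 1₃ :+ a) :+ b₁ :* c)) :+ (con 1₃ :- a :+ (c₁ :* b :- a₁ :* (con 1₃ :- a))) :+ con 1₃) refl a b c₀ a₁ b₁ c₁)
          (trans (cong₂ (λ u v → u + v + 1#) (sym (cong proj₁ e-first)) (sym (cong proj₂ e-second)))
            (trans (cong (_+ 1#) (trace (f Π.∙ g) (∙∈ S₀ f∈ g∈))) (solve 0 (con 2₃ :+ con 1₃ := con 0₃) refl)))
        where
        open Other g g∈
        e-first : to g (to f e₁) ≡ (1# + a + (a₁ * (1# + a) + b₁ * c₀) , c₀ + (c₁ * (1# + a) - a₁ * c₀))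
        e-first = trans (image p₀ c₀) (cong (λ z → z + (a₁ * z + b₁ * c₀) , c₀ + (c₁ * z - a₁ * c₀)) (solve 1 (λ p → p := con 1₃ :+ (p :- con 1₃)) refl p₀))
        e-second : to g (to f e₂) ≡ (b + (a₁ * b + b₁ * (1# - a)) , 1# - a + (c₁ * b - a₁ * (1# - a)))
        e-second = trans (image b d₀) (cong (λ z → b + (a₁ * b + b₁ * z) , z + (c₁ * b - a₁ * z)) f.d₁≡)

      square≡0 : ∀ {x} → x * x ≡ 0# → x ≡ 0#
      square≡0 {x} e = decidable-stable (x ≟ 0#) λ x≢0 → x≢0 (*-zero x≢0 e)

      choose : Dec (a ≡ 0# × b ≡ 0#) → ∃ λ v → v ≢ (0# , 0#) × (∀ g → g ∈ Member S₀ → to g v ≡ v)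
      choose (yes (a≡0 , b≡0)) = e₂ , e₂≢0 , λ g g∈ → let open Other g g∈ in
          let b₁≡0 = *-zero c₀≢0 (trans (solve 4 (λ a₁ c₁ c b₁ → c :* b₁ := con 0₃ :* a₁ :+ con 0₃ :* a₁ :+ con 0₃ :* c₁ :+ c :* b₁) refl a₁ c₁ c₀ b₁)
                 (trans (cong₂ (λ u v → u * a₁ + u * a₁ + v * c₁ + c₀ * b₁) (sym a≡0) (sym b≡0)) (orthogonal g g∈)))
              a₁≡0 = square≡0 (trans (solve 2 (λ a c → a :* a := a :* a :+ con 0₃ :* c) refl a₁ c₁) (trans (cong (λ z → a₁ * a₁ + z * c₁) (sym b₁≡0)) nilpotent))
          in trans (image 0# 1#) (trans (cong₂ (λ u v → 0# + (u * 0# + v * 1#) , 1# + (c₁ * 0# - u * 1#)) a₁≡0 b₁≡0)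
               (cong₂ _,_ (solve 0 (con 0₃ :+ (con 0₃ :* con 0₃ :+ con 0₃ :* con 1₃) := con 0₃) refl) (solve 1 (λ c → con 1₃ :+ (c :* con 0₃ :- con 0₃ :* con 1₃) := con 1₃) refl c₁)))
        where
        c₀≢0 : c₀ ≢ 0#
        c₀≢0 c₀≡0 = f≉ε λ { (x , y) → trans (f.image x y) (trans (cong₂ (λ u v → x + (u * x + v * y) , y + (c₀ * x - u * y)) a≡0 b≡0)
          (trans (cong (λ z → x + (0# * x + 0# * y) , y + (z * x - 0# * y)) c₀≡0)
            (cong₂ _,_ (solve 2 (λ x y → x :+ (con 0₃ :* x :+ con 0₃ :* y) := x) refl x y) (solve 2 (λ x y → y :+ (con 0₃ :* x :- con 0₃ :* y) := y) refl x y)))) }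
      choose (no ≢0) = (b , - a) , (λ e → ≢0 (trans (solve 1 (λ a → a := :- (:- a)) refl a) (trans (cong -_ (proj₂ (,≡ e))) -0#≈0#) , proj₁ (,≡ e)))
        , λ g g∈ → let open Other g g∈ in trans (image b (- a)) (cong₂ _,_
            (trans (cong (b +_) (square≡0 (first g g∈))) (+-identityʳ b))
            (trans (cong (- a +_) (square≡0 (second g g∈))) (+-identityʳ _)))
        where
        first : ∀ g g∈ → let open Other g g∈ in (a₁ * b + b₁ * - a) * (a₁ * b + b₁ * - a) ≡ 0#
        first g g∈ = let open Other g g∈ in trans
          (solve 6 (λ a b c a₁ b₁ c₁ → (a₁ :* b :+ b₁ :* :- a) :* (a₁ :* b :+ b₁ :* :- a)
            := b :* b :* (a₁ :* a₁ :+ b₁ :* c₁) :+ b₁ :* b₁ :* (a :* a :+ b :* c) :- b :* b₁ :* (a :* a₁ :+ a :* a₁ :+ b :* c₁ :+ c :* b₁)) refl a b c₀ a₁ b₁ c₁)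
          (trans (cong₂ (λ u v → b * b * u + b₁ * b₁ * v - b * b₁ * (a * a₁ + a * a₁ + b * c₁ + c₀ * b₁)) nilpotent f.nilpotent)
            (trans (cong (λ w → b * b * 0# + b₁ * b₁ * 0# - b * b₁ * w) (orthogonal g g∈)) (solve 2 (λ b b₁ → b :* b :* con 0₃ :+ b₁ :* b₁ :* con 0₃ :- b :* b₁ :* con 0₃ := con 0₃) refl b b₁)))
        second : ∀ g g∈ → let open Other g g∈ in (c₁ * b - a₁ * - a) * (c₁ * b - a₁ * - a) ≡ 0#
        second g g∈ = let open Other g g∈ in trans
          (solve 6 (λ a b c a₁ b₁ c₁ → (c₁ :* b :- a₁ :* :- a) :* (c₁ :* b :- a₁ :* :- a)
            := b :* c₁ :* (a :* a₁ :+ a :* a₁ :+ b :* c₁ :+ c :* b₁) :+ a :* a :* (a₁ :* a₁ :+ b₁ :* c₁) :- b₁ :* c₁ :* (a :* a :+ b :* c)) refl a b c₀ a₁ b₁ c₁)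
          (trans (cong₂ (λ u v → b * c₁ * (a * a₁ + a * a₁ + b * c₁ + c₀ * b₁) + a * a * u - b₁ * c₁ * v) nilpotent f.nilpotent)
            (trans (cong (λ w → b * c₁ * w + a * a * 0# - b₁ * c₁ * 0#) (orthogonal g g∈)) (solve 4 (λ a b b₁ c₁ → b :* c₁ :* con 0₃ :+ a :* a :* con 0₃ :- b₁ :* c₁ :* con 0₃ := con 0₃) refl a b b₁ c₁)))

module SylowConjugate (r′ : ℕ) (𝔽 : FiniteField (3 ℕ.^ ℕ.suc r′)) where
  open FieldTheory r′ 𝔽 hiding (_-_)
  open CommutativeRing commutativeRing using (_-_)
  open Permutations r′ 𝔽
  open Stabilisers r′ 𝔽
  open Products r′ 𝔽 using (γΓ)
  open Sylow r′ 𝔽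
  open Subgroup
  open Inverse using (to; from; strictlyInverseˡ; strictlyInverseʳ)
  open ≡.≡-Reasoning
  private
    module Π = Group (Sym F²)
    module SL = Group (group SL₂)

    γ-fun : ∀ e x y → fun (γΓ e) (x , y) ≡ (x + e * y , y)
    γ-fun e x y = cong₂ _,_ (solve 3 (λ e x y → con 1₃ :* x :+ e :* y := x :+ e :* y) refl e x y) (solve 2 (λ x y → con 0₃ :* x :+ con 1₃ :* y := y) refl x y)

    γ-unique : ∀ {e e′} → γΓ e Γ.≈ γΓ e′ → e ≡ e′
    γ-unique {e} {e′} h = trans (sym (value e)) (trans (cong proj₁ (h e₂)) (value e′))
      where
      value : ∀ e → proj₁ (fun (γΓ e) e₂) ≡ e
      value e = trans (cong proj₁ (γ-fun e 0# 1#)) (solve 1 (λ e → con 0₃ :+ e :* con 1₃ := e) refl e)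

    γ-∙ : ∀ d e → γΓ (d + e) Γ.≈ γΓ d Γ.∙ γΓ e
    γ-∙ d e (x , y) = trans (γ-fun (d + e) x y) (sym (trans (cong (fun (γΓ e)) (γ-fun d x y)) (trans (γ-fun e (x + d * y) y)
      (cong (_, y) (solve 4 (λ d e x y → x :+ d :* y :+ e :* y := x :+ (d :+ e) :* y) refl d e x y)))))

    γ-0 : γΓ 0# Γ.≈ Γ.ε
    γ-0 (x , y) = trans (γ-fun 0# x y) (cong (_, y) (solve 2 (λ x y → x :+ con 0₃ :* y := x) refl x y))

    γ-⁻¹ : ∀ e → γΓ (- e) Γ.≈ γΓ e Γ.⁻¹
    γ-⁻¹ e = GroupProperties.inverseʳ-unique (group ΓL₂) (γΓ e) (γΓ (- e)) λ v →
      trans (sym (γ-∙ e (- e) v)) (trans (cong (λ z → fun (γΓ z) v) (-‿inverseʳ e)) (γ-0 v))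

    γ∈SL₂ : ∀ e → proj₁ (γΓ e) ∈ Member SL₂
    γ∈SL₂ e = 1# , e , 0# , 1# , solve 1 (λ e → con 1₃ :* con 1₃ :- e :* con 0₃ := con 1₃) refl e , λ _ _ → refl

    γSL : F → SL.Carrier
    γSL e = proj₁ (γΓ e) , γ∈SL₂ e

    unitriangular : Subgroup (group SL₂)
    unitriangular = record
      { Member = λ x → ∃ λ e → proj₁ x Π.≈ proj₁ (γΓ e)
      ; resp = λ { x≈y (e , p) → e , λ v → trans (sym (x≈y v)) (p v) }
      ; ε∈ = 0# , λ v → sym (γ-0 v)
      ; ∙∈ = λ { {_} {y} (d , p) (e , q) → d + e , λ v → trans (cong (to (proj₁ y)) (p v)) (trans (q _) (sym (γ-∙ d e v))) }
      ; ⁻¹∈ = λ { {x} (e , p) → - e , λ v → trans (perm-injective (proj₁ x) (trans (strictlyInverseˡ (proj₁ x) v)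
          (sym (trans (p _) (strictlyInverseˡ (proj₁ (γΓ e)) v))))) (sym (γ-⁻¹ e v)) }
      }

    ∣unitriangular∣ : ∣ order (group unitriangular) ∣≡ q
    ∣unitriangular∣ = ∣∣-via {order (group unitriangular)} {≡.setoid F} (record
      { to = λ { (_ , e , _) → e }
      ; from = λ e → γSL e , e , λ _ → refl
      ; to-cong = λ { {_ , d , p} {_ , e , p′} x≈y → γ-unique {d} {e} (λ v → trans (sym (p v)) (trans (x≈y v) (p′ v))) }
      ; from-cong = λ { refl _ → refl }
      ; inverse = (λ { {d} {_ , e , p} y≈ → γ-unique {e} {d} (λ v → trans (sym (p v)) (y≈ v)) })
                , λ { {_ , e , p} refl v → sym (p v) }
      }) cardinality

    q-divides : ∀ {N} → ∣ order (group SL₂) ∣≡ N → q ∣ N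
    q-divides {N} c = subst (_∣ N) (∣∣-unique (proj₁ (proj₂ l)) ∣unitriangular∣) (proj₂ (proj₂ l))
      where
      unitriangular? : ∀ x → Dec (x ∈ Member unitriangular)
      unitriangular? x = ∃? {≡.setoid F} F-finite (λ e → ∣∣-dec {order (group SL₂)} c x (γSL e)) (λ { refl p → p })
      l = lagrange {group SL₂} c unitriangular unitriangular?

  module _ (S₀ : Subgroup (Sym F²)) (S₀≤ : S₀ ≤ₛ SL₂) {k m : ℕ} (∣S₀∣ : ∣ order (group S₀) ∣≡ (3 ℕ.^ k))
           (∣SL₂∣ : ∣ order (group SL₂) ∣≡ (3 ℕ.^ k ℕ.* m)) (3∤m : ¬ 3 ∣ m) where
    private
      q≤ : q ℕ.≤ 3 ℕ.^ k
      q≤ = ℕₚ.^-monoʳ-≤ 3 (prime-power-≤ r k m 3∤m (q-divides ∣SL₂∣))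

      NonTrivial : Pred (Σ (F² ↔ F²) (Member S₀)) 0ℓ
      NonTrivial x = ¬ (proj₁ x Π.≈ Π.ε)

      trivial? : ∀ x → Dec (proj₁ x Π.≈ Π.ε)
      trivial? x = ∣∣-dec {order (group S₀)} ∣S₀∣ x (Group.ε (group S₀))

      1<q : 1 ℕ.< q
      1<q = ℕₚ.^-monoʳ-< 3 (ℕ.s≤s (ℕ.s≤s ℕ.z≤n)) {0} {r} (ℕ.s≤s ℕ.z≤n)

      nontrivial : ∃ NonTrivial
      nontrivial = decidable-stable (∃? {order (group S₀)} (_ , ∣S₀∣) {NonTrivial} (λ x → ¬? (trivial? x)) (λ x≈y ne e → ne (λ v → trans (x≈y v) (e v))))
        λ none → let trivial = λ x → decidable-stable (trivial? x) (λ ne → none (x , ne)) in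
          ℕₚ.<⇒≱ (ℕₚ.<-≤-trans 1<q q≤) (injection⇒≤ {order (group S₀)} {≡.setoid (Fin 1)} ∣S₀∣
            (record { to = id ; from = id ; to-cong = id ; from-cong = id ; inverse = id , id }) {λ _ → zero}
            ((λ _ → refl) , λ {x} {y} _ v → trans (trivial x v) (sym (trivial y v))))

      fixed = commonly-fixed S₀ S₀≤ {k} ∣S₀∣ (proj₁ (proj₁ nontrivial)) (proj₂ (proj₁ nontrivial)) (proj₂ nontrivial)

      v₀ : F²
      v₀ = proj₁ fixed

      complete : ∀ v → v ≢ (0# , 0#) → Dec (proj₂ v ≡ 0#) → Σ Γ.Carrier λ h → fun h e₁ ≡ v × (∀ x → field-aut h x ≡ x)
      complete (x , y) v≢0 (no y≢0) = matrix aut-id x 1# y 0# Δ≢0 , matrix-e₁ aut-id x 1# y 0# Δ≢0 , λ _ → refl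
        where
        Δ≢0 : x * 0# - 1# * y ≢ 0#
        Δ≢0 e = y≢0 (trans (solve 2 (λ x y → y := :- (x :* con 0₃ :- con 1₃ :* y)) refl x y) (trans (cong -_ e) -0#≈0#))
      complete (x , y) v≢0 (yes y≡0) = matrix aut-id x 0# y 1# Δ≢0 , matrix-e₁ aut-id x 0# y 1# Δ≢0 , λ _ → refl
        where
        Δ≢0 : x * 1# - 0# * y ≢ 0#
        Δ≢0 e = v≢0 (cong₂ _,_ (trans (solve 2 (λ x y → x := x :* con 1₃ :- con 0₃ :* y) refl x y) e) y≡0)

      completed = complete v₀ (proj₁ (proj₂ fixed)) (proj₂ v₀ ≟ 0#)

      h₀ : Γ.Carrier
      h₀ = proj₁ completed

      ↑ ↓ : F² → F²
      ↑ = fun h₀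
      ↓ = fun (h₀ Γ.⁻¹)

      ↑↓ : ∀ v → ↑ (↓ v) ≡ v
      ↑↓ = strictlyInverseˡ (proj₁ h₀)

      ↓↑ : ∀ v → ↓ (↑ v) ≡ v
      ↓↑ = strictlyInverseʳ (proj₁ h₀)

      conj : Γ.Carrier → Γ.Carrier
      conj f = h₀ Γ.∙ f Γ.∙ h₀ Γ.⁻¹

      conj-∙ : ∀ f g → conj (f Γ.∙ g) Γ.≈ conj f Γ.∙ conj g
      conj-∙ f g v = cong (↓ ∘ fun g) (sym (↑↓ _))

      conj-cong : ∀ f g → f Γ.≈ g → conj f Γ.≈ conj g
      conj-cong f g e v = cong ↓ (e _)

      conj-injective : ∀ f g → conj f Γ.≈ conj g → f Γ.≈ g
      conj-injective f g e v = begin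
        fun f v               ≡⟨ trans (sym (↑↓ _)) (cong (↑ ∘ ↓ ∘ fun f) (sym (↑↓ v))) ⟩
        ↑ (↓ (fun f (↑ (↓ v)))) ≡⟨ cong ↑ (e (↓ v)) ⟩
        ↑ (↓ (fun g (↑ (↓ v)))) ≡⟨ trans (↑↓ _) (cong (fun g) (↑↓ v)) ⟩
        fun g v               ∎

      conj-⁻¹ : ∀ f → conj (f Γ.⁻¹) Γ.≈ conj f Γ.⁻¹
      conj-⁻¹ f v = cong (↓ ∘ from (proj₁ f)) (refl {x = ↑ v})

      unconj : Γ.Carrier → Γ.Carrier
      unconj f = h₀ Γ.⁻¹ Γ.∙ f Γ.∙ h₀

      conj-unconj : ∀ f → conj (unconj f) Γ.≈ f
      conj-unconj f v = trans (↓↑ _) (cong (fun f) (↓↑ v))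

      coordinate : ∀ f → f ∈ Member S₀ → F
      coordinate f f∈ = proj₁ (fun (conj (toΓ f (S₀≤ f∈))) e₂)

      conj≈γ : ∀ f f∈ → conj (toΓ f (S₀≤ f∈)) Γ.≈ γΓ (coordinate f f∈)
      conj≈γ f f∈ (x , y) = trans (formula x y) (trans
          (cong₂ _,_ (cong₂ _+_ (cong (_* θ x) (cong proj₁ fixes-e₁)) refl) (cong₂ (λ a b → a * θ x + b * θ y) (cong proj₂ fixes-e₁) s′≡1))
          (trans (cong₂ (λ a b → 1# * a + s * b , 0# * a + 1# * b) (θ≡id x) (θ≡id y)) refl))
        where
        g = toΓ f (S₀≤ f∈)
        open Semilinear (conj g)
        fixes-e₁ : fun (conj g) e₁ ≡ e₁
        fixes-e₁ = trans (cong (↓ ∘ to f) (proj₁ (proj₂ completed))) (trans (cong ↓ (proj₂ (proj₂ fixed) f f∈))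
          (trans (cong ↓ (sym (proj₁ (proj₂ completed)))) (↓↑ e₁)))
        ↓-linear : ∀ x → field-aut (h₀ Γ.⁻¹) x ≡ x
        ↓-linear x = trans (cong (field-aut (h₀ Γ.⁻¹)) (sym (proj₂ (proj₂ completed) x)))
          (field-aut-cong {h₀ Γ.∙ h₀ Γ.⁻¹} {Γ.ε} (Γ.inverseʳ h₀) x)
        θ≡id : ∀ x → θ x ≡ x
        θ≡id x = trans (↓-linear _) (proj₂ (proj₂ completed) x)
        det≡1 : δet (conj g) ≡ 1#
        det≡1 = begin
          δet (conj g)                           ≡⟨ δet-∙ (h₀ Γ.∙ g) (h₀ Γ.⁻¹) ⟩
          δet (h₀ Γ.⁻¹) * field-aut (h₀ Γ.⁻¹) (δet (h₀ Γ.∙ g)) ≡⟨ cong (λ z → δet (h₀ Γ.⁻¹) * field-aut (h₀ Γ.⁻¹) z) (trans (δet-∙ h₀ g) (trans (cong (_* δet h₀) (δet-SL f (S₀≤ f∈))) (*-identityˡ _))) ⟩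
          δet (h₀ Γ.⁻¹) * field-aut (h₀ Γ.⁻¹) (δet h₀) ≡⟨ δet-∙ h₀ (h₀ Γ.⁻¹) ⟨
          δet (h₀ Γ.∙ h₀ Γ.⁻¹)                   ≡⟨ δet-cong {h₀ Γ.∙ h₀ Γ.⁻¹} {Γ.ε} (Γ.inverseʳ h₀) ⟩
          δet Γ.ε                                ≡⟨ δet-ε ⟩
          1#                                     ∎
        s′≡1 : s′ ≡ 1#
        s′≡1 = trans (solve 2 (λ s s′ → s′ := con 1₃ :* s′ :- s :* con 0₃) refl s s′)
          (trans (cong (λ w → proj₁ w * s′ - s * proj₂ w) (sym fixes-e₁)) det≡1)

      -- S₀ embeds into F and is at least as large.
      element : ∀ e → ∃ λ f → Σ (f ∈ Member S₀) λ f∈ → conj (toΓ f (S₀≤ f∈)) Γ.≈ γΓ e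
      element e = let (f , f∈) , c = injection⇒surjection {order (group S₀)} {≡.setoid F} ∣S₀∣ cardinality q≤ {λ { (f , f∈) → coordinate f f∈ }}
                        ( (λ { {f , f∈} {g , g∈} f≈g → cong proj₁ (conj-cong (toΓ f (S₀≤ f∈)) (toΓ g (S₀≤ g∈)) f≈g e₂) })
                        , λ { {f , f∈} {g , g∈} c → conj-injective (toΓ f (S₀≤ f∈)) (toΓ g (S₀≤ g∈)) λ v →
                            trans (conj≈γ f f∈ v) (trans (cong (λ z → fun (γΓ z) v) c) (sym (conj≈γ g g∈ v))) }) e
                  in f , f∈ , λ v → trans (conj≈γ f f∈ v) (cong (λ z → fun (γΓ z) v) c)

      γ⇒S₀ : ∀ (f : Γ.Carrier) e → conj f Γ.≈ γΓ e → proj₁ f ∈ Member S₀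
      γ⇒S₀ f e f≈ = let g , g∈ , g≈ = element e in resp S₀ {g} {proj₁ f} (conj-injective (toΓ g (S₀≤ g∈)) f (λ v → trans (g≈ v) (sym (f≈ v)))) g∈

      N : Subgroup (Sym F²)
      N = normaliser ΓL₂ S₀

      N⇒Γ : ∀ g → g ∈ Member N → Γ.Carrier
      N⇒Γ g (g∈ , _) = g , g∈

      γ-upper : ∀ c → Semilinear.p′ c ≡ 0# → ∀ e → ∃ λ e′ → γΓ e Γ.∙ c Γ.≈ c Γ.∙ γΓ e′
      γ-upper c p′≡0 e = e′ , λ { (x , y) → trans (cong (fun c) (γ-fun e x y)) (trans (formula′ (x + e * y) y) (sym (trans (cong (fun (γΓ e′)) (formula′ x y))
          (trans (γ-fun e′ (p * θ x + s * θ y) (s′ * θ y)) (cong₂ _,_ (equal x y) refl))))) }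
        where
        cᵁ : UT.Carrier
        cᵁ = proj₁ c , proj₂ c , p′≡0
        open Triangular cᵁ
        k′ = proj₁ (recip s′≢0)
        e′ = p * θ e * k′
        equal : ∀ x y → p * θ x + s * θ y + e′ * (s′ * θ y) ≡ p * θ (x + e * y) + s * θ y
        equal x y = trans (modulo (p * θ e * θ y) (proj₂ (recip s′≢0)) (solve 7 (λ p s s′ x y e k → p :* x :+ s :* y :+ p :* e :* k :* (s′ :* y)
              := p :* (x :+ e :* y) :+ s :* y :+ p :* e :* y :* (k :* s′ :- con 1₃)) refl p s s′ (θ x) (θ y) (θ e) k′))
          (cong (λ z → p * z + s * θ y) (sym (trans (+-homo x (e * y)) (cong (θ x +_) (*-homo e y)))))

      normalises : ∀ g → Semilinear.p′ (conj g) ≡ 0# → ∀ {x} → x ∈ Member S₀ → (proj₁ g Π.⁻¹) Π.∙ x Π.∙ proj₁ g ∈ Member S₀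
      normalises g p′≡0 {x} x∈ = γ⇒S₀ (g Γ.⁻¹ Γ.∙ X Γ.∙ g) e′ λ v → begin
          fun (conj (g Γ.⁻¹ Γ.∙ X Γ.∙ g)) v
            ≡⟨ trans (conj-∙ (g Γ.⁻¹ Γ.∙ X) g v) (cong (fun (conj g)) (trans (conj-∙ (g Γ.⁻¹) X v) (cong (fun (conj X)) (conj-⁻¹ g v)))) ⟩
          fun (conj g) (fun (conj X) (fun (conj g Γ.⁻¹) v))
            ≡⟨ cong (fun (conj g)) (conj≈γ x x∈ _) ⟩
          fun (conj g) (fun (γΓ e) (fun (conj g Γ.⁻¹) v))
            ≡⟨ proj₂ (γ-upper (conj g) p′≡0 e) _ ⟩
          fun (γΓ e′) (fun (conj g) (fun (conj g Γ.⁻¹) v))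
            ≡⟨ cong (fun (γΓ e′)) (strictlyInverseˡ (proj₁ (conj g)) v) ⟩
          fun (γΓ e′) v ∎
        where
        X = toΓ x (S₀≤ x∈)
        e = coordinate x x∈
        e′ = proj₁ (γ-upper (conj g) p′≡0 e)

      upper⇒N : ∀ g → Semilinear.p′ (conj g) ≡ 0# → proj₁ g ∈ Member N
      upper⇒N g p′≡0 = proj₂ g , λ x → normalises g p′≡0 {x} , λ y∈ → resp S₀ {(proj₁ g) Π.∙ ((proj₁ g Π.⁻¹) Π.∙ x Π.∙ proj₁ g) Π.∙ (proj₁ g Π.⁻¹)} {x}
          (λ v → trans (strictlyInverseʳ (proj₁ g) _) (cong (to x) (strictlyInverseʳ (proj₁ g) v)))
          (resp S₀ {(proj₁ (g Γ.⁻¹) Π.⁻¹) Π.∙ ((proj₁ g Π.⁻¹) Π.∙ x Π.∙ proj₁ g) Π.∙ proj₁ (g Γ.⁻¹)} {(proj₁ g) Π.∙ ((proj₁ g Π.⁻¹) Π.∙ x Π.∙ proj₁ g) Π.∙ (proj₁ g Π.⁻¹)} (λ _ → refl)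
            (normalises (g Γ.⁻¹) (trans (cong proj₂ (conj-⁻¹ g e₁)) (proj₂ (⁻¹∈ UT {proj₁ (conj g)} (proj₂ (conj g) , p′≡0)))) y∈))

      N⇒upper : ∀ g (n : g ∈ Member N) → Semilinear.p′ (conj (N⇒Γ g n)) ≡ 0#
      N⇒upper g n = trans (solve 2 (λ p′ s′ → p′ := p′ :+ s′ :- s′) refl p′ s′) (trans (cong (_- s′) (trans (sym second) (cong proj₂ commute))) (-‿inverseʳ s′))
        where
        open Semilinear (conj (N⇒Γ g n))
        f = proj₁ (element 1#)
        f∈ = proj₁ (proj₂ (element 1#))
        fΓ = toΓ f (S₀≤ f∈)
        y∈ : (g Π.⁻¹) Π.∙ f Π.∙ g ∈ Member S₀
        y∈ = proj₁ (proj₂ n f) f∈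
        yΓ = toΓ ((g Π.⁻¹) Π.∙ f Π.∙ g) (S₀≤ y∈)
        gΓ = N⇒Γ g n
        e = coordinate ((g Π.⁻¹) Π.∙ f Π.∙ g) y∈
        moved : ∀ v → fun (conj gΓ) (fun (γΓ 1#) v) ≡ fun (γΓ e) (fun (conj gΓ) v)
        moved v = begin
          fun (conj gΓ) (fun (γΓ 1#) v)            ≡⟨ cong (fun (conj gΓ)) (proj₂ (proj₂ (element 1#)) v) ⟨
          fun (conj gΓ) (fun (conj fΓ) v)          ≡⟨ conj-∙ fΓ gΓ v ⟨
          fun (conj (fΓ Γ.∙ gΓ)) v                 ≡⟨ conj-cong (fΓ Γ.∙ gΓ) (gΓ Γ.∙ yΓ) (λ w → cong (to g ∘ to f) (sym (strictlyInverseʳ g w))) v ⟩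
          fun (conj (gΓ Γ.∙ yΓ)) v                 ≡⟨ conj-∙ gΓ yΓ v ⟩
          fun (conj yΓ) (fun (conj gΓ) v)          ≡⟨ conj≈γ ((g Π.⁻¹) Π.∙ f Π.∙ g) y∈ _ ⟩
          fun (γΓ e) (fun (conj gΓ) v)             ∎
        second : proj₂ (fun (conj gΓ) (1# , 1#)) ≡ p′ + s′
        second = trans (cong proj₂ (formula 1# 1#)) (trans (cong (λ z → p′ * z + s′ * z) 1#-homo) (cong₂ _+_ (*-identityʳ p′) (*-identityʳ s′)))
        commute : fun (conj gΓ) (1# , 1#) ≡ (s + e * s′ , s′)
        commute = trans (cong (fun (conj gΓ)) (sym (trans (γ-fun 1# 0# 1#) (cong (_, 1#) (solve 0 (con 0₃ :+ con 1₃ :* con 1₃ := con 1₃) refl)))))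
          (trans (moved e₂) (γ-fun e s s′))

    normaliser≅UT : group (normaliser ΓL₂ S₀) ≅ group UT
    normaliser≅UT = mk≅ {group N} {group UT} (λ { (g , n) → proj₁ (conj (N⇒Γ g n)) , proj₂ (conj (N⇒Γ g n)) , N⇒upper g n })
      (λ { {g , n} {g′ , n′} e → conj-cong (N⇒Γ g n) (N⇒Γ g′ n′) e })
      (λ { (g , n) (g′ , n′) → conj-∙ (N⇒Γ g n) (N⇒Γ g′ n′) })
      (λ { {g , n} {g′ , n′} e → conj-injective (N⇒Γ g n) (N⇒Γ g′ n′) e })
      (λ { (c , c∈ , p′≡0) → let g = unconj (c , c∈) in
         (proj₁ g , upper⇒N g (trans (cong proj₂ (conj-unconj (c , c∈) e₁)) p′≡0)) , conj-unconj (c , c∈) })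

    P : Subgroup ASL₂
    P = record
      { Member = λ { ((f , _) , _) → f ∈ Member S₀ }
      ; resp = λ { {(f , _) , _} {(g , _) , _} (f≈g , _) f∈ → resp S₀ {f} {g} f≈g f∈ }
      ; ε∈ = ε∈ S₀
      ; ∙∈ = λ { {(f , _) , _} {(g , _) , _} f∈ g∈ → ∙∈ S₀ {f} {g} f∈ g∈ }
      ; ⁻¹∈ = λ { {(f , _) , _} f∈ → ⁻¹∈ S₀ {f} f∈ }
      }

    private
      plane : Group 0ℓ 0ℓ
      plane = Direct.group +-group +-group

      ∣+∣ : ∣ order +-group ∣≡ q
      ∣+∣ = ∣∣-via {order +-group} {≡.setoid F} record { to = id ; from = id ; to-cong = id ; from-cong = id ; inverse = id , id } cardinality

      ∣plane∣ : ∣ order plane ∣≡ (q ℕ.* q)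
      ∣plane∣ = ∣∣-via {order plane} {order +-group ×ₛ order +-group} record { to = id ; from = id ; to-cong = id ; from-cong = id ; inverse = id , id } (∣+∣ ×-∣∣ ∣+∣)

      ∣P∣ : ∣ order (group P) ∣≡ (3 ℕ.^ k ℕ.* (q ℕ.* q))
      ∣P∣ = ∣∣-via {order (group P)} {order (group S₀) ×ₛ order plane} (record
        { to = λ { (((f , _) , v) , f∈) → (f , f∈) , v }
        ; from = λ { ((f , f∈) , v) → ((f , S₀≤ f∈) , v) , f∈ }
        ; to-cong = id ; from-cong = id ; inverse = id , id }) (∣S₀∣ ×-∣∣ ∣plane∣)

      ∣ASL₂∣ : ∣ order (group (whole {ASL₂})) ∣≡ (3 ℕ.^ k ℕ.* m ℕ.* (q ℕ.* q))
      ∣ASL₂∣ = ∣∣-via {order (group (whole {ASL₂}))} {order (group SL₂) ×ₛ order plane} (record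
        { to = proj₁ ; from = λ x → x , tt ; to-cong = id ; from-cong = id ; inverse = id , id }) (∣SL₂∣ ×-∣∣ ∣plane∣)

      exponent : 3 ℕ.^ k ℕ.* (q ℕ.* q) ≡ 3 ℕ.^ (k ℕ.+ (r ℕ.+ r))
      exponent = sym (trans (ℕₚ.^-distribˡ-+-* 3 k (r ℕ.+ r)) (cong (3 ℕ.^ k ℕ.*_) (ℕₚ.^-distribˡ-+-* 3 r r)))

      rearrange : ∀ a b c → a ℕ.* b ℕ.* c ≡ a ℕ.* c ℕ.* b
      rearrange a b c = trans (ℕₚ.*-assoc a b c) (trans (cong (a ℕ.*_) (ℕₚ.*-comm b c)) (sym (ℕₚ.*-assoc a c b)))

    P-sylow : IsSylow 3 whole P
    P-sylow = (λ _ → tt) , k ℕ.+ (r ℕ.+ r) , m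
      , subst (λ n → ∣ order (group P) ∣≡ n) exponent ∣P∣
      , subst (λ n → ∣ order (group (whole {ASL₂})) ∣≡ n) (trans (rearrange (3 ℕ.^ k) m (q ℕ.* q)) (cong (ℕ._* m) exponent)) ∣ASL₂∣
      , 3∤m

    private
      pair : ∀ {u v : F²} → u ≡ v → proj₁ u ≡ proj₁ v × proj₂ u ≡ proj₂ v
      pair refl = refl , refl

      unpair : ∀ {u v : F²} → proj₁ u ≡ proj₁ v × proj₂ u ≡ proj₂ v → u ≡ v
      unpair (refl , refl) = refl

      el : F → F² ↔ F²
      el e = proj₁ (element e)

      el∈ : ∀ e → el e ∈ Member S₀
      el∈ e = proj₁ (proj₂ (element e))

      elΓ : F → Γ.Carrier
      elΓ e = toΓ (el e) (S₀≤ (el∈ e))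

      el-γ : ∀ e → conj (elΓ e) Γ.≈ γΓ e
      el-γ e = proj₂ (proj₂ (element e))

      el-↑ : ∀ e v → to (el e) (↑ v) ≡ ↑ (fun (γΓ e) v)
      el-↑ e v = trans (sym (↑↓ _)) (cong ↑ (el-γ e v))

    U≅P : U ≅ group P
    U≅P = mk≅ {U} {group P} (λ { (e , v) → ((el e , S₀≤ (el∈ e)) , ↑ v) , el∈ e })
      (λ { {e , v} {_ , w} (refl , v≈w) → (λ _ → refl) , pair (cong ↑ (unpair {v} {w} v≈w)) })
      (λ { (d , v) (e , w) →
            conj-injective (elΓ (d + e)) (elΓ d Γ.∙ elΓ e) (λ u → trans (el-γ (d + e) u) (trans (γ-∙ d e u)
              (sym (trans (conj-∙ (elΓ d) (elΓ e) u) (trans (el-γ e _) (cong (fun (γΓ e)) (el-γ d u)))))))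
          , pair (trans (Semilinear.add h₀ (proj₁ v + e * proj₂ v , proj₂ v) w) (cong (_⊕ ↑ w) (sym (trans (el-↑ e v) (cong ↑ (γ-fun e (proj₁ v) (proj₂ v))))))) })
      (λ { {d , v} {e , w} (f≈ , v≈) → γ-unique {d} {e} (λ u → trans (sym (el-γ d u)) (trans (conj-cong (elΓ d) (elΓ e) f≈ u) (el-γ e u)))
          , pair (perm-injective (proj₁ h₀) (unpair v≈)) })
      (λ { (((f , _) , v) , f∈) → (coordinate f f∈ , ↓ v)
          , conj-injective (elΓ (coordinate f f∈)) (toΓ f (S₀≤ f∈)) (λ u → trans (el-γ (coordinate f f∈) u) (sym (conj≈γ f f∈ u)))
          , pair (↑↓ v) })

module VertexGroups (r′ : ℕ) (𝔽 : FiniteField (3 ℕ.^ ℕ.suc r′)) where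
  open FieldTheory r′ 𝔽
  open Permutations r′ 𝔽
  open Stabilisers r′ 𝔽
  open Products r′ 𝔽
  open Construction 𝔽 using (stabiliser; localGroup; neighbours)
  open Amalgam r′ 𝔽
  open LocalGroups r′ 𝔽 𝐆 H₁ H₂
  open PushingUp r′ 𝔽 using (K₁-elementaryAbelian; +-elementaryAbelian; ∣K₁∣)
  open SylowConjugate r′ 𝔽
  open Subgroup

  private
    H₁≅ : group H₁ ≅ group F₁.image
    H₁≅ = mk≅ {group H₁} {group F₁.image} (λ { (g , m) → proj₁ g , G₁⊆𝒢₁ {proj₁ g} m }) id (λ _ _ _ → refl) id
      (λ { (g , m) → (element₁ g m , 𝒢₁⊆G₁ {g} m) , λ _ → refl })

    H₂≅ : group H₂ ≅ group F₂.image
    H₂≅ = mk≅ {group H₂} {group F₂.image} (λ { (g , m) → proj₁ g , G₂⊆𝒢₂ {proj₁ g} m }) id (λ _ _ _ → refl) id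
      (λ { (g , m) → (element₂ g m , 𝒢₂⊆G₂ {g} m) , λ _ → refl })

  neighbours₁ : ∀ h → ∣ neighbours (inj₁ h) ∣≡ (q ℕ.+ 1)
  neighbours₁ h = Projective.count-projective 𝓛₁ h refl

  neighbours₂ : ∀ h → ∣ neighbours (inj₂ h) ∣≡ q
  neighbours₂ h = Borel.count-affine 𝓛₂ h refl lower₂≡0 onto₂ cardinality

  localGroup₁ : ∀ h → localGroup (inj₁ h) ≅ PΓL₂
  localGroup₁ h = Core.localGroup≅PΓL₂ 𝓛₁ h onto₁

  localGroup₂ : ∀ h → localGroup (inj₂ h) ≅ group AΓL₁
  localGroup₂ h = Borel.localGroup≅AΓL₁ 𝓛₂ h refl lower₂≡0 onto₂

  stabiliser₁ : ∀ h → group (stabiliser (inj₁ h)) ≅ K₁ ⋊ group ΓL₂ [ F₁.φ ]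
  stabiliser₁ h = ≅-trans {group (stabiliser (inj₁ h))} {group H₁} {K₁ ⋊ group ΓL₂ [ F₁.φ ]} (Side.Stab≅ 𝓛₁ h)
    (≅-trans {group H₁} {group F₁.image} {K₁ ⋊ group ΓL₂ [ F₁.φ ]} H₁≅ F₁.image≅)

  stabiliser₂ : ∀ h → group (stabiliser (inj₂ h)) ≅ K₂ ⋊ group UT [ F₂.φ ]
  stabiliser₂ h = ≅-trans {group (stabiliser (inj₂ h))} {group H₂} {K₂ ⋊ group UT [ F₂.φ ]} (Side.Stab≅ 𝓛₂ h)
    (≅-trans {group H₂} {group F₂.image} {K₂ ⋊ group UT [ F₂.φ ]} H₂≅ F₂.image≅)

  stabiliser₂-sylow : ∀ h (S₀ : Subgroup (Sym F²)) → IsSylow 3 SL₂ S₀ →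
    Σ (Subgroup ASL₂) λ P → IsSylow 3 whole P ×
    Σ (Group 0ℓ 0ℓ) λ U → (U ≅ group P) ×
    Σ (Group 0ℓ 0ℓ) λ N → IsElementaryAbelian 3 N × (∣ order N ∣≡ q) ×
    Σ (GroupAction (Direct.group N U) (group (normaliser ΓL₂ S₀))) λ φ →
      group (stabiliser (inj₂ h)) ≅ Direct.group N U ⋊ group (normaliser ΓL₂ S₀) [ φ ]
  stabiliser₂-sylow h S₀ (S₀≤ , k , m , ∣S₀∣ , ∣SL₂∣ , 3∤m) =
    P S₀ S₀≤ {k} {m} ∣S₀∣ ∣SL₂∣ 3∤m , P-sylow S₀ S₀≤ {k} {m} ∣S₀∣ ∣SL₂∣ 3∤m , U , U≅P S₀ S₀≤ {k} {m} ∣S₀∣ ∣SL₂∣ 3∤m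
    , +-group , +-elementaryAbelian , ∣∣-via record { to = id ; from = id ; to-cong = id ; from-cong = id ; inverse = id , id } cardinality
    , proj₁ moved , ≅-trans {group (stabiliser (inj₂ h))} {K₂ ⋊ group UT [ F₂.φ ]} {K₂ ⋊ group (normaliser ΓL₂ S₀) [ proj₁ moved ]} (stabiliser₂ h) (proj₂ moved)
    where
    moved = ≅-⋊ {K₂} {group UT} {group (normaliser ΓL₂ S₀)} F₂.φ (normaliser≅UT S₀ S₀≤ {k} {m} ∣S₀∣ ∣SL₂∣ 3∤m)

open import Data.Nat.Base using (_+_; _^_; _≤_)
open import Algebra.Construct.DirectProduct using () renaming (group to _×ᴳ_)

theorem1p1 : (r : ℕ) → 1 ≤ r → (𝔽 : FiniteField (3 ^ r)) →
    let q = 3 ^ r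
        open Construction 𝔽
        open Groups 𝔽
    in
    IsGGraph × LocallyFinite × LocallyArcTransitive 5 × PushingUpType 3 ×
    (∀ x y → x ~ y →
      ∃₂ λ x₁ x₂ → ((x₁ ≡ x × x₂ ≡ y) ⊎ (x₁ ≡ y × x₂ ≡ x)) ×
        (∣ neighbours x₁ ∣≡ (q + 1) × ∣ neighbours x₂ ∣≡ q) ×
        (localGroup x₁ ≅ PΓL₂ × localGroup x₂ ≅ Subgroup.group AΓL₁) ×
        (Σ (Group 0ℓ 0ℓ) λ N → IsElementaryAbelian 3 N × (∣ order N ∣≡ (q ^ 3)) ×
          Σ (GroupAction N (Subgroup.group ΓL₂)) λ φ →
            Subgroup.group (stabiliser x₁) ≅ N ⋊ Subgroup.group ΓL₂ [ φ ]) ×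
        ((S₀ : Subgroup (Sym F²)) → IsSylow 3 SL₂ S₀ →
          Σ (Subgroup ASL₂) λ P → IsSylow 3 whole P ×
          Σ (Group 0ℓ 0ℓ) λ U → (U ≅ Subgroup.group P) ×
          Σ (Group 0ℓ 0ℓ) λ N → IsElementaryAbelian 3 N × (∣ order N ∣≡ q) ×
          Σ (GroupAction (N ×ᴳ U) (Subgroup.group (normaliser ΓL₂ S₀))) λ φ →
            Subgroup.group (stabiliser x₂) ≅ (N ×ᴳ U) ⋊ Subgroup.group (normaliser ΓL₂ S₀) [ φ ]) ×
        TransitiveOnArcsFrom 6 x₂)
theorem1p1 (ℕ.suc r′) _ 𝔽 = isGGraph , locallyFinite , locallyArcTransitive , pushingUpType , λ
  { (inj₁ g) (inj₂ h) _ → inj₁ g , inj₂ h , inj₁ (refl , refl) , at g h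
  ; (inj₂ h) (inj₁ g) _ → inj₁ g , inj₂ h , inj₂ (refl , refl) , at g h }
  where
  open Finiteness r′ 𝔽 using (isGGraph; locallyFinite)
  open ArcTransitivity r′ 𝔽 using (locallyArcTransitive; transitive₆)
  open PushingUp r′ 𝔽 using (pushingUpType; K₁-elementaryAbelian; ∣K₁∣)
  open Permutations r′ 𝔽 using (K₁)
  open Stabilisers r′ 𝔽 using (module F₁)
  open VertexGroups r′ 𝔽
  at = λ g h → (neighbours₁ g , neighbours₂ h) , (localGroup₁ g , localGroup₂ h)
    , (K₁ , K₁-elementaryAbelian , ∣K₁∣ , F₁.φ , stabiliser₁ g)
    , stabiliser₂-sylow h , transitive₆ h
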